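{- For every constant $k\in\mathbb{N}$, a depth-first search (DFS) of a directed or undirected graph with $n$ vertices and $m$ edges can be carried out in $O(n+m)$ time with $O(n\log^{(k)} n)$ bits of working memory.
   Context: $\log$ denotes $\log_2$, $\mathbb{N}=\{1,2,\ldots\}$, and $\log^{(k)}$ denotes $k$-fold repeated application of $\log$ (e.g., $\log^{(2)}n=\log\log n$). Model of computation: word RAM with word length $\Omega(\log n)$ bits and constant-time standard word operations; the input is read-only, the output (if any) is write-only, and space is the number of bits of working memory, not counting input and output. Input representation: the vertex set is $V=\{1,\ldots,n\}$ for a known integer $n\ge 1$. For an undirected graph, the constant-time access functions are: $\mathrm{deg}(u)$, the degree of $u\in V$; for $u\in V$ and $i\in\{0,\ldots,\mathrm{deg}(u)-1\}$, $\mathrm{head}(u,i)$, the $(i+1)$st neighbor $v$ of $u$ in some arbitrary fixed ordering of the neighbors of $u$, and $\mathrm{mate}(u,i)$, the integer $j$ with $\mathrm{head}(v,j)=u$. A directed graph is represented with in/out adjacency arrays, i.e., the inneighbors as well as the outneighbors of each vertex can be accessed one by one, and there are cross links: for each edge $(u,v)$, the function $\mathrm{mate}$ maps in constant time the position of $v$ in the adjacency array of $u$ to that of $u$ in the adjacency array of $v$ and vice versa. A DFS visits all vertices and edges of the graph. Vertices are initially white, become gray when discovered, and turn black when all their incident edges (outgoing edges, if the graph is directed) have been explored. At the outermost level the DFS steps through the vertices in some order (the root order) and starts a new tree at each vertex not yet discovered. It obeys the DFS rule: whenever two or more discovered vertices have unexplored incident (out)edges, an (out)edge incident on the most recently discovered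 such vertex (the current vertex) is explored first; if it leads to a white vertex $w$, then $w$ is discovered and becomes the current vertex. Carrying out a DFS means executing such a traversal, invoking user procedures at the appropriate events (a vertex turning gray or black; exploration of an edge from the current vertex, distinguishing whether or not it leads to a new vertex; withdrawal over a tree edge). The resources of the user procedures themselves are not counted. -}

module Defs where

open import Data.Bool.Base using (Bool; true; false; if_then_else_; _∧_; _∨_; _xor_)
open import Data.Fin.Base using (Fin; zero; suc; toℕ; fromℕ<)
open import Data.List.Base as List using (List; []; _∷_; _++_; drop; tabulate; allFin)
open import Data.List.Relation.Unary.Any using (Any)
open import Data.List.Relation.Binary.Permutation.Propositional using (_↭_)
open import Data.Maybe.Base using (Maybe; just; nothing; _>>=_)
open import Data.Nat.Base
open import Data.Nat.DivMod using (_mod_)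
open import Data.Nat.Logarithm using (⌊log₂_⌋)
open import Data.Nat.ListAction using (sum)
open import Data.Nat.Properties using (m^n≢0; _<?_)
open import Data.Product.Base using (Σ-syntax; ∃-syntax; _×_; _,_; swap)
open import Data.Sum.Base using (_⊎_)
open import Data.Vec.Base as Vec using (Vec; lookup; replicate; _[_]≔_)
open import Relation.Binary.PropositionalEquality.Core using (_≡_; _≢_)
open import Relation.Nullary.Decidable.Core using (yes; no)
open import Relation.Nullary.Negation.Core using (¬_)

-- Since ⌊log₂ ⌊x⌋⌋ = ⌊log₂ x⌋ for real x ≥ 1, rounding in every round yields
-- exactly ⌊log⁽ᵏ⁾ n⌋ whenever log⁽ᵏ⁾ n ≥ 0; below that range the value is 0.
⌊log^_⌋ : ℕ → ℕ → ℕ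
⌊log^ zero  ⌋ n = n
⌊log^ suc k ⌋ n = ⌊log₂ (⌊log^ k ⌋ n) ⌋

------------------------------------------------------------------------
-- Graphs, given by adjacency arrays

-- Fin n stands for V = {1,…,n}; the machine sees u as the number 1 + toℕ u.
-- Graphs are simple: no parallel edges, and no loops if undirected.
record UndirectedGraph (n : ℕ) : Set where
  field
    deg       : Fin n → ℕ
    head      : (u : Fin n) → Fin (deg u) → Fin n
    mate      : (u : Fin n) (i : Fin (deg u)) → Fin (deg (head u i))
    head-mate : ∀ u i → head (head u i) (mate u i) ≡ u
    head-inj  : ∀ u i j → head u i ≡ head u j → i ≡ j
    loopless  : ∀ u i → head u i ≢ u

-- outmate maps the position of v in the out-array of u to the position of u in
-- the in-array of v, and inmate does the converse.  Loops are allowed.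
record DirectedGraph (n : ℕ) : Set where
  field
    outdeg indeg    : Fin n → ℕ
    outhead         : (u : Fin n) → Fin (outdeg u) → Fin n
    inhead          : (v : Fin n) → Fin (indeg v) → Fin n
    outmate         : (u : Fin n) (i : Fin (outdeg u)) → Fin (indeg (outhead u i))
    inmate          : (v : Fin n) (j : Fin (indeg v)) → Fin (outdeg (inhead v j))
    inhead-outmate  : ∀ u i → inhead (outhead u i) (outmate u i) ≡ u
    outhead-inmate  : ∀ v j → outhead (inhead v j) (inmate v j) ≡ v
    outhead-inj     : ∀ u i j → outhead u i ≡ outhead u j → i ≡ j
    inhead-inj      : ∀ v i j → inhead v i ≡ inhead v j → i ≡ j

data Kind : Set where
  undirected directed : Kind

Graph : Kind → ℕ → Set
Graph undirected = UndirectedGraph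
Graph directed   = DirectedGraph

-- An undirected edge occurs in two adjacency arrays.
#edges : ∀ kind {n} → Graph kind n → ℕ
#edges undirected G = ⌊ sum (tabulate (UndirectedGraph.deg G)) /2⌋
#edges directed   G = sum (tabulate (DirectedGraph.outdeg G))

Adjacent : ∀ kind {n} → Graph kind n → Fin n → Fin n → Set
Adjacent undirected G u v = ∃[ i ] UndirectedGraph.head G u i ≡ v
Adjacent directed   G u v = ∃[ i ] DirectedGraph.outhead G u i ≡ v

-- An undirected edge is an unordered pair: once explored from one endpoint, it
-- counts as explored at the other endpoint as well.
SameEdge : Kind → ∀ {n} → Fin n × Fin n → Fin n × Fin n → Set
SameEdge undirected e f = e ≡ f ⊎ e ≡ swap f
SameEdge directed   e f = e ≡ f

------------------------------------------------------------------------
-- Depth-first search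

-- The calls of user procedures.  In the last three, the arguments are the
-- current vertex u and the other endpoint v, respectively the parent u and
-- its child v.
data Event (A : Set) : Set where
  turnsGray turnsBlack                   : A → Event A
  exploresTree exploresNontree withdraws : (u v : A) → Event A

mapEvent : ∀ {A B} → (A → B) → Event A → Event B
mapEvent f (turnsGray u)         = turnsGray (f u)
mapEvent f (turnsBlack u)        = turnsBlack (f u)
mapEvent f (exploresTree u v)    = exploresTree (f u) (f v)
mapEvent f (exploresNontree u v) = exploresNontree (f u) (f v)
mapEvent f (withdraws u v)       = withdraws (f u) (f v)

data Colour : Set where
  white gray black : Colour

-- The stack holds the gray vertices, most recently discovered first.  Black
-- vertices have no unexplored (out)edges, so the DFS rule says that an edge
-- may be explored only from the top vertex as long as the latter has one.
-- A tree edge has been dealt with only after the withdrawal over it, so a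
-- vertex turns black when it is on top and has no unexplored edges left.
record SearchState (n : ℕ) : Set where
  constructor ⟨_,_,_,_⟩
  field
    roots    : List (Fin n)
    stack    : List (Fin n)
    colour   : Vec Colour n
    explored : List (Fin n × Fin n)

module _ (kind : Kind) {n : ℕ} (G : Graph kind n) where

  Unexplored : List (Fin n × Fin n) → Fin n → Fin n → Set
  Unexplored es u v = Adjacent kind G u v × ¬ Any (SameEdge kind (u , v)) es

  data _⟶[_]_ : SearchState n → List (Event (Fin n)) → SearchState n → Set where

    skipRoot : ∀ {r rs c es} → lookup c r ≢ white →
      ⟨ r ∷ rs , [] , c , es ⟩ ⟶[ [] ] ⟨ rs , [] , c , es ⟩

    newRoot : ∀ {r rs c es} → lookup c r ≡ white →
      ⟨ r ∷ rs , [] , c , es ⟩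
        ⟶[ turnsGray r ∷ [] ]
      ⟨ rs , r ∷ [] , c [ r ]≔ gray , es ⟩

    exploreTree : ∀ {rs u s c es v} → Unexplored es u v → lookup c v ≡ white →
      ⟨ rs , u ∷ s , c , es ⟩
        ⟶[ exploresTree u v ∷ turnsGray v ∷ [] ]
      ⟨ rs , v ∷ u ∷ s , c [ v ]≔ gray , (u , v) ∷ es ⟩

    exploreNontree : ∀ {rs u s c es v} → Unexplored es u v → lookup c v ≢ white →
      ⟨ rs , u ∷ s , c , es ⟩
        ⟶[ exploresNontree u v ∷ [] ]
      ⟨ rs , u ∷ s , c , (u , v) ∷ es ⟩

    finishChild : ∀ {rs p u s c es} → (∀ v → ¬ Unexplored es u v) →
      ⟨ rs , u ∷ p ∷ s , c , es ⟩
        ⟶[ turnsBlack u ∷ withdraws p u ∷ [] ]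
      ⟨ rs , p ∷ s , c [ u ]≔ black , es ⟩

    finishRoot : ∀ {rs u c es} → (∀ v → ¬ Unexplored es u v) →
      ⟨ rs , u ∷ [] , c , es ⟩
        ⟶[ turnsBlack u ∷ [] ]
      ⟨ rs , [] , c [ u ]≔ black , es ⟩

  data CompletesWith : SearchState n → List (Event (Fin n)) → Set where
    done : ∀ {c es} → CompletesWith ⟨ [] , [] , c , es ⟩ []
    step : ∀ {σ σ′ τ τ′} → σ ⟶[ τ ] σ′ → CompletesWith σ′ τ′ →
           CompletesWith σ (τ ++ τ′)

  IsDFS : List (Event (Fin n)) → Set
  IsDFS τ = Σ[ rootOrder ∈ List (Fin n) ]
    rootOrder ↭ allFin n ×
    CompletesWith ⟨ rootOrder , [] , replicate n white , [] ⟩ τ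

------------------------------------------------------------------------
-- The access functions, on numbers; undefined outside their domains

data Query : Kind → Set where
  deg head mate                                 : Query undirected
  outdeg outhead outmate indeg inhead inmate    : Query directed

number : ∀ {n} → Fin n → ℕ
number u = suc (toℕ u)

index? : (d : ℕ) → ℕ → Maybe (Fin d)
index? d i with i <? d
... | yes i<d = just (fromℕ< i<d)
... | no  _   = nothing

vertex? : (n : ℕ) → ℕ → Maybe (Fin n)
vertex? n zero    = nothing
vertex? n (suc x) = index? n x

-- The degree queries ignore their second argument.
answer : ∀ kind {n} → Graph kind n → Query kind → ℕ → ℕ → Maybe ℕ
answer undirected {n} G q x i = vertex? n x >>= go q
  where
  module G = UndirectedGraph G
  go : Query undirected → Fin n → Maybe ℕ
  go deg  u = just (G.deg u)
  go head u = index? (G.deg u) i >>= λ j → just (number (G.head u j))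
  go mate u = index? (G.deg u) i >>= λ j → just (toℕ (G.mate u j))
answer directed {n} G q x i = vertex? n x >>= go q
  where
  module G = DirectedGraph G
  go : Query directed → Fin n → Maybe ℕ
  go outdeg  u = just (G.outdeg u)
  go outhead u = index? (G.outdeg u) i >>= λ j → just (number (G.outhead u j))
  go outmate u = index? (G.outdeg u) i >>= λ j → just (toℕ (G.outmate u j))
  go indeg   v = just (G.indeg v)
  go inhead  v = index? (G.indeg v) i >>= λ j → just (number (G.inhead v j))
  go inmate  v = index? (G.indeg v) i >>= λ j → just (toℕ (G.inmate v j))

------------------------------------------------------------------------
-- The word RAM

Word : ℕ → Set
Word w = Fin (2 ^ w)

truncate : ∀ w → ℕ → Word w
truncate w x = _mod_ x (2 ^ w) {{m^n≢0 2 w}}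

data Op : Set where
  add sub mul quo rem and or xor shl shr eq lt : Op

quotient remainder : ℕ → ℕ → ℕ
quotient  x zero    = zero
quotient  x (suc y) = x / suc y
remainder x zero    = zero
remainder x (suc y) = x % suc y

bit : Bool → ℕ
bit b = if b then 1 else 0

bitwise : (Bool → Bool → Bool) → (w : ℕ) → ℕ → ℕ → ℕ
bitwise _⊕_ zero    x y = 0
bitwise _⊕_ (suc w) x y =
  bit ((x % 2 ≡ᵇ 1) ⊕ (y % 2 ≡ᵇ 1)) + 2 * bitwise _⊕_ w ⌊ x /2⌋ ⌊ y /2⌋

-- The results are still to be taken modulo 2 ^ w.
⟦_⟧ : Op → (w x y : ℕ) → ℕ
⟦ add ⟧ w x y = x + y
⟦ sub ⟧ w x y = x + (2 ^ w ∸ y)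
⟦ mul ⟧ w x y = x * y
⟦ quo ⟧ w x y = quotient x y
⟦ rem ⟧ w x y = remainder x y
⟦ and ⟧ w x y = bitwise _∧_ w x y
⟦ or  ⟧ w x y = bitwise _∨_ w x y
⟦ xor ⟧ w x y = bitwise _xor_ w x y
⟦ shl ⟧ w x y = x * 2 ^ y
⟦ shr ⟧ w x y = _/_ x (2 ^ y) {{m^n≢0 2 y}}
⟦ eq  ⟧ w x y = bit (x ≡ᵇ y)
⟦ lt  ⟧ w x y = bit (x <ᵇ y)

-- r is the number of registers.
data Instruction (Q : Set) (r : ℕ) : Set where
  set      : (d : Fin r) (c : ℕ) → Instruction Q r
  alu      : Op → (d a b : Fin r) → Instruction Q r
  load     : (d a : Fin r) → Instruction Q r
  store    : (a s : Fin r) → Instruction Q r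
  jumpZero : (a : Fin r) (target : ℕ) → Instruction Q r
  jump     : (target : ℕ) → Instruction Q r
  ask      : Q → (d a b : Fin r) → Instruction Q r
  call     : Event (Fin r) → Instruction Q r
  halt     : Instruction Q r

-- The two mandatory registers initially contain n and w.
record Program (Q : Set) : Set where
  field
    extraRegisters : ℕ
  #registers : ℕ
  #registers = 2 + extraRegisters
  field
    code : List (Instruction Q #registers)

-- A machine with word length w and S words of memory besides the registers,
-- whose read-only input is accessed through ans.
module Machine {Q : Set} (ans : Q → ℕ → ℕ → Maybe ℕ) (P : Program Q) (w S : ℕ) where
  open Program P

  record Config : Set where
    constructor config
    field
      pc        : ℕ
      registers : Vec (Word w) #registers
      memory    : Vec (Word w) S
  open Config

  initial : ℕ → Vec (Word w) S → Config
  initial n mem = config 0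
    (truncate w n Vec.∷ truncate w w Vec.∷ replicate extraRegisters (truncate w 0)) mem

  fetch : ℕ → Maybe (Instruction Q #registers)
  fetch i = List.head (drop i code)

  -- nothing: the machine has halted or commits an access violation.
  execute : Instruction Q #registers → Config → Maybe (Config × List (Event ℕ))
  execute ins (config pc regs mem) = go ins
    where
    val : Fin #registers → ℕ
    val a = toℕ (lookup regs a)

    assign : Fin #registers → Word w → Maybe (Config × List (Event ℕ))
    assign d x = just (config (suc pc) (regs [ d ]≔ x) mem , [])

    go : Instruction Q #registers → Maybe (Config × List (Event ℕ))
    go (set d c)      = assign d (truncate w c)
    go (alu op d a b) = assign d (truncate w (⟦ op ⟧ w (val a) (val b)))
    go (load d a)     = index? S (val a) >>= λ i → assign d (lookup mem i)
    go (store a s)    = index? S (val a) >>= λ i →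
                        just (config (suc pc) regs (mem [ i ]≔ lookup regs s) , [])
    go (jumpZero a t) = just (config (if val a ≡ᵇ 0 then t else suc pc) regs mem , [])
    go (jump t)       = just (config t regs mem , [])
    go (ask q d a b)  = ans q (val a) (val b) >>= λ x → assign d (truncate w x)
    go (call e)       = just (config (suc pc) regs mem , mapEvent val e ∷ [])
    go halt           = nothing

  -- Run c t τ: started in c, the machine halts properly after t instructions,
  -- having made the calls τ.
  data Run : Config → ℕ → List (Event ℕ) → Set where
    halted : ∀ {c} → fetch (pc c) ≡ just halt → Run c 1 []
    next   : ∀ {c ins c′ τ t τ′} →
             fetch (pc c) ≡ just ins → execute ins c ≡ just (c′ , τ) →
             Run c′ t τ′ → Run c (suc t) (τ ++ τ′)

-- The program carries out a DFS of G on a machine with word length w and S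
-- words of memory with arbitrary initial contents, within t instructions.
CarriesOutDFS : ∀ kind → Program (Query kind) → ∀ {n} → Graph kind n →
                (w S t : ℕ) → Set
CarriesOutDFS kind P {n} G w S t =
  (mem : Vec (Word w) S) →
  Σ[ τ ∈ List (Event (Fin n)) ] Σ[ t′ ∈ ℕ ]
    IsDFS kind G τ ×
    Run (initial n mem) t′ (List.map (mapEvent number) τ) ×
    t′ ≤ t
  where open Machine (answer kind G) P w S

-- All of the registers count as working memory.
bitsUsed : ∀ {Q} → Program Q → (w S : ℕ) → ℕ
bitsUsed P w S = (Program.#registers P + S) * w

-- The search keeps one position per edge of the current tree path, but mostly approximately. Level j of K + 1 levels stores
-- for each edge a field of at most bb j bits, from which the position is recovered up to d / 2 ^ bb j at a tail of degree d;
-- here bb K = Θ(log n) and bb (j - 1) = Θ(log (bb j)). Level 0 covers the whole path, a higher level only a top part, its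
-- zone, of at most n bits. On level K the field is the exact position in the list of the head, so the path can be popped. An
-- exhausted zone is rebuilt by a walk along the level below, which scans the neighbours left open by the approximation and
-- recognizes the edges by the marks on their heads. A walk along level j costs O(n + m / 2 ^ bb j) and is paid by the Ω(n)
-- bits of fields pushed or popped on level j + 1 since the last one; a vertex adds few, at most bb (j + 1) ≤ 2 ^ bb j.

{-# OPTIONS --safe #-}

module Submission where

open import Defs hiding (deg; head; mate; outdeg; outhead; outmate; indeg; inhead; inmate)
  renaming (number to ν; quotient to div; remainder to mod; DirectedGraph to Digraph; undirected to undir; directed to dir)
open import Data.Bool.Base using (Bool; true; false; if_then_else_; _∧_; _∨_; T; not) renaming (_xor_ to _⊻_)
open import Data.Bool.Properties using (xor-same; ∨-identityʳ; xor-identityʳ; xor-assoc; ∧-zeroʳ)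
open import Data.Empty using (⊥) renaming (⊥-elim to ⊥!)
open import Data.Fin using (#_)
open import Data.Fin.Base using (Fin; zero; suc; toℕ; fromℕ<; _↑ʳ_; _↑ˡ_; splitAt)
open import Data.Fin.Properties using (toℕ-fromℕ<; toℕ<n; toℕ-injective; fromℕ<-toℕ; injective⇒≤; splitAt-↑ˡ; splitAt-↑ʳ; join-splitAt)
  renaming (_≟_ to _≟ᶠ_; suc-injective to sucᶠ-injective)
open import Data.List.Base as List using (List; []; _∷_; _++_; map; drop; length; tabulate; allFin; _ʳ++_)
open import Data.List.Properties using (++-assoc; ++-identityʳ; drop-drop; length-++; map-++; map-ʳ++; ++-conicalˡ; drop-all; length-map; length-tabulate; ʳ++-ʳ++; ∷-injectiveʳ)
open import Data.List.Relation.Unary.All as All using (All; []; _∷_)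
open import Data.List.Relation.Unary.All.Properties using (++⁻ˡ)
open import Data.List.Relation.Unary.AllPairs using (AllPairs; []; _∷_)
open import Data.List.Relation.Unary.Any as Any using (Any; here; there)
open import Data.Maybe.Base using (Maybe; just; nothing; _>>=_; fromMaybe)
open import Data.Nat.Base
open import Data.Nat.DivMod hiding (_div_; _mod_)
open import Data.Nat.ListAction using (sum)
open import Data.Nat.Logarithm using (⌊log₂_⌋; ⌊log₂⌋-mono-≤; ⌊log₂[2^n]⌋≡n; ⌊log₂⌊n/2⌋⌋≡⌊log₂n⌋∸1)
open import Data.Nat.Properties
  renaming (+-identityʳ to +0; +-monoʳ-≤ to +ʳ≤; +-monoˡ-≤ to +ˡ≤; *-monoʳ-≤ to *ʳ≤; *-monoˡ-≤ to *ˡ≤; +-mono-≤ to +≤+; +-monoʳ-< to +ʳ<; m≤n⇒m<n∨m≡n to ≤-split)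
open import Data.Nat.Tactic.RingSolver using () renaming (solve-∀ to ring)
open import Data.Product.Base using (Σ-syntax; _×_; _,_; swap) renaming (proj₁ to fst; proj₂ to snd)
open import Data.Sum.Base as Sum using (_⊎_) renaming (inj₁ to inl; inj₂ to inr)
open import Data.Unit.Base using (⊤; tt)
open import Data.Vec.Base as Vec using (Vec; []; _∷_; lookup; _[_]≔_)
open import Data.Vec.Properties using (lookup-replicate) renaming (lookup∘update to lookup-≡; lookup∘update′ to lookup-≢)
open import Relation.Binary.Definitions using (tri<; tri≈; tri>)
open import Relation.Binary.PropositionalEquality
open import Relation.Nullary using (Dec; yes; no; ¬_)
open import Relation.Nullary.Decidable using (does; dec-true; dec-false; _⊎-dec_)
open import Data.Product.Properties using (≡-dec)
open import Data.List.Membership.Propositional using (_∈_)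
open import Data.List.Membership.DecPropositional using () renaming (_∈?_ to ∈?-with)
open import Data.List.Membership.Propositional.Properties using (∈-allFin; ∈-++⁺ˡ)
open import Data.List.Relation.Binary.Permutation.Propositional using (↭-refl)

-- Two different bounds on the number of refills are needed at once. The scans of all walks are
-- affordable because level `suc j` has O(j bb (suc j)) refills and `bb (suc j) < 2 ^ bb j`. But
-- every walk also costs O(n), and only O(m / n) of them fit into linear time. Hence a field is
-- never longer than a degree, and it is charged to the head of its edge: a vertex is pushed only
-- once as a head, but once per child as a tail. A path can be followed only upwards from the bottom
-- of a zone, so the part to keep is unknown until a first walk has counted the bits. A stale level
-- is never alone: all levels above it are stale, too, and this cascade causes the factor `j`. In an
-- undirected graph there is no memory for the explored edges. Exploring all edges to gray
-- neighbours right at the discovery makes "explored" equivalent to "both ends discovered", which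
-- the colours record anyway. For small `n` the addresses may exceed the word length; each such `n`
-- gets a decision tree that uses no memory.

infixr 6 _·_ _»_
infixl 7 _∙_

_·_ : ∀ {A : Set} {x y z : A} → x ≡ y → y ≡ z → x ≡ z
_·_ = trans

_»_ : ∀ {x y z} → x ≤ y → y ≤ z → x ≤ z
_»_ = ≤-trans

=≤ : ∀ {x y} → x ≡ y → x ≤ y
=≤ = ≤-reflexive

=≥ : ∀ {x y} → y ≡ x → x ≤ y
=≥ e = ≤-reflexive (sym e)

_∙_ : ∀ {A : Set} {B : A → Set} {f g : ∀ x → B x} → f ≡ g → ∀ x → f x ≡ g x
refl ∙ x = refl

≡< : ∀ {x y z} → x ≡ y → y < z → x < z
≡< refl h = h

≡≤ : ∀ {x y z} → x ≡ y → y ≤ z → x ≤ z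
≡≤ refl h = h

≤! : ∀ {a b} {_ : T (a ≤ᵇ b)} → a ≤ b
≤! {a} {b} {h} = ≤ᵇ⇒≤ a b h

x+yz≡y+xz : ∀ x y z → x + (y + z) ≡ y + (x + z)
x+yz≡y+xz = ring

x+yz≡yx+z : ∀ x y z → x + (y + z) ≡ y + x + z
x+yz≡yx+z = ring

[k+1]*w+j : ∀ k w j → (k + 1) * w + j ≡ k * w + (w + j)
[k+1]*w+j = ring

-- Binary digits of numbers and the arithmetic of words

infixl 7 _/2^_ _%2^_

_/2^_ _%2^_ : ℕ → ℕ → ℕ
x /2^ o = _/_ x (2 ^ o) {{m^n≢0 2 o}}
x %2^ o = _%_ x (2 ^ o) {{m^n≢0 2 o}}

tb : ℕ → ℕ → Bool
tb x zero = x % 2 ≡ᵇ 1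
tb x (suc l) = tb ⌊ x /2⌋ l

bit+double : ∀ x → x ≡ bit (tb x 0) + 2 * ⌊ x /2⌋
bit+double zero = refl
bit+double (suc zero) = refl
bit+double (suc (suc x)) = begin
 suc (suc x) ≡⟨ cong (2 +_) (bit+double x) ⟩
 2 + (bit (tb x 0) + 2 * ⌊ x /2⌋) ≡⟨ cong suc (sym (+-suc (bit (tb x 0)) _)) ⟩
 suc (bit (tb x 0) + suc (2 * ⌊ x /2⌋)) ≡⟨ sym (+-suc (bit (tb x 0)) _) ⟩
 bit (tb x 0) + (2 + 2 * ⌊ x /2⌋) ≡⟨ cong (bit (tb x 0) +_) (sym (*-suc 2 ⌊ x /2⌋)) ⟩
 bit (tb x 0) + 2 * suc ⌊ x /2⌋ ∎
 where open ≡-Reasoning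

bit+2*suc : ∀ b y → bit b + 2 * suc y ≡ 2 + (bit b + 2 * y)
bit+2*suc b y = cong (bit b +_) (*-suc 2 y) · +-suc (bit b) _ · cong suc (+-suc (bit b) _)

tb-bit+double : ∀ b y → tb (bit b + 2 * y) 0 ≡ b
tb-bit+double false zero = refl
tb-bit+double true zero = refl
tb-bit+double b (suc y) = cong (λ z → tb z 0) (bit+2*suc b y) · tb-bit+double b y

half-bit+double : ∀ b y → ⌊ bit b + 2 * y /2⌋ ≡ y
half-bit+double false zero = refl
half-bit+double true zero = refl
half-bit+double b (suc y) = cong ⌊_/2⌋ (bit+2*suc b y) · cong suc (half-bit+double b y)

half≡/2 : ∀ x → ⌊ x /2⌋ ≡ x / 2
half≡/2 zero = refl
half≡/2 (suc zero) = refl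
half≡/2 (suc (suc x)) = cong suc (half≡/2 x) · sym (m/n≡1+[m∸n]/n {suc (suc x)} {2} (s≤s z<s))

tb-bitwise : ∀ f w x y l → l < w → tb (bitwise f w x y) l ≡ f (tb x l) (tb y l)
tb-bitwise f (suc w) x y zero l<w = tb-bit+double (f (tb x 0) (tb y 0)) (bitwise f w ⌊ x /2⌋ ⌊ y /2⌋)
tb-bitwise f (suc w) x y (suc l) (s≤s l<w) = cong (λ z → tb z l) (half-bit+double (f (tb x 0) (tb y 0)) (bitwise f w ⌊ x /2⌋ ⌊ y /2⌋)) · (tb-bitwise f w ⌊ x /2⌋ ⌊ y /2⌋ l l<w)

bit≤1 : ∀ b → bit b ≤ 1
bit≤1 false = z≤n
bit≤1 true = z<s

bit+double-< : ∀ b y m → y < m → bit b + 2 * y < 2 * m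
bit+double-< b y m y<m = begin-strict
 bit b + 2 * y ≤⟨ +ˡ≤ (2 * y) (bit≤1 b) ⟩
 1 + 2 * y <⟨ n<1+n _ ⟩
 2 + 2 * y ≡⟨ sym (*-suc 2 y) ⟩
 2 * suc y ≤⟨ *ʳ≤ 2 y<m ⟩
 2 * m ∎
 where open ≤-Reasoning

bitwise-< : ∀ f w x y → bitwise f w x y < 2 ^ w
bitwise-< f zero x y = z<s
bitwise-< f (suc w) x y = bit+double-< (f (tb x 0) (tb y 0)) _ (2 ^ w) (bitwise-< f w ⌊ x /2⌋ ⌊ y /2⌋)

half-< : ∀ x m → x < 2 * m → ⌊ x /2⌋ < m
half-< x m x<2m = *-cancelˡ-< 2 ⌊ x /2⌋ m (≤-<-trans (m≤n+m _ (bit (tb x 0)) » =≥ (bit+double x)) x<2m)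

tb-≥ : ∀ x w l → x < 2 ^ w → w ≤ l → tb x l ≡ false
tb-≥ zero zero zero _ _ = refl
tb-≥ zero zero (suc l) _ _ = tb-≥ zero zero l z<s z≤n
tb-≥ (suc x) zero l (s≤s ()) _
tb-≥ x (suc w) (suc l) x< (s≤s w≤l) = tb-≥ ⌊ x /2⌋ w l (half-< x _ x<) w≤l

tb-ext : ∀ w x y → x < 2 ^ w → y < 2 ^ w → (∀ l → l < w → tb x l ≡ tb y l) → x ≡ y
tb-ext zero zero zero _ _ _ = refl
tb-ext zero (suc x) y (s≤s ()) _ _
tb-ext zero zero (suc y) _ (s≤s ()) _
tb-ext (suc w) x y x< y< h = begin
 x ≡⟨ bit+double x ⟩
 bit (tb x 0) + 2 * ⌊ x /2⌋ ≡⟨ cong₂ (λ b z → bit b + 2 * z) (h 0 z<s) (tb-ext w _ _ (half-< x _ x<) (half-< y _ y<) (λ l l<w → h (suc l) (s≤s l<w))) ⟩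
 bit (tb y 0) + 2 * ⌊ y /2⌋ ≡⟨ sym (bit+double y) ⟩
 y ∎
 where open ≡-Reasoning

/2^-suc : ∀ x o → x /2^ suc o ≡ ⌊ x /2⌋ /2^ o
/2^-suc x o = sym (m/n/o≡m/[n*o] x 2 (2 ^ o) {{_}} {{m^n≢0 2 o}} {{m^n≢0 2 (suc o)}}) · cong (_/2^ o) (sym (half≡/2 x))

tb-/ : ∀ x o l → tb (x /2^ o) l ≡ tb x (o + l)
tb-/ x zero l = cong (λ z → tb z l) (n/1≡n x)
tb-/ x (suc o) l = cong (λ z → tb z l) (/2^-suc x o) · (tb-/ ⌊ x /2⌋ o l)

double-* : ∀ x o → x * 2 ^ suc o ≡ bit false + 2 * (x * 2 ^ o)
double-* x o = sym (*-assoc x 2 _) · cong (_* 2 ^ o) (*-comm x 2) · *-assoc 2 x _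

tb-*-≥ : ∀ x o l → tb (x * 2 ^ o) (o + l) ≡ tb x l
tb-*-≥ x zero l = cong (λ z → tb z l) (*-identityʳ x)
tb-*-≥ x (suc o) l = cong (λ z → tb ⌊ z /2⌋ (o + l)) (double-* x o) · cong (λ z → tb z (o + l)) (half-bit+double false (x * 2 ^ o)) · tb-*-≥ x o l

tb-*-< : ∀ x o l → l < o → tb (x * 2 ^ o) l ≡ false
tb-*-< x (suc o) zero _ = cong (λ z → tb z 0) (double-* x o) · tb-bit+double false (x * 2 ^ o)
tb-*-< x (suc o) (suc l) (s≤s l<o) = cong (λ z → tb ⌊ z /2⌋ l) (double-* x o) · cong (λ z → tb z l) (half-bit+double false (x * 2 ^ o)) · tb-*-< x o l l<o

%2^-suc : ∀ x w → x %2^ suc w ≡ bit (tb x 0) + 2 * (⌊ x /2⌋ %2^ w)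
%2^-suc x w = begin
 x %2^ suc w ≡⟨ cong (_%2^ suc w) split ⟩
 ((bit (tb x 0) + 2 * r) + q * 2 ^ suc w) %2^ suc w ≡⟨ [m+kn]%n≡m%n _ q (2 ^ suc w) {{m^n≢0 2 (suc w)}} ⟩
 (bit (tb x 0) + 2 * r) %2^ suc w ≡⟨ m<n⇒m%n≡m {{m^n≢0 2 (suc w)}} (bit+double-< (tb x 0) r (2 ^ w) (m%n<n ⌊ x /2⌋ (2 ^ w) {{m^n≢0 2 w}})) ⟩
 bit (tb x 0) + 2 * r ∎
 where
 open ≡-Reasoning
 r = ⌊ x /2⌋ %2^ w
 q = ⌊ x /2⌋ /2^ w
 split : x ≡ (bit (tb x 0) + 2 * r) + q * 2 ^ suc w
 split = begin
  x ≡⟨ bit+double x ⟩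
  bit (tb x 0) + 2 * ⌊ x /2⌋ ≡⟨ cong (λ z → bit (tb x 0) + 2 * z) (m≡m%n+[m/n]*n ⌊ x /2⌋ (2 ^ w) {{m^n≢0 2 w}}) ⟩
  bit (tb x 0) + 2 * (r + q * 2 ^ w) ≡⟨ cong (bit (tb x 0) +_) (*-distribˡ-+ 2 r (q * 2 ^ w)) ⟩
  bit (tb x 0) + (2 * r + 2 * (q * 2 ^ w)) ≡⟨ sym (+-assoc (bit (tb x 0)) _ _) ⟩
  bit (tb x 0) + 2 * r + 2 * (q * 2 ^ w) ≡⟨ cong (bit (tb x 0) + 2 * r +_) (sym (*-assoc 2 q _) · cong (_* 2 ^ w) (*-comm 2 q) · *-assoc q 2 _) ⟩
  bit (tb x 0) + 2 * r + q * 2 ^ suc w ∎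

tb-% : ∀ x w l → l < w → tb (x %2^ w) l ≡ tb x l
tb-% x (suc w) zero _ = cong (λ z → tb z 0) (%2^-suc x w) · tb-bit+double (tb x 0) (⌊ x /2⌋ %2^ w)
tb-% x (suc w) (suc l) (s≤s l<w) = cong (λ z → tb ⌊ z /2⌋ l) (%2^-suc x w) · cong (λ z → tb z l) (half-bit+double (tb x 0) (⌊ x /2⌋ %2^ w)) · (tb-% ⌊ x /2⌋ w l l<w)

num : (ℕ → Bool) → ℕ → ℕ → ℕ
num f o zero = 0
num f o (suc l) = bit (f o) + 2 * num f (suc o) l

num-< : ∀ f o l → num f o l < 2 ^ l
num-< f o zero = z<s
num-< f o (suc l) = bit+double-< (f o) (num f (suc o) l) (2 ^ l) (num-< f (suc o) l)

tb-num : ∀ f o l i → i < l → tb (num f o l) i ≡ f (o + i)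
tb-num f o (suc l) zero _ = tb-bit+double (f o) (num f (suc o) l) · cong f (sym (+0 o))
tb-num f o (suc l) (suc i) (s≤s i<l) = cong (λ z → tb z i) (half-bit+double (f o) (num f (suc o) l)) · tb-num f (suc o) l i i<l · cong f (sym (+-suc o i))

num-unique : ∀ f o l x → x < 2 ^ l → (∀ i → i < l → f (o + i) ≡ tb x i) → num f o l ≡ x
num-unique f o l x x< h = tb-ext l _ _ (num-< f o l) x< (λ i i<l → tb-num f o l i i<l · h i i<l)

num-cong : ∀ f g o l → (∀ i → i < l → f (o + i) ≡ g (o + i)) → num f o l ≡ num g o l
num-cong f g o l h = num-unique f o l _ (num-< g o l) (λ i i<l → h i i<l · sym (tb-num g o l i i<l))

-- Machine arithmetic without the reduction modulo 2 ^ w wherever OpOk excludes an overflow.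
opval : ℕ → Op → ℕ → ℕ → ℕ
opval w add x y = x + y
opval w sub x y = x ∸ y
opval w mul x y = x * y
opval w quo x y = div x y
opval w rem x y = mod x y
opval w and x y = bitwise _∧_ w x y
opval w or x y = bitwise _∨_ w x y
opval w xor x y = bitwise _⊻_ w x y
opval w shl x y = (x * 2 ^ y) %2^ w
opval w shr x y = x /2^ y
opval w eq x y = bit (x ≡ᵇ y)
opval w lt x y = bit (x <ᵇ y)

OpOk : ℕ → Op → ℕ → ℕ → Set
OpOk w add x y = x + y < 2 ^ w
OpOk w sub x y = y ≤ x
OpOk w mul x y = x * y < 2 ^ w
OpOk w _ x y = ⊤

toℕ-truncate : ∀ w x → toℕ (truncate w x) ≡ x %2^ w
toℕ-truncate w x = toℕ-fromℕ< (m%n<n x (2 ^ w) {{m^n≢0 2 w}})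

toℕ-truncate-< : ∀ w x → x < 2 ^ w → toℕ (truncate w x) ≡ x
toℕ-truncate-< w x x< = toℕ-truncate w x · m<n⇒m%n≡m {{m^n≢0 2 w}} x<

bit<2^ : ∀ w b → 0 < w → bit b < 2 ^ w
bit<2^ (suc w) b _ = s≤s (m≤m+n (bit b) 0) » bit+double-< b 0 (2 ^ w) (m^n>0 2 w)

quotient≤ : ∀ x y → div x y ≤ x
quotient≤ x zero = z≤n
quotient≤ x (suc y) = m/n≤m x (suc y)

remainder≤ : ∀ x y → mod x y ≤ x
remainder≤ x zero = z≤n
remainder≤ x (suc y) = m%n≤m x (suc y)

op-sound : ∀ w → 0 < w → ∀ op x y → x < 2 ^ w → y < 2 ^ w → OpOk w op x y → toℕ (truncate w (⟦ op ⟧ w x y)) ≡ opval w op x y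
op-sound w w>0 add x y x< y< ok = toℕ-truncate-< w _ ok
op-sound w w>0 sub x y x< y< y≤x = toℕ-truncate w _ · cong (_%2^ w) eqn · [m+n]%n≡m%n (x ∸ y) (2 ^ w) {{m^n≢0 2 w}} · m<n⇒m%n≡m {{m^n≢0 2 w}} (s≤s (m∸n≤m x y) » x<)
 where
 eqn : x + (2 ^ w ∸ y) ≡ (x ∸ y) + 2 ^ w
 eqn = begin
  x + (2 ^ w ∸ y) ≡⟨ cong (_+ (2 ^ w ∸ y)) (sym (m∸n+n≡m y≤x)) ⟩
  x ∸ y + y + (2 ^ w ∸ y) ≡⟨ +-assoc (x ∸ y) y _ ⟩
  x ∸ y + (y + (2 ^ w ∸ y)) ≡⟨ cong (x ∸ y +_) (m+[n∸m]≡n (<⇒≤ y<)) ⟩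
  x ∸ y + 2 ^ w ∎
  where open ≡-Reasoning
op-sound w w>0 mul x y x< y< ok = toℕ-truncate-< w _ ok
op-sound w w>0 quo x y x< y< ok = toℕ-truncate-< w _ (s≤s (quotient≤ x y) » x<)
op-sound w w>0 rem x y x< y< ok = toℕ-truncate-< w _ (s≤s (remainder≤ x y) » x<)
op-sound w w>0 and x y x< y< ok = toℕ-truncate-< w _ (bitwise-< _∧_ w x y)
op-sound w w>0 or x y x< y< ok = toℕ-truncate-< w _ (bitwise-< _∨_ w x y)
op-sound w w>0 xor x y x< y< ok = toℕ-truncate-< w _ (bitwise-< _⊻_ w x y)
op-sound w w>0 shl x y x< y< ok = toℕ-truncate w _
op-sound w w>0 shr x y x< y< ok = toℕ-truncate-< w _ (s≤s (m/n≤m x (2 ^ y) {{m^n≢0 2 y}}) » x<)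
op-sound w w>0 eq x y x< y< ok = toℕ-truncate-< w _ (bit<2^ w (x ≡ᵇ y) w>0)
op-sound w w>0 lt x y x< y< ok = toℕ-truncate-< w _ (bit<2^ w (x <ᵇ y) w>0)

-- Indices are compared by `≡ᵇ` so that an update at a literal register reduces by computation; this
-- is why so many equations between registers below are `refl`.
upd : ∀ {R} {A : Set} → (Fin R → A) → Fin R → A → Fin R → A
upd f d v x = if toℕ d ≡ᵇ toℕ x then v else f x

updℕ : ∀ {A : Set} → (ℕ → A) → ℕ → A → ℕ → A
updℕ f d v x = if d ≡ᵇ x then v else f x

≡ᵇ-refl : ∀ m → (m ≡ᵇ m) ≡ true
≡ᵇ-refl zero = refl
≡ᵇ-refl (suc m) = ≡ᵇ-refl m

≡ᵇ-≢ : ∀ m n → m ≢ n → (m ≡ᵇ n) ≡ false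
≡ᵇ-≢ zero zero h = ⊥! (h refl)
≡ᵇ-≢ zero (suc n) h = refl
≡ᵇ-≢ (suc m) zero h = refl
≡ᵇ-≢ (suc m) (suc n) h = ≡ᵇ-≢ m n (λ e → h (cong suc e))

updℕ-≡ : ∀ {A : Set} (f : ℕ → A) d v → updℕ f d v d ≡ v
updℕ-≡ f d v rewrite ≡ᵇ-refl d = refl

updℕ-≢ : ∀ {A : Set} (f : ℕ → A) d v x → d ≢ x → updℕ f d v x ≡ f x
updℕ-≢ f d v x h rewrite ≡ᵇ-≢ d x h = refl

-- Straight-line machine code

record MState (r : ℕ) : Set where
 constructor mst
 field
  mreg : Fin r → ℕ
  mmem : ℕ → ℕ
  mout : List (Event ℕ)
open MState public

module Blocks {Q : Set} (ans : Q → ℕ → ℕ → Maybe ℕ) (w S : ℕ) {r : ℕ} where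

 setm : MState r → Fin r → ℕ → MState r
 setm σ d v = mst (upd (mreg σ) d v) (mmem σ) (mout σ)

 eff1 : Instruction Q r → MState r → MState r
 eff1 (set d c) σ = setm σ d c
 eff1 (alu op d a b) σ = setm σ d (opval w op (mreg σ a) (mreg σ b))
 eff1 (load d a) σ = setm σ d (mmem σ (mreg σ a))
 eff1 (store a s) σ = mst (mreg σ) (updℕ (mmem σ) (mreg σ a) (mreg σ s)) (mout σ)
 eff1 (ask q d a b) σ = setm σ d (fromMaybe 0 (ans q (mreg σ a) (mreg σ b)))
 eff1 (call e) σ = mst (mreg σ) (mmem σ) (mout σ ++ mapEvent (mreg σ) e ∷ [])
 eff1 _ σ = σ

 ok1 : Instruction Q r → MState r → Set
 ok1 (set d c) σ = c < 2 ^ w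
 ok1 (alu op d a b) σ = OpOk w op (mreg σ a) (mreg σ b)
 ok1 (load d a) σ = mreg σ a < S
 ok1 (store a s) σ = mreg σ a < S
 ok1 (ask q d a b) σ = Σ[ y ∈ ℕ ] ans q (mreg σ a) (mreg σ b) ≡ just y × y < 2 ^ w
 ok1 (call e) σ = ⊤
 ok1 _ σ = ⊥

 run1 : List (Instruction Q r) → MState r → MState r
 run1 [] σ = σ
 run1 (i ∷ is) σ = run1 is (eff1 i σ)

 oks1 : List (Instruction Q r) → MState r → Set
 oks1 [] σ = ⊤
 oks1 (i ∷ is) σ = ok1 i σ × oks1 is (eff1 i σ)

 run1-++ : ∀ is js σ → run1 (is ++ js) σ ≡ run1 js (run1 is σ)
 run1-++ [] js σ = refl
 run1-++ (i ∷ is) js σ = run1-++ is js (eff1 i σ)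

 oks1-++ : ∀ is js σ → oks1 is σ → oks1 js (run1 is σ) → oks1 (is ++ js) σ
 oks1-++ [] js σ _ h = h
 oks1-++ (i ∷ is) js σ (o , os) h = o , oks1-++ is js (eff1 i σ) os h

lookup-upd : ∀ {r} w (regs : Vec (Word w) r) (f : Fin r → ℕ) d v x → (∀ y → toℕ (lookup regs y) ≡ f y) → toℕ v ≡ x → ∀ y → toℕ (lookup (regs [ d ]≔ v) y) ≡ upd f d x y
lookup-upd w regs f d v x h hv y with d ≟ᶠ y
... | yes refl = cong toℕ (lookup-≡ d regs v) · hv · sym (cong (if_then x else f d) (≡ᵇ-refl (toℕ d)))
... | no d≢y = cong toℕ (lookup-≢ (≢-sym d≢y) regs v) · h y · sym (cong (if_then x else f y) (≡ᵇ-≢ (toℕ d) (toℕ y) (λ e → d≢y (toℕ-injective e))))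

mapEvent-cong : ∀ {A B : Set} (f g : A → B) → (∀ x → f x ≡ g x) → ∀ e → mapEvent f e ≡ mapEvent g e
mapEvent-cong f g h (turnsGray u) = cong turnsGray (h u)
mapEvent-cong f g h (turnsBlack u) = cong turnsBlack (h u)
mapEvent-cong f g h (exploresTree u v) = cong₂ exploresTree (h u) (h v)
mapEvent-cong f g h (exploresNontree u v) = cong₂ exploresNontree (h u) (h v)
mapEvent-cong f g h (withdraws u v) = cong₂ withdraws (h u) (h v)

index?-< : ∀ d i (i<d : i < d) → index? d i ≡ just (fromℕ< i<d)
index?-< d i i<d with i <? d
... | yes p = refl
... | no ¬p = ⊥! (¬p i<d)

module Sound {Q : Set} (ans : Q → ℕ → ℕ → Maybe ℕ) (P : Program Q) (w S : ℕ) (w>0 : 0 < w) where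
 open Program P
 open Machine ans P w S
 open Config using (pc)
 open Blocks ans w S {#registers}

 record Rel1 (σ : MState #registers) (cfg : Config) : Set where
  constructor rel1
  field
   relReg : ∀ x → toℕ (lookup (Config.registers cfg) x) ≡ mreg σ x
   relMem : ∀ i → toℕ (lookup (Config.memory cfg) i) ≡ mmem σ (toℕ i)
 open Rel1 public

 reg-< : ∀ {σ cfg} → Rel1 σ cfg → ∀ x → mreg σ x < 2 ^ w
 reg-< ρ x = ≡< (sym (relReg ρ x)) (toℕ<n _)

 mem-< : ∀ {σ cfg} → Rel1 σ cfg → ∀ a → a < S → mmem σ a < 2 ^ w
 mem-< {σ} ρ a a<S = ≡< (sym (relMem ρ (fromℕ< a<S) · cong (mmem σ) (toℕ-fromℕ< a<S))) (toℕ<n _)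

 -- `Run` describes only runs up to a `halt`. A partial run is therefore encoded by its effect on
 -- every run that continues it, and concatenation becomes composition of functions.
 Reach : Config → ℕ → List (Event ℕ) → Config → Set
 Reach c k τ c' = ∀ {t τ'} → Run c' t τ' → Run c (k + t) (τ ++ τ')

 reach-refl : ∀ {c} → Reach c 0 [] c
 reach-refl r = r

 reach-trans : ∀ {c c' c'' k k' τ τ'} → Reach c k τ c' → Reach c' k' τ' c'' → Reach c (k + k') (τ ++ τ') c''
 reach-trans {c} {k = k} {k'} {τ} {τ'} f g {t} {τ''} r = subst₂ (Run c) (sym (+-assoc k k' t)) (sym (++-assoc τ τ' τ'')) (f (g r))

 At : ℕ → List (Instruction Q #registers) → Set
 At p is = Σ[ rest ∈ _ ] drop p code ≡ is ++ rest

 at-fetch : ∀ p {i is} → At p (i ∷ is) → fetch p ≡ just i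
 at-fetch p (rest , e) = cong List.head e

 at-++ˡ : ∀ p is {js} → At p (is ++ js) → At p is
 at-++ˡ p is {js} (rest , e) = js ++ rest , e · ++-assoc is js rest

 drop-++' : ∀ {A : Set} (xs : List A) ys → drop (length xs) (xs ++ ys) ≡ ys
 drop-++' [] ys = refl
 drop-++' (x ∷ xs) ys = drop-++' xs ys

 at-++ʳ : ∀ p is {js} → At p (is ++ js) → At (p + length is) js
 at-++ʳ p is {js} (rest , e) = rest , sym (drop-drop p (length is) code) · cong (drop (length is)) (e · ++-assoc is js rest) · drop-++' is (js ++ rest)

 exec1 : ∀ i σ cfg → Rel1 σ cfg → ok1 i σ → Σ[ cfg' ∈ Config ] Σ[ τ ∈ List (Event ℕ) ] execute i cfg ≡ just (cfg' , τ) × Rel1 (eff1 i σ) cfg' ×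
  pc cfg' ≡ suc (pc cfg) × mout (eff1 i σ) ≡ mout σ ++ τ
 exec1 (set d c) σ cfg ρ ok = _ , _ , refl , rel1 (lookup-upd w (Config.registers cfg) (mreg σ) d _ c (relReg ρ) (toℕ-truncate-< w c ok)) (relMem ρ) , refl , sym (++-identityʳ _)
 exec1 (alu op d a b) σ cfg ρ ok = _ , _ , refl , rel1 (lookup-upd w (Config.registers cfg) (mreg σ) d _ _ (relReg ρ)
   (cong₂ (λ x y → toℕ (truncate w (⟦ op ⟧ w x y))) (relReg ρ a) (relReg ρ b) · op-sound w w>0 op _ _ (reg-< ρ a) (reg-< ρ b) ok)) (relMem ρ) , refl , sym (++-identityʳ _)
 exec1 (load d a) σ (config pc regs mem) ρ ok with index? S (toℕ (lookup regs a)) | index?-< S (toℕ (lookup regs a)) (≡< (relReg ρ a) ok)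
 ... | _ | refl = _ , _ , refl , rel1 (lookup-upd w regs (mreg σ) d _ _ (relReg ρ) (relMem ρ _ · cong (mmem σ) (toℕ-fromℕ< _ · relReg ρ a))) (relMem ρ) , refl , sym (++-identityʳ _)
 exec1 (store a s) σ (config pc regs mem) ρ ok with index? S (toℕ (lookup regs a)) | index?-< S (toℕ (lookup regs a)) (≡< (relReg ρ a) ok)
 ... | _ | refl = _ , _ , refl , rel1 (relReg ρ) (λ i → lookup-upd w mem (λ y → mmem σ (toℕ y)) (fromℕ< (≡< (relReg ρ a) ok)) (lookup regs s) (mreg σ s) (relMem ρ) (relReg ρ s) i ·
   cong (λ z → if z ≡ᵇ toℕ i then mreg σ s else mmem σ (toℕ i)) (toℕ-fromℕ< _ · relReg ρ a)) , refl , sym (++-identityʳ _)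
 exec1 (ask q d a b) σ (config pc regs mem) ρ (y , e , y<) =
  _ , _ , cong (_>>= λ x → just (config (suc pc) (regs [ d ]≔ truncate w x) mem , [])) (cong₂ (ans q) (relReg ρ a) (relReg ρ b) · e) ,
  rel1 (lookup-upd w regs (mreg σ) d (truncate w y) _ (relReg ρ) (toℕ-truncate-< w y y< · sym (cong (fromMaybe 0) e))) (relMem ρ) ,
  refl , sym (++-identityʳ _)
 exec1 (call e) σ cfg ρ ok = _ , _ , refl , rel1 (relReg ρ) (relMem ρ) , refl , cong (λ e → mout σ ++ e ∷ []) (sym (mapEvent-cong _ _ (relReg ρ) e))

 run1-sound : ∀ is σ cfg → Rel1 σ cfg → At (pc cfg) is → oks1 is σ → Σ[ cfg' ∈ Config ] Σ[ τ ∈ List (Event ℕ) ] Reach cfg (length is) τ cfg' × Rel1 (run1 is σ) cfg' ×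
  pc cfg' ≡ pc cfg + length is × mout (run1 is σ) ≡ mout σ ++ τ
 run1-sound [] σ cfg ρ at ok = cfg , [] , reach-refl , ρ , sym (+0 _) , sym (++-identityʳ _)
 run1-sound (i ∷ is) σ cfg ρ at (o , os) with exec1 i σ cfg ρ o
 ... | cfg1 , τ1 , e1 , ρ1 , pc1 , out1
  with run1-sound is (eff1 i σ) cfg1 ρ1 (subst (λ p → At p is) (+-comm _ 1 · sym pc1) (at-++ʳ (pc cfg) (i ∷ []) at)) os
 ... | cfg2 , τ2 , rch , ρ2 , pc2 , out2 = cfg2 , τ1 ++ τ2 , (λ {t} {τ} r → subst (Run cfg _) (sym (++-assoc τ1 τ2 τ)) (next (at-fetch (pc cfg) at) e1 (rch r))) ,
  ρ2 , pc2 · cong (_+ length is) pc1 · sym (+-suc _ _) ,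
  out2 · cong (_++ τ2) out1 · ++-assoc (mout σ) τ1 τ2

-- Bit fields that may cross a word boundary

quot+rem : ∀ x y → 0 < y → x ≡ div x y * y + mod x y
quot+rem x (suc y) _ = m≡m%n+[m/n]*n x (suc y) · +-comm (x % suc y) _

remainder-< : ∀ x y → 0 < y → mod x y < y
remainder-< x (suc y) _ = m%n<n x (suc y)

quotient-unique : ∀ k i y → i < y → div (k * y + i) y ≡ k
quotient-unique k i (suc y) i<y = begin
 (k * suc y + i) / suc y ≡⟨ +-distrib-/-∣ˡ i (divides k refl) ⟩
 k * suc y / suc y + i / suc y ≡⟨ cong₂ _+_ (m*n/n≡m k (suc y)) (m<n⇒m/n≡0 i<y) ⟩
 k + 0 ≡⟨ +0 k ⟩
 k ∎
 where
 open ≡-Reasoning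
 open import Data.Nat.Divisibility using (divides)

remainder-unique : ∀ k i y → i < y → mod (k * y + i) y ≡ i
remainder-unique k i (suc y) i<y = cong (_% suc y) (+-comm (k * suc y) i) · [m+kn]%n≡m%n i k (suc y) · m<n⇒m%n≡m i<y

if-true : ∀ {A : Set} {b} {x y : A} → b ≡ true → (if b then x else y) ≡ x
if-true refl = refl

if-false : ∀ {A : Set} {b} {x y : A} → b ≡ false → (if b then x else y) ≡ y
if-false refl = refl

<ᵇ-true : ∀ {m n} → m < n → (m <ᵇ n) ≡ true
<ᵇ-true {m} {n} m<n with m <ᵇ n | <⇒<ᵇ m<n
... | true | _ = refl

<ᵇ-false : ∀ {m n} → n ≤ m → (m <ᵇ n) ≡ false
<ᵇ-false {m} {n} n≤m with m <ᵇ n in e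
... | false = refl
... | true = ⊥! (<⇒≱ (<ᵇ⇒< m n (subst T (sym e) tt)) n≤m)

≤ᵇ-true : ∀ {m n} → m ≤ n → (m ≤ᵇ n) ≡ true
≤ᵇ-true {m} {n} m≤n with m ≤ᵇ n | ≤⇒≤ᵇ m≤n
... | true | _ = refl

≤ᵇ-false : ∀ {m n} → n < m → (m ≤ᵇ n) ≡ false
≤ᵇ-false {suc m} {n} n<m = <ᵇ-false {m} {n} (≤-pred n<m)

-- The bit with absolute index A of a memory of w-bit words.
ab : ℕ → (ℕ → ℕ) → ℕ → Bool
ab w mem A = tb (mem (div A w)) (mod A w)

ab-at : ∀ w mem k i → i < w → ab w mem (k * w + i) ≡ tb (mem k) i
ab-at w mem k i i<w = cong₂ (λ q r → tb (mem q) r) (quotient-unique k i w i<w) (remainder-unique k i w i<w)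

-- The field is assembled from two consecutive words, `X` shifted down and `Y` shifted up; for
-- `o = 0` the second one is shifted out entirely. Shifting up and down again by `w ∸ len` then
-- removes the digits above the field, which relies on the truncation in `shl`.
rdv : ℕ → ℕ → ℕ → ℕ → ℕ → ℕ
rdv w X Y o len = opval w shr (opval w shl (opval w or (opval w shr X o) (opval w shl Y (w ∸ o))) (w ∸ len)) (w ∸ len)

rdv-num : ∀ w mem k o len → mem k < 2 ^ w → mem (k + 1) < 2 ^ w → o < w → len ≤ w → rdv w (mem k) (mem (k + 1)) o len ≡ num (ab w mem) (k * w + o) len
rdv-num w mem k o len X< Y< o<w len≤w = sym (num-unique (ab w mem) (k * w + o) len _ small same)
 where
 X = mem k
 Y = mem (k + 1)
 t = bitwise _∨_ w (X /2^ o) ((Y * 2 ^ (w ∸ o)) %2^ w)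
 s = w ∸ len
 small : ((t * 2 ^ s) %2^ w) /2^ s < 2 ^ len
 small = m<n*o⇒m/o<n {{m^n≢0 2 s}} (subst ((t * 2 ^ s) %2^ w <_) (cong (2 ^_) (sym (m+[n∸m]≡n len≤w)) · ^-distribˡ-+-* 2 len s) (m%n<n _ (2 ^ w) {{m^n≢0 2 w}}))
 same : ∀ i → i < len → ab w mem (k * w + o + i) ≡ tb (((t * 2 ^ s) %2^ w) /2^ s) i
 same i i<len = sym (begin
  tb (((t * 2 ^ s) %2^ w) /2^ s) i ≡⟨ tb-/ _ s i ⟩
  tb ((t * 2 ^ s) %2^ w) (s + i) ≡⟨ tb-% (t * 2 ^ s) w (s + i) s+i<w ⟩
  tb (t * 2 ^ s) (s + i) ≡⟨ tb-*-≥ t s i ⟩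
  tb t i ≡⟨ tb-bitwise _∨_ w (X /2^ o) _ i i<w ⟩
  tb (X /2^ o) i ∨ tb ((Y * 2 ^ (w ∸ o)) %2^ w) i ≡⟨ cong₂ _∨_ (tb-/ X o i) (tb-% _ w i i<w) ⟩
  tb X (o + i) ∨ tb (Y * 2 ^ (w ∸ o)) i ≡⟨ halves ⟩
  ab w mem (k * w + o + i) ∎)
  where
  open ≡-Reasoning
  i<w = i<len » len≤w
  s+i<w = +ʳ< s i<len » =≤ (m∸n+n≡m len≤w)
  halves : tb X (o + i) ∨ tb (Y * 2 ^ (w ∸ o)) i ≡ ab w mem (k * w + o + i)
  halves with o + i <? w
  ... | yes lo = cong (tb X (o + i) ∨_) (tb-*-< Y (w ∸ o) i (+-cancelˡ-< o i (w ∸ o) (subst (o + i <_) (sym (m+[n∸m]≡n (<⇒≤ o<w))) lo))) ·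
   ∨-identityʳ _ · sym (cong (ab w mem) (+-assoc (k * w) o i) · ab-at w mem k (o + i) lo)
  ... | no hi = begin
   tb X (o + i) ∨ tb (Y * 2 ^ (w ∸ o)) i ≡⟨ cong (_∨ tb (Y * 2 ^ (w ∸ o)) i) (tb-≥ X w (o + i) X< (≮⇒≥ hi)) ⟩
   tb (Y * 2 ^ (w ∸ o)) i ≡⟨ cong (tb (Y * 2 ^ (w ∸ o))) (sym i-eq) ⟩
   tb (Y * 2 ^ (w ∸ o)) ((w ∸ o) + j) ≡⟨ tb-*-≥ Y (w ∸ o) j ⟩
   tb Y j ≡⟨ sym (ab-at w mem (k + 1) j j<w) ⟩
   ab w mem ((k + 1) * w + j) ≡⟨ cong (ab w mem) A-eq ⟩
   ab w mem (k * w + o + i) ∎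
   where
   j = o + i ∸ w
   oi = m+[n∸m]≡n (≮⇒≥ hi)
   i-eq : (w ∸ o) + j ≡ i
   i-eq = +-cancelˡ-≡ o _ _ (sym (+-assoc o (w ∸ o) j) · cong (_+ j) (m+[n∸m]≡n (<⇒≤ o<w)) · oi)
   j<w : j < w
   j<w = s≤s (subst (j ≤_) i-eq (m≤n+m j (w ∸ o))) » i<w
   A-eq : (k + 1) * w + j ≡ k * w + o + i
   A-eq = [k+1]*w+j k w j · cong (k * w +_) oi · sym (+-assoc (k * w) o i)

-- The difference `δ` is split between the words `k` and `k + 1`. Digits outside the field meet
-- zeros, so no masks have to be built.
xorMem : ℕ → (ℕ → ℕ) → ℕ → ℕ → ℕ → ℕ → ℕ
xorMem w mem k o δ = updℕ (updℕ mem k (opval w xor (mem k) (opval w shl δ o))) (k + 1) (opval w xor (updℕ mem k (opval w xor (mem k) (opval w shl δ o)) (k + 1)) (opval w shr δ (w ∸ o)))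

m≢m+1 : ∀ m → m ≢ m + 1
m≢m+1 m e = m≢1+m+n m (e · +-comm m 1 · cong suc (sym (+0 m)))

-- A field of at most `w` bits that starts in word `k` ends in word `k + 1` at the latest. The cases
-- are the first word, the second word, and all others, which lie before the field or beyond the
-- digits of `δ`.
ab-xorMem : ∀ w mem k o len δ A → 0 < w → o < w → len ≤ w → δ < 2 ^ len → ab w (xorMem w mem k o δ) A ≡ ab w mem A ⊻ ((k * w + o ≤ᵇ A) ∧ tb δ (A ∸ (k * w + o)))
ab-xorMem w mem k o len δ A w>0 o<w len≤w δ< = subst (λ A → ab w mem' A ≡ ab w mem A ⊻ D A) (sym A≡) main
 where
 open ≡-Reasoning
 D : ℕ → Bool
 D A = (k * w + o ≤ᵇ A) ∧ tb δ (A ∸ (k * w + o))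
 mem' = xorMem w mem k o δ
 q = div A w
 r = mod A w
 r<w : r < w
 r<w = remainder-< A w w>0
 A≡ : A ≡ q * w + r
 A≡ = quot+rem A w w>0
 X' = opval w xor (mem k) (opval w shl δ o)
 mem-k : mem' k ≡ X'
 mem-k = updℕ-≢ (updℕ mem k X') (k + 1) _ k (λ e → m≢m+1 k (sym e)) · updℕ-≡ mem k X'
 mem-k1 : mem' (k + 1) ≡ opval w xor (mem (k + 1)) (opval w shr δ (w ∸ o))
 mem-k1 = updℕ-≡ (updℕ mem k X') (k + 1) _ · cong (λ z → opval w xor z (opval w shr δ (w ∸ o))) (updℕ-≢ mem k X' (k + 1) (m≢m+1 k))
 main : ab w mem' (q * w + r) ≡ ab w mem (q * w + r) ⊻ D (q * w + r)
 main with q ≟ k | q ≟ k + 1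
 ... | yes e | _ = begin
  ab w mem' (q * w + r) ≡⟨ ab-at w mem' q r r<w ⟩
  tb (mem' q) r ≡⟨ cong (λ z → tb z r) (cong mem' e · mem-k) ⟩
  tb X' r ≡⟨ tb-bitwise _⊻_ w (mem k) _ r r<w ⟩
  tb (mem k) r ⊻ tb ((δ * 2 ^ o) %2^ w) r ≡⟨ cong₂ _⊻_ (cong (λ z → tb (mem z) r) (sym e) · sym (ab-at w mem q r r<w)) (tb-% _ w r r<w · low) ⟩
  ab w mem (q * w + r) ⊻ D (q * w + r) ∎
  where
  low : tb (δ * 2 ^ o) r ≡ D (q * w + r)
  low with o ≤? r
  ... | yes o≤r = cong (tb (δ * 2 ^ o)) (sym (m+[n∸m]≡n o≤r)) · tb-*-≥ δ o (r ∸ o) · sym (cong₂ _∧_ (≤ᵇ-true (=≤ (cong (λ z → z * w + o) (sym e)) » +ʳ≤ (q * w) o≤r))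
    (cong (tb δ) (cong (λ z → q * w + r ∸ (z * w + o)) (sym e) · [m+n]∸[m+o]≡n∸o (q * w) r o)))
  ... | no o≰r = tb-*-< δ o r (≰⇒> o≰r) · sym (cong (_∧ tb δ (q * w + r ∸ (k * w + o))) (≤ᵇ-false (+ʳ< (q * w) (≰⇒> o≰r) » =≤ (cong (λ z → z * w + o) e))))
 ... | no q≢k | yes e = begin
  ab w mem' (q * w + r) ≡⟨ ab-at w mem' q r r<w ⟩
  tb (mem' q) r ≡⟨ cong (λ z → tb z r) (cong mem' e · mem-k1) ⟩
  tb (opval w xor (mem (k + 1)) (δ /2^ (w ∸ o))) r ≡⟨ tb-bitwise _⊻_ w (mem (k + 1)) _ r r<w ⟩
  tb (mem (k + 1)) r ⊻ tb (δ /2^ (w ∸ o)) r ≡⟨ cong₂ _⊻_ (cong (λ z → tb (mem z) r) (sym e) · sym (ab-at w mem q r r<w)) (tb-/ δ (w ∸ o) r · high) ⟩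
  ab w mem (q * w + r) ⊻ D (q * w + r) ∎
  where
  A≡' : q * w + r ≡ (k * w + o) + ((w ∸ o) + r)
  A≡' = begin
   q * w + r ≡⟨ cong (λ z → z * w + r) e ⟩
   (k + 1) * w + r ≡⟨ [k+1]*w+j k w r ⟩
   k * w + (w + r) ≡⟨ cong (λ z → k * w + (z + r)) (sym (m+[n∸m]≡n (<⇒≤ o<w))) ⟩
   k * w + (o + (w ∸ o) + r) ≡⟨ assoc (k * w) o (w ∸ o) r ⟩
   (k * w + o) + ((w ∸ o) + r) ∎
   where
   assoc : ∀ a b c d → a + (b + c + d) ≡ (a + b) + (c + d)
   assoc = ring
  high : tb δ ((w ∸ o) + r) ≡ D (q * w + r)
  high = sym (cong₂ _∧_ (≤ᵇ-true (m≤m+n (k * w + o) _ » =≥ A≡')) (cong (tb δ) (cong (_∸ (k * w + o)) A≡' · m+n∸m≡n (k * w + o) _)))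
 ... | no q≢k | no q≢k1 = begin
  ab w mem' (q * w + r) ≡⟨ ab-at w mem' q r r<w ⟩
  tb (mem' q) r ≡⟨ cong (λ z → tb z r) (updℕ-≢ (updℕ mem k X') (k + 1) _ q (≢-sym q≢k1) · updℕ-≢ mem k X' q (≢-sym q≢k)) ⟩
  tb (mem q) r ≡⟨ sym (ab-at w mem q r r<w) ⟩
  ab w mem (q * w + r) ≡⟨ sym (xor-identityʳ _) ⟩
  ab w mem (q * w + r) ⊻ false ≡⟨ cong (ab w mem (q * w + r) ⊻_) (sym D-false) ⟩
  ab w mem (q * w + r) ⊻ D (q * w + r) ∎
  where
  D-false : D (q * w + r) ≡ false
  D-false with <-cmp q k
  ... | tri< q<k _ _ = cong (_∧ tb δ (q * w + r ∸ (k * w + o))) (≤ᵇ-false (+ʳ< (q * w) r<w » =≤ (+-comm (q * w) w) » *ˡ≤ w q<k » m≤m+n (k * w) o))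
  ... | tri≈ _ e _ = ⊥! (q≢k e)
  ... | tri> _ _ k<q = cong ((k * w + o ≤ᵇ q * w + r) ∧_) (tb-≥ δ len _ δ< far) · ∧-zeroʳ _
   where
   k+2≤q : k + 2 ≤ q
   k+2≤q = =≤ (+-comm k 2) » (≤∧≢⇒< k<q (λ e → q≢k1 (sym e · +-comm 1 k)))
   far : len ≤ q * w + r ∸ (k * w + o)
   far = len≤w » =≥ (m+n∸m≡n (k * w + o) w) » ∸-monoˡ-≤ (k * w + o) (=≤ (+-assoc (k * w) o w) » +ʳ≤ (k * w) (+ˡ≤ w (<⇒≤ o<w)) » =≤ (dist k w) » *ˡ≤ w k+2≤q » m≤m+n (q * w) r)
    where
    dist : ∀ k w → k * w + (w + w) ≡ (k + 2) * w
    dist = ring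

-- Writing a field by xor with the difference between the old and the new contents.
writeMem : ℕ → (ℕ → ℕ) → ℕ → ℕ → ℕ → ℕ → (ℕ → ℕ)
writeMem w mem k o len x = xorMem w mem k o (opval w xor (rdv w (mem k) (mem (k + 1)) o len) x)

ab-write : ∀ w mem k o len x → 0 < w → mem k < 2 ^ w → mem (k + 1) < 2 ^ w → o < w → len ≤ w → x < 2 ^ len → (∀ i → i < len → ab w (writeMem w mem k o len x) (k * w + o + i) ≡ tb x i) ×
 (∀ A → A < k * w + o ⊎ k * w + o + len ≤ A → ab w (writeMem w mem k o len x) A ≡ ab w mem A)
ab-write w mem k o len x w>0 X< Y< o<w len≤w x< = inside , outside
 where
 open ≡-Reasoning
 old = rdv w (mem k) (mem (k + 1)) o len
 δ = opval w xor old x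
 old≡ : old ≡ num (ab w mem) (k * w + o) len
 old≡ = rdv-num w mem k o len X< Y< o<w len≤w
 old< : old < 2 ^ len
 old< = ≡< old≡ (num-< (ab w mem) (k * w + o) len)
 δ-bits : ∀ i → i < w → tb δ i ≡ tb old i ⊻ tb x i
 δ-bits i i<w = tb-bitwise _⊻_ w old x i i<w
 δ< : δ < 2 ^ len
 δ< = ≡< (tb-ext w δ (δ %2^ len) (bitwise-< _⊻_ w old x) (m%n<n δ (2 ^ len) {{m^n≢0 2 len}} » ^-monoʳ-≤ 2 len≤w) same) (m%n<n δ (2 ^ len) {{m^n≢0 2 len}})
  where
  same : ∀ l → l < w → tb δ l ≡ tb (δ %2^ len) l
  same l l<w with l <? len
  ... | yes l<len = sym (tb-% δ len l l<len)
  ... | no l≮len = δ-bits l l<w · (cong₂ _⊻_ (tb-≥ old len l old< (≮⇒≥ l≮len)) (tb-≥ x len l x< (≮⇒≥ l≮len))) · sym (tb-≥ (δ %2^ len) len l (m%n<n δ (2 ^ len) {{m^n≢0 2 len}}) (≮⇒≥ l≮len))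
 all : ∀ A → ab w (writeMem w mem k o len x) A ≡ ab w mem A ⊻ ((k * w + o ≤ᵇ A) ∧ tb δ (A ∸ (k * w + o)))
 all A = ab-xorMem w mem k o len δ A w>0 o<w len≤w δ<
 inside : ∀ i → i < len → ab w (writeMem w mem k o len x) (k * w + o + i) ≡ tb x i
 inside i i<len = begin
  ab w (writeMem w mem k o len x) (k * w + o + i) ≡⟨ all _ ⟩
  _ ≡⟨ cong (ab w mem (k * w + o + i) ⊻_) (cong₂ _∧_ (≤ᵇ-true (m≤m+n (k * w + o) i)) (cong (tb δ) (m+n∸m≡n (k * w + o) i))) ⟩
  ab w mem (k * w + o + i) ⊻ tb δ i ≡⟨ cong₂ _⊻_ (sym (tb-num (ab w mem) (k * w + o) len i i<len)) (δ-bits i (i<len » len≤w)) ⟩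
  tb (num (ab w mem) (k * w + o) len) i ⊻ (tb old i ⊻ tb x i) ≡⟨ cong (λ z → tb z i ⊻ (tb old i ⊻ tb x i)) (sym old≡) ⟩
  tb old i ⊻ (tb old i ⊻ tb x i) ≡⟨ sym (xor-assoc (tb old i) _ _) ⟩
  (tb old i ⊻ tb old i) ⊻ tb x i ≡⟨ cong (_⊻ tb x i) (xor-same (tb old i)) ⟩
  tb x i ∎
 outside : ∀ A → A < k * w + o ⊎ k * w + o + len ≤ A → ab w (writeMem w mem k o len x) A ≡ ab w mem A
 outside A (inl A<) = all A · cong (λ z → ab w mem A ⊻ (z ∧ tb δ (A ∸ (k * w + o)))) (≤ᵇ-false A<) · xor-identityʳ _
 outside A (inr ≤A) = all A · cong (λ z → ab w mem A ⊻ ((k * w + o ≤ᵇ A) ∧ z)) (tb-≥ δ len _ δ< (=≥ (m+n∸m≡n (k * w + o) len) » ∸-monoˡ-≤ (k * w + o) ≤A)) ·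
  cong (ab w mem A ⊻_) (∧-zeroʳ _) · xor-identityʳ _

-- Primitive operations on level words, bit planes and slots

data Operand (R : ℕ) : Set where
 lit : ℕ → Operand R
 var : Fin R → Operand R
 off : ℕ → Fin R → Operand R

data Prim (Q : Set) (R : ℕ) : Set where
 mov : Fin R → Operand R → Prim Q R
 getN : Fin R → Prim Q R
 alu : Op → Fin R → (A B : Operand R) → Prim Q R
 ask : Q → Fin R → (A B : Operand R) → Prim Q R
 call : Event (Fin R) → Prim Q R
 LD : Fin R → (A : Operand R) → Prim Q R
 ST : (A B : Operand R) → Prim Q R
 RD : Fin R → (A B C : Operand R) → Prim Q R
 WR : (A B C D : Operand R) → Prim Q R
 RD0 : Fin R → (A C : Operand R) → Prim Q R
 WR0 : (A C D : Operand R) → Prim Q R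

-- Level words lev, bit planes pl, and one slot per vertex ν sl.
record State (R : ℕ) : Set where
 no-eta-equality
 constructor st
 field
  reg : Fin R → ℕ
  lev : ℕ → ℕ
  pl : ℕ → ℕ → Bool
  sl : ℕ → ℕ
  out : List (Event ℕ)
  ticks : ℕ
open State public

wrP : (ℕ → ℕ → Bool) → ℕ → ℕ → ℕ → ℕ → ℕ → ℕ → Bool
wrP f r o l x r' o' = if (r ≡ᵇ r') ∧ ((o ≤ᵇ o') ∧ (o' <ᵇ o + l)) then tb x (o' ∸ o) else f r' o'

valO : ∀ {R} → Operand R → State R → ℕ
valO (lit c) s = c
valO (var r) s = reg s r
valO (off c r) s = c + reg s r

sreg : ∀ {R} → State R → Fin R → ℕ → State R
sreg s d v = record s { reg = upd (reg s) d v }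

≡ᵇ-true⇒≡ : ∀ {m n} → (m ≡ᵇ n) ≡ true → m ≡ n
≡ᵇ-true⇒≡ {m} {n} e = ≡ᵇ⇒≡ m n (subst T (sym e) tt)

true≢false : true ≢ false
true≢false ()

pattern ten = _ ∷ _ ∷ _ ∷ _ ∷ _ ∷ _ ∷ _ ∷ _ ∷ _ ∷ _ ∷ []

n<2^n : ∀ m → m < 2 ^ m
n<2^n zero = z<s
n<2^n (suc m) = +≤+ (m^n>0 2 m) (n<2^n m) » =≤ (cong (2 ^ m +_) (sym (+0 (2 ^ m))))

module Code {Q : Set} (PB NR R : ℕ) where

 I1 : Set
 I1 = Instruction Q (12 + R)

 -- Registers 0 and 1 keep `n` and `w` for good, 2 to 11 are scratch space within a single
 -- primitive, and program register `r` is machine register `12 + r`.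
 t0 t1 t2 t3 t4 t5 t6 t7 t8 t9 rN rW : Fin (12 + R)
 rN = zero
 rW = suc zero
 t0 = # 2
 t1 = # 3
 t2 = # 4
 t3 = # 5
 t4 = # 6
 t5 = # 7
 t6 = # 8
 t7 = # 9
 t8 = # 10
 t9 = # 11

 tm : Fin 10 → Fin (12 + R)
 tm i = suc (suc (i ↑ˡ R))

 opd : Operand R → Fin 10 → List I1
 opd (lit c) t = set (tm t) c ∷ []
 opd (var r) t = set (tm t) 0 ∷ alu add (tm t) (tm t) (12 ↑ʳ r) ∷ []
 opd (off c r) t = set (tm t) c ∷ alu add (tm t) (tm t) (12 ↑ʳ r) ∷ []

 -- Temporary 9 is only used for zero here, so the moved temporary must be another one.
 mv : Fin R → Fin (12 + R) → List I1
 mv d t = set t9 0 ∷ alu add (12 ↑ʳ d) t9 t ∷ []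

 -- In: plane t0, bit offset t1. Out: word address t3, bit offset within the word t4.
 addrP : List I1
 addrP = alu quo t3 rN rW ∷ set t4 2 ∷ alu add t3 t3 t4 ∷ alu mul t3 t0 t3 ∷ alu quo t4 t1 rW ∷ alu add t3 t3 t4 ∷ set t4 PB ∷ alu add t3 t4 t3 ∷ alu rem t4 t1 rW ∷ []

 -- In: vertex ν t0, slot length t2. Out: as above.
 addr0 : List I1
 addr0 = alu quo t5 rW t2 ∷ alu rem t4 t0 t5 ∷ alu mul t4 t4 t2 ∷ alu quo t1 t0 t5 ∷ alu quo t5 rN rW ∷ set t6 2 ∷
  alu add t5 t5 t6 ∷ set t6 NR ∷ alu mul t5 t6 t5 ∷ set t6 PB ∷ alu add t5 t6 t5 ∷ alu add t3 t5 t1 ∷ []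

 rdCore : List I1
 rdCore = load t6 t3 ∷ set t7 1 ∷ alu add t7 t3 t7 ∷ load t7 t7 ∷ alu shr t6 t6 t4 ∷ alu sub t8 rW t4 ∷
  alu shl t7 t7 t8 ∷ alu or t6 t6 t7 ∷ alu sub t8 rW t2 ∷ alu shl t6 t6 t8 ∷ alu shr t5 t6 t8 ∷ []

 wrCore : List I1
 wrCore = alu xor t5 t5 t9 ∷ load t6 t3 ∷ alu shl t7 t5 t4 ∷ alu xor t6 t6 t7 ∷ store t3 t6 ∷ set t7 1 ∷
  alu add t7 t3 t7 ∷ load t6 t7 ∷ alu sub t8 rW t4 ∷ alu shr t8 t5 t8 ∷ alu xor t6 t6 t8 ∷ store t7 t6 ∷ []

 code1 : Prim Q R → List I1
 code1 (mov d A) = opd A zero ++ mv d t0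
 code1 (getN d) = mv d rN
 code1 (alu op d A B) = opd A zero ++ opd B (suc zero) ++ alu op t0 t0 t1 ∷ mv d t0
 code1 (ask q d A B) = opd A zero ++ opd B (suc zero) ++ ask q t0 t0 t1 ∷ mv d t0
 code1 (call e) = call (mapEvent (12 ↑ʳ_) e) ∷ []
 code1 (LD d A) = opd A zero ++ load t0 t0 ∷ mv d t0
 code1 (ST A B) = opd A zero ++ opd B (suc zero) ++ store t0 t1 ∷ []
 code1 (RD d A B C) = opd A zero ++ opd B (suc zero) ++ opd C (suc (suc zero)) ++ addrP ++ rdCore ++ mv d t5
 code1 (WR A B C D) = opd A zero ++ opd B (suc zero) ++ opd C (suc (suc zero)) ++ opd D (# 9) ++ addrP ++ rdCore ++ wrCore
 code1 (RD0 d A C) = opd A zero ++ opd C (suc (suc zero)) ++ addr0 ++ rdCore ++ mv d t5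
 code1 (WR0 A C D) = opd A zero ++ opd C (suc (suc zero)) ++ opd D (# 9) ++ addr0 ++ rdCore ++ wrCore

-- Memory layout and correctness of the primitives

module Layout {Q : Set} (ans : Q → ℕ → ℕ → Maybe ℕ) (n w PB NR b0 R : ℕ) where

 W g L0 S : ℕ
 -- Fields start at bit `n` at the latest and have at most `w` bits, hence two words more than the
 -- quotient (`n+w≤Ww`).
 W = div n w + 2
 g = div w b0
 L0 = PB + NR * W
 -- One word for the last slot and one more because each access also touches the word after the
 -- addressed one.
 S = L0 + div n g + 2

 eff2 : Prim Q R → State R → State R
 eff2 (mov d A) s = sreg s d (valO A s)
 eff2 (getN d) s = sreg s d n
 eff2 (alu op d A B) s = sreg s d (opval w op (valO A s) (valO B s))
 eff2 (ask q d A B) s = sreg s d (fromMaybe 0 (ans q (valO A s) (valO B s)))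
 eff2 (call e) s = record s { out = out s ++ mapEvent (reg s) e ∷ [] }
 eff2 (LD d A) s = sreg s d (lev s (valO A s))
 eff2 (ST A B) s = record s { lev = updℕ (lev s) (valO A s) (valO B s) }
 eff2 (RD d A B C) s = sreg s d (num (pl s (valO A s)) (valO B s) (valO C s))
 eff2 (WR A B C D) s = record s { pl = wrP (pl s) (valO A s) (valO B s) (valO C s) (valO D s) }
 eff2 (RD0 d A C) s = sreg s d (sl s (valO A s))
 eff2 (WR0 A C D) s = record s { sl = updℕ (sl s) (valO A s) (valO D s) }

 okO : Operand R → State R → Set
 okO (lit c) s = c < 2 ^ w
 okO (var r) s = ⊤
 okO (off c r) s = c + reg s r < 2 ^ w

 -- Demanded only by the primitives that access the memory: for small graphs it may fail, and there
 -- no such primitive is executed.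
 Fits : Set
 Fits = S ≤ 2 ^ w

 ok2 : Prim Q R → State R → Set
 ok2 (mov d A) s = okO A s
 ok2 (getN d) s = ⊤
 ok2 (alu op d A B) s = okO A s × okO B s × OpOk w op (valO A s) (valO B s)
 ok2 (ask q d A B) s = okO A s × okO B s × (Σ[ y ∈ ℕ ] ans q (valO A s) (valO B s) ≡ just y × y < 2 ^ w)
 ok2 (call e) s = ⊤
 ok2 (LD d A) s = okO A s × valO A s < PB × Fits
 ok2 (ST A B) s = okO A s × okO B s × valO A s < PB × Fits
 ok2 (RD d A B C) s = okO A s × okO B s × okO C s × valO A s < NR × valO B s ≤ n × valO C s ≤ w × Fits
 ok2 (WR A B C D) s = okO A s × okO B s × okO C s × okO D s × valO A s < NR × valO B s ≤ n × valO C s ≤ w × valO D s < 2 ^ valO C s × Fits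
 ok2 (RD0 d A C) s = okO A s × okO C s × valO A s ≤ n × valO C s ≡ b0 × Fits
 ok2 (WR0 A C D) s = okO A s × okO C s × okO D s × valO A s ≤ n × valO C s ≡ b0 × valO D s < 2 ^ b0 × Fits

 open Code {Q} PB NR R public

 open Blocks ans w S {12 + R}

 Abase : ℕ → ℕ
 Abase r = (PB + r * W) * w

 -- Slots are packed `g` to a word and never cross a word boundary. The bit address `v * b0` might
 -- exceed the word length, whereas the quotient and the remainder of `v` by `g` are harmless.
 A0base : ℕ → ℕ
 A0base v = (L0 + div v g) * w + mod v g * b0

 record MemRel (mem : ℕ → ℕ) (lv : ℕ → ℕ) (pn : ℕ → ℕ → Bool) (sv : ℕ → ℕ) : Set where
  constructor memrel
  field
   levs : ∀ a → a < PB → mem a ≡ lv a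
   pls : ∀ r o → r < NR → o < W * w → ab w mem (Abase r + o) ≡ pn r o
   sls : ∀ v l → v ≤ n → l < b0 → ab w mem (A0base v + l) ≡ tb (sv v) l
   sl< : ∀ v → v ≤ n → sv v < 2 ^ b0
 open MemRel public

 record Rel2 (s : State R) (σ : MState (12 + R)) : Set where
  constructor rel2
  field
   rel-N : mreg σ zero ≡ n
   rel-W : mreg σ (suc zero) ≡ w
   rel-reg : ∀ x → mreg σ (12 ↑ʳ x) ≡ reg s x
   rel-mem : MemRel (mmem σ) (lev s) (pl s) (sl s)
   rel-out : mout σ ≡ out s
 open Rel2 public

 canonT : ∀ {m} → Vec ℕ m → (Fin R → ℕ) → Fin (m + R) → ℕ
 canonT [] f i = f i
 canonT (a ∷ as) f zero = a
 canonT (a ∷ as) f (suc i) = canonT as f i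

 -- Allows symbolic execution: in this form an assignment to a temporary is an update of a vector,
 -- and `to-canon` brings every related state into this form.
 C : Vec ℕ 10 → State R → (ℕ → ℕ) → MState (12 + R)
 C ts s mem = mst (canonT (n ∷ w ∷ ts) (reg s)) mem (out s)

 -- Register files are functions, so they can be compared only pointwise; all instructions respect
 -- this.
 record _≈_ (σ σ' : MState (12 + R)) : Set where
  constructor same
  field
   ≈reg : ∀ x → mreg σ x ≡ mreg σ' x
   ≈mem : mmem σ ≡ mmem σ'
   ≈out : mout σ ≡ mout σ'
 open _≈_

 upd-cong : ∀ {f f' : Fin (12 + R) → ℕ} d {v v'} → (∀ x → f x ≡ f' x) → v ≡ v' → ∀ x → upd f d v x ≡ upd f' d v' x
 upd-cong d h e x with toℕ d ≡ᵇ toℕ x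
 ... | true = e
 ... | false = h x

 eff1-cong : ∀ i {σ σ'} → σ ≈ σ' → eff1 i σ ≈ eff1 i σ'
 eff1-cong (set d c) (same r m o) = same (upd-cong d r refl) m o
 eff1-cong (alu op d a b) (same r m o) = same (upd-cong d r (cong₂ (opval w op) (r a) (r b))) m o
 eff1-cong (load d a) (same r m o) = same (upd-cong d r (cong₂ (λ f x → f x) m (r a))) m o
 eff1-cong (store a s) {σ} {σ'} (same r m o) = same r (cong₂ (λ f x → updℕ f x (mreg σ s)) m (r a) · cong (updℕ (mmem σ') (mreg σ' a)) (r s)) o
 eff1-cong (ask q d a b) (same r m o) = same (upd-cong d r (cong₂ (λ x y → fromMaybe 0 (ans q x y)) (r a) (r b))) m o
 eff1-cong (call e) (same r m o) = same r m (cong₂ (λ l e → l ++ e ∷ []) o (mapEvent-cong _ _ r e))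
 eff1-cong (jumpZero a t) h = h
 eff1-cong (jump t) h = h
 eff1-cong halt h = h

 ok1-cong : ∀ i {σ σ'} → σ ≈ σ' → ok1 i σ' → ok1 i σ
 ok1-cong (set d c) h ok = ok
 ok1-cong (alu op d a b) (same r m o) ok = subst₂ (OpOk w op) (sym (r a)) (sym (r b)) ok
 ok1-cong (load d a) (same r m o) ok = ≡< (r a) ok
 ok1-cong (store a s) (same r m o) ok = ≡< (r a) ok
 ok1-cong (ask q d a b) (same r m o) ok = subst₂ (λ x y → Σ[ z ∈ ℕ ] ans q x y ≡ just z × z < 2 ^ w) (sym (r a)) (sym (r b)) ok
 ok1-cong (call e) h ok = ok

 run1-cong : ∀ is {σ σ'} → σ ≈ σ' → run1 is σ ≈ run1 is σ'
 run1-cong [] h = h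
 run1-cong (i ∷ is) h = run1-cong is (eff1-cong i h)

 oks1-cong : ∀ is {σ σ'} → σ ≈ σ' → oks1 is σ' → oks1 is σ
 oks1-cong [] h _ = tt
 oks1-cong (i ∷ is) h (o , os) = ok1-cong i h o , oks1-cong is (eff1-cong i h) os

 Good : List I1 → MState (12 + R) → State R → Set
 Good is σ s = oks1 is σ × Rel2 s (run1 is σ)

 good-cong : ∀ is {σ σ' s} → σ ≈ σ' → Good is σ' s → Good is σ s
 good-cong is {s = s} h (os , rel2 rN rW rx m o) with run1-cong is h
 ... | same r' m' o' = oks1-cong is h os , rel2 (r' zero · rN) (r' (suc zero) · rW) (λ x → r' _ · rx x) (subst (λ z → MemRel z (lev s) (pl s) (sl s)) (sym m') m) (o' · o)

 good-++ : ∀ is js {σ s} → oks1 is σ → Good js (run1 is σ) s → Good (is ++ js) σ s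
 good-++ is js {σ} {s} os (os' , r) = oks1-++ is js σ os os' , subst (Rel2 s) (sym (run1-++ is js σ)) r

 temps : MState (12 + R) → Vec ℕ 10
 temps σ = Vec.tabulate (λ i → mreg σ (tm i))

 canonT-tabulate : ∀ m (h : Fin (m + R) → ℕ) f → (∀ x → h (m ↑ʳ x) ≡ f x) → ∀ x → h x ≡ canonT (Vec.tabulate (λ i → h (i ↑ˡ R))) f x
 canonT-tabulate zero h f e x = e x
 canonT-tabulate (suc m) h f e zero = refl
 canonT-tabulate (suc m) h f e (suc x) = canonT-tabulate m (λ i → h (suc i)) f e x

 to-canon : ∀ {s σ} → Rel2 s σ → σ ≈ C (temps σ) s (mmem σ)
 to-canon {s} {σ} r = same pointwise refl (rel-out r)
  where
  pointwise : ∀ x → mreg σ x ≡ mreg (C (temps σ) s (mmem σ)) x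
  pointwise zero = rel-N r
  pointwise (suc zero) = rel-W r
  pointwise (suc (suc x)) = canonT-tabulate 10 (λ i → mreg σ (suc (suc i))) (reg s) (rel-reg r) x

 canonT-upd : ∀ {m} (ts : Vec ℕ m) f (i : Fin m) v (x : Fin (m + R)) → upd (canonT ts f) (i ↑ˡ R) v x ≡ canonT (ts [ i ]≔ v) f x
 canonT-upd (a ∷ ts) f zero v zero = refl
 canonT-upd (a ∷ ts) f zero v (suc x) = refl
 canonT-upd (a ∷ ts) f (suc i) v zero = refl
 canonT-upd (a ∷ ts) f (suc i) v (suc x) = canonT-upd ts f i v x

 canon-set : ∀ (ts : Vec ℕ 10) s mem i v → setm (C ts s mem) (tm i) v ≈ C (ts [ i ]≔ v) s mem
 canon-set ts s mem i v = same (λ x → canonT-upd (n ∷ w ∷ ts) (reg s) (suc (suc i)) v x) refl refl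

 setm-twice : ∀ ts s mem i u v → setm (setm (C ts s mem) (tm i) u) (tm i) v ≈ C (ts [ i ]≔ v) s mem
 setm-twice ts s mem i u v = same (λ x → overwrite x · canonT-upd (n ∷ w ∷ ts) (reg s) (suc (suc i)) v x) refl refl
  where
  overwrite : ∀ x → upd (upd (canonT (n ∷ w ∷ ts) (reg s)) (tm i) u) (tm i) v x ≡ upd (canonT (n ∷ w ∷ ts) (reg s)) (tm i) v x
  overwrite x with toℕ (tm i) ≡ᵇ toℕ x
  ... | true = refl
  ... | false = refl

 upd-same : ∀ (f : Fin (12 + R) → ℕ) d v → upd f d v d ≡ v
 upd-same f d v rewrite ≡ᵇ-refl (toℕ d) = refl

 ↑ˡ≢↑ʳ : ∀ m (i : Fin m) (r : Fin R) → (toℕ (i ↑ˡ R) ≡ᵇ toℕ (m ↑ʳ r)) ≡ false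
 ↑ˡ≢↑ʳ (suc m) zero r = refl
 ↑ˡ≢↑ʳ (suc m) (suc i) r = ↑ˡ≢↑ʳ m i r

 canonT-↑ʳ : ∀ {m} (ts : Vec ℕ m) f x → canonT ts f (m ↑ʳ x) ≡ f x
 canonT-↑ʳ [] f x = refl
 canonT-↑ʳ (a ∷ ts) f x = canonT-↑ʳ ts f x

 canon-reg : ∀ ts s mem i v r → mreg (setm (C ts s mem) (tm i) v) (12 ↑ʳ r) ≡ reg s r
 canon-reg ts s mem i v r = if-false (↑ˡ≢↑ʳ 10 i r) · canonT-↑ʳ ts (reg s) r

 RegB : State R → Set
 RegB s = ∀ x → reg s x < 2 ^ w

 valO-< : ∀ A s → RegB s → okO A s → valO A s < 2 ^ w
 valO-< (lit c) s B ok = ok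
 valO-< (var r) s B ok = B r
 valO-< (off c r) s B ok = ok

 good-opd : ∀ A i is {ts s mem s'} → RegB s → okO A s → Good is (C (ts [ i ]≔ valO A s) s mem) s' → Good (opd A i ++ is) (C ts s mem) s'
 good-opd (lit c) i is {ts} {s} {mem} B ok gd = good-++ (opd (lit c) i) is (ok , tt) (good-cong is (canon-set ts s mem i c) gd)
 good-opd (var r) i is {ts} {s} {mem} B ok gd = good-++ (opd (var r) i) is ((s≤s z≤n » B r) , ≡< (cong₂ _+_ (upd-same (mreg (C ts s mem)) (tm i) 0) (canon-reg ts s mem i 0 r)) (B r) , tt)
  (good-cong is (subst (λ v → setm (setm (C ts s mem) (tm i) 0) (tm i) v ≈ C (ts [ i ]≔ reg s r) s mem)
   (sym (cong₂ _+_ (upd-same (mreg (C ts s mem)) (tm i) 0) (canon-reg ts s mem i 0 r))) (setm-twice ts s mem i 0 (reg s r))) gd)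
 good-opd (off c r) i is {ts} {s} {mem} B ok gd = good-++ (opd (off c r) i) is
  ((s≤s (m≤m+n c _) » ok) , ≡< (cong₂ _+_ (upd-same (mreg (C ts s mem)) (tm i) c) (canon-reg ts s mem i c r)) ok , tt)
  (good-cong is (subst (λ v → setm (setm (C ts s mem) (tm i) c) (tm i) v ≈ C (ts [ i ]≔ (c + reg s r)) s mem)
   (sym (cong₂ _+_ (upd-same (mreg (C ts s mem)) (tm i) c) (canon-reg ts s mem i c r))) (setm-twice ts s mem i c (c + reg s r))) gd)

 quotient-mono : ∀ {x y} d → x ≤ y → div x d ≤ div y d
 quotient-mono zero x≤y = z≤n
 quotient-mono (suc d) x≤y = /-monoˡ-≤ (suc d) x≤y

 quotient*≤ : ∀ x d → div x d * d ≤ x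
 quotient*≤ x zero = z≤n
 quotient*≤ x (suc d) = m/n*n≤m x (suc d)

 module _ (w>0 : 0 < w) (n<2^w : n < 2 ^ w) (b0>0 : 0 < b0) (b0≤w : b0 ≤ w) (NR>0 : 0 < NR) where

  w<2^w = n<2^n w

  W>1 : 1 < W
  W>1 = m≤n+m 2 (div n w)

  n+w≤Ww : n + w ≤ W * w
  n+w≤Ww = +ˡ≤ w (=≤ (quot+rem n w w>0) » +ʳ≤ (div n w * w) (<⇒≤ (remainder-< n w w>0))) » =≤ (e (div n w) w)
   where
   e : ∀ q w → q * w + w + w ≡ (q + 2) * w
   e = ring

  module PlaneAddr (r o : ℕ) (r<NR : r < NR) (o≤n : o ≤ n) (fits : Fits) where
   k = PB + (r * W + div o w)
   sk≤L0 : suc k < L0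
   sk≤L0 = begin-strict
    suc (PB + (r * W + div o w)) <⟨ s≤s (s≤s (+ʳ≤ PB (+ʳ≤ (r * W) (quotient-mono w o≤n)))) ⟩
    suc (suc (PB + (r * W + div n w))) ≡⟨ e PB r W (div n w) ⟩
    PB + (W + r * W) ≤⟨ +ʳ≤ PB (*ˡ≤ W r<NR) ⟩
    L0 ∎
    where
    open ≤-Reasoning
    e : ∀ P r W' q → suc (suc (P + (r * W' + q))) ≡ P + ((q + 2) + r * W')
    e = ring
   L0≤S : L0 ≤ S
   L0≤S = m≤m+n L0 (div n g) » m≤m+n _ 2
   k+1<S : k + 1 < S
   k+1<S = =≤ (cong suc (+-comm k 1)) » sk≤L0 » L0≤S
   k<S : k < S
   k<S = s≤s (m≤m+n k 1) » k+1<S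
   k<2^w = k<S » fits
   PB<2^w : PB < 2 ^ w
   PB<2^w = s≤s (m≤m+n PB _) » k<2^w
   rW+q<2^w : r * W + div o w < 2 ^ w
   rW+q<2^w = s≤s (m≤n+m _ PB) » k<2^w
   rW<2^w : r * W < 2 ^ w
   rW<2^w = s≤s (m≤m+n (r * W) _) » rW+q<2^w
   W<2^w : W < 2 ^ w
   W<2^w = s≤s (=≥ (*-identityˡ W) » *ˡ≤ W (z<s » r<NR)) » s≤s (m≤n+m (NR * W) PB) » s≤s (m≤m+n L0 (div n g)) » m<m+n _ z<s » fits
   2<2^w : 2 < 2 ^ w
   2<2^w = s≤s W>1 » W<2^w
   1<2^w : 1 < 2 ^ w
   1<2^w = <-trans (s≤s z<s) 2<2^w
   addr : k * w + mod o w ≡ Abase r + o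
   addr = e PB (r * W) (div o w) w (mod o w) · cong (Abase r +_) (sym (quot+rem o w w>0))
    where
    e : ∀ P a q w' m → (P + (a + q)) * w' + m ≡ (P + a) * w' + (q * w' + m)
    e = ring

  module SlotAddr (v : ℕ) (v≤n : v ≤ n) (fits : Fits) where
   g>0 : 0 < g
   g>0 = ≡≤ (sym (quotient-unique 1 0 b0 b0>0)) (quotient-mono b0 (=≤ (e b0) » b0≤w))
    where
    e : ∀ b → 1 * b + 0 ≡ b
    e = ring
   k o' : ℕ
   k = L0 + div v g
   o' = mod v g * b0
   o'+b0≤w = =≤ (+-comm o' b0) » *ˡ≤ b0 (remainder-< v g g>0) » quotient*≤ w b0
   o'<w = m<m+n o' b0>0 » o'+b0≤w
   k+1<S : k + 1 < S
   k+1<S = s≤s (+ˡ≤ 1 (+ʳ≤ L0 (quotient-mono g v≤n))) » =≥ (+-suc (L0 + div n g) 1)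
   k<S : k < S
   k<S = s≤s (m≤m+n k 1) » k+1<S
   k<2^w = k<S » fits
   L0<2^w : L0 < 2 ^ w
   L0<2^w = s≤s (m≤m+n L0 _) » k<2^w
   PB<2^w : PB < 2 ^ w
   PB<2^w = s≤s (m≤m+n PB _) » L0<2^w
   NRW<2^w : NR * W < 2 ^ w
   NRW<2^w = s≤s (m≤n+m _ PB) » L0<2^w
   NR<2^w : NR < 2 ^ w
   NR<2^w = s≤s (=≥ (*-identityʳ NR) » *ʳ≤ NR (<⇒≤ W>1)) » NRW<2^w
   W<2^w : W < 2 ^ w
   W<2^w = s≤s (=≥ (*-identityˡ W) » *ˡ≤ W NR>0) » NRW<2^w
   2<2^w : 2 < 2 ^ w
   2<2^w = s≤s W>1 » W<2^w

  num-<2^w : ∀ f o {l} → l ≤ w → num f o l < 2 ^ w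
  num-<2^w f o {l} l≤w = num-< f o l » ^-monoʳ-≤ 2 l≤w

  MemB : (ℕ → ℕ) → Set
  MemB mem = ∀ a → a < S → mem a < 2 ^ w

  plane-end : ∀ P r W' w' → (P + r * W') * w' + W' * w' ≡ (P + (W' + r * W')) * w'
  plane-end = ring

  plane-gap : ∀ r r' o o' len → r ≢ r' → o + len ≤ W * w → o' < W * w → Abase r' + o' < Abase r + o ⊎ Abase r + o + len ≤ Abase r' + o'
  plane-gap r r' o o' len r≢r' ol≤ o'< with <-cmp r r'
  ... | tri≈ _ e _ = ⊥! (r≢r' e)
  ... | tri< r<r' _ _ = inr (=≤ (+-assoc (Abase r) o len) » +ʳ≤ (Abase r) ol≤ » next-plane r r' r<r' » m≤m+n _ o')
   where
   next-plane : ∀ r r' → r < r' → Abase r + W * w ≤ Abase r'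
   next-plane r r' r<r' = =≤ (plane-end PB r W w) » *ˡ≤ w (+ʳ≤ PB (*ˡ≤ W r<r'))
  ... | tri> _ _ r'<r = inl (+ʳ< (Abase r') o'< » =≤ (plane-end PB r' W w) » *ˡ≤ w (+ʳ≤ PB (*ˡ≤ W r'<r)) » m≤m+n _ o)

  plane<slots : ∀ r o v → r < NR → o ≤ W * w → Abase r + o ≤ A0base v
  plane<slots r o v r<NR o≤ = +ʳ≤ (Abase r) o≤ » =≤ (plane-end PB r W w) » *ˡ≤ w (+ʳ≤ PB (*ˡ≤ W r<NR) » m≤m+n L0 (div v g)) » m≤m+n _ _

  slot-gap : ∀ v v' → v < v' → v ≤ n → Fits → A0base v + b0 ≤ A0base v'
  slot-gap v v' v<v' v≤n fits with ≤-split (quotient-mono g (<⇒≤ v<v'))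
  ... | inl q<q' = begin
   (L0 + div v g) * w + mod v g * b0 + b0 ≡⟨ +-assoc _ (mod v g * b0) b0 ⟩
   (L0 + div v g) * w + (mod v g * b0 + b0) ≤⟨ +ʳ≤ ((L0 + div v g) * w) (SlotAddr.o'+b0≤w v v≤n fits) ⟩
   (L0 + div v g) * w + w ≡⟨ +-comm _ w ⟩
   suc (L0 + div v g) * w ≤⟨ *ˡ≤ w (+ʳ< L0 q<q') ⟩
   (L0 + div v' g) * w ≤⟨ m≤m+n _ _ ⟩
   A0base v' ∎
   where open ≤-Reasoning
  ... | inr q≡q' = begin
   (L0 + div v g) * w + mod v g * b0 + b0 ≡⟨ +-assoc _ (mod v g * b0) b0 ⟩
   (L0 + div v g) * w + (mod v g * b0 + b0) ≡⟨ cong₂ (λ q z → (L0 + q) * w + z) q≡q' (+-comm (mod v g * b0) b0) ⟩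
   (L0 + div v' g) * w + suc (mod v g) * b0 ≤⟨ +ʳ≤ ((L0 + div v' g) * w) (*ˡ≤ b0 r<r') ⟩
   A0base v' ∎
   where
   open ≤-Reasoning
   g>0 = SlotAddr.g>0 v v≤n fits
   r<r' : mod v g < mod v' g
   r<r' = +-cancelˡ-< (div v g * g) _ _ (subst₂ _<_ (quot+rem v g g>0) (quot+rem v' g g>0 · cong (λ q → q * g + mod v' g) (sym q≡q')) v<v')

  write-below : ∀ mem k o len x a → a < k → writeMem w mem k o len x a ≡ mem a
  write-below mem k o len x a a<k = updℕ-≢ (updℕ mem k X) (k + 1) (opval w xor (updℕ mem k X (k + 1)) (opval w shr δ (w ∸ o))) a (λ e → <⇒≢ (<-trans a<k (m<m+n k z<s)) (sym e)) ·
   updℕ-≢ mem k X a (>⇒≢ a<k)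
   where
   δ = opval w xor (rdv w (mem k) (mem (k + 1)) o len) x
   X = opval w xor (mem k) (opval w shl δ o)

  range-true : ∀ o o' l → o ≤ o' → o' < o + l → ((o ≤ᵇ o') ∧ (o' <ᵇ o + l)) ≡ true
  range-true o o' l p q = cong₂ _∧_ (≤ᵇ-true p) (<ᵇ-true q)

  good-WR : ∀ (s : State R) {mem} r o l x → MemRel mem (lev s) (pl s) (sl s) → MemB mem → r < NR → o ≤ n → l ≤ w → x < 2 ^ l → Fits →
   MemRel (writeMem w mem (PB + (r * W + div o w)) (mod o w) l x) (lev s) (wrP (pl s) r o l x) (sl s)
  good-WR s {mem} r o l x mr mb r<NR o≤n l≤w x< fits = memrel levs' pls' sls' (sl< mr)
   where
   open PlaneAddr r o r<NR o≤n fits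
   wr = ab-write w mem k (mod o w) l x w>0 (mb k k<S) (mb (k + 1) k+1<S) (remainder-< o w w>0) l≤w x<
   mem' = writeMem w mem k (mod o w) l x
   inside : ∀ i → i < l → ab w mem' (Abase r + o + i) ≡ tb x i
   inside i i<l = cong (λ A → ab w mem' (A + i)) (sym addr) · fst wr i i<l
   outside : ∀ A → A < Abase r + o ⊎ Abase r + o + l ≤ A → ab w mem' A ≡ ab w mem A
   outside A h = snd wr A (subst (λ z → A < z ⊎ z + l ≤ A) (sym addr) h)
   ol≤ = +≤+ o≤n l≤w » n+w≤Ww
   levs' : ∀ a → a < PB → mem' a ≡ lev s a
   levs' a a<PB = write-below mem k (mod o w) l x a (a<PB » m≤m+n PB _) · levs mr a a<PB
   pls' : ∀ r' o' → r' < NR → o' < W * w → ab w mem' (Abase r' + o') ≡ wrP (pl s) r o l x r' o'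
   pls' r' o' r'< o'< with r ≟ r'
   ... | no r≢r' = outside _ (plane-gap r r' o o' l r≢r' ol≤ o'<) · pls mr r' o' r'< o'< · sym (if-false (cong (_∧ ((o ≤ᵇ o') ∧ (o' <ᵇ o + l))) (≡ᵇ-≢ r r' r≢r')))
   ... | yes refl with o ≤? o' | o' <? o + l
   ... | yes p | yes q = cong (ab w mem') A≡ · inside (o' ∸ o) (+-cancelˡ-< o _ _ (≡< (m+[n∸m]≡n p) q)) · sym (if-true (cong₂ _∧_ (≡ᵇ-refl r) (range-true o o' l p q)))
    where
    A≡ : Abase r + o' ≡ Abase r + o + (o' ∸ o)
    A≡ = cong (Abase r +_) (sym (m+[n∸m]≡n p)) · sym (+-assoc (Abase r) o _)
   ... | no p | _ = outside _ (inl (+ʳ< (Abase r) (≰⇒> p))) · pls mr r o' r'< o'< · sym (if-false (cong (λ z → (r ≡ᵇ r) ∧ (z ∧ (o' <ᵇ o + l))) (≤ᵇ-false (≰⇒> p)) · ∧-zeroʳ (r ≡ᵇ r)))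
   ... | yes _ | no q = outside _ (inr (=≤ (+-assoc (Abase r) o l) » +ʳ≤ (Abase r) (≮⇒≥ q))) · pls mr r o' r'< o'< ·
    sym (if-false (cong (λ z → (r ≡ᵇ r) ∧ ((o ≤ᵇ o') ∧ z)) (<ᵇ-false (≮⇒≥ q)) · cong ((r ≡ᵇ r) ∧_) (∧-zeroʳ (o ≤ᵇ o')) · ∧-zeroʳ (r ≡ᵇ r)))
   sls' : ∀ v i → v ≤ n → i < b0 → ab w mem' (A0base v + i) ≡ tb (sl s v) i
   sls' v i v≤n i<b0 = outside _ (inr (=≤ (+-assoc (Abase r) o l) » plane<slots r (o + l) v r<NR ol≤ » m≤m+n _ i)) · sls mr v i v≤n i<b0

  good-WR0 : ∀ (s : State R) {mem} v x → MemRel mem (lev s) (pl s) (sl s) → MemB mem → v ≤ n → x < 2 ^ b0 → Fits →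
   MemRel (writeMem w mem (L0 + div v g) (mod v g * b0) b0 x) (lev s) (pl s) (updℕ (sl s) v x)
  good-WR0 s {mem} v x mr mb v≤n x< fits = memrel levs' pls' sls' sl<'
   where
   open SlotAddr v v≤n fits
   wr = ab-write w mem k o' b0 x w>0 (mb k k<S) (mb (k + 1) k+1<S) o'<w b0≤w x<
   mem' = writeMem w mem k o' b0 x
   levs' : ∀ a → a < PB → mem' a ≡ lev s a
   levs' a a<PB = write-below mem k o' b0 x a (a<PB » m≤m+n PB _ » m≤m+n L0 _) · levs mr a a<PB
   pls' : ∀ r' o'' → r' < NR → o'' < W * w → ab w mem' (Abase r' + o'') ≡ pl s r' o''
   pls' r' o'' r'< o''< = snd wr _ (inl (+ʳ< (Abase r') o''< » plane<slots r' (W * w) v r'< ≤-refl)) · pls mr r' o'' r'< o''<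
   sls' : ∀ u i → u ≤ n → i < b0 → ab w mem' (A0base u + i) ≡ tb (updℕ (sl s) v x u) i
   sls' u i u≤n i<b0 with <-cmp v u
   ... | tri≈ _ refl _ = fst wr i i<b0 · cong (λ z → tb z i) (sym (updℕ-≡ (sl s) v x))
   ... | tri< v<u v≢u _ = snd wr _ (inr (slot-gap v u v<u v≤n fits » m≤m+n _ i)) · sls mr u i u≤n i<b0 · cong (λ z → tb z i) (sym (updℕ-≢ (sl s) v x u v≢u))
   ... | tri> _ v≢u u<v = snd wr _ (inl (+ʳ< (A0base u) i<b0 » slot-gap u v u<v u≤n fits)) · sls mr u i u≤n i<b0 · cong (λ z → tb z i) (sym (updℕ-≢ (sl s) v x u v≢u))
   sl<' : ∀ u → u ≤ n → updℕ (sl s) v x u < 2 ^ b0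
   sl<' u u≤n with v ≡ᵇ u
   ... | true = x<
   ... | false = sl< mr u u≤n

  mapEvent-∘ : ∀ {A B D : Set} (f : B → D) (g : A → B) e → mapEvent f (mapEvent g e) ≡ mapEvent (λ x → f (g x)) e
  mapEvent-∘ f g (turnsGray u) = refl
  mapEvent-∘ f g (turnsBlack u) = refl
  mapEvent-∘ f g (exploresTree u v) = refl
  mapEvent-∘ f g (exploresNontree u v) = refl
  mapEvent-∘ f g (withdraws u v) = refl

  record GoodC (is : List I1) (ts : Vec ℕ 10) (s : State R) (mem : ℕ → ℕ) (s' : State R) : Set where
   constructor good
   field un : Good is (C ts s mem) s'
  open GoodC

  opd-good : ∀ A i is {ts s mem s'} → RegB s → okO A s → GoodC is (ts [ i ]≔ valO A s) s mem s' → GoodC (opd A i ++ is) ts s mem s'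
  opd-good A i is B ok gd = good (good-opd A i is B ok (un gd))

  step-set : ∀ i {c is ts s mem s'} → c < 2 ^ w → GoodC is (ts [ i ]≔ c) s mem s' → GoodC (set (tm i) c ∷ is) ts s mem s'
  step-set i {c} {is} {ts} {s} {mem} c< gd = good (good-++ (set (tm i) c ∷ []) is (c< , tt) (good-cong is (canon-set ts s mem i c) (un gd)))

  step-alu : ∀ {op} i {x y is ts s mem s'} u v → mreg (C ts s mem) x ≡ u → mreg (C ts s mem) y ≡ v → OpOk w op u v →
   GoodC is (ts [ i ]≔ opval w op u v) s mem s' → GoodC (alu op (tm i) x y ∷ is) ts s mem s'
  step-alu {op} i {x} {y} {is} {ts} {s} {mem} u v refl refl ok gd = good (good-++ (alu op (tm i) x y ∷ []) is (ok , tt) (good-cong is (canon-set ts s mem i _) (un gd)))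

  step-load : ∀ i {x is ts s mem s'} a → mreg (C ts s mem) x ≡ a → a < S → GoodC is (ts [ i ]≔ mem a) s mem s' → GoodC (load (tm i) x ∷ is) ts s mem s'
  step-load i {x} {is} {ts} {s} {mem} a refl ok gd = good (good-++ (load (tm i) x ∷ []) is (ok , tt) (good-cong is (canon-set ts s mem i _) (un gd)))

  step-ask : ∀ i {q x y is ts s mem s' z} → let v = mreg (C ts s mem) in ans q (v x) (v y) ≡ just z → z < 2 ^ w →
   GoodC is (ts [ i ]≔ fromMaybe 0 (ans q (v x) (v y))) s mem s' → GoodC (ask q (tm i) x y ∷ is) ts s mem s'
  step-ask i {q} {x} {y} {is} {ts} {s} {mem} e z< gd = good (good-++ (ask q (tm i) x y ∷ []) is ((_ , e , z<) , tt) (good-cong is (canon-set ts s mem i _) (un gd)))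

  step-store : ∀ {x y is ts s mem s'} a v → mreg (C ts s mem) x ≡ a → mreg (C ts s mem) y ≡ v → a < S → GoodC is ts s (updℕ mem a v) s' → GoodC (store x y ∷ is) ts s mem s'
  step-store {x} {y} {is} {ts} {s} {mem} a v refl refl ok gd = good (good-++ (store x y ∷ []) is (ok , tt) (un gd))

  good-mv : ∀ d x {ts s mem s'} v → mreg (C (ts [ # 9 ]≔ 0) s mem) x ≡ v → v < 2 ^ w →
   (∀ y → upd (reg s) d v y ≡ reg s' y) → MemRel mem (lev s') (pl s') (sl s') → out s ≡ out s' → GoodC (mv d x) ts s mem s'
  good-mv d x {ts} {s} {mem} {s'} v e v< hr hm ho = step-set (# 9) (m^n>0 2 w) (last (ts [ # 9 ]≔ 0) (at9 ts) e)
   where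
   at9 : ∀ (ts : Vec ℕ 10) → mreg (C (ts [ # 9 ]≔ 0) s mem) t9 ≡ 0
   at9 ten = refl
   last : ∀ ts → mreg (C ts s mem) t9 ≡ 0 → mreg (C ts s mem) x ≡ v → GoodC (alu add (12 ↑ʳ d) t9 x ∷ []) ts s mem s'
   last ts e0 e1 = good ((≡< sum≡ v< , tt) ,
    rel2 refl refl (λ y → (cong (λ z → if toℕ d ≡ᵇ toℕ y then z else canonT ts (reg s) (10 ↑ʳ y)) sum≡ · cong (λ z → if toℕ d ≡ᵇ toℕ y then v else z) (canonT-↑ʳ ts (reg s) y)) · hr y) hm ho)
    where
    sum≡ : mreg (C ts s mem) t9 + mreg (C ts s mem) x ≡ v
    sum≡ = cong₂ _+_ e0 e1

  addrP-good : ∀ r o l is {a3 a4 a5 a6 a7 a8 a9 s mem s'} (r<NR : r < NR) (o≤n : o ≤ n) (fits : Fits) →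
   GoodC is (r ∷ o ∷ l ∷ PlaneAddr.k r o r<NR o≤n fits ∷ mod o w ∷ a5 ∷ a6 ∷ a7 ∷ a8 ∷ a9 ∷ []) s mem s' →
   GoodC (addrP ++ is) (r ∷ o ∷ l ∷ a3 ∷ a4 ∷ a5 ∷ a6 ∷ a7 ∷ a8 ∷ a9 ∷ []) s mem s'
  addrP-good r o l is r<NR o≤n fits gd = step-alu (# 3) n w refl refl tt (step-set (# 4) 2<2^w (step-alu (# 3) (div n w) 2 refl refl W<2^w (step-alu (# 3) r W refl refl rW<2^w
   (step-alu (# 4) o w refl refl tt
   (step-alu (# 3) (r * W) (div o w) refl refl rW+q<2^w
   (step-set (# 4) PB<2^w
   (step-alu (# 3) PB (r * W + div o w) refl refl k<2^w
   (step-alu (# 4) o w refl refl tt gd))))))))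
   where open PlaneAddr r o r<NR o≤n fits

  addr0-good : ∀ v is {a1 a3 a4 a5 a6 a7 a8 a9 s mem s'} (v≤n : v ≤ n) (fits : Fits) →
   (∀ a1 a5 a6 → GoodC is (v ∷ a1 ∷ b0 ∷ SlotAddr.k v v≤n fits ∷ SlotAddr.o' v v≤n fits ∷ a5 ∷ a6 ∷ a7 ∷ a8 ∷ a9 ∷ []) s mem s') →
   GoodC (addr0 ++ is) (v ∷ a1 ∷ b0 ∷ a3 ∷ a4 ∷ a5 ∷ a6 ∷ a7 ∷ a8 ∷ a9 ∷ []) s mem s'
  addr0-good v is v≤n fits gd = step-alu (# 5) w b0 refl refl tt (step-alu (# 4) v g refl refl tt (step-alu (# 4) (mod v g) b0 refl refl (s≤s (m≤m+n _ b0 » o'+b0≤w) » w<2^w)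
   (step-alu (# 1) v g refl refl tt
   (step-alu (# 5) n w refl refl tt
   (step-set (# 6) 2<2^w
   (step-alu (# 5) (div n w) 2 refl refl W<2^w
   (step-set (# 6) NR<2^w
   (step-alu (# 5) NR W refl refl NRW<2^w
   (step-set (# 6) PB<2^w
   (step-alu (# 5) PB (NR * W) refl refl L0<2^w
   (step-alu (# 3) L0 (div v g) refl refl k<2^w (gd _ _ _))))))))))))
   where open SlotAddr v v≤n fits

  rdCore-good : ∀ k o l is {a0 a1 a5 a6 a7 a8 a9 s mem s'} → k + 1 < S → S ≤ 2 ^ w → 1 < 2 ^ w → o ≤ w → l ≤ w →
   (∀ a6 a7 a8 → GoodC is (a0 ∷ a1 ∷ l ∷ k ∷ o ∷ rdv w (mem k) (mem (k + 1)) o l ∷ a6 ∷ a7 ∷ a8 ∷ a9 ∷ []) s mem s') →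
   GoodC (rdCore ++ is) (a0 ∷ a1 ∷ l ∷ k ∷ o ∷ a5 ∷ a6 ∷ a7 ∷ a8 ∷ a9 ∷ []) s mem s'
  rdCore-good k o l is {mem = mem} k+1<S fits 1<2^w o≤w l≤w gd = step-load (# 6) k refl (s≤s (m≤m+n k 1) » k+1<S) (step-set (# 7) 1<2^w (step-alu (# 7) k 1 refl refl (k+1<S » fits)
   (step-load (# 7) (k + 1) refl k+1<S
   (step-alu (# 6) (mem k) o refl refl tt
   (step-alu (# 8) w o refl refl o≤w
   (step-alu (# 7) (mem (k + 1)) (w ∸ o) refl refl tt
   (step-alu (# 6) (opval w shr (mem k) o) (opval w shl (mem (k + 1)) (w ∸ o)) refl refl tt
   (step-alu (# 8) w l refl refl l≤w
   (step-alu (# 6) (opval w or (opval w shr (mem k) o) (opval w shl (mem (k + 1)) (w ∸ o))) (w ∸ l) refl refl tt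
   (step-alu (# 5) _ (w ∸ l) refl refl tt (gd _ _ _)))))))))))

  wrCore-good : ∀ k o l x old {a0 a1 a2 a6 a7 a8 s mem s'} → k + 1 < S → S ≤ 2 ^ w → 1 < 2 ^ w → o ≤ w → old ≡ rdv w (mem k) (mem (k + 1)) o l → (∀ y → reg s y ≡ reg s' y) →
   MemRel (writeMem w mem k o l x) (lev s') (pl s') (sl s') → out s ≡ out s' →
   GoodC wrCore (a0 ∷ a1 ∷ a2 ∷ k ∷ o ∷ old ∷ a6 ∷ a7 ∷ a8 ∷ x ∷ []) s mem s'
  wrCore-good k o l x old {mem = mem} k+1<S fits 1<2^w o≤w refl hr hm ho = step-alu (# 5) old x refl refl tt (step-load (# 6) k refl (s≤s (m≤m+n k 1) » k+1<S)
   (step-alu (# 7) δ o refl refl tt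
   (step-alu (# 6) (mem k) (opval w shl δ o) refl refl tt
   (step-store k _ refl refl (s≤s (m≤m+n k 1) » k+1<S)
   (step-set (# 7) 1<2^w
   (step-alu (# 7) k 1 refl refl (k+1<S » fits)
   (step-load (# 6) (k + 1) refl k+1<S
   (step-alu (# 8) w o refl refl o≤w
   (step-alu (# 8) δ (w ∸ o) refl refl tt
   (step-alu (# 6) (mem' (k + 1)) (opval w shr δ (w ∸ o)) refl refl tt
   (step-store (k + 1) _ refl refl k+1<S
   (good (tt , rel2 refl refl hr hm ho)))))))))))))
   where
   δ = opval w xor old x
   mem' = updℕ mem k (opval w xor (mem k) (opval w shl δ o))

  good-RD : ∀ d r o l ts {s mem} → MemRel mem (lev s) (pl s) (sl s) → MemB mem → r < NR → o ≤ n → l ≤ w → Fits →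
   GoodC (addrP ++ rdCore ++ mv d t5) (((ts [ # 0 ]≔ r) [ # 1 ]≔ o) [ # 2 ]≔ l) s mem (sreg s d (num (pl s r) o l))
  good-RD d r o l ten {s} {mem} mr mb r< o≤ l≤ fits = addrP-good r o l _ r< o≤ fits (rdCore-good k (mod o w) l _ k+1<S fits 1<2^w (<⇒≤ (remainder-< o w w>0)) l≤ (λ _ _ _ →
    good-mv d t5 _ refl (≡< val (num-<2^w (pl s r) o l≤)) (λ x → cong (λ z → upd (reg s) d z x) val) mr refl))
   where
   open PlaneAddr r o r< o≤ fits
   val : rdv w (mem k) (mem (k + 1)) (mod o w) l ≡ num (pl s r) o l
   val = rdv-num w mem k (mod o w) l (mb k k<S) (mb (k + 1) k+1<S) (remainder-< o w w>0) l≤ ·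
    num-unique (ab w mem) (k * w + mod o w) l _ (num-< (pl s r) o l) (λ i i<l → cong (λ z → ab w mem (z + i)) addr · cong (ab w mem) (+-assoc (Abase r) o i) ·
      pls mr r (o + i) r< (+ʳ< o i<l » +≤+ o≤ l≤ » n+w≤Ww) · sym (tb-num (pl s r) o l i i<l))

  good-WR' : ∀ r o l x ts {s mem} → MemRel mem (lev s) (pl s) (sl s) → MemB mem → r < NR → o ≤ n → l ≤ w → x < 2 ^ l → Fits →
   GoodC (addrP ++ rdCore ++ wrCore) ((((ts [ # 0 ]≔ r) [ # 1 ]≔ o) [ # 2 ]≔ l) [ # 9 ]≔ x) s mem (record s { pl = wrP (pl s) r o l x })
  good-WR' r o l x ten {s} {mem} mr mb r< o≤ l≤ x< fits = addrP-good r o l _ r< o≤ fits (rdCore-good k (mod o w) l _ k+1<S fits 1<2^w (<⇒≤ (remainder-< o w w>0)) l≤ (λ _ _ _ →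
    wrCore-good k (mod o w) l x _ k+1<S fits 1<2^w (<⇒≤ (remainder-< o w w>0)) refl (λ y → refl) (good-WR s r o l x mr mb r< o≤ l≤ x< fits) refl))
   where open PlaneAddr r o r< o≤ fits

  good-RD0 : ∀ d v ts {s mem} → MemRel mem (lev s) (pl s) (sl s) → MemB mem → v ≤ n → Fits → GoodC (addr0 ++ rdCore ++ mv d t5) ((ts [ # 0 ]≔ v) [ # 2 ]≔ b0) s mem (sreg s d (sl s v))
  good-RD0 d v ten {s} {mem} mr mb v≤ fits = addr0-good v _ v≤ fits (λ _ _ _ → rdCore-good k o' b0 _ k+1<S fits (<-trans (s≤s z<s) 2<2^w) (<⇒≤ o'<w) b0≤w (λ _ _ _ →
    good-mv d t5 _ refl (≡< val (sl< mr v v≤ » ^-monoʳ-≤ 2 b0≤w)) (λ x → cong (λ z → upd (reg s) d z x) val) mr refl))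
   where
   open SlotAddr v v≤ fits
   val : rdv w (mem k) (mem (k + 1)) o' b0 ≡ sl s v
   val = rdv-num w mem k o' b0 (mb k k<S) (mb (k + 1) k+1<S) o'<w b0≤w · num-unique (ab w mem) (k * w + o') b0 _ (sl< mr v v≤) (λ i i<l → sls mr v i v≤ i<l)

  good-WR0' : ∀ v x ts {s mem} → MemRel mem (lev s) (pl s) (sl s) → MemB mem → v ≤ n → x < 2 ^ b0 → Fits →
   GoodC (addr0 ++ rdCore ++ wrCore) (((ts [ # 0 ]≔ v) [ # 2 ]≔ b0) [ # 9 ]≔ x) s mem (record s { sl = updℕ (sl s) v x })
  good-WR0' v x ten {s} {mem} mr mb v≤ x< fits = addr0-good v _ v≤ fits (λ _ _ _ → rdCore-good k o' b0 _ k+1<S fits (<-trans (s≤s z<s) 2<2^w) (<⇒≤ o'<w) b0≤w (λ _ _ _ →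
    wrCore-good k o' b0 x _ k+1<S fits (<-trans (s≤s z<s) 2<2^w) (<⇒≤ o'<w) refl (λ y → refl) (good-WR0 s v x mr mb v≤ x< fits) refl))
   where open SlotAddr v v≤ fits

  good-ST : ∀ (s : State R) {mem} a v → MemRel mem (lev s) (pl s) (sl s) → a < PB → MemRel (updℕ mem a v) (updℕ (lev s) a v) (pl s) (sl s)
  good-ST s {mem} a v mr a< = memrel levs' pls' sls' (sl< mr)
   where
   mem' = updℕ mem a v
   levs' : ∀ b → b < PB → mem' b ≡ updℕ (lev s) a v b
   levs' b b< with a ≡ᵇ b
   ... | true = refl
   ... | false = levs mr b b<
   high : ∀ k i → i < w → PB ≤ k → ab w mem' (k * w + i) ≡ ab w mem (k * w + i)
   high k i i<w PB≤k = ab-at w mem' k i i<w · cong (λ z → tb z i) (updℕ-≢ mem a _ k (λ e → <⇒≢ (a< » PB≤k) e)) · sym (ab-at w mem k i i<w)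
   high' : ∀ A → PB * w ≤ A → ab w mem' A ≡ ab w mem A
   high' A PBw≤A = subst (λ z → ab w mem' z ≡ ab w mem z) (sym (quot+rem A w w>0)) (high (div A w) (mod A w) (remainder-< A w w>0)
    (≡≤ (sym (cong (λ z → div z w) (sym (+0 (PB * w))) · quotient-unique PB 0 w w>0)) (quotient-mono w PBw≤A)))
   pls' : ∀ r o → r < NR → o < W * w → ab w mem' (Abase r + o) ≡ pl s r o
   pls' r o r< o< = high' _ (*ˡ≤ w (m≤m+n PB (r * W)) » m≤m+n _ o) · pls mr r o r< o<
   sls' : ∀ v l → v ≤ n → l < b0 → ab w mem' (A0base v + l) ≡ tb (sl s v) l
   sls' v l v≤ l< = high' _ (*ˡ≤ w (m≤m+n PB (NR * W) » m≤m+n L0 (div v g)) » m≤m+n _ (mod v g * b0) » m≤m+n _ l) · sls mr v l v≤ l<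

  PB≤S : PB ≤ S
  PB≤S = m≤m+n PB (NR * W) » m≤m+n L0 (div n g) » m≤m+n _ 2

  good-code : ∀ p {ts s mem} → RegB s → MemRel mem (lev s) (pl s) (sl s) → MemB mem → ok2 p s → GoodC (code1 p) ts s mem (eff2 p s)
  good-code (mov d A) {ten} {s} B mr mb ok = opd-good A zero (mv d t0) B ok (good-mv d t0 _ refl (valO-< A s B ok) (λ _ → refl) mr refl)
  good-code (getN d) {ten} B mr mb ok = good-mv d rN n refl n<2^w (λ _ → refl) mr refl
  good-code (alu op d A A') {ten} {s} B mr mb (oA , oA' , oop) = opd-good A zero _ B oA (opd-good A' (suc zero) _ B oA' (step-alu (# 0) _ _ refl refl oop
    (good-mv d t0 _ refl (≡< (sym (op-sound w w>0 op _ _ (valO-< A s B oA) (valO-< A' s B oA') oop)) (toℕ<n _)) (λ _ → refl) mr refl)))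
  good-code (ask q d A A') {ten} {s} B mr mb (oA , oA' , y , e , y<) = opd-good A zero _ B oA (opd-good A' (suc zero) _ B oA' (step-ask (# 0) e y<
    (good-mv d t0 _ refl (≡< (cong (fromMaybe 0) e) y<) (λ _ → refl) mr refl)))
  good-code (call e) {ts} {s} {mem} B mr mb ok = good ((tt , tt) , rel2 refl refl (canonT-↑ʳ (n ∷ w ∷ ts) (reg s)) mr
   (cong (λ z → out s ++ z ∷ []) (mapEvent-∘ _ (12 ↑ʳ_) e · mapEvent-cong _ _ (canonT-↑ʳ (n ∷ w ∷ ts) (reg s)) e)))
  good-code (LD d A) {ten} {s} B mr mb (oA , a< , fits) = opd-good A zero _ B oA (step-load (# 0) (valO A s) refl (a< » PB≤S)
    (good-mv d t0 _ refl (mb _ (a< » PB≤S)) (λ x → cong (λ z → upd (reg s) d z x) (levs mr _ a<)) mr refl))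
  good-code (ST A A') {ten} {s} B mr mb (oA , oA' , a< , fits) = opd-good A zero _ B oA (opd-good A' (suc zero) _ B oA' (step-store _ _ refl refl (a< » PB≤S)
    (good (tt , rel2 refl refl (λ _ → refl) (good-ST s (valO A s) (valO A' s) mr a<) refl))))
  good-code (RD d A B' C') {ts} {s} B mr mb (oA , oB , oC , r< , o≤ , l≤ , fits) = opd-good A zero _ B oA (opd-good B' (suc zero) _ B oB (opd-good C' (suc (suc zero)) _ B oC
   (good-RD d (valO A s) (valO B' s) (valO C' s) ts mr mb r< o≤ l≤ fits)))
  good-code (WR A B' C' D) {ts} {s} B mr mb (oA , oB , oC , oD , r< , o≤ , l≤ , x< , fits) = opd-good A zero _ B oA (opd-good B' (suc zero) _ B oB (opd-good C' (suc (suc zero)) _ B oC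
   (opd-good D (# 9) _ B oD (good-WR' (valO A s) (valO B' s) (valO C' s) (valO D s) ts mr mb r< o≤ l≤ x< fits))))
  good-code (RD0 d A C') {ts} {s} {mem} B mr mb (oA , oC , v≤ , b≡ , fits) = opd-good A zero _ B oA (opd-good C' (suc (suc zero)) _ B oC
   (subst (λ b → GoodC (addr0 ++ rdCore ++ mv d t5) ((ts [ zero ]≔ valO A s) [ suc (suc zero) ]≔ b) s mem (eff2 (RD0 d A C') s)) (sym b≡) (good-RD0 d (valO A s) ts mr mb v≤ fits)))
  good-code (WR0 A C' D) {ts} {s} {mem} B mr mb (oA , oC , oD , v≤ , b≡ , x< , fits) = opd-good A zero _ B oA (opd-good C' (suc (suc zero)) _ B oC (opd-good D (# 9) _ B oD
   (subst (λ b → GoodC (addr0 ++ rdCore ++ wrCore) (((ts [ zero ]≔ valO A s) [ suc (suc zero) ]≔ b) [ # 9 ]≔ valO D s) s mem (eff2 (WR0 A C' D) s)) (sym b≡)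
    (good-WR0' (valO A s) (valO D s) ts mr mb v≤ x< fits))))

  good-prim : ∀ p {s σ} → Rel2 s σ → (∀ x → mreg σ x < 2 ^ w) → MemB (mmem σ) → ok2 p s → Good (code1 p) σ (eff2 p s)
  good-prim p {s} {σ} ρ rb mb ok = good-cong (code1 p) (to-canon ρ) (un (good-code p (λ x → ≡< (sym (rel-reg ρ x)) (rb (12 ↑ʳ x))) (rel-mem ρ) mb ok))

-- Structured commands and their compilation

infixr 4 _⨾_

data Cmd (Q : Set) (R : ℕ) : Set where
 block : List (Prim Q R) → Cmd Q R
 _⨾_ : Cmd Q R → Cmd Q R → Cmd Q R
 ifnz : Fin R → Cmd Q R → Cmd Q R → Cmd Q R
 loop : Cmd Q R → Fin R → Cmd Q R → Cmd Q R

tick : ∀ {R} → State R → State R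
tick s = record s { ticks = suc (ticks s) }

module Semantics {Q : Set} (ans : Q → ℕ → ℕ → Maybe ℕ) (n w PB NR b0 R : ℕ) where

 open Layout ans n w PB NR b0 R public using (eff2; ok2; okO; Fits; W; S; L0; g)

 runs : List (Prim Q R) → State R → State R
 runs [] s = s
 runs (p ∷ ps) s = runs ps (eff2 p s)

 oks : List (Prim Q R) → State R → Set
 oks [] s = ⊤
 oks (p ∷ ps) s = ok2 p s × oks ps (eff2 p s)

 -- The ticks count the iterations of loops only: everything else costs a constant.
 data Exec : Cmd Q R → State R → State R → Set where
  blk : ∀ {ps s} → oks ps s → Exec (block ps) s (runs ps s)
  _▸_ : ∀ {c d s s' s''} → Exec c s s' → Exec d s' s'' → Exec (c ⨾ d) s s''
  ifT : ∀ {r c d s s'} → reg s r ≢ 0 → Exec c s s' → Exec (ifnz r c d) s s'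
  ifF : ∀ {r c d s s'} → reg s r ≡ 0 → Exec d s s' → Exec (ifnz r c d) s s'
  stop : ∀ {pre r c s s'} → Exec pre s s' → reg s' r ≡ 0 → Exec (loop pre r c) s s'
  again : ∀ {pre r c s s1 s2 s3} → Exec pre s s1 → reg s1 r ≢ 0 → Exec c s1 s2 → Exec (loop pre r c) (tick s2) s3 → Exec (loop pre r c) s s3

 infixr 5 _▸_

module Compile {Q : Set} (PB NR R : ℕ) where

 open Code {Q} PB NR R using (code1)

 codes : List (Prim Q R) → List (Instruction Q (12 + R))
 codes [] = []
 codes (p ∷ ps) = code1 p ++ codes ps

 csize : Cmd Q R → ℕ
 csize (block ps) = length (codes ps)
 csize (c ⨾ d) = csize c + csize d
 csize (ifnz r c d) = suc (csize c + suc (csize d))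
 csize (loop pre r c) = csize pre + suc (csize c + 1)

 -- The position of the code is passed along because jumps have absolute targets.
 compile : Cmd Q R → ℕ → List (Instruction Q (12 + R))
 compile (block ps) p = codes ps
 compile (c ⨾ d) p = compile c p ++ compile d (p + csize c)
 compile (ifnz r c d) p = jumpZero (12 ↑ʳ r) (suc p + csize c + 1) ∷ compile c (suc p) ++ jump (p + csize (ifnz r c d)) ∷ compile d (suc p + csize c + 1)
 compile (loop pre r c) p = compile pre p ++ jumpZero (12 ↑ʳ r) (p + csize (loop pre r c)) ∷ compile c (p + csize pre + 1) ++ jump p ∷ []

 length-compile : ∀ c p → length (compile c p) ≡ csize c
 length-compile (block ps) p = refl
 length-compile (c ⨾ d) p = length-++ (compile c p) · (cong₂ _+_ (length-compile c p) (length-compile d _))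
 length-compile (ifnz r c d) p = cong suc (length-++ (compile c _) · cong₂ (λ x y → x + suc y) (length-compile c _) (length-compile d _))
 length-compile (loop pre r c) p = length-++ (compile pre p) · cong₂ (λ x y → x + suc y) (length-compile pre p) (length-++ (compile c _) · cong (_+ 1) (length-compile c _))

module Correct {Q : Set} (ans : Q → ℕ → ℕ → Maybe ℕ) (n w PB NR b0 R : ℕ) (code : List (Instruction Q (12 + R)))
 (w>0 : 0 < w) (n<2^w : n < 2 ^ w) (b0>0 : 0 < b0) (b0≤w : b0 ≤ w) (NR>0 : 0 < NR) where

 open Semantics ans n w PB NR b0 R
 open Compile {Q} PB NR R
 open Code {Q} PB NR R using (code1)
 open Layout ans n w PB NR b0 R using (Rel2; good-prim; rel-reg; MemRel)

 P : Program Q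
 P = record { extraRegisters = 10 + R; code = code }

 open Machine ans P w S
 open Config using (pc)
 open Sound ans P w S w>0
 open Blocks ans w S {12 + R}

 RelC : State R → Config → Set
 RelC s cfg = Σ[ σ ∈ MState (12 + R) ] Rel1 σ cfg × Rel2 s σ

 -- The only backward jumps close loop iterations, and each of these ticks. So no instruction is
 -- executed twice between two ticks, and the size of the code times `suc Δ` bounds the number of
 -- steps. All later time analysis counts ticks only.
 record Outcome (N : ℕ) (s s' : State R) (cfg : Config) : Set where
  field
   cfg' : Config
   τ : List (Event ℕ)
   k Δ : ℕ
   reach : Reach cfg k τ cfg'
   rel : RelC s' cfg'
   pc' : pc cfg' ≡ pc cfg + N
   out' : out s' ≡ out s ++ τ
   tick' : ticks s' ≡ Δ + ticks s
   bound : k ≤ N * suc Δ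

 out-eff2 : ∀ p s → ticks (eff2 p s) ≡ ticks s
 out-eff2 (mov d A) s = refl
 out-eff2 (getN d) s = refl
 out-eff2 (alu o d A B) s = refl
 out-eff2 (ask q d A B) s = refl
 out-eff2 (call e) s = refl
 out-eff2 (LD d A) s = refl
 out-eff2 (ST A B) s = refl
 out-eff2 (RD d A B C) s = refl
 out-eff2 (WR A B C D) s = refl
 out-eff2 (RD0 d A C) s = refl
 out-eff2 (WR0 A C D) s = refl

 seq-outcome : ∀ {M N s s' s'' cfg} (o : Outcome M s s' cfg) → Outcome N s' s'' (Outcome.cfg' o) → Outcome (M + N) s s'' cfg
 seq-outcome {M} {N} {s} {s'} {s''} {cfg} o o2 = record { reach = reach-trans (reach o) (reach o2); rel = rel o2 ; pc' = pc' o2 · cong (_+ N) (pc' o) · +-assoc (pc cfg) M N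
  ; out' = out' o2 · cong (_++ τ o2) (out' o) · ++-assoc (out s) (τ o) (τ o2)
  ; tick' = tick' o2 · cong (Δ o2 +_) (tick' o) · sym (+-assoc (Δ o2) (Δ o) _) · cong (_+ ticks s) (+-comm (Δ o2) (Δ o))
  ; bound = +≤+ (bound o) (bound o2) » +≤+ (*ʳ≤ M (s≤s (m≤m+n (Δ o) (Δ o2)))) (*ʳ≤ N (s≤s (m≤n+m (Δ o2) (Δ o)))) » =≥ (*-distribʳ-+ (suc (Δ o + Δ o2)) M N) }
  where open Outcome

 codes-sound : ∀ ps s cfg → RelC s cfg → At (pc cfg) (codes ps) → oks ps s → Outcome (length (codes ps)) s (runs ps s) cfg
 codes-sound [] s cfg ρ at ok = record { cfg' = cfg; reach = reach-refl; rel = ρ; pc' = sym (+0 _); out' = sym (++-identityʳ _) ; Δ = 0; tick' = refl; bound = z≤n }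
 codes-sound (p ∷ ps) s cfg (σ , ρ1 , ρ2) at (o , os)
  with good-prim w>0 n<2^w b0>0 b0≤w NR>0 p ρ2 (reg-< ρ1) (mem-< ρ1) o
 ... | oks-1 , ρ2' with run1-sound (code1 p) σ cfg ρ1 (at-++ˡ (pc cfg) (code1 p) at) oks-1
 ... | cfg' , τ , reach , ρ1' , pc' , out' = subst (λ N → Outcome N s (runs ps (eff2 p s)) cfg) (sym (length-++ (code1 p))) (seq-outcome first (codes-sound ps (eff2 p s) cfg' (_ , ρ1' , ρ2')
   (subst (λ q → At q (codes ps)) (sym (Outcome.pc' first)) (at-++ʳ (pc cfg) (code1 p) at)) os))
  where
  first : Outcome (length (code1 p)) s (eff2 p s) cfg
  first = record { cfg' = cfg'; τ = τ; k = length (code1 p); Δ = 0; reach = reach; rel = _ , ρ1' , ρ2' ; pc' = pc' ; out' = sym (Layout.rel-out ρ2') · out' · cong (_++ τ) (Layout.rel-out ρ2)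
   ; tick' = out-eff2 p s; bound = =≥ (*-identityʳ _) }

 jumpZero-taken : ∀ {s cfg r t} → RelC s cfg → fetch (pc cfg) ≡ just (jumpZero (12 ↑ʳ r) t) → reg s r ≡ 0 → Reach cfg 1 [] (record cfg { pc = t })
 jumpZero-taken {s} {cfg} {r} {t} (σ , ρ1 , ρ2) f e run = next f
  (cong (λ z → just (config (if z ≡ᵇ 0 then t else suc (pc cfg)) (Config.registers cfg) (Config.memory cfg) , [])) (relReg ρ1 (12 ↑ʳ r) · rel-reg ρ2 r · e)) run

 jumpZero-not-taken : ∀ {s cfg r t} → RelC s cfg → fetch (pc cfg) ≡ just (jumpZero (12 ↑ʳ r) t) → reg s r ≢ 0 → Reach cfg 1 [] (record cfg { pc = suc (pc cfg) })
 jumpZero-not-taken {s} {cfg} {r} {t} (σ , ρ1 , ρ2) f e run = next f (cong (λ z → just (config (if z then t else suc (pc cfg)) (Config.registers cfg) (Config.memory cfg) , []))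
   (≡ᵇ-≢ _ 0 (λ z → e (sym (relReg ρ1 (12 ↑ʳ r) · rel-reg ρ2 r) · z)))) run

 goto : ∀ {s cfg} t → RelC s cfg → RelC s (record cfg { pc = t })
 goto t (σ , rel1 a b , ρ2) = σ , rel1 a b , ρ2

 goto-tick : ∀ {s cfg} t → RelC s cfg → RelC (tick s) (record cfg { pc = t })
 goto-tick t (σ , rel1 a b , Layout.rel2 c d e f g) = σ , rel1 a b , Layout.rel2 c d e f g

 at-cast : ∀ {p q is} → p ≡ q → At p is → At q is
 at-cast refl at = at

 branch-at : ∀ {r c d} p → At p (compile (ifnz r c d) p) → At (suc p) (compile c (suc p) ++ jump (p + csize (ifnz r c d)) ∷ compile d (suc p + csize c + 1))
 branch-at {r} p at = at-cast (+-comm p 1) (at-++ʳ p (jumpZero (12 ↑ʳ r) _ ∷ []) at)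

 loop-jump : ∀ {pre r c s s' cfg} (o : Outcome (csize pre) s s' cfg) → let p = pc cfg in At p (compile (loop pre r c) p) →
  At (pc (Outcome.cfg' o)) (jumpZero (12 ↑ʳ r) (p + csize (loop pre r c)) ∷ compile c (p + csize pre + 1) ++ jump p ∷ [])
 loop-jump {pre} {cfg = cfg} o at = at-cast (cong (pc cfg +_) (length-compile pre (pc cfg)) · sym (Outcome.pc' o)) (at-++ʳ (pc cfg) (compile pre (pc cfg)) at)

 sound : ∀ {c s s' cfg} → Exec c s s' → RelC s cfg → At (pc cfg) (compile c (pc cfg)) → Outcome (csize c) s s' cfg
 sound {block ps} (blk ok) ρ at = codes-sound ps _ _ ρ at ok
 sound {c ⨾ d} {s} {s'} {cfg} (ex ▸ ex') ρ at = seq-outcome first (sound ex' (Outcome.rel first) (subst (λ q → At q (compile d q)) (sym (Outcome.pc' first))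
   (at-cast (cong (pc cfg +_) (length-compile c (pc cfg))) (at-++ʳ (pc cfg) (compile c (pc cfg)) at))))
  where
  first : Outcome (csize c) s _ cfg
  first = sound ex ρ (at-++ˡ (pc cfg) (compile c (pc cfg)) at)
 sound {ifnz r c d} {s} {s'} {cfg} (ifT r≢0 ex) ρ at = record { cfg' = record (cfg' o) { pc = p + csize (ifnz r c d) }; τ = τ o; k = suc (k o + 1); Δ = Δ o
  ; reach = λ {t} {τ'} run → jumpZero-not-taken ρ (at-fetch p at) r≢0
   (subst (λ z → Run (record cfg { pc = suc p }) z (τ o ++ τ')) (sym (+-assoc (k o) 1 t)) (reach o (next (at-fetch (pc (cfg' o)) at-jump) refl run)))
  ; rel = goto _ (Outcome.rel o); pc' = refl; out' = out' o; tick' = tick' o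
  ; bound = s≤s (+ˡ≤ 1 (bound o) » +ʳ≤ (csize c * suc (Δ o)) z<s » =≥ (*-distribʳ-+ (suc (Δ o)) (csize c) (suc (csize d))) » m≤n+m _ (Δ o)) }
  where
  open Outcome
  p = pc cfg
  at' = branch-at {r} {c} {d} p at
  o : Outcome (csize c) s s' (record cfg { pc = suc p })
  o = sound ex (goto (suc p) ρ) (at-++ˡ (suc p) (compile c (suc p)) at')
  at-jump : At (pc (cfg' o)) (jump (p + csize (ifnz r c d)) ∷ compile d (suc p + csize c + 1))
  at-jump = at-cast (cong (suc p +_) (length-compile c (suc p)) · sym (pc' o)) (at-++ʳ (suc p) (compile c (suc p)) at')
 sound {ifnz r c d} {s} {s'} {cfg} (ifF r≡0 ex) ρ at = record { cfg' = cfg' o; τ = τ o; k = suc (k o); Δ = Δ o ; reach = λ run → jumpZero-taken ρ (at-fetch p at) r≡0 (reach o run)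
  ; rel = Outcome.rel o; pc' = pc' o · e p (csize c) (csize d); out' = out' o; tick' = tick' o
  ; bound = s≤s (bound o » *ˡ≤ (suc (Δ o)) (n≤1+n (csize d) » m≤n+m (suc (csize d)) (csize c)) » m≤n+m _ (Δ o)) }
  where
  open Outcome
  p = pc cfg
  e : ∀ p c d → suc p + c + 1 + d ≡ p + suc (c + suc d)
  e = ring
  at' = branch-at {r} {c} {d} p at
  o : Outcome (csize d) s s' (record cfg { pc = suc p + csize c + 1 })
  o = sound ex (goto _ ρ) (at-cast (cong (_+ 1) (cong (suc p +_) (length-compile c (suc p))))
   (at-++ʳ (suc p + length (compile c (suc p))) (jump (p + csize (ifnz r c d)) ∷ []) (at-++ʳ (suc p) (compile c (suc p)) at')))
 sound {loop pre r c} {s} {s'} {cfg} (stop ex r≡0) ρ at = record { cfg' = record (cfg' o) { pc = p + csize (loop pre r c) }; τ = τ o; k = k o + 1; Δ = Δ o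
  ; reach = λ {t} {τ'} run → subst (λ z → Run cfg z (τ o ++ τ')) (sym (+-assoc (k o) 1 t)) (reach o (jumpZero-taken (Outcome.rel o) (at-fetch (pc (cfg' o)) at-jump) r≡0 run))
  ; rel = goto _ (Outcome.rel o); pc' = refl; out' = out' o; tick' = tick' o
  ; bound = +≤+ (bound o) z<s » =≥ (*-distribʳ-+ (suc (Δ o)) (csize pre) (suc (csize c + 1))) }
  where
  open Outcome
  p = pc cfg
  o : Outcome (csize pre) s _ cfg
  o = sound ex ρ (at-++ˡ p (compile pre p) at)
  at-jump = loop-jump {pre} {r} {c} o at
 sound {loop pre r c} {s} {s'} {cfg} (again {s1 = s1} {s2} ex r≢0 ex2 ex3) ρ at = record
  { cfg' = cfg' o3; τ = τ o ++ τ o2 ++ τ o3; k = k o + suc (k o2 + suc (k o3)); Δ = Δ o + Δ o2 + suc (Δ o3)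
  ; reach = λ {t} {τ'} run → subst₂ (Run cfg) (e1 (k o) (k o2) (k o3) t) (cong (τ o ++_) (sym (++-assoc (τ o2) (τ o3) τ')) · sym (++-assoc (τ o) (τ o2 ++ τ o3) τ'))
   (reach o (jumpZero-not-taken (Outcome.rel o) (at-fetch (pc (cfg' o)) at-jump) r≢0 (reach o2 (next (at-fetch (pc (cfg' o2)) at-back) refl (reach o3 run)))))
  ; rel = Outcome.rel o3; pc' = pc' o3
  ; out' = out' o3 · cong (_++ τ o3) (out' o2 · cong (_++ τ o2) (out' o)) · ++-assoc (out s ++ τ o) (τ o2) (τ o3) · ++-assoc (out s) (τ o) (τ o2 ++ τ o3)
  ; tick' = tick' o3 · cong (λ z → Δ o3 + suc z) (tick' o2 · cong (Δ o2 +_) (tick' o)) · e2 (Δ o) (Δ o2) (Δ o3) (ticks s)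
  -- The explicit argument of `m≤m+n` is the slack of the estimate, chosen such that the ring solver
  -- closes the remaining equation; the same device recurs below.
  ; bound = +≤+ (bound o) (s≤s (+≤+ (bound o2) (s≤s (bound o3)))) » m≤m+n _ (csize pre * Δ o2 + csize c * Δ o + 2 * (Δ o + Δ o2)) » =≤ (e3 (csize pre) (csize c) (Δ o) (Δ o2) (Δ o3)) }
  where
  open Outcome
  p = pc cfg
  o : Outcome (csize pre) s _ cfg
  o = sound ex ρ (at-++ˡ p (compile pre p) at)
  at-jump = loop-jump {pre} {r} {c} o at
  q≡ : pc (cfg' o) + 1 ≡ p + csize pre + 1
  q≡ = cong (_+ 1) (pc' o)
  at-body : At (p + csize pre + 1) (compile c (p + csize pre + 1) ++ jump p ∷ [])
  at-body = at-cast q≡ (at-++ʳ (pc (cfg' o)) (jumpZero (12 ↑ʳ r) _ ∷ []) at-jump)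
  suc-q : suc (pc (cfg' o)) ≡ p + csize pre + 1
  suc-q = +-comm 1 _ · q≡
  o2 : Outcome (csize c) s1 s2 (record (cfg' o) { pc = suc (pc (cfg' o)) })
  o2 = sound ex2 (goto _ (Outcome.rel o)) (subst (λ q → At q (compile c q)) (sym suc-q) (at-++ˡ (p + csize pre + 1) (compile c (p + csize pre + 1)) at-body))
  at-back : At (pc (cfg' o2)) (jump p ∷ [])
  at-back = at-cast (cong (p + csize pre + 1 +_) (length-compile c (p + csize pre + 1)) · cong (_+ csize c) (sym suc-q) · sym (pc' o2)) (at-++ʳ (p + csize pre + 1) (compile c (p + csize pre + 1)) at-body)
  o3 : Outcome (csize (loop pre r c)) (tick s2) s' (record (cfg' o2) { pc = p })
  o3 = sound ex3 (goto-tick p (Outcome.rel o2)) at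
  e1 : ∀ a b c t → a + suc (b + suc (c + t)) ≡ a + suc (b + suc c) + t
  e1 = ring
  e2 : ∀ a b c t → c + suc (b + (a + t)) ≡ a + b + suc c + t
  e2 = ring
  e3 : ∀ P c a b d → P * suc a + suc (c * suc b + suc ((P + suc (c + 1)) * suc d)) + (P * b + c * a + 2 * (a + b)) ≡ (P + suc (c + 1)) * suc (a + b + suc d)
  e3 = ring

-- Graph access and sums over the vertices

-- An undir graph is handled as the symmetric dir one.
net : ∀ kind {n} → Graph kind n → Digraph n
net undir G = record { outdeg = G.deg; indeg = G.deg; outhead = G.head; inhead = G.head; outmate = G.mate; inmate = G.mate
 ; inhead-outmate = G.head-mate; outhead-inmate = G.head-mate; outhead-inj = G.head-inj; inhead-inj = G.head-inj }
  where module G = UndirectedGraph G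
net dir G = G

outdegQ outheadQ outmateQ indegQ inheadQ inmateQ : ∀ kind → Query kind
outdegQ undir = Query.deg
outdegQ dir = Query.outdeg
outheadQ undir = Query.head
outheadQ dir = Query.outhead
outmateQ undir = Query.mate
outmateQ dir = Query.outmate
indegQ undir = Query.deg
indegQ dir = Query.indeg
inheadQ undir = Query.head
inheadQ dir = Query.inhead
inmateQ undir = Query.mate
inmateQ dir = Query.inmate

index?-toℕ : ∀ {d} (i : Fin d) → index? d (toℕ i) ≡ just i
index?-toℕ {d} i = index?-< d (toℕ i) (toℕ<n i) · cong just (fromℕ<-toℕ i (toℕ<n i))

ans-outdeg : ∀ kind {n} (G : Graph kind n) u x → let module N = Digraph (net kind G) in
 answer kind G (outdegQ kind) (ν u) x ≡ just (N.outdeg u)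
ans-outdeg undir G u x rewrite index?-toℕ u = refl
ans-outdeg dir G u x rewrite index?-toℕ u = refl

ans-indeg : ∀ kind {n} (G : Graph kind n) u x → let module N = Digraph (net kind G) in
 answer kind G (indegQ kind) (ν u) x ≡ just (N.indeg u)
ans-indeg undir G u x rewrite index?-toℕ u = refl
ans-indeg dir G u x rewrite index?-toℕ u = refl

ans-outhead : ∀ kind {n} (G : Graph kind n) u i → let module N = Digraph (net kind G) in
 answer kind G (outheadQ kind) (ν u) (toℕ i) ≡ just (ν (N.outhead u i))
ans-outhead undir G u i rewrite index?-toℕ u | index?-toℕ i = refl
ans-outhead dir G u i rewrite index?-toℕ u | index?-toℕ i = refl

ans-outmate : ∀ kind {n} (G : Graph kind n) u i → let module N = Digraph (net kind G) in
 answer kind G (outmateQ kind) (ν u) (toℕ i) ≡ just (toℕ (N.outmate u i))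
ans-outmate undir G u i rewrite index?-toℕ u | index?-toℕ i = refl
ans-outmate dir G u i rewrite index?-toℕ u | index?-toℕ i = refl

ans-inhead : ∀ kind {n} (G : Graph kind n) u i → let module N = Digraph (net kind G) in
 answer kind G (inheadQ kind) (ν u) (toℕ i) ≡ just (ν (N.inhead u i))
ans-inhead undir G u i rewrite index?-toℕ u | index?-toℕ i = refl
ans-inhead dir G u i rewrite index?-toℕ u | index?-toℕ i = refl

ans-inmate : ∀ kind {n} (G : Graph kind n) u i → let module N = Digraph (net kind G) in
 answer kind G (inmateQ kind) (ν u) (toℕ i) ≡ just (toℕ (N.inmate u i))
ans-inmate undir G u i rewrite index?-toℕ u | index?-toℕ i = refl
ans-inmate dir G u i rewrite index?-toℕ u | index?-toℕ i = refl

adjacent→ : ∀ kind {n} (G : Graph kind n) {u v} → Adjacent kind G u v → Σ[ i ∈ _ ] Digraph.outhead (net kind G) u i ≡ v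
adjacent→ undir G a = a
adjacent→ dir G a = a

adjacent← : ∀ kind {n} (G : Graph kind n) u i → Adjacent kind G u (Digraph.outhead (net kind G) u i)
adjacent← undir G u i = i , refl
adjacent← dir G u i = i , refl

sumF : ∀ {n} → (Fin n → ℕ) → ℕ
sumF f = sum (tabulate f)

sumF-mono : ∀ {n} {f g : Fin n → ℕ} → (∀ v → f v ≤ g v) → sumF f ≤ sumF g
sumF-mono {zero} h = z≤n
sumF-mono {suc n} h = +≤+ (h zero) (sumF-mono (λ v → h (suc v)))

sumF-+ : ∀ {n} (f g : Fin n → ℕ) → sumF (λ v → f v + g v) ≡ sumF f + sumF g
sumF-+ {zero} f g = refl
sumF-+ {suc n} f g = cong (f zero + g zero +_) (sumF-+ (λ v → f (suc v)) (λ v → g (suc v))) · e (f zero) (g zero) _ _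
 where
 e : ∀ a b c d → a + b + (c + d) ≡ a + c + (b + d)
 e = ring

sumF-* : ∀ {n} c (f : Fin n → ℕ) → sumF (λ v → c * f v) ≡ c * sumF f
sumF-* {zero} c f = sym (*-zeroʳ c)
sumF-* {suc n} c f = cong (c * f zero +_) (sumF-* c (λ v → f (suc v))) · sym (*-distribˡ-+ c (f zero) _)

sumF-const : ∀ n c → sumF {n} (λ _ → c) ≡ n * c
sumF-const zero c = refl
sumF-const (suc n) c = cong (c +_) (sumF-const n c)

sumF-cong : ∀ {n} {f g : Fin n → ℕ} → (∀ v → f v ≡ g v) → sumF f ≡ sumF g
sumF-cong h = ≤-antisym (sumF-mono (λ v → =≤ (h v))) (sumF-mono (λ v → =≥ (h v)))

sumF-update : ∀ {n} (f g : Fin n → ℕ) u → (∀ v → v ≢ u → f v ≡ g v) → sumF g + f u ≡ sumF f + g u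
sumF-update {suc n} f g zero h = e (g zero) _ (f zero) · cong (λ z → f zero + z + g zero) (sumF-cong (λ v → sym (h (suc v) λ ()))) · refl
 where
 e : ∀ a b c → a + b + c ≡ c + b + a
 e = ring
sumF-update {suc n} f g (suc u) h = +-assoc (g zero) _ _ · (cong₂ _+_ (sym (h zero λ ())) (sumF-update (λ v → f (suc v)) (λ v → g (suc v)) u (λ v v≢u → h (suc v) (λ e → v≢u (sucᶠ-injective e))))) ·
 sym (+-assoc (f zero) _ _)

-- The budgets of the search are sums of weights that depend on the colours, and a recolouring
-- changes one summand. Adding on both sides avoids truncated subtraction.
sumF-weight : ∀ {n} (ω : Colour → Fin n → ℕ) (c : Vec Colour n) u x → sumF (λ v → ω (lookup (c [ u ]≔ x) v) v) + ω (lookup c u) u ≡ sumF (λ v → ω (lookup c v) v) + ω x u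
sumF-weight ω c u x = sumF-update (λ v → ω (lookup c v) v) (λ v → ω (lookup (c [ u ]≔ x) v) v) u (λ v v≢u → cong (λ z → ω z v) (sym (lookup-≢ v≢u c x))) ·
 cong (λ z → sumF (λ v → ω (lookup c v) v) + ω z u) (lookup-≡ u c x)

sumF-unique : ∀ {n} (f : Fin n → ℕ) xs → AllPairs _≢_ xs → sum (map f xs) ≤ sumF f
sumF-unique f [] _ = z≤n
sumF-unique f (x ∷ xs) (x∉ ∷ u) = begin
 f x + sum (map f xs) ≡⟨ cong (f x +_) (map-f' xs x∉) ⟩
 f x + sum (map f' xs) ≤⟨ +ʳ≤ (f x) (sumF-unique f' xs u) ⟩
 f x + sumF f' ≡⟨ +-comm (f x) _ ⟩
 sumF f' + f x ≡⟨ sumF-update f f' x agree ⟩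
 sumF f + f' x ≡⟨ cong (sumF f +_) zero-at ⟩
 sumF f + 0 ≡⟨ +0 _ ⟩
 sumF f ∎
 where
 open ≤-Reasoning
 -- `f` with its value at `x` used up; the tail does not contain `x` and so does not notice the
 -- change.
 f' : Fin _ → ℕ
 f' v with v ≟ᶠ x
 ... | yes _ = 0
 ... | no _ = f v
 agree : ∀ v → v ≢ x → f v ≡ f' v
 agree v v≢x with v ≟ᶠ x
 ... | yes e = ⊥! (v≢x e)
 ... | no _ = refl
 zero-at : f' x ≡ 0
 zero-at with x ≟ᶠ x
 ... | yes _ = refl
 ... | no x≢x = ⊥! (x≢x refl)
 map-f' : ∀ ys → All (x ≢_) ys → sum (map f ys) ≡ sum (map f' ys)
 map-f' [] _ = refl
 map-f' (y ∷ ys) (x≢y ∷ h) = cong₂ _+_ (agree y (≢-sym x≢y)) (map-f' ys h)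

-- Enumerates the pairs of a vertex and an array position, so that an injection between such pairs
-- becomes an inequality between degree sums.
enc : ∀ {n} (f : Fin n → ℕ) u → Fin (f u) → Fin (sumF f)
enc f zero i = i ↑ˡ _
enc f (suc u) i = f zero ↑ʳ enc (λ v → f (suc v)) u i

dec : ∀ {n} (f : Fin n → ℕ) → Fin (sumF f) → Σ[ u ∈ Fin n ] Fin (f u)
dec {suc n} f x = Sum.[ (λ i → zero , i) , (λ y → let (u , i) = dec (λ v → f (suc v)) y in suc u , i) ] (splitAt (f zero) x)

enc-dec : ∀ {n} (f : Fin n → ℕ) x → enc f (fst (dec f x)) (snd (dec f x)) ≡ x
enc-dec {suc n} f x with splitAt (f zero) x | join-splitAt (f zero) (sum (tabulate (λ v → f (suc v)))) x
... | inl i | e = e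
... | inr y | e = cong (f zero ↑ʳ_) (enc-dec (λ v → f (suc v)) y) · e

dec-enc : ∀ {n} (f : Fin n → ℕ) u i → dec f (enc f u i) ≡ (u , i)
dec-enc {suc n} f zero i rewrite splitAt-↑ˡ (f zero) i (sum (tabulate (λ v → f (suc v)))) = refl
dec-enc {suc n} f (suc u) i rewrite splitAt-↑ʳ (f zero) (sum (tabulate (λ v → f (suc v)))) (enc (λ v → f (suc v)) u i) | dec-enc (λ v → f (suc v)) u i = refl

module _ {n : ℕ} (G : Digraph n) where
 open Digraph G

 outdeg≤n : ∀ u → outdeg u ≤ n
 outdeg≤n u = injective⇒≤ (λ {i} {j} → outhead-inj u i j)

 indeg≤n : ∀ u → indeg u ≤ n
 indeg≤n u = injective⇒≤ (λ {i} {j} → inhead-inj u i j)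

 -- `inmate` sends the in-entries injectively to out-entries: the head is recovered by
 -- `outhead-inmate`, and then the entry by `inhead-inj`.
 sum-indeg≤ : sumF indeg ≤ sumF outdeg
 sum-indeg≤ = injective⇒≤ {f = φ} φ-inj
  where
  mate' : Σ[ v ∈ Fin n ] Fin (indeg v) → Σ[ u ∈ Fin n ] Fin (outdeg u)
  mate' (v , j) = inhead v j , inmate v j
  mate'-inj : ∀ p q → mate' p ≡ mate' q → p ≡ q
  mate'-inj (v , j) (v' , j') e with sym (outhead-inmate v j) · cong (λ (u , i) → outhead u i) e · outhead-inmate v' j'
  ... | refl = cong (v ,_) (inhead-inj v j j' (cong fst e))
  φ : Fin (sumF indeg) → Fin (sumF outdeg)
  φ x = let (u , i) = mate' (dec indeg x) in enc outdeg u i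
  φ-inj : ∀ {x y} → φ x ≡ φ y → x ≡ y
  φ-inj {x} {y} e = sym (enc-dec indeg x) · cong (λ (v , j) → enc indeg v j) (mate'-inj _ _ (sym (dec-enc outdeg _ _) · cong (dec outdeg) e · dec-enc outdeg _ _)) · enc-dec indeg y

-- `#edges` halves the degree sum with rounding; allowing for one more avoids proving that the sum
-- is even.
sum-outdeg≤ : ∀ kind {n} (G : Graph kind n) → sumF (Digraph.outdeg (net kind G)) ≤ suc (2 * #edges kind G)
sum-outdeg≤ undir G = =≤ (bit+double (sumF (UndirectedGraph.deg G))) » +ˡ≤ _ (bit≤1 (tb (sumF (UndirectedGraph.deg G)) 0))
sum-outdeg≤ dir G = m≤m+n _ _ » n≤1+n _

sumF-strict : ∀ {n} {f g : Fin n → ℕ} u → (∀ v → f v ≤ g v) → f u < g u → sumF f < sumF g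
sumF-strict zero h f<g = +-mono-<-≤ f<g (sumF-mono (λ v → h (suc v)))
sumF-strict (suc u) h f<g = +-mono-≤-< (h zero) (sumF-strict u (λ v → h (suc v)) f<g)

-- Graphs of bounded size by decision trees

sameEdge? : ∀ kind {n} (e f : Fin n × Fin n) → Dec (SameEdge kind e f)
sameEdge? undir e f = ≡-dec _≟ᶠ_ _≟ᶠ_ e f ⊎-dec ≡-dec _≟ᶠ_ _≟ᶠ_ e (swap f)
sameEdge? dir e f = ≡-dec _≟ᶠ_ _≟ᶠ_ e f

sameEdge-refl : ∀ kind {n} {e f : Fin n × Fin n} → e ≡ f → SameEdge kind e f
sameEdge-refl undir eqn = inl eqn
sameEdge-refl dir eqn = eqn

explored? : ∀ kind {n} es (e : Fin n × Fin n) → Dec (Any (SameEdge kind e) es)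
explored? kind es e = Any.any? (sameEdge? kind e) es

isWhite : Colour → Bool
isWhite white = true
isWhite gray = false
isWhite black = false

-- Looks for exactly this ordered pair, for both kinds of graphs. In the undirected case an explored
-- edge may thus still be missing in the other direction, but every exploration of a new edge makes
-- one missing pair disappear.
missing : ∀ {n} → List (Fin n × Fin n) → Fin n → Fin n → ℕ
missing es a b = if does (explored? dir es (a , b)) then 0 else 1

indicator-mono : ∀ {A B : Set} (a? : Dec A) (b? : Dec B) → (A → B) → (if does b? then 0 else 1) ≤ (if does a? then 0 else 1)
indicator-mono (yes a) (yes b) h = z≤n
indicator-mono (yes a) (no ¬b) h = ⊥! (¬b (h a))
indicator-mono (no ¬a) (yes b) h = z≤n
indicator-mono (no ¬a) (no ¬b) h = ≤-refl

indicator-yes : ∀ {A : Set} (a? : Dec A) → A → (if does a? then 0 else 1) ≡ 0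
indicator-yes (yes _) a = refl
indicator-yes (no ¬a) a = ⊥! (¬a a)

missing-∷ : ∀ {n} (e : Fin n × Fin n) es a b → missing (e ∷ es) a b ≤ missing es a b
missing-∷ e es a b = indicator-mono (explored? dir es (a , b)) (explored? dir (e ∷ es) (a , b)) there

missing-here : ∀ {n} (es : List (Fin n × Fin n)) a b → missing ((a , b) ∷ es) a b ≡ 0
missing-here es a b = indicator-yes (explored? dir ((a , b) ∷ es) (a , b)) (here refl)

missing-new : ∀ kind {n} (es : List (Fin n × Fin n)) a b → ¬ Any (SameEdge kind (a , b)) es → missing es a b ≡ 1
missing-new kind es a b new with explored? dir es (a , b)
... | yes p = ⊥! (new (Any.map (sameEdge-refl kind) p))
... | no _ = refl

#missing : ∀ {n} → List (Fin n × Fin n) → ℕ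
#missing es = sumF (λ a → sumF (missing es a))

#missing-< : ∀ kind {n} (es : List (Fin n × Fin n)) a b → ¬ Any (SameEdge kind (a , b)) es → #missing ((a , b) ∷ es) < #missing es
#missing-< kind es a b new = sumF-strict a (λ u → sumF-mono (missing-∷ (a , b) es u))
 (sumF-strict b (missing-∷ (a , b) es a) (subst₂ _<_ (sym (missing-here es a b)) (sym (missing-new kind es a b new)) z<s))

-- Every transition lowers the first summand by at least n + 2, and skipping an explored edge the second one.
measure : ∀ {n} → SearchState n → ℕ → ℕ
measure {n} ⟨ rs , s , c , es ⟩ i = (2 * #missing es + (2 * length rs + length s)) * (2 + n) + (suc n ∸ i)

measure-drop : ∀ n A A' i i' {f} → A' < A → A * (2 + n) + (suc n ∸ i) ≤ suc f → A' * (2 + n) + (suc n ∸ i') ≤ f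
measure-drop n A A' i i' {f} A'<A h = ≤-pred (begin
 suc (A' * (2 + n) + (suc n ∸ i')) ≤⟨ s≤s (+ʳ≤ (A' * (2 + n)) (m∸n≤m (suc n) i')) ⟩
 suc (A' * (2 + n) + suc n) ≡⟨ e A' n ⟩
 suc A' * (2 + n) ≤⟨ *ˡ≤ (2 + n) A'<A ⟩
 A * (2 + n) ≤⟨ m≤m+n _ _ ⟩
 A * (2 + n) + (suc n ∸ i) ≤⟨ h ⟩
 suc f ∎)
 where
 open ≤-Reasoning
 e : ∀ A n → suc (A * (2 + n) + suc n) ≡ suc A * (2 + n)
 e = ring

R2 : ℕ
R2 = 40

rX rY : Fin R2
rX = # 0
rY = # 1

outset : ∀ n → SearchState n
outset n = ⟨ allFin n , [] , Vec.replicate n white , [] ⟩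

-- For a fixed n the whole search can be unrolled into a decision tree, which needs no memory.
module Tree (kind : Kind) where

 Command : Set
 Command = Cmd (Query kind) R2

 -- The tree must not depend on the graph. The answer to a query is therefore turned into a
 -- branching over all vertices, and on each branch the search state is known statically.
 cases : ∀ {n} → List (Fin n) → (Fin n → Command) → Command
 cases [] k = block []
 cases (v ∷ vs) k = block (alu eq rY (var rX) (lit (ν v)) ∷ []) ⨾ ifnz rY (k v) (cases vs k)

 leave : ∀ {n} → Fin n → List (Fin n) → List (Prim (Query kind) R2)
 leave u [] = mov rX (lit (ν u)) ∷ call (turnsBlack rX) ∷ []
 leave u (p ∷ _) = mov rX (lit (ν u)) ∷ mov rY (lit (ν p)) ∷ call (turnsBlack rX) ∷ call (withdraws rY rX) ∷ []

 tree : ∀ {n} → ℕ → SearchState n → ℕ → Command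
 -- The stack comes first because it has to be inspected before the roots.
 node : ∀ {n} → ℕ → List (Fin n) → List (Fin n) → Vec Colour n → List (Fin n × Fin n) → ℕ → Command
 visit : ∀ {n} → ℕ → SearchState n → Fin n → ℕ → Fin n → Command

 tree zero σ i = block []
 tree (suc f) ⟨ rs , s , c , es ⟩ i = node f s rs c es i

 node f [] [] c es i = block []
 node f [] (r ∷ rs) c es i = if isWhite (lookup c r) then block (mov rX (lit (ν r)) ∷ call (turnsGray rX) ∷ []) ⨾ tree f ⟨ rs , r ∷ [] , c [ r ]≔ gray , es ⟩ 0
  else tree f ⟨ rs , [] , c , es ⟩ 0
 node f (u ∷ s) rs c es i = block (ask (outdegQ kind) rX (lit (ν u)) (lit 0) ∷ alu eq rX (var rX) (lit i) ∷ []) ⨾ ifnz rX (block (leave u s) ⨾ tree f ⟨ rs , s , c [ u ]≔ black , es ⟩ 0)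
   (block (ask (outheadQ kind) rX (lit (ν u)) (lit i) ∷ []) ⨾ cases (allFin _) (visit f ⟨ rs , u ∷ s , c , es ⟩ u i))

 visit f ⟨ rs , s , c , es ⟩ u i v = if does (explored? kind es (u , v)) then tree f ⟨ rs , s , c , es ⟩ (suc i)
  else block (mov rX (lit (ν u)) ∷ mov rY (lit (ν v)) ∷ []) ⨾ (if isWhite (lookup c v)
    then block (call (exploresTree rX rY) ∷ call (turnsGray rY) ∷ []) ⨾ tree f ⟨ rs , v ∷ s , c [ v ]≔ gray , (u , v) ∷ es ⟩ 0
    else block (call (exploresNontree rX rY) ∷ []) ⨾ tree f ⟨ rs , s , c , (u , v) ∷ es ⟩ (suc i))

 treeFor : ℕ → Command
 treeFor n = tree (measure (outset n) 0) (outset n) 0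

 -- One tree for every `n` below a bound that depends on `K` alone, so the size of the program is a
 -- constant.
 dispatch : ℕ → ℕ → Command → Command
 dispatch zero c big = big
 dispatch (suc k) c big = block (getN rX ∷ alu eq rX (var rX) (lit c) ∷ []) ⨾ ifnz rX (treeFor c) (dispatch k (suc c) big)

 module _ {n : ℕ} (G : Graph kind n) (w PB NR b0 : ℕ) (n<2^w : n < 2 ^ w) where

  open Semantics (answer kind G) n w PB NR b0 R2
  open Digraph (net kind G)

  ν<2^w : ∀ (u : Fin n) → ν u < 2 ^ w
  ν<2^w u = s≤s (toℕ<n u) » n<2^w

  record Emits (s s' : State R2) (τ : List (Event (Fin n))) : Set where
   constructor emits
   field
    emitted : out s' ≡ out s ++ map (mapEvent ν) τ
    no-tick : ticks s' ≡ ticks s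

  rebase : ∀ {s s1 s' τ} → out s1 ≡ out s → ticks s1 ≡ ticks s → Emits s1 s' τ → Emits s s' τ
  rebase {τ = τ} e q (emits e1 q1) = emits (e1 · cong (_++ map (mapEvent ν) τ) e) (q1 · q)

  emits-++ : ∀ {s s1 s'} τ1 τ2 → Emits s s1 τ1 → Emits s1 s' τ2 → Emits s s' (τ1 ++ τ2)
  emits-++ {s} τ1 τ2 (emits o1 q1) (emits o2 q2) = emits (o2 · cong (_++ _) o1 · ++-assoc (out s) _ _ · cong (out s ++_) (sym (map-++ (mapEvent ν) τ1 τ2))) (q2 · q1)

  Result : Command → State R2 → (List (Event (Fin n)) → Set) → Set
  Result cmd s Φ = Σ[ s' ∈ State R2 ] Σ[ τ ∈ List (Event (Fin n)) ] Exec cmd s s' × Emits s s' τ × Φ τ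

  1≢0 : 1 ≢ 0
  1≢0 ()

  cases-exec : ∀ vs k {v s} Φ → v ∈ vs → reg s rX ≡ ν v → (∀ s1 → Emits s s1 [] → Result (k v) s1 Φ) → Result (cases vs k) s Φ
  cases-exec (v' ∷ vs) k {v} {s} Φ v∈ e h with ν v ≟ ν v'
  ... | yes same with toℕ-injective (suc-injective same)
  ... | refl = let (s' , τ , ex , em , φ) = h _ (emits (sym (++-identityʳ _)) refl) in
   s' , τ , blk ((tt , ν<2^w v' , tt) , tt) ▸ ifT (λ z → 1≢0 (sym (cong bit (cong (_≡ᵇ ν v') e · ≡ᵇ-refl (ν v'))) · z)) ex , rebase refl refl em , φ
  cases-exec (v' ∷ vs) k {v} {s} Φ (here refl) e h | no differ = ⊥! (differ refl)
  cases-exec (v' ∷ vs) k {v} {s} Φ (there v∈) e h | no differ =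
   let (s' , τ , ex , em , φ) = cases-exec vs k {s = s1} Φ v∈ e (λ s2 em → h s2 (rebase refl refl em)) in
   s' , τ , blk ((tt , ν<2^w v' , tt) , tt) ▸ ifF (cong bit (cong (_≡ᵇ ν v') e · (≡ᵇ-≢ _ _ differ))) ex , rebase refl refl em , φ
   where
   s1 = sreg s rY (bit (reg s rX ≡ᵇ ν v'))

  Scanned : SearchState n → ℕ → Set
  Scanned ⟨ rs , [] , c , es ⟩ i = ⊤
  Scanned ⟨ rs , u ∷ s , c , es ⟩ i = i ≤ outdeg u × (∀ j → toℕ j < i → Any (SameEdge kind (u , outhead u j)) es)

  scanned-0 : ∀ σ → Scanned σ 0
  scanned-0 ⟨ rs , [] , c , es ⟩ = tt
  scanned-0 ⟨ rs , u ∷ s , c , es ⟩ = z≤n , λ _ ()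

  all-explored : ∀ {u es} → (∀ j → toℕ j < outdeg u → Any (SameEdge kind (u , outhead u j)) es) → ∀ v → ¬ Unexplored kind G es u v
  all-explored h v (adj , new) with adjacent→ kind G adj
  ... | j , refl = new (h j (toℕ<n j))

  white-≡ : ∀ {c} → isWhite c ≡ true → c ≡ white
  white-≡ {white} _ = refl

  white-≢ : ∀ {c} → isWhite c ≡ false → c ≢ white
  white-≢ () refl

  Completes : Command → SearchState n → Set
  Completes cmd σ = ∀ s → Result cmd s (CompletesWith kind G σ)

  farewell : Fin n → List (Fin n) → List (Event (Fin n))
  farewell u [] = turnsBlack u ∷ []
  farewell u (p ∷ s) = turnsBlack u ∷ withdraws p u ∷ []

  leave-ok : ∀ u stk s → oks (leave u stk) s
  leave-ok u [] s = ν<2^w u , tt , tt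
  leave-ok u (p ∷ _) s = ν<2^w u , ν<2^w p , tt , tt , tt

  leave-emits : ∀ u stk s → Emits s (runs (leave u stk) s) (farewell u stk)
  leave-emits u [] s = emits refl refl
  leave-emits u (p ∷ _) s = emits (++-assoc (out s) _ _) refl

  finish : ∀ u stk {rs c es τ} → (∀ v → ¬ Unexplored kind G es u v) →
   CompletesWith kind G ⟨ rs , stk , c [ u ]≔ black , es ⟩ τ → CompletesWith kind G ⟨ rs , u ∷ stk , c , es ⟩ (farewell u stk ++ τ)
  finish u [] h run = step (finishRoot h) run
  finish u (p ∷ _) h run = step (finishChild h) run

  asked : ∀ u {i s} → i ≤ outdeg u → oks (ask (outdegQ kind) rX (lit (ν u)) (lit 0) ∷ alu eq rX (var rX) (lit i) ∷ []) s
  asked u i≤ = (ν<2^w u , m^n>0 2 w , outdeg u , ans-outdeg kind G u 0 , s≤s (outdeg≤n (net kind G) u) » n<2^w) , (tt , s≤s (i≤ » outdeg≤n (net kind G) u) » n<2^w , tt) , tt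

  -- Induction on the fuel. A state with roots or gray vertices left has positive `measure`, so the
  -- fuel cannot run out before the search is complete.
  tree-exec : ∀ f σ i → Scanned σ i → measure σ i ≤ f → Completes (tree f σ i) σ
  scan-exec : ∀ f rs u s c es i → Scanned ⟨ rs , u ∷ s , c , es ⟩ i → i < outdeg u → measure ⟨ rs , u ∷ s , c , es ⟩ i ≤ suc f →
   Completes (block (ask (outheadQ kind) rX (lit (ν u)) (lit i) ∷ []) ⨾ cases (allFin _) (visit f ⟨ rs , u ∷ s , c , es ⟩ u i)) ⟨ rs , u ∷ s , c , es ⟩

  tree-exec zero ⟨ [] , [] , c , es ⟩ i sc μ s = s , [] , blk tt , (emits (sym (++-identityʳ _)) refl) , done
  tree-exec zero ⟨ r ∷ rs , s , c , es ⟩ i sc μ _ = ⊥! (n≮0 (*ˡ≤ (2 + n) {1} (z<s » m≤m+n (2 * length (r ∷ rs)) (length s) » m≤n+m _ (2 * #missing es)) » m≤m+n _ _ » μ))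
  tree-exec zero ⟨ [] , u ∷ s , c , es ⟩ i sc μ _ = ⊥! (n≮0 (*ˡ≤ (2 + n) {1} (z<s » m≤n+m _ (2 * #missing es)) » m≤m+n _ _ » μ))
  tree-exec (suc f) ⟨ [] , [] , c , es ⟩ i sc μ s = s , [] , blk tt , (emits (sym (++-identityʳ _)) refl) , done
  tree-exec (suc f) ⟨ r ∷ rs , [] , c , es ⟩ i sc μ s with isWhite (lookup c r) in wh
  ... | true =
   let s1 = runs (mov rX (lit (ν r)) ∷ call (turnsGray rX) ∷ []) s
       (s' , τ , ex , em , run) = tree-exec f ⟨ rs , r ∷ [] , c [ r ]≔ gray , es ⟩ 0 (scanned-0 ⟨ rs , r ∷ [] , c [ r ]≔ gray , es ⟩)
        (measure-drop n (2 * #missing es + (2 * suc (length rs) + 0)) _ i 0 (+ʳ< (2 * #missing es) (=≤ (e (length rs)))) μ) s1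
   in s' , turnsGray r ∷ τ , blk (ν<2^w r , tt , tt) ▸ ex , emits-++ {s} (turnsGray r ∷ []) τ (emits refl refl) em , step (newRoot (white-≡ wh)) run
   where
   e : ∀ l → suc (2 * l + 1) ≡ 2 * suc l + 0
   e = ring
  ... | false =
   let (s' , τ , ex , em , run) = tree-exec f ⟨ rs , [] , c , es ⟩ 0 tt
        (measure-drop n (2 * #missing es + (2 * suc (length rs) + 0)) _ i 0 (+ʳ< (2 * #missing es) (+-monoˡ-< 0 (*-monoʳ-< 2 (n<1+n _)))) μ) s
   in s' , τ , ex , em , step (skipRoot (white-≢ wh)) run
  tree-exec (suc f) ⟨ rs , u ∷ stk , c , es ⟩ i sc μ s with outdeg u ≟ i
  ... | yes refl =
   let s1 = runs (ask (outdegQ kind) rX (lit (ν u)) (lit 0) ∷ alu eq rX (var rX) (lit (outdeg u)) ∷ []) s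
       (s' , τ , ex , em , run) = tree-exec f ⟨ rs , stk , c [ u ]≔ black , es ⟩ 0 (scanned-0 ⟨ rs , stk , c [ u ]≔ black , es ⟩)
        (measure-drop n (2 * #missing es + (2 * length rs + suc (length stk))) _ i 0 (+ʳ< (2 * #missing es) (+ʳ< (2 * length rs) (n<1+n _))) μ) (runs (leave u stk) s1)
   in s' , farewell u stk ++ τ ,
    blk (asked u {s = s} ≤-refl) ▸ ifT (λ z → 1≢0 (sym (cong bit (cong (λ z → fromMaybe 0 z ≡ᵇ outdeg u) (ans-outdeg kind G u 0) · ≡ᵇ-refl (outdeg u))) · z)) (blk (leave-ok u stk s1) ▸ ex) ,
    emits-++ {s} (farewell u stk) τ (rebase {s} {s1} refl refl (leave-emits u stk s1)) em , finish u stk (all-explored (snd sc)) run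
  ... | no differ =
   let (s' , τ , ex , em , run) = scan-exec f rs u stk c es i sc (≤∧≢⇒< (fst sc) (≢-sym differ)) μ _
   in s' , τ , blk (asked u {s = s} (fst sc)) ▸ ifF (cong bit (cong (λ z → fromMaybe 0 z ≡ᵇ i) (ans-outdeg kind G u 0) · (≡ᵇ-≢ _ _ differ))) ex , rebase refl refl em , run

  scan-exec f rs u stk c es i sc i<d μ s =
   let (s' , τ , ex , em , run) = cases-exec (allFin n) (visit f σ u i) (CompletesWith kind G σ) (∈-allFin v) (cong (fromMaybe 0) answer≡) (λ s2 _ → visit-exec s2)
   in s' , τ , blk ((ν<2^w u , (s≤s ((<⇒≤ i<d) » outdeg≤n (net kind G) u) » n<2^w) , ν v , answer≡ , ν<2^w v) , tt) ▸ ex , rebase refl refl em , run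
   where
   j : Fin (outdeg u)
   j = fromℕ< i<d
   v : Fin n
   v = outhead u j
   answer≡ : answer kind G (outheadQ kind) (ν u) i ≡ just (ν v)
   answer≡ = cong (answer kind G (outheadQ kind) (ν u)) (sym (toℕ-fromℕ< i<d)) · ans-outhead kind G u j
   σ = ⟨ rs , u ∷ stk , c , es ⟩
   A = 2 * #missing es + (2 * length rs + suc (length stk))
   scanned-suc : ∀ es' → Any (SameEdge kind (u , v)) es' → (∀ j → toℕ j < i → Any (SameEdge kind (u , outhead u j)) es') → ∀ j → toℕ j < suc i → Any (SameEdge kind (u , outhead u j)) es'
   scanned-suc es' new old j' j'<si with toℕ j' ≟ i
   ... | yes e = subst (λ j → Any (SameEdge kind (u , outhead u j)) es') (toℕ-injective (toℕ-fromℕ< i<d · sym e)) new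
   ... | no ≢i = old j' (≤∧≢⇒< (≤-pred j'<si) ≢i)
   drop-A : ∀ l → ¬ Any (SameEdge kind (u , v)) es → l ≤ suc (suc (length stk)) → 2 * #missing ((u , v) ∷ es) + (2 * length rs + l) < A
   drop-A l new l≤ = begin-strict
    2 * #missing ((u , v) ∷ es) + (2 * length rs + l) ≤⟨ +ʳ≤ (2 * #missing ((u , v) ∷ es)) (+ʳ≤ (2 * length rs) l≤) ⟩
    2 * #missing ((u , v) ∷ es) + (2 * length rs + suc (suc (length stk))) <⟨ n<1+n _ ⟩
    suc (2 * #missing ((u , v) ∷ es) + (2 * length rs + suc (suc (length stk)))) ≡⟨ e (#missing ((u , v) ∷ es)) (2 * length rs) (length stk) ⟩
    2 * suc (#missing ((u , v) ∷ es)) + (2 * length rs + suc (length stk)) ≤⟨ +ˡ≤ _ (*ʳ≤ 2 (#missing-< kind es u v new)) ⟩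
    A ∎
    where
    open ≤-Reasoning
    e : ∀ m r l → suc (2 * m + (r + suc (suc l))) ≡ 2 * suc m + (r + suc l)
    e = ring
   visit-exec : Completes (visit f σ u i v) σ
   visit-exec s with explored? kind es (u , v)
   ... | yes old = tree-exec f σ (suc i) (i<d , scanned-suc es old (snd sc)) (≤-pred (=≤ skip » μ)) s
    where
    skip : suc (A * (2 + n) + (n ∸ i)) ≡ A * (2 + n) + (suc n ∸ i)
    skip = sym (+-suc _ _) · cong (A * (2 + n) +_) (sym (+-∸-assoc 1 ((<⇒≤ i<d) » outdeg≤n (net kind G) u)))
   ... | no new with isWhite (lookup c v) in wh
   ... | true =
    let (s' , τ , ex , em , run) = tree-exec f ⟨ rs , v ∷ u ∷ stk , c [ v ]≔ gray , (u , v) ∷ es ⟩ 0 (scanned-0 ⟨ rs , v ∷ u ∷ stk , c [ v ]≔ gray , (u , v) ∷ es ⟩)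
         (measure-drop n A _ i 0 (drop-A (length (v ∷ u ∷ stk)) new ≤-refl) μ) _
    in s' , exploresTree u v ∷ turnsGray v ∷ τ ,
     blk (ν<2^w u , ν<2^w v , tt) ▸ (blk (tt , tt , tt) ▸ ex) ,
     emits-++ {s} (exploresTree u v ∷ turnsGray v ∷ []) τ (emits (++-assoc (out s) _ _) refl) em ,
     step (exploreTree (subst (Adjacent kind G u) refl (adjacent← kind G u j) , new) (white-≡ wh)) run
   ... | false =
    let (s' , τ , ex , em , run) = tree-exec f ⟨ rs , u ∷ stk , c , (u , v) ∷ es ⟩ (suc i)
         (i<d , scanned-suc ((u , v) ∷ es) (here (sameEdge-refl kind refl)) (λ j j<i → there (snd sc j j<i)))
         (measure-drop n A _ i (suc i) (drop-A (suc (length stk)) new (n≤1+n _)) μ) _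
    in s' , exploresNontree u v ∷ τ ,
     blk (ν<2^w u , ν<2^w v , tt) ▸ (blk (tt , tt) ▸ ex) ,
     emits-++ {s} (exploresNontree u v ∷ []) τ (emits refl refl) em ,
     step (exploreNontree (adjacent← kind G u j , new) (white-≢ wh)) run

  treeFor-exec : ∀ s → Result (treeFor n) s (CompletesWith kind G (outset n))
  treeFor-exec = tree-exec (measure (outset n) 0) (outset n) 0 tt ≤-refl

  dispatch-small : ∀ k c big s → c ≤ n → n < c + k → Result (dispatch k c big) s (CompletesWith kind G (outset n))
  dispatch-small zero c big s c≤n n<c = ⊥! (<⇒≱ (subst (n <_) (+0 c) n<c) c≤n)
  dispatch-small (suc k) c big s c≤n n<c+k with n ≟ c
  ... | yes refl = let (s' , τ , ex , em , run) = treeFor-exec _ in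
   s' , τ , blk (tt , (tt , n<2^w , tt) , tt) ▸ ifT (λ z → 1≢0 (sym (cong bit (≡ᵇ-refl n)) · z)) ex , rebase refl refl em , run
  ... | no n≢c = let (s' , τ , ex , em , run) = dispatch-small k (suc c) big _ (≤∧≢⇒< c≤n (≢-sym n≢c)) (subst (n <_) (+-suc c k) n<c+k) in
   s' , τ , blk (tt , (tt , (s≤s c≤n » n<2^w) , tt) , tt) ▸ ifF (cong bit (≡ᵇ-≢ n c n≢c)) ex , rebase refl refl em , run

  dispatch-big : ∀ k c big s → c + k ≤ n → (Φ : State R2 → Set) →
   (∀ s1 → lev s1 ≡ lev s → pl s1 ≡ pl s → sl s1 ≡ sl s → out s1 ≡ out s → ticks s1 ≡ ticks s → Σ[ s' ∈ State R2 ] Exec big s1 s' × Φ s') →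
   Σ[ s' ∈ State R2 ] Exec (dispatch k c big) s s' × Φ s'
  dispatch-big zero c big s c≤n Φ h = h s refl refl refl refl refl
  dispatch-big (suc k) c big s c+k≤n Φ h =
   let (s' , ex , φ) = dispatch-big k (suc c) big _ (=≥ (+-suc c k) » c+k≤n) Φ h in
   s' , blk (tt , (tt , (s≤s (<⇒≤ c<n) » n<2^w) , tt) , tt) ▸ ifF (cong bit (≡ᵇ-≢ n c (>⇒≢ c<n))) ex , φ
   where
   c<n : c < n
   c<n = s≤s (m≤m+n c k) » =≥ (+-suc c k) » c+k≤n

-- Tree paths and the vertices on them

_∈?_ : ∀ {n} (v : Fin n) xs → Dec (v ∈ xs)
_∈?_ = ∈?-with _≟ᶠ_

membF : ∀ {n} → Fin n → List (Fin n) → Bool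
membF v xs = does (v ∈? xs)

membF-true : ∀ {n} {v : Fin n} {xs} → v ∈ xs → membF v xs ≡ true
membF-true = dec-true (_ ∈? _)

membF-∈ : ∀ {n} {v : Fin n} {xs} → membF v xs ≡ true → v ∈ xs
membF-∈ {v = v} {xs} e with v ∈? xs
... | yes h = h

membF-false : ∀ {n} {v : Fin n} {xs} → ¬ v ∈ xs → membF v xs ≡ false
membF-false = dec-false (_ ∈? _)

∈-ʳ++ʳ : ∀ {A : Set} {v : A} xs {ys} → v ∈ ys → v ∈ (xs ʳ++ ys)
∈-ʳ++ʳ [] h = h
∈-ʳ++ʳ (x ∷ xs) h = ∈-ʳ++ʳ xs (there h)

∈-ʳ++ˡ : ∀ {A : Set} {v : A} {xs} {ys} → v ∈ xs → v ∈ (xs ʳ++ ys)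
∈-ʳ++ˡ {xs = x ∷ xs} (here refl) = ∈-ʳ++ʳ xs (here refl)
∈-ʳ++ˡ {xs = x ∷ xs} (there h) = ∈-ʳ++ˡ h

∈-ʳ++⁻ : ∀ {A : Set} {v : A} xs {ys} → v ∈ (xs ʳ++ ys) → v ∈ xs ⊎ v ∈ ys
∈-ʳ++⁻ [] h = inr h
∈-ʳ++⁻ (x ∷ xs) h with ∈-ʳ++⁻ xs h
... | inl v∈xs = inl (there v∈xs)
... | inr (here v≡x) = inl (here v≡x)
... | inr (there v∈ys) = inr v∈ys

ʳ++-++′ : ∀ {A : Set} (xs : List A) {ys zs} → (xs ʳ++ ys) ++ zs ≡ xs ʳ++ (ys ++ zs)
ʳ++-++′ [] = refl
ʳ++-++′ (x ∷ xs) = ʳ++-++′ xs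

unique-ʳ++ : ∀ {A : Set} (xs : List A) {ys} → AllPairs _≢_ (xs ʳ++ ys) → AllPairs _≢_ ys × (∀ {v} → v ∈ xs → ¬ v ∈ ys)
unique-ʳ++ [] u = u , λ ()
unique-ʳ++ (x ∷ xs) u with unique-ʳ++ xs u
... | x∉ys ∷ uys , dis = uys , λ { (here refl) x∈ys → All.lookup x∉ys x∈ys refl; (there v∈xs) v∈ys → dis v∈xs (there v∈ys) }

unique-++ˡ : ∀ {A : Set} (xs : List A) {ys} → AllPairs _≢_ (xs ++ ys) → AllPairs _≢_ xs
unique-++ˡ [] u = []
unique-++ˡ (x ∷ xs) (x∉ ∷ u) = ++⁻ˡ xs x∉ ∷ unique-++ˡ xs u

num-1 : ∀ f o → num f o 1 ≡ bit (f o)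
num-1 f o = +0 (bit (f o))

wrP-inside : ∀ f r o l x i → i < l → wrP f r o l x r (o + i) ≡ tb x i
wrP-inside f r o l x i i<l = if-true (cong₂ _∧_ (≡ᵇ-refl r) (cong₂ _∧_ (≤ᵇ-true (m≤m+n o i)) (<ᵇ-true (+ʳ< o i<l)))) · cong (tb x) (m+n∸m≡n o i)

wrP-plane : ∀ f r o l x r' o' → r ≢ r' → wrP f r o l x r' o' ≡ f r' o'
wrP-plane f r o l x r' o' r≢ = if-false (cong (_∧ ((o ≤ᵇ o') ∧ (o' <ᵇ o + l))) (≡ᵇ-≢ r r' r≢))

wrP-below : ∀ f r o l x r' o' → o' < o → wrP f r o l x r' o' ≡ f r' o'
wrP-below f r o l x r' o' o'<o = if-false (cong (λ z → (r ≡ᵇ r') ∧ (z ∧ (o' <ᵇ o + l))) (≤ᵇ-false o'<o) · ∧-zeroʳ (r ≡ᵇ r'))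

wrP-above : ∀ f r o l x r' o' → o + l ≤ o' → wrP f r o l x r' o' ≡ f r' o'
wrP-above f r o l x r' o' ol≤ = if-false (cong (λ z → (r ≡ᵇ r') ∧ ((o ≤ᵇ o') ∧ z)) (<ᵇ-false ol≤) · cong ((r ≡ᵇ r') ∧_) (∧-zeroʳ (o ≤ᵇ o')) · ∧-zeroʳ (r ≡ᵇ r'))

wrP-bit : ∀ f r o b r' o' → wrP f r o 1 (bit b) r' o' ≡ (if (r ≡ᵇ r') ∧ (o ≡ᵇ o') then b else f r' o')
wrP-bit f r o b r' o' with r ≟ r' | <-cmp o o'
... | no r≢ | _ = wrP-plane f r o 1 (bit b) r' o' r≢ · sym (if-false (cong (_∧ (o ≡ᵇ o')) (≡ᵇ-≢ r r' r≢)))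
... | yes refl | tri≈ _ refl _ = cong (wrP f r o 1 (bit b) r) (sym (+0 o)) · wrP-inside f r o 1 (bit b) 0 z<s · tb-bit b · sym (if-true (cong₂ _∧_ (≡ᵇ-refl r) (≡ᵇ-refl o)))
 where
 tb-bit : ∀ b → tb (bit b) 0 ≡ b
 tb-bit true = refl
 tb-bit false = refl
... | yes refl | tri< o<o' o≢o' _ = wrP-above f r o 1 (bit b) r o' (=≤ (+-comm o 1) » o<o') · sym (if-false (cong ((r ≡ᵇ r) ∧_) (≡ᵇ-≢ o o' o≢o') · ∧-zeroʳ (r ≡ᵇ r)))
... | yes refl | tri> _ o≢o' o'<o = wrP-below f r o 1 (bit b) r o' o'<o · sym (if-false (cong ((r ≡ᵇ r) ∧_) (≡ᵇ-≢ o o' o≢o') · ∧-zeroʳ (r ≡ᵇ r)))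

num-wr-same : ∀ f r o l x → x < 2 ^ l → num (wrP f r o l x r) o l ≡ x
num-wr-same f r o l x x< = num-unique (wrP f r o l x r) o l x x< (λ i i<l → wrP-inside f r o l x i i<l)

ν-inj : ∀ {n} {u v : Fin n} → ν u ≡ ν v → u ≡ v
ν-inj e = toℕ-injective (suc-injective e)

module Paths {n : ℕ} (N : Digraph n) where
 open Digraph N

 -- The position i stands for the edge from p to its i-th out-neighbour.
 Edge : Set
 Edge = Σ[ p ∈ Fin n ] Fin (outdeg p)

 hd tl : Edge → Fin n
 hd (p , i) = outhead p i
 tl (p , i) = p

 -- Paths are listed from their last edge to their first.
 Chain : Fin n → List Edge → Fin n → Set
 Chain u [] x = u ≡ x
 Chain u (e ∷ es) x = hd e ≡ u × Chain (tl e) es x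

 heads tails : List Edge → List (Fin n)
 heads = map hd
 tails = map tl

 stackOf : Fin n → List Edge → List (Fin n)
 stackOf u ps = u ∷ tails ps

 heads-tails : ∀ {u} ps {r} → Chain u ps r → heads ps ++ r ∷ [] ≡ stackOf u ps
 heads-tails [] refl = refl
 heads-tails (e ∷ ps) (refl , c) = cong (hd e ∷_) (heads-tails ps c)

 chain-ʳ++ : ∀ {u} xs {ys x} → Chain u (xs ʳ++ ys) x → Σ[ y ∈ Fin n ] Chain y ys x
 chain-ʳ++ [] c = _ , c
 chain-ʳ++ (x ∷ xs) c = let (_ , _ , c') = chain-ʳ++ xs c in _ , c'

 chain-unique : ∀ {u y} es {x} → Chain u es x → Chain y es x → u ≡ y
 chain-unique [] refl refl = refl
 chain-unique (e ∷ es) (p , _) (q , _) = sym p · q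

 chain-++ : ∀ {u} es {ds x} → Chain u (es ++ ds) x → Σ[ y ∈ Fin n ] Chain u es y × Chain y ds x
 chain-++ [] c = _ , refl , c
 chain-++ (e ∷ es) (p , c) = let (y , c1 , c2) = chain-++ es c in y , (p , c1) , c2

 -- An edge before the one taken leads to a black vertex or to an ancestor.
 Prior : Vec Colour n → List Edge → Set
 Prior c [] = ⊤
 Prior c (e ∷ es) = (∀ j → toℕ j < toℕ (snd e) → lookup c (outhead (tl e) j) ≡ black ⊎ outhead (tl e) j ∈ stackOf (tl e) es) × Prior c es

 prior-ʳ++ : ∀ c xs {ys} → Prior c (xs ʳ++ ys) → Prior c ys
 prior-ʳ++ c [] p = p
 prior-ʳ++ c (x ∷ xs) p = snd (prior-ʳ++ c xs p)

 record PathInv (c : Vec Colour n) (r u : Fin n) (ps : List Edge) : Set where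
  field
   chain : Chain u ps r
   uniq : AllPairs _≢_ (stackOf u ps)
   gray→∈ : ∀ {v} → lookup c v ≡ gray → v ∈ stackOf u ps
   ∈→gray : ∀ {v} → v ∈ stackOf u ps → lookup c v ≡ gray
   prior : Prior c ps

 candidate : List Edge → List Edge → Fin n → Bool
 candidate zone lo v = membF v (heads zone) ∧ not (membF v (heads lo))

 module _ {c r u ps} (inv : PathInv c r u ps) where
  open PathInv inv

  uniq-heads : AllPairs _≢_ (heads ps ++ r ∷ [])
  uniq-heads = subst (AllPairs _≢_) (sym (heads-tails ps chain)) uniq

  -- Paths list their last edge first, whereas a walk starts at the bottom: `lo` has been passed
  -- already, `e` comes next, and `rem` lists the edges still ahead in the order of the walk.
  module WalkStep {zone d} (eqn : zone ++ d ≡ ps) (e : Edge) (rem lo : List Edge) (z≡ : zone ≡ rem ʳ++ (e ∷ lo)) where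

   B : List Edge
   B = lo ++ d

   ps≡ : ps ≡ rem ʳ++ (e ∷ B)
   ps≡ = sym eqn · cong (_++ d) z≡ · (ʳ++-++′ rem)

   stack≡ : heads ps ++ r ∷ [] ≡ heads rem ʳ++ (hd e ∷ stackOf (tl e) B)
   stack≡ = cong (λ z → heads z ++ r ∷ []) ps≡ · cong (_++ r ∷ []) (map-ʳ++ hd rem) · (ʳ++-++′ (heads rem)) · cong (λ z → heads rem ʳ++ (hd e ∷ z)) (heads-tails B tail-chain)
    where
    tail-chain : Chain (tl e) B r
    tail-chain = snd (snd (chain-ʳ++ rem (subst (λ z → Chain u z r) ps≡ chain)))

   separated : AllPairs _≢_ (hd e ∷ stackOf (tl e) B) × (∀ {v} → v ∈ heads rem → ¬ v ∈ (hd e ∷ stackOf (tl e) B))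
   separated = unique-ʳ++ (heads rem) (subst (AllPairs _≢_) stack≡ uniq-heads)

   zone-heads : heads zone ≡ heads rem ʳ++ (hd e ∷ heads lo)
   zone-heads = cong heads z≡ · map-ʳ++ hd rem

   lo⊆ : ∀ {v} → v ∈ heads lo → v ∈ stackOf (tl e) B
   lo⊆ {v} v∈ = subst (v ∈_) (heads-tails B (snd (snd (chain-ʳ++ rem (subst (λ z → Chain u z r) ps≡ chain))))) (∈-++⁺ˡ {ys = r ∷ []} (subst (v ∈_) (sym (map-++ hd lo d)) (∈-++⁺ˡ v∈)))

   candidate-hd : candidate zone lo (hd e) ≡ true
   candidate-hd = cong₂ (λ a b → a ∧ not b) (membF-true (subst (hd e ∈_) (sym zone-heads) (∈-ʳ++ʳ (heads rem) (here refl))))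
    (membF-false (λ h → (case separated of λ { (h∉ ∷ _ , _) → All.lookup h∉ (lo⊆ h) refl })))
    where open import Function.Base using (case_of_)

   -- By `Prior` an earlier neighbour is black or an ancestor of the tail. It cannot be black, since
   -- heads in the zone are gray. As an ancestor it cannot be a head ahead of the walk, so if it is
   -- in the zone it belongs to `lo`. Together with `candidate-hd`, the first candidate is the right
   -- edge.
   candidate-prior : ∀ j → toℕ j < toℕ (snd e) → candidate zone lo (outhead (tl e) j) ≡ false
   candidate-prior j j<i with membF (outhead (tl e) j) (heads zone) in m
   ... | false = refl
   ... | true with membF (outhead (tl e) j) (heads lo) in m'
   ... | true = refl
   ... | false with fst (prior-ʳ++ c rem (subst (Prior c) ps≡ prior)) j j<i | membF-∈ {xs = heads zone} m
   ... | inl b | z∈ = ⊥! (gray≢black (sym (∈→gray (subst (_ ∈_) (sym stack≡ · heads-tails ps chain) (in-stack (∈-ʳ++⁻ (heads rem) (subst (_ ∈_) zone-heads z∈))))) · b))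
    where
    gray≢black : gray ≢ black
    gray≢black ()
    in-stack : ∀ {v} → v ∈ heads rem ⊎ v ∈ (hd e ∷ heads lo) → v ∈ (heads rem ʳ++ (hd e ∷ stackOf (tl e) B))
    in-stack (inl h) = ∈-ʳ++ˡ h
    in-stack (inr (here refl)) = ∈-ʳ++ʳ (heads rem) (here refl)
    in-stack (inr (there h)) = ∈-ʳ++ʳ (heads rem) (there (lo⊆ h))
   ... | inr anc | z∈ with ∈-ʳ++⁻ (heads rem) (subst (_ ∈_) zone-heads z∈)
   ... | inl h = ⊥! (snd separated h (there anc))
   ... | inr (here v≡) = ⊥! (case separated of λ { (h∉ ∷ _ , _) → All.lookup h∉ anc (sym v≡) })
    where open import Function.Base using (case_of_)
   ... | inr (there h) = ⊥! (true≢false (sym (membF-true h) · m'))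

   -- A walk ends when it reaches `u`, so it must not meet `u` earlier.
   tl≢u : tl e ≢ u
   tl≢u tl≡u with uniq | subst (tl e ∈_) (sym (cong tails ps≡)) (subst (tl e ∈_) (sym (map-ʳ++ tl rem)) (∈-ʳ++ʳ (tails rem) (here refl)))
   ... | u∉ ∷ _ | t∈ = All.lookup u∉ t∈ (sym tl≡u)

  sum-tails≤ : ∀ (f : Fin n → ℕ) {zone d} → zone ++ d ≡ ps → sum (map f (tails zone)) ≤ sumF f
  sum-tails≤ f {zone} {d} eqn = sumF-unique f (tails zone) (unique-++ˡ (tails zone) (subst (AllPairs _≢_) (cong tails (sym eqn) · map-++ tl zone d) (tail-unique uniq)))
   where
   tail-unique : ∀ {x xs} → AllPairs _≢_ (x ∷ xs) → AllPairs _≢_ xs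
   tail-unique (_ ∷ u) = u

 -- Heads and tails of a path are the same vertices except for its two ends. So a quantity that
 -- depends on the tails, such as the field lengths below level `K`, may be charged to the heads at
 -- the cost of a boundary term.
 telescope : ∀ (f : Fin n → ℕ) {u} es {x} → Chain u es x → sum (map f (heads es)) + f x ≡ sum (map f (tails es)) + f u
 telescope f [] refl = refl
 telescope f (e ∷ es) {x} (refl , ch) = +-assoc (f (hd e)) _ _ · cong (f (hd e) +_) (telescope f es ch) · swap3 (f (hd e)) _ (f (tl e))
  where
  swap3 : ∀ a b c → a + (b + c) ≡ c + b + a
  swap3 = ring

-- Registers and the text of the program

-- The registers of a procedure are numbered above those that it has to preserve.
RT U I V RUN CC PAR CNT LEV : Fin R2
RT = # 0
U = # 1
I = # 2
V = # 3
RUN = # 4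
CC = # 5
PAR = # 6
CNT = # 7
LEV = # 8

ELL HF HI LO YY QQ DD BB GG LN AA ZZ T1 : Fin R2
ELL = # 9
HF = # 10
HI = # 11
LO = # 12
YY = # 13
QQ = # 14
DD = # 15
BB = # 16
GG = # 17
LN = # 18
AA = # 19
ZZ = # 20
T1 = # 21

P1 P2 P3 : Fin R2
P1 = # 9
P2 = # 10
P3 = # 11

PY PI PZ FL FV F1 F2 F3 CO : Fin R2
PY = # 24
PI = # 25
PZ = # 26
FL = # 27
FV = # 28
F1 = # 29
F2 = # 30
F3 = # 31
CO = # 32

-- The levels are 0,…,K. Level word layout: stack pointers, start vertices, field lengths.
module Code2 (kind : Kind) (K : ℕ) where

 Command : Set
 Command = Cmd (Query kind) R2

 spA xA bA : ℕ
 spA = 0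
 xA = suc K
 bA = 2 * suc K

 -- Discovered vertices, gray vertices and vertices visited by the current walk; then, per level,
 -- the marks on the heads in the zone and the stack of fields. The fields of level 0 are in the
 -- slots of their tails.
 nwP grP visP inP stP : ℕ
 nwP = 0
 grP = 1
 visP = 2
 inP = 3
 stP = 3 + suc K

 PB2 NR2 : ℕ
 PB2 = 3 * suc K
 NR2 = 3 + 2 * suc K

 Block : Set
 Block = List (Prim (Query kind) R2)

 first-level walk-start half-block stale-test test-block next-block store-block room-test enter-block drop-block length-block parent-block root-test degree-block look-block : Block
 advance-block discover-block descend-block finish-block rise-block plant-block here-block root-block last-block length-test length-next measure-start measure-next found-block : Block
 walk-start = LD YY (off xA ELL) ∷ mov QQ (lit 0) ∷ ST (off spA LEV) (lit 0) ∷ ST (off xA LEV) (var YY) ∷ mov HI (lit 0) ∷ mov LO (lit 0) ∷ []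
 -- This computes `HI ∸ 1`; for `HI = 0` the subtrahend is 0 because `sub` is specified only for
 -- nonnegative results.
 half-block = alu lt T1 (lit 0) (var HI) ∷ alu sub HF (var HI) (var T1) ∷ []
 stale-test = LD P1 (off xA LEV) ∷ alu eq P1 (var P1) (var U) ∷ []
 test-block = alu lt P1 (var LEV) (lit (suc K)) ∷ []
 first-level = mov LEV (lit 1) ∷ []
 next-block = alu add LEV (var LEV) (lit 1) ∷ []
 store-block = WR (off stP LEV) (var P2) (var FL) (var FV) ∷ alu add P2 (var P2) (var FL) ∷ ST (off spA LEV) (var P2) ∷ WR (off inP LEV) (var V) (lit 1) (lit 1) ∷ []
 room-test = LD P2 (off spA LEV) ∷ getN P1 ∷ alu sub P1 (var P1) (var P2) ∷ alu lt P1 (var P1) (var FL) ∷ alu or P3 (var P3) (var P1) ∷ []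
 enter-block = ask (outdegQ kind) P1 (var U) (lit 0) ∷ LD P2 (lit bA) ∷ alu shr P1 (var P1) (var P2) ∷ alu add P1 (var P1) (lit 1) ∷ alu quo P1 (var I) (var P1) ∷ WR0 (var U) (var P2) (var P1) ∷ WR (lit inP) (var V) (lit 1) (lit 1) ∷ mov P3 (lit 0) ∷ mov PY (var U) ∷ mov PI (var I) ∷ mov PZ (var V) ∷ []
 drop-block = LD P2 (off spA LEV) ∷ alu sub P2 (var P2) (var FL) ∷ ST (off spA LEV) (var P2) ∷ WR (off inP LEV) (var U) (lit 1) (lit 0) ∷ []
 length-block = ask (indegQ kind) P1 (var U) (lit 0) ∷ LD P2 (lit (bA + K)) ∷ alu lt P3 (var P2) (var P1) ∷ []
 parent-block = LD P2 (lit (spA + K)) ∷ alu sub P2 (var P2) (var P3) ∷ RD P1 (lit (stP + K)) (var P2) (var P3) ∷ ask (inheadQ kind) PY (var U) (var P1) ∷ ask (inmateQ kind) PI (var U) (var P1) ∷ mov PZ (var U) ∷ WR (lit inP) (var U) (lit 1) (lit 0) ∷ []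
 root-test = alu eq P1 (var U) (var RT) ∷ []
 degree-block = ask (outdegQ kind) CC (var U) (lit 0) ∷ alu lt CC (var I) (var CC) ∷ []
 look-block = ask (outheadQ kind) V (var U) (var I) ∷ RD CC (lit nwP) (var V) (lit 1) ∷ []
 advance-block = alu add I (var I) (lit 1) ∷ []
 discover-block = call (exploresTree U V) ∷ call (turnsGray V) ∷ WR (lit nwP) (var V) (lit 1) (lit 1) ∷ WR (lit grP) (var V) (lit 1) (lit 1) ∷ []
 descend-block = mov PAR (var U) ∷ mov U (var V) ∷ mov I (lit 0) ∷ []
 finish-block = call (turnsBlack U) ∷ WR (lit grP) (var U) (lit 1) (lit 0) ∷ alu eq CC (var U) (var RT) ∷ []
 rise-block = mov V (var U) ∷ mov U (var PY) ∷ alu add I (var PI) (lit 1) ∷ call (withdraws U V) ∷ []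
 -- The root has no parent: `PAR` is 0, which is not the number of any vertex.
 plant-block = call (turnsGray RT) ∷ WR (lit nwP) (var RT) (lit 1) (lit 1) ∷ WR (lit grP) (var RT) (lit 1) (lit 1) ∷ mov U (var RT) ∷ mov I (lit 0) ∷ mov PAR (lit 0) ∷ ST (lit xA) (var RT) ∷ []
 here-block = ST (off xA LEV) (var RT) ∷ []
 root-block = getN RT ∷ alu sub RT (var RT) (var CNT) ∷ alu add RT (var RT) (lit 1) ∷ RD CC (lit nwP) (var RT) (lit 1) ∷ []
 last-block = alu sub CNT (var CNT) (lit 1) ∷ []
 length-test = alu shr P3 (var P2) (var P1) ∷ []
 length-next = alu add P1 (var P1) (lit 1) ∷ []
 measure-start = getN P2 ∷ mov LEV (lit K) ∷ []
 measure-next = alu sub LEV (var LEV) (lit 1) ∷ ST (off bA LEV) (var P1) ∷ []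
 found-block = WR (lit visP) (var ZZ) (lit 1) (lit 1) ∷ mov PY (var YY) ∷ mov PI (var AA) ∷ mov PZ (var ZZ) ∷ []

 skip : Command
 skip = block []

 clear : Operand R2 → Command
 clear A = block (getN CO ∷ []) ⨾ loop skip CO (block (WR A (var CO) (lit 1) (lit 0) ∷ alu sub CO (var CO) (lit 1) ∷ []))

 -- Length FL and contents FV of the field of the edge at position PI of PY, leading to PZ, on level LEV.
 params : Command
 params = block (alu eq F1 (var LEV) (lit K) ∷ []) ⨾ ifnz F1 (block (ask (indegQ kind) F2 (var PZ) (lit 0) ∷ LD F3 (off bA LEV) ∷ ask (outmateQ kind) FV (var PY) (var PI) ∷ []))
   (block (ask (outdegQ kind) F2 (var PY) (lit 0) ∷ LD F3 (off bA LEV) ∷ alu shr F1 (var F2) (var F3) ∷ alu add F1 (var F1) (lit 1) ∷ alu quo FV (var PI) (var F1) ∷ [])) ⨾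
  block (alu lt F1 (var F3) (var F2) ∷ []) ⨾
  ifnz F1 (block (mov FL (var F3) ∷ [])) (block (mov FL (var F2) ∷ []))

 scan : Command
 scan = loop (block (ask (outheadQ kind) ZZ (var YY) (var AA) ∷ RD T1 (off inP ELL) (var ZZ) (lit 1) ∷
  RD DD (lit visP) (var ZZ) (lit 1) ∷ alu lt T1 (var DD) (var T1) ∷ alu eq T1 (var T1) (lit 0) ∷ []))
  T1 (block (alu add AA (var AA) (lit 1) ∷ []))

 approx : Command
 approx = block (ask (outdegQ kind) DD (var YY) (lit 0) ∷ LD BB (off bA ELL) ∷ alu shr GG (var DD) (var BB) ∷ alu add GG (var GG) (lit 1) ∷ []) ⨾ ifnz ELL
   ((block (alu lt LN (var BB) (var DD) ∷ []) ⨾ ifnz LN (block (mov LN (var BB) ∷ [])) (block (mov LN (var DD) ∷ []))) ⨾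
    block (RD AA (off stP ELL) (var QQ) (var LN) ∷ alu add QQ (var QQ) (var LN) ∷ []))
   (block (RD0 AA (var YY) (var BB) ∷ [])) ⨾
  block (alu mul AA (var AA) (var GG) ∷ [])

 record-edge : Command
 record-edge = block (alu lt T1 (var HI) (var HF) ∷ []) ⨾ ifnz T1 (block (ST (off xA LEV) (var ZZ) ∷ []))
   (block (LD DD (off spA LEV) ∷ WR (off stP LEV) (var DD) (var FL) (var FV) ∷ alu add DD (var DD) (var FL) ∷ ST (off spA LEV) (var DD) ∷ WR (off inP LEV) (var ZZ) (lit 1) (lit 1) ∷ []))

 count : Command
 count = block (alu add LO (var LO) (var FL) ∷ getN DD ∷ alu quo DD (var DD) (lit 4) ∷ alu lt T1 (var LO) (var DD) ∷ []) ⨾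
  ifnz T1 skip (block (mov LO (lit 0) ∷ alu add HI (var HI) (lit 1) ∷ []))

 walk-body : Command
 walk-body = approx ⨾ scan ⨾ block found-block ⨾ params ⨾ record-edge ⨾ count ⨾ block (mov YY (var ZZ) ∷ [])

 walk : Command
 walk = clear (lit visP) ⨾ block walk-start ⨾ loop (block (alu eq T1 (var YY) (var U) ∷ alu eq T1 (var T1) (lit 0) ∷ [])) T1 walk-body

 -- The first walk only counts: HI stays below n. The second one keeps the edges from the last full segment on.
 refill : Command
 refill = block (alu sub ELL (var LEV) (lit 1) ∷ []) ⨾ clear (off inP LEV) ⨾ block (getN HF ∷ []) ⨾ walk ⨾ block half-block ⨾ walk

 levels : Command → Command
 levels c = block first-level ⨾ loop (block test-block) P1 (c ⨾ block next-block)

 fix-level : Command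
 fix-level = block stale-test ⨾ ifnz P1 refill skip

 -- At the root all zones are empty and start at the current vertex, which `stale-test` would
 -- mistake for staleness; hence the exception.
 fix : Command
 fix = block root-test ⨾ ifnz P1 skip (levels fix-level)

 push-level : Command
 push-level = params ⨾ block room-test ⨾ ifnz P3 (block (ST (off xA LEV) (var V) ∷ [])) (block store-block)

 -- From the first level without room on, all levels become stale: their start vertex is the current vertex.
 push : Command
 push = block enter-block ⨾ levels push-level

 pop-level : Command
 pop-level = params ⨾ block drop-block

 pop : Command
 pop = block length-block ⨾ ifnz P3 (block (mov P3 (var P2) ∷ [])) (block (mov P3 (var P1) ∷ [])) ⨾ block parent-block ⨾ levels pop-level

 -- All edges to gray neighbours are explored right after the discovery; later only tree edges are left.
 back-edges : Kind → Command
 back-edges dir = skip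
 back-edges undir = block (mov P1 (lit 0) ∷ ask (outdegQ kind) P2 (var U) (lit 0) ∷ []) ⨾ loop (block (alu lt P3 (var P1) (var P2) ∷ [])) P3
   (block (ask (outheadQ kind) LO (var U) (var P1) ∷ RD YY (lit grP) (var LO) (lit 1) ∷ alu eq QQ (var LO) (var PAR) ∷ alu lt P3 (var QQ) (var YY) ∷ []) ⨾
    ifnz P3 (block (call (exploresNontree U LO) ∷ [])) skip ⨾
    block length-next)

 nontree : Kind → Command
 nontree dir = block (call (exploresNontree U V) ∷ [])
 nontree undir = skip

 search-step : Command
 search-step = block degree-block ⨾ ifnz CC (block look-block ⨾ ifnz CC (nontree kind ⨾ block advance-block) (block discover-block ⨾ push ⨾ block descend-block ⨾ back-edges kind ⨾ fix))
   (block finish-block ⨾ ifnz CC (block (mov RUN (lit 0) ∷ [])) (pop ⨾ block rise-block ⨾ fix))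

 new-tree : Command
 new-tree = block plant-block ⨾ levels (block here-block) ⨾ back-edges kind ⨾ block (mov RUN (lit 1) ∷ []) ⨾ loop skip RUN search-step

 root-step : Command
 root-step = block root-block ⨾ ifnz CC skip new-tree ⨾ block last-block

 bit-length : Command
 bit-length = block (mov P1 (lit 1) ∷ []) ⨾ loop (block length-test) P3 (block length-next)

 init-lengths : Command
 init-lengths = block measure-start ⨾ bit-length ⨾ block (ST (off bA LEV) (var P1) ∷ []) ⨾ loop skip LEV (block (mov P2 (var P1) ∷ []) ⨾ bit-length ⨾ block measure-next)

 clear-level : Command
 clear-level = clear (off inP LEV) ⨾ block (ST (off spA LEV) (lit 0) ∷ [])

 main : Command
 main = init-lengths ⨾ clear (lit nwP) ⨾ clear (lit grP) ⨾ clear (lit inP) ⨾ levels clear-level ⨾ block (getN CNT ∷ []) ⨾ loop skip CNT root-step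

-- Frame conditions

Frame : ℕ → State R2 → State R2 → Set
Frame k s s' = ∀ x → toℕ x < k → reg s' x ≡ reg s x

below : ∀ {k} {f g : Fin R2 → ℕ} → (∀ x → toℕ x < k → g x ≡ f x) → ∀ x {_ : T (suc (toℕ x) ≤ᵇ k)} → g x ≡ f x
below f x {h} = f x (≤ᵇ⇒≤ _ _ h)

record Quiet (k : ℕ) (s s' : State R2) : Set where
 constructor quiet
 field
  frame : Frame k s s'
  lev≡ : lev s' ≡ lev s
  pl≡ : pl s' ≡ pl s
  sl≡ : sl s' ≡ sl s
  out≡ : out s' ≡ out s
 kept = below frame

quiet-trans : ∀ {k s s1 s2} → Quiet k s s1 → Quiet k s1 s2 → Quiet k s s2
quiet-trans (quiet f a b c d) (quiet f' a' b' c' d') = quiet (λ x p → f' x p · f x p) (a' · a) (b' · b) (c' · c) (d' · d)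

quiet-weaken : ∀ {j k s s1} → j ≤ k → Quiet k s s1 → Quiet j s s1
quiet-weaken j≤k (quiet f a b c d) = quiet (λ x p → f x (p » j≤k)) a b c d

-- A Boolean check, so that the frame conditions of concrete blocks are proved by `refl`.
preserves : ∀ {Q} → ℕ → Prim Q R2 → Bool
preserves k (mov d A) = k ≤ᵇ toℕ d
preserves k (getN d) = k ≤ᵇ toℕ d
preserves k (alu o d A B) = k ≤ᵇ toℕ d
preserves k (ask q d A B) = k ≤ᵇ toℕ d
preserves k (call e) = true
preserves k (LD d A) = k ≤ᵇ toℕ d
preserves k (ST A B) = true
preserves k (RD d A B C) = k ≤ᵇ toℕ d
preserves k (WR A B C D) = true
preserves k (RD0 d A C) = k ≤ᵇ toℕ d
preserves k (WR0 A C D) = true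

silent : ∀ {Q R} → Prim Q R → Bool
silent (call e) = false
silent (ST A B) = false
silent (WR A B C D) = false
silent (WR0 A C D) = false
silent _ = true

allᵇ : ∀ {A : Set} → (A → Bool) → List A → Bool
allᵇ p [] = true
allᵇ p (x ∷ xs) = p x ∧ allᵇ p xs

∧-true : ∀ {a b} → a ∧ b ≡ true → a ≡ true × b ≡ true
∧-true {true} {true} _ = refl , refl

upd-frame : ∀ {k} (f : Fin R2 → ℕ) d v → (k ≤ᵇ toℕ d) ≡ true → ∀ x → toℕ x < k → upd f d v x ≡ f x
upd-frame {k} f d v k≤d x x<k = if-false (≡ᵇ-≢ (toℕ d) (toℕ x) (λ e → <⇒≱ x<k (subst (k ≤_) e (≤ᵇ⇒≤ k (toℕ d) (subst T (sym k≤d) tt)))))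

module Frames {Q : Set} (ans : Q → ℕ → ℕ → Maybe ℕ) (n w PB NR b0 : ℕ) where
 open Semantics ans n w PB NR b0 R2

 eff2-frame : ∀ {k} p s → preserves k p ≡ true → Frame k s (eff2 p s)
 eff2-frame (mov d A) s e = upd-frame (reg s) d _ e
 eff2-frame (getN d) s e = upd-frame (reg s) d _ e
 eff2-frame (alu o d A B) s e = upd-frame (reg s) d _ e
 eff2-frame (ask q d A B) s e = upd-frame (reg s) d _ e
 eff2-frame (call x) s e = λ _ _ → refl
 eff2-frame (LD d A) s e = upd-frame (reg s) d _ e
 eff2-frame (ST A B) s e = λ _ _ → refl
 eff2-frame (RD d A B C) s e = upd-frame (reg s) d _ e
 eff2-frame (WR A B C D) s e = λ _ _ → refl
 eff2-frame (RD0 d A C) s e = upd-frame (reg s) d _ e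
 eff2-frame (WR0 A C D) s e = λ _ _ → refl

 runs-frame : ∀ {k} ps s → allᵇ (preserves k) ps ≡ true → Frame k s (runs ps s)
 runs-frame [] s e = λ _ _ → refl
 runs-frame (p ∷ ps) s e = λ x l → runs-frame ps (eff2 p s) (snd (∧-true e)) x l · eff2-frame p s (fst (∧-true e)) x l

 eff2-quiet : ∀ {k} p s → preserves k p ∧ silent p ≡ true → Quiet k s (eff2 p s)
 eff2-quiet (mov d A) s e = quiet (eff2-frame (mov d A) s (fst (∧-true e))) refl refl refl refl
 eff2-quiet (getN d) s e = quiet (eff2-frame {_} (getN d) s (fst (∧-true e))) refl refl refl refl
 eff2-quiet (alu o d A B) s e = quiet (eff2-frame (alu o d A B) s (fst (∧-true e))) refl refl refl refl
 eff2-quiet (ask q d A B) s e = quiet (eff2-frame (ask q d A B) s (fst (∧-true e))) refl refl refl refl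
 eff2-quiet (LD d A) s e = quiet (eff2-frame (LD d A) s (fst (∧-true e))) refl refl refl refl
 eff2-quiet (RD d A B C) s e = quiet (eff2-frame (RD d A B C) s (fst (∧-true e))) refl refl refl refl
 eff2-quiet (RD0 d A C) s e = quiet (eff2-frame (RD0 d A C) s (fst (∧-true e))) refl refl refl refl

 runs-quiet : ∀ {k} ps s → allᵇ (λ p → preserves k p ∧ silent p) ps ≡ true → Quiet k s (runs ps s)
 runs-quiet [] s e = quiet (λ _ _ → refl) refl refl refl refl
 runs-quiet (p ∷ ps) s e = quiet-trans (eff2-quiet p s (fst (∧-true e))) (runs-quiet ps (eff2 p s) (snd (∧-true e)))

-- Bit lengths, their iteration, and the fields of an edge

bl : ℕ → ℕ
bl x = suc ⌊log₂ x ⌋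

x<2^bl : ∀ x → x < 2 ^ bl x
x<2^bl x = ≰⇒> (λ h → 1+n≰n (≡≤ (sym (⌊log₂[2^n]⌋≡n (bl x))) (⌊log₂⌋-mono-≤ h)))

log₂-< : ∀ m x → x < 2 ^ suc m → ⌊log₂ x ⌋ ≤ m
log₂-< zero zero h = z≤n
log₂-< zero (suc zero) h = z≤n
log₂-< zero (suc (suc x)) (s≤s (s≤s ()))
log₂-< (suc m) x h = (m≤n+m∸n ⌊log₂ x ⌋ 1) » s≤s (≡≤ (sym (⌊log₂⌊n/2⌋⌋≡⌊log₂n⌋∸1 x)) (log₂-< m ⌊ x /2⌋ (half-< x (2 ^ suc m) h)))

bl-≤ : ∀ b x → 0 < b → x < 2 ^ b → bl x ≤ b
bl-≤ (suc b) x _ h = s≤s (log₂-< b x h)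

bl≤x : ∀ x → 0 < x → bl x ≤ x
bl≤x x x>0 = bl-≤ x x x>0 (n<2^n x)

-- tower n i is the field length on the level K ∸ i.
tower : ℕ → ℕ → ℕ
tower n zero = bl n
tower n (suc i) = bl (tower n i)

tower>0 : ∀ n i → 0 < tower n i
tower>0 n zero = z<s
tower>0 n (suc i) = z<s

tower-suc≤ : ∀ n i → tower n (suc i) ≤ tower n i
tower-suc≤ n i = bl≤x (tower n i) (tower>0 n i)

tower≤bl : ∀ n i → tower n i ≤ bl n
tower≤bl n zero = ≤-refl
tower≤bl n (suc i) = tower-suc≤ n i » tower≤bl n i

module Fields {n : ℕ} (N : Digraph n) (K : ℕ) where
 open Digraph N
 open Paths N public

 bb : ℕ → ℕ
 bb j = tower n (K ∸ j)

 -- The number of positions that share a value of an approximate field. Rounding up keeps it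
 -- positive and makes `bb j` bits sufficient for the quotient, see `quot-gap<`.
 gap : ℕ → Fin n → ℕ
 gap j p = outdeg p /2^ bb j + 1

 -- λ j v bounds the field length charged to the vertex v, see telescope.
 weight : ℕ → Fin n → ℕ
 weight j v = bb j ⊓ (if j ≡ᵇ K then indeg v else outdeg v)

 -- A field has to be readable without a stored length. A walk comes from below and knows the tail,
 -- while a pop on level `K` knows the head; this decides whose degree enters. The cap by the degree
 -- loses nothing, as a position below `d` is below `2 ^ d`, and it bounds the weights of all
 -- vertices together by the degree sum, not only by `n * bb j`.
 fl fv : ℕ → Edge → ℕ
 fl j e = bb j ⊓ (if j ≡ᵇ K then indeg (hd e) else outdeg (tl e))
 fv j e = if j ≡ᵇ K then toℕ (outmate (tl e) (snd e)) else div (toℕ (snd e)) (gap j (tl e))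

 size : ℕ → List Edge → ℕ
 size j [] = 0
 size j (e ∷ es) = fl j e + size j es

 gap>0 : ∀ j p → 0 < gap j p
 gap>0 j p = m≤n+m 1 (outdeg p /2^ bb j)

 quotient-< : ∀ x d m → 0 < d → x < m * d → div x d < m
 quotient-< x (suc d) m _ h = m<n*o⇒m/o<n h

 quot-gap< : ∀ j p (i : Fin (outdeg p)) → div (toℕ i) (gap j p) < 2 ^ bb j
 quot-gap< j p i = quotient-< (toℕ i) (gap j p) (2 ^ bb j) (gap>0 j p) (toℕ<n i » (begin
  outdeg p ≡⟨ m≡m%n+[m/n]*n (outdeg p) (2 ^ bb j) {{m^n≢0 2 (bb j)}} ⟩
  outdeg p %2^ bb j + (outdeg p /2^ bb j) * 2 ^ bb j ≤⟨ +ˡ≤ _ (<⇒≤ (m%n<n (outdeg p) (2 ^ bb j) {{m^n≢0 2 (bb j)}})) ⟩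
  2 ^ bb j + (outdeg p /2^ bb j) * 2 ^ bb j ≡⟨ e (outdeg p /2^ bb j) (2 ^ bb j) ⟩
  2 ^ bb j * gap j p ∎))
  where
  open ≤-Reasoning
  e : ∀ q m → m + q * m ≡ m * (q + 1)
  e = ring

 2^-⊓ : ∀ a b x → x < 2 ^ a → x < 2 ^ b → x < 2 ^ (a ⊓ b)
 2^-⊓ a b x x<a x<b with ⊓-sel a b
 ... | inl e = subst (λ z → x < 2 ^ z) (sym e) x<a
 ... | inr e = subst (λ z → x < 2 ^ z) (sym e) x<b

 fv-< : ∀ j e → j ≤ K → fv j e < 2 ^ fl j e
 fv-< j (p , i) j≤K with j ≡ᵇ K in eqn
 ... | true = 2^-⊓ (bb j) _ _ (subst (λ z → toℕ (outmate p i) < 2 ^ tower n z) (sym K∸j≡0) (<-trans (toℕ<n (outmate p i) » indeg≤n N (outhead p i)) (x<2^bl n)))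
  (<-trans (toℕ<n (outmate p i)) (n<2^n _))
  where
  K∸j≡0 : K ∸ j ≡ 0
  K∸j≡0 = cong (K ∸_) (≡ᵇ-true⇒≡ {j} {K} eqn) · n∸n≡0 K
 ... | false = 2^-⊓ (bb j) _ _ (quot-gap< j p i) (s≤s (quotient≤' (toℕ i) (gap j p)) » <-trans (toℕ<n i) (n<2^n _))
  where
  quotient≤' : ∀ x y → div x y ≤ x
  quotient≤' = quotient≤

 fl≤bb : ∀ j e → fl j e ≤ bb j
 fl≤bb j e = m⊓n≤m (bb j) _

 bb≤L : ∀ j → bb j ≤ bl n
 bb≤L j = tower≤bl n (K ∸ j)

 bb>0 : ∀ j → 0 < bb j
 bb>0 j = tower>0 n (K ∸ j)

-- Everything the program relies on when n is large.
record Large (K n w : ℕ) : Set where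
 field
  n<2^w : n < 2 ^ w
  K≥1 : 1 ≤ K
  big : 64 * (K + bl n + 4) ≤ n
  fits : Layout.S {⊤} (λ _ _ _ → nothing) n w (3 * suc K) (3 + 2 * suc K) (tower n K) R2 ≤ 2 ^ w

bit-<ᵇ : ∀ a b → (bit a <ᵇ bit b) ≡ b ∧ not a
bit-<ᵇ true true = refl
bit-<ᵇ true false = refl
bit-<ᵇ false true = refl
bit-<ᵇ false false = refl

bit-≡ᵇ0 : ∀ a → (bit a ≡ᵇ 0) ≡ not a
bit-≡ᵇ0 true = refl
bit-≡ᵇ0 false = refl

quotient*+remainder : ∀ x y → 0 < y → x ∸ div x y * y ≡ mod x y
quotient*+remainder x y y>0 = cong (_∸ div x y * y) (quot+rem x y y>0) · m+n∸m≡n (div x y * y) (mod x y)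

wrP-cong : ∀ f {r1 r2 o1 o2 l1 l2 rY x2} r o → r1 ≡ r2 → o1 ≡ o2 → l1 ≡ l2 → rY ≡ x2 → wrP f r1 o1 l1 rY r o ≡ wrP f r2 o2 l2 x2 r o
wrP-cong f r o refl refl refl refl = refl

record Change (k : ℕ) (rs as : List ℕ) (s s' : State R2) : Set where
 constructor change
 field
  frame : Frame k s s'
  planes : ∀ r → All (r ≢_) rs → ∀ o → pl s' r o ≡ pl s r o
  words : ∀ a → All (a ≢_) as → lev s' a ≡ lev s a
  sl≡ : sl s' ≡ sl s
  out≡ : out s' ≡ out s
 kept = below frame

change-trans : ∀ {k rs as s s1 s2} → Change k rs as s s1 → Change k rs as s1 s2 → Change k rs as s s2
change-trans (change f p a σ o) (change f' p' a' σ' o') = change (λ x l → f' x l · f x l) (λ r h i → p' r h i · p r h i) (λ b h → a' b h · a b h) (σ' · σ) (o' · o)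

change-weaken : ∀ {j k rs as rs' as' s s1} → j ≤ k → (∀ {r} → All (r ≢_) rs' → All (r ≢_) rs) → (∀ {a} → All (a ≢_) as' → All (a ≢_) as) → Change k rs as s s1 → Change j rs' as' s s1
change-weaken j≤k hr ha (change f p a σ o) = change (λ x l → f x (l » j≤k)) (λ r h → p r (hr h)) (λ b h → a b (ha h)) σ o

quiet→change : ∀ {k rs as s s'} → Quiet k s s' → Change k rs as s s'
quiet→change (quiet f l p σ o) = change f (λ r _ i → p ∙ r ∙ i) (λ a _ → l ∙ a) σ o

sum-ʳ++ : ∀ {A : Set} (f : A → ℕ) xs {ys} → sum (map f (xs ʳ++ ys)) ≡ sum (map f xs) + sum (map f ys)
sum-ʳ++ f [] = refl
sum-ʳ++ f (x ∷ xs) {ys} = sum-ʳ++ f xs · x+yz≡yx+z (sum (map f xs)) (f x) (sum (map f ys))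

length-unique : ∀ {n} (xs : List (Fin n)) → AllPairs _≢_ xs → length xs ≤ n
length-unique {n} xs u = =≤ (ones xs) » sumF-unique (λ _ → 1) xs u » =≤ (sumF-const n 1 · *-identityʳ n)
 where
 ones : ∀ (xs : List (Fin n)) → length xs ≡ sum (map (λ _ → 1) xs)
 ones [] = refl
 ones (x ∷ xs) = cong suc (ones xs)

length-ʳ++ : ∀ {A : Set} (xs : List A) {ys} → length (xs ʳ++ ys) ≡ length xs + length ys
length-ʳ++ [] = refl
length-ʳ++ (x ∷ xs) = length-ʳ++ xs · +-suc (length xs) _

ʳ++-ʳ++-[] : ∀ {A : Set} (xs : List A) → (xs ʳ++ []) ʳ++ [] ≡ xs
ʳ++-ʳ++-[] xs = ʳ++-ʳ++ xs · ++-identityʳ xs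

quiet-tick : ∀ {k s s'} → Quiet k s s' → Quiet k s (tick s')
quiet-tick (quiet a b c d e) = quiet a b c d e

bitwise-∨-0 : ∀ w → bitwise _∨_ w 0 0 ≡ 0
bitwise-∨-0 zero = refl
bitwise-∨-0 (suc w) = cong (2 *_) (bitwise-∨-0 w)

bitwise-∨-bit : ∀ w a b → 0 < w → bitwise _∨_ w (bit a) (bit b) ≡ bit (a ∨ b)
bitwise-∨-bit (suc w) true true _ = cong (λ z → 1 + 2 * z) (bitwise-∨-0 w)
bitwise-∨-bit (suc w) true false _ = cong (λ z → 1 + 2 * z) (bitwise-∨-0 w)
bitwise-∨-bit (suc w) false true _ = cong (λ z → 1 + 2 * z) (bitwise-∨-0 w)
bitwise-∨-bit (suc w) false false _ = cong (2 *_) (bitwise-∨-0 w)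

≢0 : ∀ {x k} → x ≡ suc k → x ≢ 0
≢0 refl ()

bit≢0 : ∀ {b} → b ≡ true → bit b ≢ 0
bit≢0 refl ()

updF : ∀ {n} → (Fin n → ℕ) → Fin n → ℕ → Fin n → ℕ
updF f u x v = if does (v ≟ᶠ u) then x else f v

updF-≡ : ∀ {n} (f : Fin n → ℕ) u x → updF f u x u ≡ x
updF-≡ f u x = if-true (dec-true (u ≟ᶠ u) refl)

updF-≢ : ∀ {n} (f : Fin n → ℕ) u x v → v ≢ u → updF f u x v ≡ f v
updF-≢ f u x v v≢u = if-false (dec-false (v ≟ᶠ u) v≢u)

-- Colours, explored edges and steps of the path

NonWhite : ∀ {n} → Vec Colour n → Fin n → Set
NonWhite c v = lookup c v ≢ white

nonWhite-upd : ∀ {n} (c : Vec Colour n) u {x} v → x ≢ white → NonWhite c v → NonWhite (c [ u ]≔ x) v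
nonWhite-upd c u {x} v x≢ h e with v ≟ᶠ u
... | yes refl = x≢ (sym (lookup-≡ v c x) · e)
... | no v≢u = h (sym (lookup-≢ v≢u c x) · e)

nonWhite-upd⁻ : ∀ {n} (c : Vec Colour n) u {x} v → v ≢ u → NonWhite (c [ u ]≔ x) v → NonWhite c v
nonWhite-upd⁻ c u {x} v v≢u h e = h (lookup-≢ v≢u c x · e)

white-upd⁻ : ∀ {n} (c : Vec Colour n) u {x} v → x ≢ white → lookup (c [ u ]≔ x) v ≡ white → lookup c v ≡ white
white-upd⁻ c u {x} v x≢ e with v ≟ᶠ u
... | yes refl = ⊥! (x≢ (sym (lookup-≡ v c x) · e))
... | no v≢u = sym (lookup-≢ v≢u c x) · e

cons≢[] : ∀ {A : Set} {x : A} {xs ys : List A} → ys ≡ x ∷ xs → ys ≢ []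
cons≢[] refl ()

black≢white : black ≢ white
black≢white ()

gray≢white : gray ≢ white
gray≢white ()

gray≢black : gray ≢ black
gray≢black ()

SameEdge-sym : ∀ {n} {a b : Fin n} {f} → SameEdge undir (a , b) f → SameEdge undir (b , a) f
SameEdge-sym (inl refl) = inr refl
SameEdge-sym {f = x , y} (inr refl) = inl refl

-- prog u counts the edges explored from u. An undir edge between discovered vertices is always explored.
Explored : ∀ kind {n} (G : Graph kind n) → Vec Colour n → List (Fin n × Fin n) → (Fin n → ℕ) → Set
Explored dir G c es prog = ∀ p x → (Any (SameEdge dir (p , x)) es → Σ[ k ∈ _ ] toℕ k < prog p × G.outhead p k ≡ x) ×
 (∀ k → toℕ k < prog p → G.outhead p k ≡ x → Any (SameEdge dir (p , x)) es)
 where module G = Digraph G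
Explored undir G c es prog = ∀ a b → Adjacent undir G a b → (Any (SameEdge undir (a , b)) es → NonWhite c a × NonWhite c b) × (NonWhite c a → NonWhite c b → Any (SameEdge undir (a , b)) es)

-- While the edges from the new vertex v to its gray neighbours are explored; q is the ν of the parent of v, or 0.
module BackEdges {n} (G : UndirectedGraph n) (v : Fin n) (q : ℕ) where
 open UndirectedGraph G

 Done : ℕ → Fin n → Set
 Done k x = ν x ≡ q ⊎ Σ[ k' ∈ Fin (deg v) ] toℕ k' < k × head v k' ≡ x

 -- Interpolates between the situation right after the discovery of `v` (`mid-start`) and `Explored`
 -- (`mid-end`): edges at `v` count only if they lead to the parent or to one of the first `k`
 -- neighbours.
 Mid : ℕ → Vec Colour n → List (Fin n × Fin n) → Set
 Mid k c es = ∀ a b → Adjacent undir G a b → (Any (SameEdge undir (a , b)) es → NonWhite c a × NonWhite c b × (a ≡ v → Done k b) × (b ≡ v → Done k a)) ×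
  (NonWhite c a → NonWhite c b → (a ≡ v → Done k b) → (b ≡ v → Done k a) → Any (SameEdge undir (a , b)) es)

 done-suc : ∀ {k x} → Done k x → Done (suc k) x
 done-suc (inl e) = inl e
 done-suc (inr (k' , k'< , e)) = inr (k' , m≤n⇒m≤1+n k'< , e)

 done-new : ∀ {x} (k : Fin (deg v)) → Done (suc (toℕ k)) x → Done (toℕ k) x ⊎ head v k ≡ x
 done-new k (inl e) = inl (inl e)
 done-new k (inr (k' , k'< , e)) with ≤-split (≤-pred k'<)
 ... | inl h = inl (inr (k' , h , e))
 ... | inr h = inr (cong (head v) (toℕ-injective (sym h)) · e)

 adjacent-sym : ∀ {a b} → Adjacent undir G a b → Adjacent undir G b a
 adjacent-sym {a} (i , refl) = mate a i , head-mate a i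

 adjacent-≢ : ∀ {a b} → Adjacent undir G a b → a ≢ b
 adjacent-≢ {a} (i , refl) e = loopless a i (sym e)

 -- Nothing has to be explored if the next neighbour is white or the parent.
 mid-skip : ∀ (k : Fin (deg v)) {c es} → (lookup c (head v k) ≡ white ⊎ ν (head v k) ≡ q) → Mid (toℕ k) c es → Mid (suc (toℕ k)) c es
 mid-skip k {c} h m a b ab = (λ x → let (p , q , f , g) = fst (m a b ab) x in p , q , (λ e → done-suc (f e)) , (λ e → done-suc (g e))) ,
  (λ p q f g → snd (m a b ab) p q (λ e → back q (f e)) (λ e → back p (g e)))
  where
  back : ∀ {x} → NonWhite c x → Done (suc (toℕ k)) x → Done (toℕ k) x
  back {x} nw d = Sum.[ (λ d' → d') , (λ e → Sum.[ (λ w → ⊥! (nw (cong (lookup c) (sym e) · w))) , (λ q≡ → inl (cong ν (sym e) · q≡)) ] h) ] (done-new k d)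

 mid-unexplored : ∀ (k : Fin (deg v)) {c es} → ν (head v k) ≢ q → Mid (toℕ k) c es → Unexplored undir G es v (head v k)
 mid-unexplored k q≢ m = (k , refl) , λ x → absurd (fst (snd (snd (fst (m v (head v k) (k , refl)) x))) refl)
  where
  absurd : Done (toℕ k) (head v k) → ⊥
  absurd (inl e) = q≢ e
  absurd (inr (k' , k'< , e)) = <⇒≢ k'< (cong toℕ (head-inj v k' k e))

 mid-explore : ∀ (k : Fin (deg v)) {c es} → NonWhite c v → NonWhite c (head v k) → Mid (toℕ k) c es → Mid (suc (toℕ k)) c ((v , head v k) ∷ es)
 mid-explore k {c} {es} nv nx m a b ab = to , from
  where
  x≢v = loopless v k
  here! : Done (suc (toℕ k)) (head v k)
  here! = inr (k , ≤-refl , refl)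
  to : Any (SameEdge undir (a , b)) ((v , head v k) ∷ es) → _
  to (here (inl refl)) = nv , nx , (λ _ → here!) , (λ e → ⊥! (x≢v e))
  to (here (inr refl)) = nx , nv , (λ e → ⊥! (x≢v e)) , (λ _ → here!)
  to (there h) = let (p , q , f , g) = fst (m a b ab) h in p , q , (λ e → done-suc (f e)) , (λ e → done-suc (g e))
  from : NonWhite c a → NonWhite c b → (a ≡ v → Done (suc (toℕ k)) b) → (b ≡ v → Done (suc (toℕ k)) a) → Any (SameEdge undir (a , b)) ((v , head v k) ∷ es)
  from p q f g with a ≟ᶠ v | b ≟ᶠ v
  ... | yes refl | yes refl = ⊥! (adjacent-≢ ab refl)
  ... | yes refl | no b≢v = on (done-new k (f refl))
   where
   on : Done (toℕ k) b ⊎ head v k ≡ b → _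
   on (inl d) = there (snd (m a b ab) p q (λ _ → d) (λ e → ⊥! (b≢v e)))
   on (inr refl) = here (inl refl)
  ... | no a≢v | yes refl = on (done-new k (g refl))
   where
   on : Done (toℕ k) a ⊎ head v k ≡ a → _
   on (inl d) = there (snd (m a b ab) p q (λ e → ⊥! (a≢v e)) (λ _ → d))
   on (inr refl) = here (inr refl)
  ... | no a≢v | no b≢v = there (snd (m a b ab) p q (λ e → ⊥! (a≢v e)) (λ e → ⊥! (b≢v e)))

 mid-end : ∀ {k c es} → deg v ≤ k → Mid k c es → ∀ prog → Explored undir G c es prog
 mid-end {k} d≤k m prog a b ab = (λ x → let (p , q , _ , _) = fst (m a b ab) x in p , q) ,
  λ p q → snd (m a b ab) p q (λ { refl → reached ab }) (λ { refl → reached (adjacent-sym ab) })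
  where
  reached : ∀ {x} → Adjacent undir G v x → Done k x
  reached (i , refl) = inr (i , (toℕ<n i » d≤k) , refl)

 mid-start : ∀ {c es prog es'} → Explored undir G c es prog → lookup c v ≡ white → (∀ {a b} → Any (SameEdge undir (a , b)) es → Any (SameEdge undir (a , b)) es') →
  (∀ {a b} → Any (SameEdge undir (a , b)) es' → Any (SameEdge undir (a , b)) es ⊎ (NonWhite c a × b ≡ v × ν a ≡ q ⊎ NonWhite c b × a ≡ v × ν b ≡ q)) →
  (∀ x → ν x ≡ q → Any (SameEdge undir (v , x)) es') → Mid 0 (c [ v ]≔ gray) es'
 mid-start {c} {es} {prog} {es'} ex wh keep split edge a b ab = to , from
  where
  nv : NonWhite (c [ v ]≔ gray) v
  nv e = gray≢white (sym (lookup-≡ v c gray) · e)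
  ≢v : ∀ {x} → NonWhite c x → x ≢ v
  ≢v nx refl = nx wh
  up : ∀ {x} → NonWhite c x → NonWhite (c [ v ]≔ gray) x
  up = nonWhite-upd c v _ gray≢white
  to : Any (SameEdge undir (a , b)) es' → _
  to x with split x
  ... | inl y = let (p , q) = fst (ex a b ab) y in up p , up q , (λ e → ⊥! (≢v p e)) , (λ e → ⊥! (≢v q e))
  ... | inr (inl (p , refl , e)) = up p , nv , (λ e → ⊥! (≢v p e)) , λ _ → inl e
  ... | inr (inr (p , refl , e)) = nv , up p , (λ _ → inl e) , λ e → ⊥! (≢v p e)
  from : NonWhite (c [ v ]≔ gray) a → NonWhite (c [ v ]≔ gray) b → (a ≡ v → Done 0 b) → (b ≡ v → Done 0 a) → Any (SameEdge undir (a , b)) es'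
  from p q f g with a ≟ᶠ v | b ≟ᶠ v
  ... | yes refl | _ = on (f refl)
   where
   on : Done 0 b → _
   on (inl e) = edge b e
   on (inr (_ , () , _))
  ... | no _ | yes refl = on (g refl)
   where
   on : Done 0 a → _
   on (inl e) = Any.map SameEdge-sym (edge a e)
   on (inr (_ , () , _))
  ... | no a≢v | no b≢v = keep (snd (ex a b ab) (nonWhite-upd⁻ c v a a≢v p) (nonWhite-upd⁻ c v b b≢v q))

-- In a directed graph nothing happens between the discovery of a vertex and its first search step,
-- so there is no intermediate stage.
Mid : ∀ kind {n} (G : Graph kind n) (v : Fin n) (q k : ℕ) → Vec Colour n → List (Fin n × Fin n) → (Fin n → ℕ) → Set
Mid dir G v q k c es prog = Explored dir G c es prog
Mid undir G v q k c es prog = BackEdges.Mid G v q k c es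

mid-directed : ∀ kind {n} (G : Graph kind n) {v q k c es prog} → kind ≡ dir → Mid kind G v q k c es prog → Explored kind G c es prog
mid-directed dir G refl m = m

mid-skip : ∀ kind {n} (G : Graph kind n) {v q c es prog} → kind ≡ undir → ∀ k → let x = Digraph.outhead (net kind G) v k in
 lookup c x ≡ white ⊎ ν x ≡ q → Mid kind G v q (toℕ k) c es prog → Mid kind G v q (suc (toℕ k)) c es prog
mid-skip undir G {v} {q} {c} {es} refl k = BackEdges.mid-skip G v q k {c} {es}

mid-explore : ∀ kind {n} (G : Graph kind n) {v q c es prog} → kind ≡ undir → ∀ k → let x = Digraph.outhead (net kind G) v k in
 NonWhite c v → NonWhite c x → ν x ≢ q → Mid kind G v q (toℕ k) c es prog → Unexplored kind G es v x × Mid kind G v q (suc (toℕ k)) c ((v , x) ∷ es) prog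
mid-explore undir G {v} {q} {c} {es} refl k nv nx x≢q m = BackEdges.mid-unexplored G v q k {c} {es} x≢q m , BackEdges.mid-explore G v q k {c} {es} nv nx m

mid-end : ∀ kind {n} (G : Graph kind n) {v q k c es prog} → kind ≡ undir → Digraph.outdeg (net kind G) v ≤ k → Mid kind G v q k c es prog → Explored kind G c es prog
mid-end undir G {v} {q} {k} {c} {es} {prog} refl d≤k m = BackEdges.mid-end G v q {k} {c} {es} d≤k m prog

explored-same : ∀ kind {n} (G : Graph kind n) {c es prog prog'} → kind ≡ undir → Explored kind G c es prog → Explored kind G c es prog'
explored-same undir G refl ex = ex

explored-upd : ∀ kind {n} (G : Graph kind n) {c es prog} u {x} → x ≢ white → NonWhite c u → Explored kind G c es prog → Explored kind G (c [ u ]≔ x) es prog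
explored-upd dir G u x≢ nu ex = ex
explored-upd undir G {c} u x≢ nu ex a b ab = (λ h → let (p , q) = fst (ex a b ab) h in nonWhite-upd c u a x≢ p , nonWhite-upd c u b x≢ q) ,
 λ p q → snd (ex a b ab) (down a p) (down b q)
 where
 down : ∀ v → NonWhite (c [ u ]≔ _) v → NonWhite c v
 down v h with v ≟ᶠ u
 ... | yes refl = nu
 ... | no v≢u = nonWhite-upd⁻ c u v v≢u h

explored-all : ∀ kind {n} (G : Graph kind n) {c es prog} u → Explored kind G c es prog → Digraph.outdeg (net kind G) u ≤ prog u → NonWhite c u →
 (∀ k → NonWhite c (Digraph.outhead (net kind G) u k)) → ∀ v → ¬ Unexplored kind G es u v
explored-all dir G u ex d≤ nu h v ((k , refl) , un) = un (snd (ex u v) k (toℕ<n k » d≤) refl)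
explored-all undir G u ex d≤ nu h v ((k , refl) , un) = un (snd (ex u v (k , refl)) nu (h k))

module _ {n} (G : Digraph n) where
 open Digraph G

 unexplored-directed : ∀ {c es prog} u (k : Fin (outdeg u)) → Explored dir G c es prog → prog u ≡ toℕ k → Unexplored dir G es u (outhead u k)
 unexplored-directed u k ex pr = (k , refl) , λ h → let (k' , k'< , e) = fst (ex u (outhead u k)) h in
  <⇒≢ (k'< » =≤ pr) (cong toℕ (outhead-inj u k' k e))

 explored-directed : ∀ {c c' es prog} u (k : Fin (outdeg u)) → Explored dir G c es prog → prog u ≡ toℕ k → Explored dir G c' ((u , outhead u k) ∷ es) (updF prog u (suc (toℕ k)))
 explored-directed {es = es} {prog} u k ex pr p x = to , from
  where
  prog' = updF prog u (suc (toℕ k))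
  mono : prog p ≤ prog' p
  mono with p ≟ᶠ u
  ... | yes refl = =≤ pr » n≤1+n _
  ... | no p≢u = ≤-refl
  to : Any (SameEdge dir (p , x)) ((u , outhead u k) ∷ es) → Σ[ k ∈ _ ] toℕ k < prog' p × outhead p k ≡ x
  to (here refl) = k , =≥ (updF-≡ prog u _) , refl
  to (there h) = let (k' , k'< , e) = fst (ex p x) h in k' , (k'< » mono) , e
  from : ∀ k' → toℕ k' < prog' p → outhead p k' ≡ x → Any (SameEdge dir (p , x)) ((u , outhead u k) ∷ es)
  from k' k'< refl = on (p ≟ᶠ u)
   where
   on : Dec (p ≡ u) → _
   on (no p≢u) = there (snd (ex p x) k' (subst (toℕ k' <_) (updF-≢ prog u _ p p≢u) k'<) refl)
   on (yes refl) with ≤-split (≤-pred (subst (toℕ k' <_) (updF-≡ prog u _) k'<))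
   ... | inl h = there (snd (ex p x) k' (subst (toℕ k' <_) (sym pr) h) refl)
   ... | inr h = here (cong (λ i → (u , outhead u i)) (toℕ-injective h))

unexplored-tree : ∀ kind {n} (G : Graph kind n) {c es prog} u k → let v = Digraph.outhead (net kind G) u k in
 Explored kind G c es prog → prog u ≡ toℕ k → lookup c v ≡ white → Unexplored kind G es u v
unexplored-tree dir G {c} u k ex pr wh = unexplored-directed G {c} u k ex pr
unexplored-tree undir G u k ex pr wh = (k , refl) , λ h → snd (fst (ex u _ (k , refl)) h) wh

before-tree : ∀ kind {n} (G : Graph kind n) {c es prog} u k → let v = Digraph.outhead (net kind G) u k in
 Explored kind G c es prog → prog u ≡ toℕ k → lookup c v ≡ white → NonWhite c u → Mid kind G v (ν u) 0 (c [ v ]≔ gray) ((u , v) ∷ es) (updF prog u (suc (toℕ k)))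
before-tree dir G {c} u k ex pr wh nu = explored-directed G {c} {c} u k ex pr
before-tree undir G {c} {es} {prog} u k ex pr wh nu = BackEdges.mid-start G v (ν u) {c} {es} {prog} ex wh there split (λ x e → here (inr (cong (v ,_) (ν-inj e))))
 where
 v = UndirectedGraph.head G u k
 split : ∀ {a b} → Any (SameEdge undir (a , b)) ((u , v) ∷ es) → Any (SameEdge undir (a , b)) es ⊎ (NonWhite c a × b ≡ v × ν a ≡ ν u ⊎ NonWhite c b × a ≡ v × ν b ≡ ν u)
 split (here (inl refl)) = inr (inl (nu , refl , refl))
 split (here (inr refl)) = inr (inr (nu , refl , refl))
 split (there h) = inl h

before-root : ∀ kind {n} (G : Graph kind n) {c es prog} r → Explored kind G c es prog → lookup c r ≡ white → Mid kind G r 0 0 (c [ r ]≔ gray) es prog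
before-root dir G r ex wh = ex
before-root undir G {c} {es} {prog} r ex wh = BackEdges.mid-start G r 0 {c} {es} {prog} ex wh (λ h → h) inl (λ x ())

Closed : ∀ {n} (N : Digraph n) → Vec Colour n → Set
Closed N c = ∀ v → lookup c v ≡ black → ∀ k → NonWhite c (Digraph.outhead N v k)

closed-gray : ∀ {n} (N : Digraph n) {c} v → Closed N c → Closed N (c [ v ]≔ gray)
closed-gray N {c} v cl x b k with x ≟ᶠ v
... | yes refl = ⊥! (gray≢black (sym (lookup-≡ x c gray) · b))
... | no x≢v = nonWhite-upd c v _ gray≢white (cl x (sym (lookup-≢ x≢v c gray) · b) k)

closed-black : ∀ {n} (N : Digraph n) {c} u → (∀ k → NonWhite c (Digraph.outhead N u k)) → Closed N c → Closed N (c [ u ]≔ black)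
closed-black N {c} u h cl x b k with x ≟ᶠ u
... | yes refl = nonWhite-upd c x _ black≢white (h k)
... | no x≢u = nonWhite-upd c u _ black≢white (cl x (sym (lookup-≢ x≢u c black) · b) k)

-- In an undir graph a white vertex has no black neighbours.
no-black : ∀ {n} (G : UndirectedGraph n) {c} v → Closed (net undir G) c → lookup c v ≡ white → ∀ k → lookup c (UndirectedGraph.head G v k) ≢ black
no-black G {c} v cl wh k b = cl _ b (UndirectedGraph.mate G v k) (cong (lookup c) (UndirectedGraph.head-mate G v k) · wh)

module PathSteps {n} (N : Digraph n) where
 open Digraph N
 open Paths N

 prior-mono : ∀ {c c'} ps → (∀ v → lookup c v ≡ black → lookup c' v ≡ black) → Prior c ps → Prior c' ps
 prior-mono [] h p = tt
 prior-mono (e ∷ ps) h (p , q) = (λ j j< → Sum.map₁ (h _) (p j j<)) , prior-mono ps h q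

 not-white : ∀ {c : Vec Colour n} {v} → lookup c v ≢ white → lookup c v ≡ black ⊎ lookup c v ≡ gray
 not-white {c} {v} h with lookup c v
 ... | white = ⊥! (h refl)
 ... | gray = inr refl
 ... | black = inl refl

 black-stays : ∀ {c : Vec Colour n} {v x} → lookup c v ≢ black → ∀ w → lookup c w ≡ black → lookup (c [ v ]≔ x) w ≡ black
 black-stays {c} {v} {x} v≢b w b with w ≟ᶠ v
 ... | yes refl = ⊥! (v≢b b)
 ... | no w≢v = lookup-≢ w≢v c x · b

 path-root : ∀ {c : Vec Colour n} r → (∀ v → lookup c v ≢ gray) → PathInv (c [ r ]≔ gray) r r []
 path-root {c} r no-gray = record { chain = refl; uniq = [] ∷ []; gray→∈ = to; ∈→gray = λ { (here refl) → lookup-≡ r c gray; (there ()) }; prior = tt }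
  where
  to : ∀ {v} → lookup (c [ r ]≔ gray) v ≡ gray → v ∈ (r ∷ [])
  to {v} g with v ≟ᶠ r
  ... | yes v≡r = here v≡r
  ... | no v≢r = ⊥! (no-gray v (sym (lookup-≢ v≢r c gray) · g))

 -- The neighbours before position `k` are discovered, and a gray one is an ancestor because the
 -- gray vertices are exactly those on the stack. This gives `Prior` for the new edge.
 path-push : ∀ {c r ps} u (k : Fin (outdeg u)) → PathInv c r u ps → lookup c (outhead u k) ≡ white → (∀ j → toℕ j < toℕ k → NonWhite c (outhead u j)) →
  PathInv (c [ outhead u k ]≔ gray) r (outhead u k) ((u , k) ∷ ps)
 path-push {c} {r} {ps} u k inv wh seen = record { chain = refl , chain; uniq = All.tabulate fresh ∷ uniq; gray→∈ = to; ∈→gray = from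
  ; prior = (λ j j< → Sum.[ (λ b → inl (stays _ b)) , (λ g → inr (gray→∈ g)) ] (not-white {c} (seen j j<))) , prior-mono ps stays prior }
  where
  open PathInv inv
  v = outhead u k
  fresh : ∀ {x} → x ∈ stackOf u ps → v ≢ x
  fresh x∈ refl = gray≢white (sym (∈→gray x∈) · wh)
  stays : ∀ w → lookup c w ≡ black → lookup (c [ v ]≔ gray) w ≡ black
  stays = black-stays {c} (λ b → black≢white (sym b · wh))
  to : ∀ {w} → lookup (c [ v ]≔ gray) w ≡ gray → w ∈ (v ∷ u ∷ tails ps)
  to {w} g with w ≟ᶠ v
  ... | yes w≡v = here w≡v
  ... | no w≢v = there (gray→∈ (sym (lookup-≢ w≢v c gray) · g))
  from : ∀ {w} → w ∈ (v ∷ u ∷ tails ps) → lookup (c [ v ]≔ gray) w ≡ gray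
  from (here refl) = lookup-≡ v c gray
  from {w} (there w∈) = lookup-≢ (λ e → fresh w∈ (sym e)) c gray · ∈→gray w∈

 path-pop : ∀ {c r ps} e → PathInv c r (hd e) (e ∷ ps) → PathInv (c [ hd e ]≔ black) r (tl e) ps
 path-pop {c} {r} {ps} e inv with PathInv.uniq inv
 ... | u∉ ∷ uniq' = record { chain = snd chain; uniq = uniq'; gray→∈ = to; ∈→gray = from; prior = prior-mono ps stays (snd prior) }
  where
  open PathInv inv
  u = hd e
  stays : ∀ w → lookup c w ≡ black → lookup (c [ u ]≔ black) w ≡ black
  stays = black-stays {c} (λ b → gray≢black (sym (∈→gray (here refl)) · b))
  to : ∀ {w} → lookup (c [ u ]≔ black) w ≡ gray → w ∈ stackOf (tl e) ps
  to {w} g with w ≟ᶠ u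
  ... | yes refl = ⊥! (gray≢black (sym g · lookup-≡ w c black))
  ... | no w≢u with gray→∈ (sym (lookup-≢ w≢u c black) · g)
  ... | here w≡u = ⊥! (w≢u w≡u)
  ... | there w∈ = w∈
  from : ∀ {w} → w ∈ stackOf (tl e) ps → lookup (c [ u ]≔ black) w ≡ gray
  from {w} w∈ = lookup-≢ (λ w≡u → All.lookup u∉ w∈ (sym w≡u)) c black · ∈→gray (there w∈)

 -- After the withdrawal over e, the first suc i neighbours of its tail are discovered.
 seen-pop : ∀ {c r ps} e → PathInv c r (hd e) (e ∷ ps) → ∀ j → toℕ j < suc (toℕ (snd e)) → NonWhite (c [ hd e ]≔ black) (outhead (tl e) j)
 seen-pop {c} (p , i) inv j j< = nonWhite-upd c _ _ black≢white (on (≤-split (≤-pred j<)))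
  where
  open PathInv inv
  on : toℕ j < toℕ i ⊎ toℕ j ≡ toℕ i → NonWhite c (outhead p j)
  on (inr j≡i) w = gray≢white (sym (∈→gray (here (cong (outhead p) (toℕ-injective j≡i)))) · w)
  on (inl j<i) w with fst prior j j<i
  ... | inl b = black≢white (sym b · w)
  ... | inr anc = gray≢white (sym (∈→gray (there anc)) · w)

 no-gray-end : ∀ {c r u} → PathInv c r u [] → ∀ v → lookup (c [ u ]≔ black) v ≢ gray
 no-gray-end {c} {r} {u} inv v g with v ≟ᶠ u
 ... | yes refl = gray≢black (sym g · lookup-≡ v c black)
 ... | no v≢u with PathInv.gray→∈ inv (sym (lookup-≢ v≢u c black) · g)
 ... | here v≡u = v≢u v≡u

-- In continuation form, as `Reach` is: `CompletesWith` is built from the end of a search, whereas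
-- the calls are made from its beginning.
Leads : ∀ kind {n} (G : Graph kind n) → SearchState n → List (Event (Fin n)) → SearchState n → Set
Leads kind G σ τ σ' = ∀ {τ'} → CompletesWith kind G σ' τ' → CompletesWith kind G σ (τ ++ τ')

leads-step : ∀ kind {n} (G : Graph kind n) {σ σ' σ'' τ τ1} → Leads kind G σ τ σ' → _⟶[_]_ kind G σ' τ1 σ'' → Leads kind G σ (τ ++ τ1) σ''
leads-step kind G {σ} {τ = τ} {τ1} l s {τ'} comp = subst (CompletesWith kind G σ) (sym (++-assoc τ τ1 τ')) (l (CompletesWith.step s comp))

isGray nonWhite : Colour → Bool
isGray gray = true
isGray _ = false
nonWhite white = false
nonWhite _ = true

Trace : ∀ kind {n} (G : Graph kind n) → SearchState n → List (Event ℕ) → Set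
Trace kind {n} G σ o = Σ[ τ ∈ List (Event (Fin _)) ] o ≡ map (mapEvent ν) τ × Leads kind G (outset n) τ σ

trace-step : ∀ kind {n} (G : Graph kind n) {σ σ' τ o o'} → Trace kind G σ o → _⟶[_]_ kind G σ τ σ' → o' ≡ o ++ map (mapEvent ν) τ → Trace kind G σ' o'
trace-step kind G {τ = τ} (τ0 , o≡ , l) s e = τ0 ++ τ , e · cong (_++ map (mapEvent ν) τ) o≡ · sym (map-++ (mapEvent ν) τ0 τ) , leads-step kind G l s

-- Lets `back-edges` look at the gray marks only: a neighbour without such a mark is white, and its
-- edge can wait.
fair : ∀ kind {n} (G : Graph kind n) {c} v → Closed (net kind G) c → lookup c v ≡ white → kind ≡ undir → ∀ k → lookup (c [ v ]≔ gray) (Digraph.outhead (net kind G) v k) ≢ black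
fair undir G {c} v cl wh refl k b with UndirectedGraph.head G v k ≟ᶠ v
... | yes e = UndirectedGraph.loopless G v k e
... | no x≢v = no-black G {c} v cl wh k (sym (lookup-≢ x≢v c gray) · b)

nontree-directed : ∀ kind {n} (G : Graph kind n) {c es prog} u k → let x = Digraph.outhead (net kind G) u k in kind ≡ dir → prog u ≡ toℕ k →
 Explored kind G c es prog → Unexplored kind G es u x × Explored kind G c ((u , x) ∷ es) (updF prog u (suc (toℕ k)))
nontree-directed dir G {c} u k refl pr ex = unexplored-directed G {c} u k ex pr , explored-directed G {c} {c} u k ex pr

∸-suc : ∀ {d i} → i < d → d ∸ i ≡ suc (d ∸ suc i)
∸-suc i<d = +-∸-assoc 1 i<d

drop-tabulate : ∀ {n} {A : Set} (f : Fin n → A) i (i<n : i < n) → drop i (tabulate f) ≡ f (fromℕ< i<n) ∷ drop (suc i) (tabulate f)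
drop-tabulate {suc n} f zero i<n = refl
drop-tabulate {suc n} f (suc i) (s≤s i<n) = drop-tabulate (λ j → f (suc j)) i i<n

drop-allFin : ∀ n → drop n (allFin n) ≡ []
drop-allFin n = drop-all n (allFin n) (=≤ (length-tabulate {n = n} (λ i → i)))

-- Time per unit of n + m.
pace : ℕ → ℕ
pace K = (7 * K + 6) + 2 * (2 * K + 2 + 144 * (K * K))

-- Large graphs: addresses, queries and field parameters

module LargeCase {kind : Kind} {K n : ℕ} (G : Graph kind n) {w : ℕ} (large : Large K n w) where
 open Large large
 open Code2 kind K public
 open Fields (net kind G) K public
 open Digraph (net kind G) public
 open Semantics (answer kind G) n w PB2 NR2 (bb 0) R2 public
 open Frames (answer kind G) n w PB2 NR2 (bb 0) public

 Runs : Command → State R2 → (State R2 → Set) → Set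
 Runs c s Φ = Σ[ s' ∈ State R2 ] Exec c s s' × Φ s'

 L : ℕ
 L = bl n

 K+L+4≤n : K + L + 4 ≤ n
 K+L+4≤n = m≤n*m (K + L + 4) 64 » big

 n≥1 : 1 ≤ n
 n≥1 = z<s » m≤n+m 4 (K + L) » K+L+4≤n

 n<w : ∀ {c} → c ≤ n → c < 2 ^ w
 n<w c≤n = s≤s c≤n » n<2^w

 K<w : K < 2 ^ w
 K<w = n<w (m≤m+n K L » m≤m+n (K + L) 4 » K+L+4≤n)

 small : ∀ {c} → c ≤ 64 * (K + L + 4) → c < 2 ^ w
 small h = n<w (h » big)

 lit≤ : ∀ c → c ≤ 64 → c < 2 ^ w
 lit≤ c h = small (h » m≤m*n 64 (K + L + 4) {{>-nonZero (z<s » m≤n+m 4 (K + L))}})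

 lit! : ∀ {c} {_ : T (c ≤ᵇ 64)} → c < 2 ^ w
 lit! {c} {h} = lit≤ c (≤ᵇ⇒≤ c 64 h)

 lin : ∀ a b {j} → a ≤ 64 → b ≤ 3 → j ≤ K → a + b * suc K + j < 2 ^ w
 lin a b {j} a≤ b≤ j≤K = small (+≤+ (+≤+ a≤ (*ˡ≤ (suc K) b≤)) j≤K » m≤m+n _ (60 * K + 64 * L + 189) » =≤ (e K L))
  where
  e : ∀ K L → 64 + 3 * suc K + K + (60 * K + 64 * L + 189) ≡ 64 * (K + L + 4)
  e = ring

 w>0 : 0 < w
 w>0 = exponent>0 w (s≤s n≥1 » n<2^w)
  where
  exponent>0 : ∀ w → 1 < 2 ^ w → 0 < w
  exponent>0 zero (s≤s ())
  exponent>0 (suc w) _ = z<s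

 L≤w : L ≤ w
 L≤w = bl-≤ w n w>0 n<2^w

 ν≤n : ∀ (v : Fin n) → ν v ≤ n
 ν≤n v = toℕ<n v

 num≤n : ∀ {x} {v : Fin n} → x ≡ ν v → x ≤ n
 num≤n {v = v} refl = ν≤n v

 st-ok : ∀ {x y} → x ≡ y → y < 2 ^ w → y < PB2 → x < 2 ^ w × ⊤ × x < PB2 × Fits
 st-ok refl p q = p , tt , q , fits

 ld-ok : ∀ {x y} → x ≡ y → y < 2 ^ w → y < PB2 → x < 2 ^ w × x < PB2 × Fits
 ld-ok refl p q = p , q , fits

 j<PB : ∀ b {j} → b ≤ 2 → j ≤ K → b * suc K + j < PB2
 j<PB b {j} b≤2 j≤K = =≥ (+-suc (b * suc K) j) » +≤+ (*ˡ≤ (suc K) b≤2) (s≤s j≤K) » =≤ (e K)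
  where
  e : ∀ K → 2 * suc K + suc K ≡ 3 * suc K
  e = ring

 sp<PB : ∀ {j} → j ≤ K → j < PB2
 sp<PB = j<PB 0 z≤n

 xA≡ : xA ≡ 1 * suc K
 xA≡ = sym (*-identityˡ (suc K))

 x<PB : ∀ {j} → j ≤ K → xA + j < PB2
 x<PB {j} j≤K = subst (λ z → z + j < PB2) (sym xA≡) (j<PB 1 z<s j≤K)

 b<PB : ∀ {j} → j ≤ K → bA + j < PB2
 b<PB = j<PB 2 ≤-refl

 x<w : ∀ {j} → j ≤ K → xA + j < 2 ^ w
 x<w {j} j≤K = subst (λ z → z + j < 2 ^ w) (sym xA≡) (lin 0 1 z≤n z<s j≤K)

 b<w : ∀ {j} → j ≤ K → bA + j < 2 ^ w
 b<w = lin 0 2 z≤n (s≤s z<s)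

 in<NR : ∀ {j} → j ≤ K → inP + j < NR2
 in<NR j≤K = +ʳ< 3 (s≤s j≤K » m≤m+n (suc K) _)

 in<w : ∀ {j} → j ≤ K → inP + j < 2 ^ w
 in<w j≤K = lin 3 0 ≤! z≤n j≤K

 st<NR : ∀ {j} → j ≤ K → stP + j < NR2
 st<NR {j} j≤K = +ʳ< 3 (=≥ (+-suc (suc K) j) » +ʳ≤ (suc K) (s≤s j≤K) » +ʳ≤ (suc K) (m≤m+n (suc K) 0))

 st<w : ∀ {j} → j ≤ K → stP + j < 2 ^ w
 st<w {j} j≤K = subst (λ z → 3 + z + j < 2 ^ w) (*-identityˡ (suc K)) (lin 3 1 ≤! z<s j≤K)

 plane<NR : ∀ {r} → r ≤ 3 → r < NR2
 plane<NR r≤3 = s≤s r≤3 » m<m+n 3 z<s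

 mark-ok : ∀ {r b x} {v : Fin n} → r ≤ 3 → b < 2 → x ≡ ν v → r < 2 ^ w × ⊤ × 1 < 2 ^ w × b < 2 ^ w × r < NR2 × x ≤ n × 1 ≤ w × b < 2 ^ 1 × Fits
 mark-ok r≤ b< x≡ = lit≤ _ (r≤ » ≤!) , tt , lit! , lit≤ _ (<⇒≤ (b< » ≤!)) , plane<NR r≤ , num≤n x≡ , w>0 , b< , fits

 test-ok : ∀ {r x} {v : Fin n} → r ≤ 3 → x ≡ ν v → r < 2 ^ w × ⊤ × 1 < 2 ^ w × r < NR2 × x ≤ n × 1 ≤ w × Fits
 test-ok r≤ x≡ = lit≤ _ (r≤ » ≤!) , tt , lit! , plane<NR r≤ , num≤n x≡ , w>0 , fits

 record Cleared (r : ℕ) (s s' : State R2) : Set where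
  field
   frame : Frame 32 s s'
   lev≡ : lev s' ≡ lev s
   sl≡ : sl s' ≡ sl s
   out≡ : out s' ≡ out s
   ticks≡ : ticks s' ≡ n + ticks s
   others : ∀ r' o → r' ≢ r → pl s' r' o ≡ pl s r' o
   cleared : ∀ (v : Fin n) → pl s' r (ν v) ≡ false
  kept = below frame

 -- The number of the plane may depend on a register. It only has to survive the loop, which
 -- modifies no register except `CO`, the register 32.
 clear-spec : ∀ A r s → r < NR2 → (∀ s' → Frame 32 s s' → okO A s' × valO A s' ≡ r) → Runs (clear A) s (Cleared r s)
 clear-spec A r s r< hA =
  let (s' , ex , f , l , σ , o , t , oth , cl) = go n s1 refl ≤-refl (λ x x<32 → upd-frame {32} (reg s) CO n refl x x<32)
  in s' , blk (tt , tt) ▸ ex , record { frame = f; lev≡ = l; sl≡ = σ; out≡ = o; ticks≡ = t; others = λ r' o r'≢r → oth r' o (inl r'≢r)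
   ; cleared = λ v → cl (ν v) z<s (ν≤n v) }
  where
  s1 = eff2 (getN CO) s
  go : ∀ c t → reg t CO ≡ c → c ≤ n → Frame 32 s t → Σ[ s' ∈ State R2 ] Exec (loop skip CO (block (WR A (var CO) (lit 1) (lit 0) ∷ alu sub CO (var CO) (lit 1) ∷ []))) t s' ×
   Frame 32 s s' × lev s' ≡ lev t × sl s' ≡ sl t × out s' ≡ out t × ticks s' ≡ c + ticks t ×
   (∀ r' o → r' ≢ r ⊎ c < o → pl s' r' o ≡ pl t r' o) × (∀ o → 1 ≤ o → o ≤ c → pl s' r o ≡ false)
  go zero t e c≤n f = t , stop (blk tt) e , f , refl , refl , refl , refl , (λ _ _ _ → refl) , λ o 1≤o o≤0 → ⊥! (<⇒≱ 1≤o o≤0)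
  go (suc c) t e c≤n f =
   let (s' , ex , f' , l , σ , o , tk , oth , cl) = go c (tick t-1) (cong (_∸ 1) e) (n≤1+n c » c≤n)
        (λ x x<32 → upd-frame {32} (reg t) CO _ refl x x<32 · f x x<32)
   in s' ,
    again (blk tt) (≢0 e) (blk ((okA , tt , lit! , lit! , ≡< valA r< , ≡≤ e c≤n , w>0 , z<s , fits) , (tt , lit! , subst (1 ≤_) (sym e) z<s) , tt)) ex ,
    f' , l , σ , o , tk · +-suc c _ ,
    (λ { r' o (inl r'≢r) → oth r' o (inl r'≢r) · wrP-plane (pl t) (valO A t) (reg t CO) 1 0 r' o (λ e → r'≢r (sym e · valA)) ; r' o (inr sc<o) → oth r' o (inr (<-trans (n<1+n c) sc<o)) ·
      wrP-above (pl t) (valO A t) (reg t CO) 1 0 r' o (=≤ (cong (_+ 1) e · +-comm (suc c) 1) » sc<o) }) ,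
    last s' (λ o c<o → oth r o (inr c<o)) cl
   where
   okA = fst (hA t f)
   valA = snd (hA t f)
   t-1 = runs (WR A (var CO) (lit 1) (lit 0) ∷ alu sub CO (var CO) (lit 1) ∷ []) t
   last : ∀ s' → (∀ o → c < o → pl s' r o ≡ pl t-1 r o) → (∀ o → 1 ≤ o → o ≤ c → pl s' r o ≡ false) → ∀ o → 1 ≤ o → o ≤ suc c → pl s' r o ≡ false
   last s' oth cl o 1≤o o≤ with o ≟ suc c
   ... | no o≢ = cl o 1≤o (≤-pred (≤∧≢⇒< o≤ o≢))
   ... | yes refl = oth (suc c) (n<1+n c) · cong₂ (λ a b → wrP (pl t) a b 1 0 r (suc c)) valA e · cong (wrP (pl t) r (suc c) 1 0 r) (sym (+0 (suc c))) · wrP-inside (pl t) r (suc c) 1 0 0 z<s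

 record Levels (s : State R2) : Set where
  field lengths : ∀ {j} → j ≤ K → lev s (bA + j) ≡ bb j
 open Levels public

 outdeg-ask : ∀ {x} p → x ≡ ν p → answer kind G (outdegQ kind) x 0 ≡ just (outdeg p)
 outdeg-ask p e = cong (λ x → answer kind G (outdegQ kind) x 0) e · ans-outdeg kind G p 0

 indeg-ask : ∀ {x} p → x ≡ ν p → answer kind G (indegQ kind) x 0 ≡ just (indeg p)
 indeg-ask p e = cong (λ x → answer kind G (indegQ kind) x 0) e · ans-indeg kind G p 0

 outhead-ask : ∀ {x y} p i → x ≡ ν p → y ≡ toℕ i → answer kind G (outheadQ kind) x y ≡ just (ν (outhead p i))
 outhead-ask p i e e' = cong₂ (answer kind G (outheadQ kind)) e e' · ans-outhead kind G p i

 outmate-ask : ∀ {x y} p i → x ≡ ν p → y ≡ toℕ i → answer kind G (outmateQ kind) x y ≡ just (toℕ (outmate p i))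
 outmate-ask p i e e' = cong₂ (answer kind G (outmateQ kind)) e e' · ans-outmate kind G p i

 inhead-ask : ∀ {x y} p i → x ≡ ν p → y ≡ toℕ i → answer kind G (inheadQ kind) x y ≡ just (ν (inhead p i))
 inhead-ask p i e e' = cong₂ (answer kind G (inheadQ kind)) e e' · ans-inhead kind G p i

 inmate-ask : ∀ {x y} p i → x ≡ ν p → y ≡ toℕ i → answer kind G (inmateQ kind) x y ≡ just (toℕ (inmate p i))
 inmate-ask p i e e' = cong₂ (answer kind G (inmateQ kind)) e e' · ans-inmate kind G p i

 outdeg<w : ∀ p → outdeg p < 2 ^ w
 outdeg<w p = n<w (outdeg≤n (net kind G) p)

 indeg<w : ∀ p → indeg p < 2 ^ w
 indeg<w p = n<w (indeg≤n (net kind G) p)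

 ν<w : ∀ (p : Fin n) → ν p < 2 ^ w
 ν<w p = n<w (ν≤n p)

 pos<w : ∀ {p} (i : Fin (outdeg p)) → toℕ i < 2 ^ w
 pos<w {p} i = <-trans (toℕ<n i) (outdeg<w p)

 rpos<w : ∀ {p} (i : Fin (indeg p)) → toℕ i < 2 ^ w
 rpos<w {p} i = <-trans (toℕ<n i) (indeg<w p)

 gap≤n : ∀ j p → gap j p ≤ n
 gap≤n j p = begin
  outdeg p /2^ bb j + 1 ≤⟨ +ˡ≤ 1 (/-monoʳ-≤ (outdeg p) {{m^n≢0 2 (bb j)}} (^-monoʳ-≤ 2 (bb>0 j)) » /-monoˡ-≤ 2 (outdeg≤n (net kind G) p)) ⟩
  n / 2 + 1 ≤⟨ half+1 n n≥2 ⟩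
  n ∎
  where
  open ≤-Reasoning
  n≥2 : 2 ≤ n
  n≥2 = s≤s z<s » m≤n+m 4 (K + L) » K+L+4≤n
  half+1 : ∀ m → 2 ≤ m → m / 2 + 1 ≤ m
  half+1 m 2≤m = =≤ (+-comm (m / 2) 1) » m/n<m m 2 {{>-nonZero (z<s » 2≤m)}} (s≤s z<s)

 record EdgeIn (e : Edge) (j : ℕ) (s : State R2) : Set where
  constructor edge-in
  field
   atY : reg s PY ≡ ν (tl e)
   atI : reg s PI ≡ toℕ (snd e)
   atZ : reg s PZ ≡ ν (hd e)
   atJ : reg s LEV ≡ j

 record Params (e : Edge) (j : ℕ) (s s' : State R2) : Set where
  field
   still : Quiet 27 s s'
   tick≡ : ticks s' ≡ ticks s
   fl≡ : reg s' FL ≡ fl j e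
   fv≡ : reg s' FV ≡ fv j e

 min-true : ∀ {b D} → (b <ᵇ D) ≡ true → b ⊓ D ≡ b
 min-true {b} {D} e = m≤n⇒m⊓n≡m (<⇒≤ (<ᵇ⇒< b D (subst T (sym e) tt)))

 min-false : ∀ {b D} → (b <ᵇ D) ≡ false → b ⊓ D ≡ D
 min-false e = m≥n⇒m⊓n≡n (≮⇒≥ (λ b<D → subst T e (<⇒<ᵇ b<D)))

 params-finish : ∀ {e j} s b D → reg s F3 ≡ b → reg s F2 ≡ D → fl j e ≡ b ⊓ D → reg s FV ≡ fv j e →
  Runs (block (alu lt F1 (var F3) (var F2) ∷ []) ⨾ ifnz F1 (block (mov FL (var F3) ∷ [])) (block (mov FL (var F2) ∷ []))) s (Params e j s)
 params-finish s b D refl refl fl≡ fv≡ with reg s F3 <ᵇ reg s F2 in lt≡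
 ... | true = runs (mov FL (var F3) ∷ []) s1 , blk ((tt , tt , tt) , tt) ▸ ifT (≢0 (cong bit lt≡)) (blk (tt , tt)) ,
  record { still = runs-quiet {27} (alu lt F1 (var F3) (var F2) ∷ mov FL (var F3) ∷ []) s refl; tick≡ = refl
   ; fl≡ = sym (fl≡ · min-true lt≡); fv≡ = fv≡ }
  where
  s1 = runs (alu lt F1 (var F3) (var F2) ∷ []) s
 ... | false = runs (mov FL (var F2) ∷ []) s1 , blk ((tt , tt , tt) , tt) ▸ ifF (cong bit lt≡) (blk (tt , tt)) ,
  record { still = runs-quiet {27} (alu lt F1 (var F3) (var F2) ∷ mov FL (var F2) ∷ []) s refl; tick≡ = refl
   ; fl≡ = sym (fl≡ · min-false lt≡); fv≡ = fv≡ }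
  where
  s1 = runs (alu lt F1 (var F3) (var F2) ∷ []) s

 params-spec : ∀ e j s → j ≤ K → EdgeIn e j s → Levels s → Runs params s (Params e j s)
 params-spec e@(p , i) j s j≤K (edge-in atY atI atZ refl) lv with reg s LEV ≡ᵇ K in isK
 ... | true =
  let b = bb (reg s LEV)
      D = indeg (hd e)
      ps = ask (indegQ kind) F2 (var PZ) (lit 0) ∷ LD F3 (off bA LEV) ∷ ask (outmateQ kind) FV (var PY) (var PI) ∷ []
      s1 = runs (alu eq F1 (var LEV) (lit K) ∷ []) s
      s2 = runs ps s1
      (s' , ex , res) = params-finish {e} {reg s LEV} s2 b D (lengths lv j≤K) (cong (fromMaybe 0) (indeg-ask (hd e) atZ)) (cong (λ z → b ⊓ (if z then indeg (hd e) else outdeg p)) isK)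
       (cong (fromMaybe 0) (outmate-ask p i atY atI) · sym (if-true isK))
  in s' ,
   (blk ((tt , K<w , tt) , tt) ▸ (ifT (≢0 (cong bit isK)) (blk ((tt , lit! , D , indeg-ask (hd e) atZ , indeg<w (hd e)) , (b<w j≤K , b<PB j≤K , fits) ,
     (tt , tt , toℕ (outmate p i) , outmate-ask p i atY atI , rpos<w (outmate p i)) , tt)) ▸ ex)) ,
   record { still = quiet-trans (runs-quiet {27} (alu eq F1 (var LEV) (lit K) ∷ ps) s refl) (Params.still res)
    ; tick≡ = Params.tick≡ res; fl≡ = Params.fl≡ res; fv≡ = Params.fv≡ res }
 ... | false =
  let b = bb (reg s LEV)
      D = outdeg p
      ps = ask (outdegQ kind) F2 (var PY) (lit 0) ∷ LD F3 (off bA LEV) ∷ alu shr F1 (var F2) (var F3) ∷ alu add F1 (var F1) (lit 1) ∷ alu quo FV (var PI) (var F1) ∷ []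
      s1 = runs (alu eq F1 (var LEV) (lit K) ∷ []) s
      s2 = runs ps s1
      D≡ = cong (fromMaybe 0) (outdeg-ask p atY)
      gap≡ = cong₂ (λ d b → d /2^ b + 1) D≡ (lengths lv j≤K)
      (s' , ex , res) = params-finish {e} {reg s LEV} s2 b D (lengths lv j≤K) D≡ (cong (λ z → b ⊓ (if z then indeg (hd e) else outdeg p)) isK) (cong₂ div atI gap≡ · sym (if-false isK))
  in s' ,
   (blk ((tt , K<w , tt) , tt) ▸ (ifF (cong bit isK) (blk ((tt , lit! , D , outdeg-ask p atY , outdeg<w p) , (b<w j≤K , b<PB j≤K , fits) , (tt , tt , tt) ,
     (tt , lit! , ≡< gap≡ (n<w (gap≤n (reg s LEV) p))) , (tt , tt , tt) , tt)) ▸ ex)) ,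
   record { still = quiet-trans (runs-quiet {27} (alu eq F1 (var LEV) (lit K) ∷ ps) s refl) (Params.still res)
    ; tick≡ = Params.tick≡ res; fl≡ = Params.fl≡ res; fv≡ = Params.fv≡ res }

 σ0 : SearchState n
 σ0 = ⟨ allFin n , [] , Vec.replicate n white , [] ⟩

 init-ticks : ℕ
 init-ticks = L + K * suc L + 3 * n + K * (n + 1)

 -- What is allowed apart from the walks that rebuild levels.
 B0 : ℕ
 B0 = init-ticks + (sumF (λ v → (2 * K + 1) * (outdeg v + 1) + outdeg v) + (K + 1) * n)

 -- A stack of fields of various lengths without separators: the fields of the edges below determine
 -- the offset, and each length follows from the edge.
 Enc : (ℕ → Bool) → ℕ → List Edge → Set
 Enc f j [] = ⊤
 Enc f j (e ∷ es) = num f (size j es) (fl j e) ≡ fv j e × Enc f j es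

 Enc0 : (ℕ → ℕ) → List Edge → Set
 Enc0 f [] = ⊤
 Enc0 f (e ∷ es) = f (ν (tl e)) ≡ fv 0 e × Enc0 f es

 Marks : (ℕ → Bool) → List Edge → Set
 Marks f z = ∀ v → f (ν v) ≡ membF v (heads z)

 Stored : State R2 → ℕ → List Edge → Set
 Stored s zero z = Enc0 (sl s) z
 Stored s (suc j) z = Enc (pl s (stP + suc j)) (suc j) z

 enc-cong : ∀ f g j z → (∀ o → o < size j z → g o ≡ f o) → Enc f j z → Enc g j z
 enc-cong f g j [] h _ = tt
 enc-cong f g j (e ∷ es) h (eqn , r) = num-cong g f (size j es) (fl j e) (λ i i< → h (size j es + i) (+ʳ< (size j es) i< » =≤ (+-comm (size j es) (fl j e)))) · eqn ,
  enc-cong f g j es (λ o o< → h o (o< » m≤n+m _ (fl j e))) r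

 enc-push : ∀ f r j e z → j ≤ K → Enc (f r) j z → Enc (wrP f r (size j z) (fl j e) (fv j e) r) j (e ∷ z)
 enc-push f r j e z j≤K enc = num-wr-same f r (size j z) (fl j e) (fv j e) (fv-< j e j≤K) , enc-cong (f r) _ j z (λ o o< → wrP-below f r (size j z) (fl j e) (fv j e) r o o<) enc

 enc-ʳ++ : ∀ f j xs {ys} → Enc f j (xs ʳ++ ys) → Enc f j ys
 enc-ʳ++ f j [] h = h
 enc-ʳ++ f j (x ∷ xs) h = snd (enc-ʳ++ f j xs h)

 enc0-ʳ++ : ∀ f xs {ys} → Enc0 f (xs ʳ++ ys) → Enc0 f ys
 enc0-ʳ++ f [] h = h
 enc0-ʳ++ f (x ∷ xs) h = snd (enc0-ʳ++ f xs h)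

 stored-ʳ++ : ∀ s j xs {ys} → Stored s j (xs ʳ++ ys) → Stored s j ys
 stored-ʳ++ s zero xs = enc0-ʳ++ (sl s) xs
 stored-ʳ++ s (suc j) xs = enc-ʳ++ (pl s (stP + suc j)) (suc j) xs

 size-ʳ++ : ∀ j xs {ys} → size j ys ≤ size j (xs ʳ++ ys)
 size-ʳ++ j [] = ≤-refl
 size-ʳ++ j (x ∷ xs) = m≤n+m _ (fl j x) » size-ʳ++ j xs

 -- Recovering the next edge of a zone

 record Approx (ℓ : ℕ) (e : Edge) (lo : List Edge) (s s' : State R2) : Set where
  field
   still : Quiet 14 s s'
   tick≡ : ticks s' ≡ ticks s
   AA≡ : reg s' AA ≡ div (toℕ (snd e)) (gap ℓ (tl e)) * gap ℓ (tl e)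
   QQ≡ : ℓ ≢ 0 → reg s' QQ ≡ size ℓ (e ∷ lo)

 fl-low : ∀ {ℓ} e → ℓ < K → fl ℓ e ≡ bb ℓ ⊓ outdeg (tl e)
 fl-low {ℓ} e ℓ<K = cong (λ z → bb ℓ ⊓ (if z then indeg (hd e) else outdeg (tl e))) (≡ᵇ-≢ ℓ K (<⇒≢ ℓ<K))

 fv-low : ∀ {ℓ} e → ℓ < K → fv ℓ e ≡ div (toℕ (snd e)) (gap ℓ (tl e))
 fv-low {ℓ} e ℓ<K = if-false (≡ᵇ-≢ ℓ K (<⇒≢ ℓ<K))

 quot-gap≤ : ∀ ℓ (e : Edge) → div (toℕ (snd e)) (gap ℓ (tl e)) * gap ℓ (tl e) ≤ toℕ (snd e)
 quot-gap≤ ℓ e = m≤m+n _ _ » =≥ (quot+rem (toℕ (snd e)) (gap ℓ (tl e)) (gap>0 ℓ (tl e)))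

 mul-finish : ∀ {s} e ℓ → reg s AA ≡ div (toℕ (snd e)) (gap ℓ (tl e)) → reg s GG ≡ gap ℓ (tl e) →
  oks (alu mul AA (var AA) (var GG) ∷ []) s × reg s AA * reg s GG ≡ div (toℕ (snd e)) (gap ℓ (tl e)) * gap ℓ (tl e)
 mul-finish e ℓ a g = ((tt , tt , ≡< (cong₂ _*_ a g) (s≤s (quot-gap≤ ℓ e) » pos<w (snd e))) , tt) , cong₂ _*_ a g

 approx-spec : ∀ ℓ e lo s → ℓ < K → reg s YY ≡ ν (tl e) → reg s ELL ≡ ℓ → (ℓ ≢ 0 → reg s QQ ≡ size ℓ lo × size ℓ (e ∷ lo) ≤ n) →
  Stored s ℓ (e ∷ lo) → Levels s → Runs approx s (Approx ℓ e lo s)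
 approx-spec ℓ e lo s ℓ<K Y≡ refl hQ stored lv = cases (reg s ELL) refl hQ stored
  where
  p = tl e
  ps1 = ask (outdegQ kind) DD (var YY) (lit 0) ∷ LD BB (off bA ELL) ∷ alu shr GG (var DD) (var BB) ∷ alu add GG (var GG) (lit 1) ∷ []
  s1 = runs ps1 s
  b = bb (reg s ELL)
  ℓ≤K = <⇒≤ ℓ<K
  D≡ : reg s1 DD ≡ outdeg p
  D≡ = cong (fromMaybe 0) (outdeg-ask p Y≡)
  B≡ = lengths lv ℓ≤K
  G≡ : reg s1 GG ≡ gap (reg s ELL) p
  G≡ = cong₂ (λ d b → d /2^ b + 1) D≡ B≡
  ok-1 : oks ps1 s
  ok-1 = (tt , lit! , outdeg p , outdeg-ask p Y≡ , outdeg<w p) , (b<w ℓ≤K , b<PB ℓ≤K , fits) , (tt , tt , tt) , (tt , lit! , ≡< G≡ (n<w (gap≤n (reg s ELL) p))) , tt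
  Result = Runs approx s (Approx (reg s ELL) e lo s)
  last-mul = alu mul AA (var AA) (var GG) ∷ []
  high : ∀ {ℓ'} → reg s ELL ≡ suc ℓ' → (s3 : State R2) (ps : Block) →
   Exec (block (alu lt LN (var BB) (var DD) ∷ []) ⨾ ifnz LN (block (mov LN (var BB) ∷ [])) (block (mov LN (var DD) ∷ []))) s1 s3 →
   Quiet 14 s s3 → ticks s3 ≡ ticks s → reg s3 GG ≡ gap (reg s ELL) p → reg s3 LN ≡ fl (reg s ELL) e → reg s3 QQ ≡ reg s QQ → reg s3 ELL ≡ reg s ELL →
   (reg s QQ ≡ size (reg s ELL) lo × size (reg s ELL) (e ∷ lo) ≤ n) →
   num (pl s (stP + reg s ELL)) (size (reg s ELL) lo) (fl (reg s ELL) e) ≡ fv (reg s ELL) e → Result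
  high {ℓ'} ell≡ s3 _ ex q tk G3 L3 Q3 E3 (Q≡ , fits') field≡ =
   let rd = RD AA (off stP ELL) (var QQ) (var LN) ∷ alu add QQ (var QQ) (var LN) ∷ []
       s4 = runs rd s3
       A4 : num (pl s3 (stP + reg s3 ELL)) (reg s3 QQ) (reg s3 LN) ≡ div (toℕ (snd e)) (gap (reg s ELL) p)
       A4 = cong (λ f → num (f (stP + reg s3 ELL)) (reg s3 QQ) (reg s3 LN)) (Quiet.pl≡ q) · cong (λ z → num (pl s (stP + z)) (reg s3 QQ) (reg s3 LN)) E3 ·
         cong₂ (num (pl s (stP + reg s ELL))) (Q3 · Q≡) L3 · field≡ · fv-low e ℓ<K
       sum≡ : reg s3 QQ + reg s3 LN ≡ size (reg s ELL) (e ∷ lo)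
       sum≡ = (cong₂ _+_ (Q3 · Q≡) L3) · +-comm (size (reg s ELL) lo) _
       (okm , val) = mul-finish {s4} e (reg s ELL) A4 G3
   in runs last-mul s4 ,
    blk ok-1 ▸ (ifT (≢0 ell≡) (ex ▸ blk ((subst (λ z → stP + z < 2 ^ w) (sym E3) (st<w ℓ≤K) , tt , tt , subst (λ z → stP + z < NR2) (sym E3) (st<NR ℓ≤K) ,
      ≡≤ (Q3 · Q≡) (m≤n+m _ (fl (reg s ELL) e) » fits') ,
      ≡≤ L3 (fl≤bb (reg s ELL) e » bb≤L (reg s ELL) » L≤w) , fits) ,
      (tt , tt , ≡< sum≡ (n<w fits')) , tt)) ▸ blk okm) ,
    record { still = quiet-trans q (runs-quiet {14} (rd ++ last-mul) s3 refl); tick≡ = tk; AA≡ = val; QQ≡ = λ _ → sum≡ }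
  field-at : ∀ {ℓ'} ℓ → ℓ ≡ suc ℓ' → Stored s ℓ (e ∷ lo) → num (pl s (stP + ℓ)) (size ℓ lo) (fl ℓ e) ≡ fv ℓ e
  field-at _ refl = fst
  cases : ∀ ℓ' → reg s ELL ≡ ℓ' → (reg s ELL ≢ 0 → reg s QQ ≡ size (reg s ELL) lo × size (reg s ELL) (e ∷ lo) ≤ n) → Stored s (reg s ELL) (e ∷ lo) → Result
  cases zero ell≡ _ st' =
   let s2 = runs (RD0 AA (var YY) (var BB) ∷ []) s1
       A2 : sl s (reg s YY) ≡ div (toℕ (snd e)) (gap (reg s ELL) p)
       A2 = cong (sl s) Y≡ · fst (subst (λ z → Stored s z (e ∷ lo)) ell≡ st') · cong (λ z → fv z e) (sym ell≡) · fv-low e ℓ<K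
       (okm , val) = mul-finish {s2} e (reg s ELL) A2 G≡
   in runs last-mul s2 ,
    blk ok-1 ▸ (ifF ell≡ (blk ((tt , tt , num≤n Y≡ , B≡ · cong bb ell≡ , fits) , tt)) ▸ blk okm) ,
    record { still = runs-quiet {14} (ps1 ++ RD0 AA (var YY) (var BB) ∷ last-mul) s refl; tick≡ = refl; AA≡ = val
     ; QQ≡ = λ h → ⊥! (h ell≡) }
  cases (suc ℓ') ell≡ hQ' st' with reg s1 BB <ᵇ reg s1 DD in lt≡
  ... | true =
   let lts = alu lt LN (var BB) (var DD) ∷ []
       mvs = mov LN (var BB) ∷ []
       LN≡ : reg s1 BB ≡ fl (reg s ELL) e
       LN≡ = sym (min-true lt≡) · (cong₂ _⊓_ B≡ D≡) · sym (fl-low e ℓ<K)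
   in high ell≡ (runs mvs (runs lts s1)) [] (blk ((tt , tt , tt) , tt) ▸ ifT (≢0 (cong bit lt≡)) (blk (tt , tt)))
    (runs-quiet {14} (ps1 ++ lts ++ mvs) s refl) refl G≡ LN≡ refl refl (hQ' (≢0 ell≡)) (field-at (reg s ELL) ell≡ st')
  ... | false =
   let lts = alu lt LN (var BB) (var DD) ∷ []
       mvs = mov LN (var DD) ∷ []
       LN≡ : reg s1 DD ≡ fl (reg s ELL) e
       LN≡ = sym (min-false lt≡) · (cong₂ _⊓_ B≡ D≡) · sym (fl-low e ℓ<K)
   in high ell≡ (runs mvs (runs lts s1)) [] (blk ((tt , tt , tt) , tt) ▸ ifF (cong bit lt≡) (blk (tt , tt)))
    (runs-quiet {14} (ps1 ++ lts ++ mvs) s refl) refl G≡ LN≡ refl refl (hQ' (≢0 ell≡)) (field-at (reg s ELL) ell≡ st')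

 record Scan (e : Edge) (d : ℕ) (s s' : State R2) : Set where
  field
   still : Quiet 15 s s'
   tick≡ : ticks s' ≡ d + ticks s
   AA≡ : reg s' AA ≡ toℕ (snd e)
   ZZ≡ : reg s' ZZ ≡ ν (hd e)

 scan-spec : ∀ ℓ e (zone lo : List Edge) d s → ℓ ≤ K → reg s YY ≡ ν (tl e) → reg s ELL ≡ ℓ → d + reg s AA ≡ toℕ (snd e) → Marks (pl s (inP + ℓ)) zone → Marks (pl s visP) lo →
  (∀ j → toℕ j < toℕ (snd e) → candidate zone lo (outhead (tl e) j) ≡ false) → candidate zone lo (hd e) ≡ true →
  Runs scan s (Scan e d s)
 scan-spec ℓ e zone lo d s ℓ≤K Y≡ refl A≡ marks vis none found = go d A≡
  where
  p = tl e
  i = snd e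
  ps = ask (outheadQ kind) ZZ (var YY) (var AA) ∷ RD T1 (off inP ELL) (var ZZ) (lit 1) ∷ RD DD (lit visP) (var ZZ) (lit 1) ∷ alu lt T1 (var DD) (var T1) ∷ alu eq T1 (var T1) (lit 0) ∷ []
  s1 = runs ps s
  probe : ∀ j → toℕ j ≡ reg s AA → oks ps s × reg s1 ZZ ≡ ν (outhead p j) × reg s1 T1 ≡ bit (not (candidate zone lo (outhead p j)))
  probe j j≡ = ((tt , tt , ν v , ask≡ , ν<w v) , (in<w ℓ≤K , tt , lit! , in<NR ℓ≤K , num≤n Z≡ , w>0 , fits) , test-ok ≤! Z≡ , (tt , tt , tt) , (tt , lit! , tt) , tt) , Z≡ , T≡
   where
   v = outhead p j
   ask≡ = outhead-ask p j Y≡ (sym j≡)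
   Z≡ : fromMaybe 0 (answer kind G (outheadQ kind) (reg s YY) (reg s AA)) ≡ ν v
   Z≡ = cong (fromMaybe 0) ask≡
   T≡ : reg s1 T1 ≡ bit (not (candidate zone lo v))
   T≡ = begin
    reg s1 T1
     ≡⟨ cong₂ (λ a b → bit (bit (a <ᵇ b) ≡ᵇ 0)) (num-1 (pl s visP) (reg s1 ZZ) · cong bit (cong (pl s visP) Z≡ · vis v)) (num-1 (pl s (inP + reg s ELL)) (reg s1 ZZ) · cong bit (cong (pl s (inP + reg s ELL)) Z≡ · marks v)) ⟩
    bit (bit (bit (membF v (heads lo)) <ᵇ bit (membF v (heads zone))) ≡ᵇ 0)
     ≡⟨ cong (λ z → bit (bit z ≡ᵇ 0)) (bit-<ᵇ (membF v (heads lo)) (membF v (heads zone))) ⟩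
    bit (bit (candidate zone lo v) ≡ᵇ 0)
     ≡⟨ cong bit (bit-≡ᵇ0 (candidate zone lo v)) ⟩
    bit (not (candidate zone lo v)) ∎
    where open ≡-Reasoning
  go : ∀ d → d + reg s AA ≡ toℕ i → Runs scan s (Scan e d s)
  go zero A≡ = s1 , stop (blk (fst (probe i (sym A≡)))) (snd (snd (probe i (sym A≡))) · cong (λ z → bit (not z)) found) ,
   record { still = runs-quiet {15} ps s refl; tick≡ = refl; AA≡ = A≡; ZZ≡ = fst (snd (probe i (sym A≡))) }
  go (suc d) A≡ =
   let j<i : reg s AA < toℕ i
       j<i = s≤s (m≤n+m (reg s AA) d) » =≤ A≡
       j = fromℕ< (<-trans j<i (toℕ<n i))
       j≡ : toℕ j ≡ reg s AA
       j≡ = toℕ-fromℕ< (<-trans j<i (toℕ<n i))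
       (ok-1 , _ , T≡) = probe j j≡
       s2 = runs (alu add AA (var AA) (lit 1) ∷ []) s1
       (s' , ex , r) = scan-spec ℓ e zone lo d (tick s2) ℓ≤K Y≡ refl (cong (d +_) (+-comm (reg s AA) 1) · +-suc d (reg s AA) · A≡) marks vis none found
   in s' , again (blk ok-1) (λ z → 1+n≢0 (sym (T≡ · cong (λ z → bit (not z)) (none j (≡< j≡ j<i))) · z))
    (blk ((tt , lit! , (s≤s (=≤ (+-comm (reg s AA) 1)) » s≤s j<i » pos<w i)) , tt)) ex ,
    record { still = quiet-trans (runs-quiet {15} (ps ++ alu add AA (var AA) (lit 1) ∷ []) s refl) (from-tick (Scan.still r))
     ; tick≡ = Scan.tick≡ r · +-suc d (ticks s); AA≡ = Scan.AA≡ r; ZZ≡ = Scan.ZZ≡ r }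
   where
   from-tick : ∀ {t t'} → Quiet 15 (tick t) t' → Quiet 15 t t'
   from-tick (quiet a b c d e) = quiet a b c d e

 -- A level in memory and the walk that rebuilds it

 quarter : ℕ
 quarter = div n 4

 -- `x` is the bottom end of the zone, where walks begin. Level 0 has no stack pointer, so `room`
 -- concerns the levels above it.
 record Level (s : State R2) (j : ℕ) (z : List Edge) (u x : Fin n) : Set where
  constructor level
  field
   chainL : Chain u z x
   start : lev s (xA + j) ≡ ν x
   marks : Marks (pl s (inP + j)) z
   stored : Stored s j z
   room : j ≢ 0 → lev s (spA + j) ≡ size j z × size j z ≤ n

 in≢st : ∀ {i j} → i ≤ K → inP + i ≢ stP + j
 in≢st {i} {j} i≤K e = <⇒≢ (+ʳ< 3 (s≤s i≤K) » m≤m+n (3 + suc K) j) e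

 in-inj : ∀ {i j} → i ≢ j → inP + i ≢ inP + j
 in-inj h e = h (+-cancelˡ-≡ inP _ _ e)

 st-inj : ∀ {i j} → i ≢ j → stP + i ≢ stP + j
 st-inj h e = h (+-cancelˡ-≡ stP _ _ e)

 in≢low : ∀ {r} j → r < 3 → inP + j ≢ r
 in≢low j r<3 e = <⇒≢ (r<3 » m≤m+n 3 j) (sym e)

 st≢low : ∀ {r} j → r < 3 → stP + j ≢ r
 st≢low j r<3 e = <⇒≢ (r<3 » m≤m+n 3 (suc K) » m≤m+n _ j) (sym e)

 sp≢x : ∀ {i j} → i ≤ K → spA + i ≢ xA + j
 sp≢x {i} {j} i≤K e = <⇒≢ (s≤s i≤K » m≤m+n (suc K) j) e

 sp≢b : ∀ {i j} → i ≤ K → spA + i ≢ bA + j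
 sp≢b {i} {j} i≤K e = <⇒≢ (s≤s i≤K » m≤m+n (suc K) _ » m≤m+n bA j) e

 x≢b : ∀ {i j} → i ≤ K → xA + i ≢ bA + j
 x≢b {i} {j} i≤K e = <⇒≢ (+ʳ< (suc K) (s≤s i≤K) » +ʳ≤ (suc K) (m≤m+n (suc K) 0) » m≤m+n bA j) e

 x-inj : ∀ {i j} → i ≢ j → xA + i ≢ xA + j
 x-inj h e = h (+-cancelˡ-≡ xA _ _ e)

 -- What a walk that rebuilds level j may touch.
 planesOf wordsOf : ℕ → List ℕ
 planesOf j = visP ∷ inP + j ∷ stP + j ∷ []
 wordsOf j = spA + j ∷ xA + j ∷ []

 levels-change : ∀ {k rs j s s'} → j ≤ K → Change k rs (wordsOf j) s s' → Levels s → Levels s'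
 levels-change {j = j} j≤K c lv = record { lengths = λ {i} i≤K → Change.words c (bA + i) ((λ e → sp≢b j≤K (sym e)) ∷ (λ e → x≢b j≤K (sym e)) ∷ []) · lengths lv i≤K }

 stored-change : ∀ {s s'} j z → (∀ o → pl s' (stP + j) o ≡ pl s (stP + j) o) → sl s' ≡ sl s → Stored s j z → Stored s' j z
 stored-change zero z p σ h = subst (λ f → Enc0 f z) (sym σ) h
 stored-change (suc j) z p σ h = enc-cong _ _ (suc j) z (λ o _ → p o) h

 level-change : ∀ {k j ℓ z u x s s'} → Change k (planesOf j) (wordsOf j) s s' → ℓ ≢ j → ℓ ≤ K → j ≤ K → Level s ℓ z u x → Level s' ℓ z u x
 level-change {j = j} {ℓ} {z} c ℓ≢j ℓ≤K j≤K (level ch sr mk sd rm) = level ch (words (xA + ℓ) ((λ e → sp≢x j≤K (sym e)) ∷ x-inj ℓ≢j ∷ []) · sr)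
  (λ v → planes (inP + ℓ) (in≢low ℓ ≤! ∷ in-inj ℓ≢j ∷ in≢st ℓ≤K ∷ []) (ν v) · mk v)
  (stored-change ℓ z (planes (stP + ℓ) (st≢low ℓ ≤! ∷ (λ e → in≢st j≤K (sym e)) ∷ st-inj ℓ≢j ∷ [])) sl≡ sd)
  (λ ℓ≢0 → words (spA + ℓ) (ℓ≢j ∷ sp≢x ℓ≤K ∷ []) · fst (rm ℓ≢0) , snd (rm ℓ≢0))
  where open Change c

 level-quiet : ∀ {k j z u x s s'} → Quiet k s s' → Level s j z u x → Level s' j z u x
 level-quiet {j = j} {z} q (level ch sr mk sd rm) = level ch (lev≡ ∙ (xA + j) · sr) (λ v → pl≡ ∙ (inP + j) ∙ ν v · mk v) (stored-change j z (λ o → pl≡ ∙ (stP + j) ∙ o) sl≡ sd)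
  (λ h → lev≡ ∙ (spA + j) · fst (rm h) , snd (rm h))
  where open Quiet q

 to-stored : ∀ s j z → j ≢ 0 → Enc (pl s (stP + j)) j z → Stored s j z
 to-stored s zero z h _ = ⊥! (h refl)
 to-stored s (suc j) z h x = x

 to-enc : ∀ s j z → j ≢ 0 → Stored s j z → Enc (pl s (stP + j)) j z
 to-enc s zero z h _ = ⊥! (h refl)
 to-enc s (suc j) z h x = x

 marks-set : ∀ f f' e z → (∀ v → f' (ν v) ≡ (if ν (hd e) ≡ᵇ ν v then true else f (ν v))) → Marks f z → Marks f' (e ∷ z)
 marks-set f f' e z h mk v with v ≟ᶠ hd e
 ... | yes refl = h v · if-true (≡ᵇ-refl (ν v))
 ... | no v≢ = h v · if-false (≡ᵇ-≢ _ _ (λ e' → v≢ (sym (ν-inj e')))) · mk v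

 set-bit : ∀ f r o b v → wrP f r o 1 (bit b) r v ≡ (if o ≡ᵇ v then b else f r v)
 set-bit f r o b v = wrP-bit f r o b r v · cong (λ c → if c ∧ (o ≡ᵇ v) then b else f r v) (≡ᵇ-refl r)

 record Acc : Set where
  constructor acc
  field
   hi lo : ℕ
   zone : List Edge
   from : Fin n

 -- Cuts the fields into segments; `hi` counts the complete ones, and `lo` is the number of bits in
 -- the current one. The overshoot of the last field is forgotten, so a complete segment has at
 -- least `quarter` and less than `quarter + L` bits.
 tally : ℕ → ℕ → ℕ → ℕ × ℕ
 tally hi lo f = if lo + f <ᵇ quarter then (hi , lo + f) else (suc hi , 0)

 stepA : ℕ → ℕ → Acc → Edge → Acc
 stepA hf j (acc hi lo z x) e = acc (fst (tally hi lo (fl j e))) (snd (tally hi lo (fl j e))) (if hi <ᵇ hf then [] else e ∷ z) (if hi <ᵇ hf then hd e else x)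

 -- Everything that the iterations of a walk need to know about the accumulator, stated for the
 -- entire fold. It separates the execution of the walk from the arithmetic of the segments, which
 -- `fit1` and `fit2` do.
 Fit : ℕ → ℕ → Acc → List Edge → Set
 Fit hf j a [] = ⊤
 Fit hf j a@(acc hi lo z x) (e ∷ es) = ((hi < hf → z ≡ []) × (hf ≤ hi → size j (e ∷ z) ≤ n) × lo < quarter × hi < n) × Fit hf j (stepA hf j a e) es

 record Recorded (j : ℕ) (z : List Edge) (u x : Fin n) (s s' : State R2) : Set where
  field
   tick≡ : ticks s' ≡ ticks s
   ZZ≡ : reg s' ZZ ≡ reg s ZZ
   FL≡ : reg s' FL ≡ reg s FL
   chg : Change 15 (inP + j ∷ stP + j ∷ []) (wordsOf j) s s'
   levelR : Level s' j z u x

 record-spec : ∀ j hf hi e z x s → j ≤ K → j ≢ 0 → Level s j z (tl e) x → reg s ZZ ≡ ν (hd e) → reg s LEV ≡ j →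
  reg s FL ≡ fl j e → reg s FV ≡ fv j e → reg s HI ≡ hi → reg s HF ≡ hf → (hi < hf → z ≡ []) → (hf ≤ hi → size j (e ∷ z) ≤ n) →
  Runs record-edge s (Recorded j (if hi <ᵇ hf then [] else e ∷ z) (hd e) (if hi <ᵇ hf then hd e else x) s)
 record-spec j hf hi e z x s j≤K j≢0 (level ch sr mk sd rm) Z≡ refl FL≡ FV≡ refl refl drop-case push-case
  with reg s HI <ᵇ reg s HF in lt≡
 ... | true = s2 , (blk ((tt , tt , tt) , tt) ▸ ifT (≢0 (cong bit lt≡)) (blk ((x<w j≤K , tt , x<PB j≤K , fits) , tt))) , record { tick≡ = refl; ZZ≡ = refl; FL≡ = refl
  ; chg = change (runs-frame {15} ps s refl) (λ _ _ _ → refl) (λ { a (_ ∷ a≢ ∷ []) → updℕ-≢ (lev s) (xA + j0) _ a (≢-sym a≢) }) refl refl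
  ; levelR = level refl (updℕ-≡ (lev s) (xA + j0) (reg s ZZ) · Z≡) (subst (Marks (pl s (inP + j0))) z≡[] mk) (stored-change {s} {s2} j0 [] (λ _ → refl) refl (subst (Stored s j0) z≡[] sd))
   (λ h → updℕ-≢ (lev s) (xA + j0) (reg s ZZ) j0 (λ e → sp≢x j≤K (sym e)) · fst (rm h) · cong (size j0) z≡[] , z≤n) }
  where
  j0 = reg s LEV
  z≡[] : z ≡ []
  z≡[] = drop-case (<ᵇ⇒< _ _ (subst T (sym lt≡) tt))
  ps = alu lt T1 (var HI) (var HF) ∷ ST (off xA LEV) (var ZZ) ∷ []
  s2 = runs ps s
 ... | false = s2 , (blk ((tt , tt , tt) , tt) ▸ ifF (cong bit lt≡) (blk oks-2)) , record { tick≡ = refl; ZZ≡ = refl; FL≡ = refl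
  ; chg = change (runs-frame {15} (alu lt T1 (var HI) (var HF) ∷ ps) s refl)
   (λ { r (r≢in ∷ r≢st ∷ []) o → wrP-plane f1 (inP + j0) (reg s ZZ) 1 1 r o (≢-sym r≢in) · wrP-plane (pl s) (stP + j0) sp (reg s FL) (reg s FV) r o (≢-sym r≢st) })
   (λ { a (a≢ ∷ _ ∷ []) → updℕ-≢ (lev s) j0 _ a (≢-sym a≢) }) refl refl
  ; levelR = level (refl , ch) (updℕ-≢ (lev s) j0 _ (xA + j0) (sp≢x j≤K) · sr) (marks-set (pl s (inP + j0)) (pl s2 (inP + j0)) e z (λ v → set-bit f1 (inP + j0) (reg s ZZ) true (ν v) ·
    cong (λ o → if o ≡ᵇ ν v then true else f1 (inP + j0) (ν v)) Z≡ ·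
     cong (λ b → if ν (hd e) ≡ᵇ ν v then true else b) (wrP-plane (pl s) (stP + j0) sp (reg s FL) (reg s FV) (inP + j0) (ν v) (λ e → in≢st j≤K (sym e)))) mk)
   (to-stored s2 j0 (e ∷ z) j≢0 (enc-cong (wrP (pl s) (stP + j0) (size j0 z) (fl j0 e) (fv j0 e) (stP + j0)) (pl s2 (stP + j0)) j0 (e ∷ z)
    (λ o _ → wrP-plane f1 (inP + j0) (reg s ZZ) 1 1 (stP + j0) o (in≢st j≤K) · wrP-cong (pl s) {stP + j0} {stP + j0} (stP + j0) o refl sp≡ FL≡ FV≡)
    (enc-push (pl s) (stP + j0) j0 e z j≤K (to-enc s j0 z j≢0 sd))))
   (λ _ → updℕ-≡ (lev s) j0 _ · (cong₂ _+_ sp≡ FL≡) · +-comm (size j0 z) _ , fits') }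
  where
  j0 = reg s LEV
  sp = lev s j0
  sp≡ = fst (rm j≢0)
  f1 = wrP (pl s) (stP + j0) sp (reg s FL) (reg s FV)
  fits' : size j0 (e ∷ z) ≤ n
  fits' = push-case (≮⇒≥ (λ h → subst T lt≡ (<⇒<ᵇ h)))
  ps = LD DD (off spA LEV) ∷ WR (off stP LEV) (var DD) (var FL) (var FV) ∷ alu add DD (var DD) (var FL) ∷ ST (off spA LEV) (var DD) ∷ WR (off inP LEV) (var ZZ) (lit 1) (lit 1) ∷ []
  s1 = runs (alu lt T1 (var HI) (var HF) ∷ []) s
  s2 = runs ps s1
  j0<w : j0 < 2 ^ w
  j0<w = lin 0 0 z≤n z≤n j≤K
  oks-2 : oks ps s1
  oks-2 = (j0<w , sp<PB j≤K , fits) , (st<w j≤K , tt , tt , tt , st<NR j≤K , ≡≤ sp≡ (m≤n+m _ (fl j0 e) » fits') ,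
    ≡≤ FL≡ (fl≤bb j0 e » bb≤L j0 » L≤w) , subst₂ (λ a b → a < 2 ^ b) (sym FV≡) (sym FL≡) (fv-< j0 e j≤K) , fits) ,
   (tt , tt , ≡< (sym (+-comm (fl j0 e) (size j0 z) · sym (cong₂ _+_ sp≡ FL≡))) (n<w fits')) ,
   (j0<w , tt , sp<PB j≤K , fits) ,
   (in<w j≤K , tt , lit! , lit! , in<NR j≤K , num≤n Z≡ , w>0 , s≤s z<s , fits) , tt

 record Counted (hi lo : ℕ) (s s' : State R2) : Set where
  field
   still : Quiet 11 s s'
   tick≡ : ticks s' ≡ ticks s
   HI≡ : reg s' HI ≡ hi
   LO≡ : reg s' LO ≡ lo
   YY≡ : reg s' YY ≡ reg s YY
   QQ≡ : reg s' QQ ≡ reg s QQ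
   ZZ≡ : reg s' ZZ ≡ reg s ZZ

 count-spec : ∀ hi lo f s → reg s HI ≡ hi → reg s LO ≡ lo → reg s FL ≡ f → lo + f ≤ n → hi < n → Runs count s (Counted (fst (tally hi lo f)) (snd (tally hi lo f)) s)
 count-spec hi lo f s refl refl refl lo+f≤n hi<n with reg s LO + reg s FL <ᵇ quarter in lt≡
 ... | true = s1 , (blk ok-1 ▸ ifT (≢0 (cong bit lt≡)) (blk tt)) , record { still = runs-quiet {11} ps s refl; tick≡ = refl; HI≡ = refl; LO≡ = refl; YY≡ = refl; QQ≡ = refl; ZZ≡ = refl }
  where
  ps = alu add LO (var LO) (var FL) ∷ getN DD ∷ alu quo DD (var DD) (lit 4) ∷ alu lt T1 (var LO) (var DD) ∷ []
  s1 = runs ps s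
  ok-1 : oks ps s
  ok-1 = (tt , tt , n<w lo+f≤n) , tt , (tt , lit! , tt) , (tt , tt , tt) , tt
 ... | false = s2 , (blk ok-1 ▸ ifF (cong bit lt≡) (blk (lit! , (tt , lit! , n<w (=≤ (+-comm (reg s HI) 1) » hi<n)) , tt))) ,
  record { still = runs-quiet {11} (ps ++ qs) s refl; tick≡ = refl; HI≡ = +-comm (reg s HI) 1; LO≡ = refl; YY≡ = refl; QQ≡ = refl; ZZ≡ = refl }
  where
  ps = alu add LO (var LO) (var FL) ∷ getN DD ∷ alu quo DD (var DD) (lit 4) ∷ alu lt T1 (var LO) (var DD) ∷ []
  qs = mov LO (lit 0) ∷ alu add HI (var HI) (lit 1) ∷ []
  s1 = runs ps s
  s2 = runs qs s1
  ok-1 : oks ps s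
  ok-1 = (tt , tt , n<w lo+f≤n) , tt , (tt , lit! , tt) , (tt , tt , tt) , tt

 foldA : ℕ → ℕ → Acc → List Edge → Acc
 foldA hf j a [] = a
 foldA hf j a (e ∷ es) = foldA hf j (stepA hf j a e) es

 level-keep : ∀ {j z u x s s'} → (∀ o → pl s' (inP + j) o ≡ pl s (inP + j) o) → (∀ o → pl s' (stP + j) o ≡ pl s (stP + j) o) →
  lev s' ≡ lev s → sl s' ≡ sl s → Level s j z u x → Level s' j z u x
 level-keep {j} {z} hin hst hl hs (level ch sr mk sd rm) = level ch (hl ∙ (xA + j) · sr) (λ v → hin (ν v) · mk v) (stored-change j z hst hs sd)
  (λ h → hl ∙ (spA + j) · fst (rm h) , snd (rm h))

 levels-keep : ∀ {s s'} → lev s' ≡ lev s → Levels s → Levels s'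
 levels-keep hl lv = record { lengths = λ {i} i≤K → hl ∙ (bA + i) · lengths lv i≤K }

 -- Makes single fields rounding errors: a few lengths of at most `L` fit between the bounds of a
 -- refilled zone and the limits of a level.
 quarter>L : 3 * L + 3 ≤ quarter
 quarter>L = *-cancelʳ-≤ (3 * L + 3) quarter 4 (+-cancelʳ-≤ 4 _ _ (begin
  (3 * L + 3) * 4 + 4 ≤⟨ m≤m+n _ (64 * K + 52 * L + 240) ⟩
  (3 * L + 3) * 4 + 4 + (64 * K + 52 * L + 240) ≡⟨ e K L ⟩
  64 * (K + L + 4) ≤⟨ big ⟩
  n ≡⟨ quot+rem n 4 z<s ⟩
  quarter * 4 + mod n 4 ≤⟨ +ʳ≤ (quarter * 4) (<⇒≤ (remainder-< n 4 z<s)) ⟩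
  quarter * 4 + 4 ∎))
  where
  open ≤-Reasoning
  e : ∀ K L → (3 * L + 3) * 4 + 4 + (64 * K + 52 * L + 240) ≡ 64 * (K + L + 4)
  e = ring

 quarter*4≤n : quarter * 4 ≤ n
 quarter*4≤n = m/n*n≤m n 4

 module WalkLoop {c r u ps} (inv : PathInv c r u ps) {zone d : List Edge} (eqn : zone ++ d ≡ ps) (ℓ : ℕ) (ℓ<K : ℓ < K) (hf : ℕ) (x : Fin n)
  (s0 : State R2) (lev0 : Level s0 ℓ zone u x) (lv0 : Levels s0)
  (ELL≡ : reg s0 ELL ≡ ℓ) (LEV≡ : reg s0 LEV ≡ suc ℓ) (U≡ : reg s0 U ≡ ν u) (HF≡ : reg s0 HF ≡ hf) where

  j : ℕ
  j = suc ℓ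

  record WState (lo : List Edge) (y : Fin n) (a : Acc) (s : State R2) : Set where
   field
    chainY : Chain y lo x
    YY≡ : reg s YY ≡ ν y
    QQ≡ : ℓ ≢ 0 → reg s QQ ≡ size ℓ lo
    HI≡ : reg s HI ≡ Acc.hi a
    LO≡ : reg s LO ≡ Acc.lo a
    vis : Marks (pl s visP) lo
    lvl : Level s j (Acc.zone a) y (Acc.from a)
    chg : Change 11 (planesOf j) (wordsOf j) s0 s

  record Front (e : Edge) (lo : List Edge) (s s3 : State R2) : Set where
   field
    down : ∀ k → toℕ k < 14 → reg s3 k ≡ reg s k
    QQ3 : ℓ ≢ 0 → reg s3 QQ ≡ size ℓ (e ∷ lo)
    ZZ3 : reg s3 ZZ ≡ ν (hd e)
    input : EdgeIn e j s3
    vis3 : Marks (pl s3 visP) (e ∷ lo)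
    pl3 : ∀ r → r ≢ visP → ∀ o → pl s3 r o ≡ pl s r o
    lev3 : lev s3 ≡ lev s
    sl3 : sl s3 ≡ sl s
    out3 : out s3 ≡ out s
    tick3 : ticks s3 ≤ gap ℓ (tl e) + ticks s

  front : ∀ {e lo a s s1 s2} → WState lo (tl e) a s → Approx ℓ e lo s s1 → Scan e (toℕ (snd e) ∸ div (toℕ (snd e)) (gap ℓ (tl e)) * gap ℓ (tl e)) s1 s2 →
   oks found-block s2 × Front e lo s (runs found-block s2)
  front {e} {lo} {a} {s} {s1} {s2} ws r1 r2 = (mark-ok ≤! (s≤s z<s) Z2 , tt , tt , tt , tt) , record { down = λ k k< → f3 k (k< » ≤!) · Quiet.frame q12 k k<
    ; QQ3 = λ h → below f3 QQ · Quiet.kept q2 QQ · Approx.QQ≡ r1 h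
    ; ZZ3 = Z2
    ; input = edge-in (Quiet.kept q12 YY · YY≡) (Scan.AA≡ r2) Z2 (below f3 LEV · Quiet.kept q12 LEV · Change.kept chg LEV · LEV≡)
    ; vis3 = marks-set (pl s2 visP) (pl (runs found-block s2) visP) e lo (λ v → set-bit (pl s2) visP (reg s2 ZZ) true (ν v) ·
     cong (λ o → if o ≡ᵇ ν v then true else pl s2 visP (ν v)) Z2) (λ v → Quiet.pl≡ q12 ∙ visP ∙ ν v · vis v)
    ; pl3 = λ r r≢ o → wrP-plane (pl s2) visP (reg s2 ZZ) 1 1 r o (≢-sym r≢) · Quiet.pl≡ q12 ∙ r ∙ o
    ; lev3 = Quiet.lev≡ q12; sl3 = Quiet.sl≡ q12; out3 = Quiet.out≡ q12
    -- The scan starts at the last multiple of the gap up to the position, so it makes as many steps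
    -- as the remainder, fewer than the gap.
    ; tick3 = =≤ (Scan.tick≡ r2 · cong (_+_ _) (Approx.tick≡ r1)) »
     +ˡ≤ (ticks s) (=≤ (quotient*+remainder (toℕ (snd e)) (gap ℓ (tl e)) (gap>0 ℓ (tl e))) » <⇒≤ (remainder-< (toℕ (snd e)) (gap ℓ (tl e)) (gap>0 ℓ (tl e)))) }
   where
   open WState ws
   q1 = Approx.still r1
   q2 = Scan.still r2
   q12 : Quiet 14 s s2
   q12 = quiet-trans q1 (quiet-weaken ≤! q2)
   Z2 = Scan.ZZ≡ r2
   f3 : Frame 24 s2 (runs found-block s2)
   f3 = runs-frame {24} found-block s2 refl

  level-front : ∀ {e lo s s3 z u x} → Front e lo s s3 → Level s j z u x → Level s3 j z u x
  level-front fr = level-keep (Front.pl3 fr (inP + j) (in≢low j ≤!)) (Front.pl3 fr (stP + j) (st≢low j ≤!)) (Front.lev3 fr) (Front.sl3 fr)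

  body-end : ∀ {e lo a s s3 s4 s5 s6} → WState lo (tl e) a s → Front e lo s s3 → Params e j s3 s4 →
   Recorded j (Acc.zone (stepA hf j a e)) (hd e) (Acc.from (stepA hf j a e)) s4 s5 → Counted (Acc.hi (stepA hf j a e)) (Acc.lo (stepA hf j a e)) s5 s6 →
   WState (e ∷ lo) (hd e) (stepA hf j a e) (runs (mov YY (var ZZ) ∷ []) s6) × ticks s6 ≤ gap ℓ (tl e) + ticks s
  body-end {e} {lo} {a} {s} {s3} {s4} {s5} {s6} ws fr r4 r5 r6 = record { chainY = refl , WState.chainY ws ; YY≡ = Counted.ZZ≡ r6 · Recorded.ZZ≡ r5 · Quiet.kept q4 ZZ · Front.ZZ3 fr
    ; QQ≡ = λ h → Counted.QQ≡ r6 · Change.kept c5 QQ · Quiet.kept q4 QQ · Front.QQ3 fr h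
    ; HI≡ = Counted.HI≡ r6; LO≡ = Counted.LO≡ r6
    ; vis = λ v → Quiet.pl≡ q6 ∙ visP ∙ ν v · Change.planes c5 visP ((λ e → in≢low j ≤! (sym e)) ∷ (λ e → st≢low j ≤! (sym e)) ∷ []) (ν v) · Quiet.pl≡ q4 ∙ visP ∙ ν v · Front.vis3 fr v
    ; lvl = level-quiet q7 (level-quiet q6 (Recorded.levelR r5))
    ; chg = change-trans (WState.chg ws) (change-trans c3 (change-trans (quiet→change (quiet-weaken ≤! q4))
     (change-trans (change-weaken ≤! (λ { (_ ∷ h) → h }) (λ h → h) c5) (change-trans (quiet→change q6) (quiet→change q7))))) } ,
   =≤ (Counted.tick≡ r6 · Recorded.tick≡ r5 · Params.tick≡ r4) » Front.tick3 fr
   where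
   q4 = Params.still r4
   c5 = Recorded.chg r5
   q6 = Counted.still r6
   q7 : Quiet 11 s6 (runs (mov YY (var ZZ) ∷ []) s6)
   q7 = runs-quiet {11} (mov YY (var ZZ) ∷ []) s6 refl
   c3 : Change 11 (planesOf j) (wordsOf j) s s3
   c3 = change (λ k k< → Front.down fr k (k< » ≤!)) (λ { r (r≢ ∷ _) o → Front.pl3 fr r r≢ o }) (λ a _ → Front.lev3 fr ∙ a) (Front.sl3 fr) (Front.out3 fr)

  lo+f≤n : ∀ l e → l < quarter → l + fl j e ≤ n
  lo+f≤n l e l<q = +≤+ (<⇒≤ l<q) (fl≤bb j e » bb≤L j » m≤m+n L _ » m≤m+n _ 3 » quarter>L) » =≤ (e2 quarter) » *ʳ≤ quarter ≤! » quarter*4≤n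
   where
   e2 : ∀ q → q + q ≡ q * 2
   e2 = ring

  body-spec : ∀ e rst lo a s → zone ≡ rst ʳ++ (e ∷ lo) → WState lo (tl e) a s →
   (Acc.hi a < hf → Acc.zone a ≡ []) → (hf ≤ Acc.hi a → size j (e ∷ Acc.zone a) ≤ n) → Acc.lo a < quarter → Acc.hi a < n →
   Σ[ s' ∈ State R2 ] Exec walk-body s s' × WState (e ∷ lo) (hd e) (stepA hf j a e) s' × ticks s' ≤ gap ℓ (tl e) + ticks s
  body-spec e rst lo (acc hi l z x') s z≡ ws drop-case push-case l<q hi<n =
   let (s1 , ex1 , r1) = approx-spec ℓ e lo s ℓ<K YY≡ ELLs (λ h → QQ≡ h , room' h) (stored-ʳ++ s ℓ rst (subst (Stored s ℓ) z≡ (Level.stored lℓ))) lvs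
   in after-approx s1 ex1 r1
   where
   open WState ws
   open WalkStep inv eqn e rst lo z≡
   Result = Σ[ s' ∈ State R2 ] Exec walk-body s s' × WState (e ∷ lo) (hd e) (stepA hf j (acc hi l z x') e) s' × ticks s' ≤ gap ℓ (tl e) + ticks s
   p = tl e
   i = toℕ (snd e)
   A = div i (gap ℓ p) * gap ℓ p
   ELLs = Change.kept chg ELL · ELL≡
   lvs = levels-change ℓ<K chg lv0
   lℓ = level-change chg (≢-sym 1+n≢n) (<⇒≤ ℓ<K) ℓ<K lev0
   room' : ℓ ≢ 0 → size ℓ (e ∷ lo) ≤ n
   room' h = size-ʳ++ ℓ rst » =≤ (cong (size ℓ) (sym z≡)) » snd (Level.room lℓ h)
   after-count : ∀ s3 s4 s5 s6 → (Exec params s3 s4 × Exec record-edge s4 s5 × Exec count s5 s6) →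
    (∀ {s7} → Exec (params ⨾ record-edge ⨾ count ⨾ block (mov YY (var ZZ) ∷ [])) s3 s7 → Exec walk-body s s7) →
    Front e lo s s3 → Params e j s3 s4 → Recorded j _ (hd e) _ s4 s5 → Counted _ _ s5 s6 → Result
   after-count s3 s4 s5 s6 (ex4 , ex5 , ex6) pre fr r4 r5 r6 = runs (mov YY (var ZZ) ∷ []) s6 , pre (ex4 ▸ ex5 ▸ ex6 ▸ blk (tt , tt)) , body-end ws fr r4 r5 r6
   after-params : ∀ s3 s4 → Exec params s3 s4 → (∀ {s7} → Exec (params ⨾ record-edge ⨾ count ⨾ block (mov YY (var ZZ) ∷ [])) s3 s7 → Exec walk-body s s7) →
    Front e lo s s3 → Params e j s3 s4 → Result
   after-params s3 s4 ex4 pre fr r4 =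
    let (s5 , ex5 , r5) = record-spec j hf hi e z x' s4 ℓ<K (λ ()) (level-quiet (Params.still r4) (level-front fr lvl)) (Quiet.kept (Params.still r4) ZZ · Front.ZZ3 fr)
         (down LEV tt · Change.kept chg LEV · LEV≡) (Params.fl≡ r4) (Params.fv≡ r4)
         (down HI tt · HI≡) (down HF tt · Change.kept chg HF · HF≡) drop-case push-case
    in after-record s5 ex5 r5
    where
    down : ∀ k → T (suc (toℕ k) ≤ᵇ 14) → reg s4 k ≡ reg s k
    down k h = Quiet.frame (Params.still r4) k (≤ᵇ⇒≤ (suc (toℕ k)) 14 h » ≤!) · Front.down fr k (≤ᵇ⇒≤ (suc (toℕ k)) 14 h)
    after-record : ∀ s5 → Exec record-edge s4 s5 → Recorded j (if hi <ᵇ hf then [] else e ∷ z) (hd e) (if hi <ᵇ hf then hd e else x') s4 s5 → Result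
    after-record s5 ex5 r5 =
     let (s6 , ex6 , r6) = count-spec hi l (fl j e) s5 (Change.kept (Recorded.chg r5) HI · down HI tt · HI≡)
          (Change.kept (Recorded.chg r5) LO · down LO tt · LO≡) (Recorded.FL≡ r5 · Params.fl≡ r4) (lo+f≤n l e l<q) hi<n
     in after-count s3 s4 s5 s6 (ex4 , ex5 , ex6) pre fr r4 r5 r6
   after-front : ∀ s3 → (∀ {s7} → Exec (params ⨾ record-edge ⨾ count ⨾ block (mov YY (var ZZ) ∷ [])) s3 s7 → Exec walk-body s s7) → Front e lo s s3 → Result
   after-front s3 pre fr =
    let (s4 , ex4 , r4) = params-spec e j s3 ℓ<K (Front.input fr) (levels-keep (Front.lev3 fr) lvs) in after-params s3 s4 ex4 pre fr r4
   after-approx : ∀ s1 → Exec approx s s1 → Approx ℓ e lo s s1 → Result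
   after-approx s1 ex1 r1 =
    let (s2 , ex2 , r2) = scan-spec ℓ e zone lo (i ∸ A) s1 (<⇒≤ ℓ<K) (Quiet.kept (Approx.still r1) YY · YY≡)
         (Quiet.kept (Approx.still r1) ELL · ELLs) (cong (i ∸ A +_) (Approx.AA≡ r1) · m∸n+n≡m (quot-gap≤ ℓ e))
         (Level.marks (level-quiet (Approx.still r1) lℓ)) (λ v → Quiet.pl≡ (Approx.still r1) ∙ visP ∙ ν v · vis v) candidate-prior candidate-hd
    in after-scan s2 ex2 r2
    where
    after-scan : ∀ s2 → Exec scan s1 s2 → Scan e (i ∸ A) s1 s2 → Result
    after-scan s2 ex2 r2 = after-front (runs found-block s2) (λ ex → ex1 ▸ ex2 ▸ blk (fst (front ws r1 r2)) ▸ ex) (snd (front ws r1 r2))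

  tail-sum : List Edge → ℕ
  tail-sum es = sum (map (λ v → suc (gap ℓ v)) (tails es))

  shift-state : ∀ {l y a s s'} → Quiet 21 s s' → WState l y a s → WState l y a s'
  shift-state q ws = record { chainY = chainY; YY≡ = Quiet.kept q YY · YY≡; QQ≡ = λ h → Quiet.kept q QQ · QQ≡ h ; HI≡ = Quiet.kept q HI · HI≡; LO≡ = Quiet.kept q LO · LO≡
   ; vis = λ v → Quiet.pl≡ q ∙ visP ∙ ν v · vis v; lvl = level-quiet q lvl
   ; chg = change-trans chg (quiet→change (quiet-weaken ≤! q)) }
    where open WState ws

  tick-quiet : ∀ {k s} → Quiet k s (tick s)
  tick-quiet = quiet (λ _ _ → refl) refl refl refl refl

  loop-spec : ∀ rst lo y a s → zone ≡ rst ʳ++ lo → WState lo y a s → Fit hf j a rst →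
   Σ[ s' ∈ State R2 ] Exec (loop (block (alu eq T1 (var YY) (var U) ∷ alu eq T1 (var T1) (lit 0) ∷ [])) T1 walk-body) s s' ×
    WState zone u (foldA hf j a rst) s' × ticks s' ≤ tail-sum rst + ticks s
  loop-spec [] lo y a s z≡ ws _ = s1 , stop (blk ((tt , tt , tt) , (tt , lit! , tt) , tt)) done≡ , subst₂ (λ l y → WState l y a s1) (sym z≡) y≡u (shift-state q ws) , ≤-refl
   where
   open WState ws
   bs = alu eq T1 (var YY) (var U) ∷ alu eq T1 (var T1) (lit 0) ∷ []
   s1 = runs bs s
   q : Quiet 21 s s1
   q = runs-quiet {21} bs s refl
   y≡u : y ≡ u
   y≡u = chain-unique lo chainY (subst (λ l → Chain u l x) z≡ (Level.chainL lev0))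
   done≡ : bit (bit (reg s YY ≡ᵇ reg s U) ≡ᵇ 0) ≡ 0
   done≡ = cong (λ b → bit (bit b ≡ᵇ 0)) ((cong₂ _≡ᵇ_ (YY≡ · cong ν y≡u) (Change.frame chg U ≤! · U≡)) · ≡ᵇ-refl (ν u))
  loop-spec (e ∷ rst) lo y a s z≡ ws ((dc , pc , l<q , hi<n) , fit) =
   let (s2 , ex2 , ws2 , t-2) = body-spec e rst lo a s1 z≡ (subst (λ y → WState lo y a s1) y≡tl (shift-state q ws)) dc pc l<q hi<n
   in after-body s2 ex2 ws2 t-2
   where
   open WState ws
   bs = alu eq T1 (var YY) (var U) ∷ alu eq T1 (var T1) (lit 0) ∷ []
   s1 = runs bs s
   q : Quiet 21 s s1
   q = runs-quiet {21} bs s refl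
   y≡tl : y ≡ tl e
   y≡tl = chain-unique lo chainY (snd (snd (chain-ʳ++ rst (subst (λ l → Chain u l x) z≡ (Level.chainL lev0)))))
   going : bit (bit (reg s YY ≡ᵇ reg s U) ≡ᵇ 0) ≡ 1
   going = cong (λ b → bit (bit b ≡ᵇ 0)) ((cong₂ _≡ᵇ_ YY≡ (Change.frame chg U ≤! · U≡)) · (≡ᵇ-≢ _ _ (λ e' → WalkStep.tl≢u inv eqn e rst lo z≡ (sym y≡tl · ν-inj e'))))
   e1 : ∀ S g t → S + suc (g + t) ≡ suc g + S + t
   e1 = ring
   after-body : ∀ s2 → Exec walk-body s1 s2 → WState (e ∷ lo) (hd e) (stepA hf j a e) s2 → ticks s2 ≤ gap ℓ (tl e) + ticks s →
    Σ[ s' ∈ State R2 ] Exec (loop (block bs) T1 walk-body) s s' × WState zone u (foldA hf j (stepA hf j a e) rst) s' × ticks s' ≤ tail-sum (e ∷ rst) + ticks s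
   after-body s2 ex2 ws2 t-2 =
    let (s3 , ex3 , ws3 , t-3) = loop-spec rst (e ∷ lo) (hd e) (stepA hf j a e) (tick s2) z≡ (shift-state tick-quiet ws2) fit
    in s3 , again (blk ((tt , tt , tt) , (tt , lit! , tt) , tt)) (≢0 going) ex2 ex3 , ws3 ,
     t-3 » +ʳ≤ (tail-sum rst) (s≤s t-2) » =≤ (e1 (tail-sum rst) (gap ℓ (tl e)) (ticks s))

 -- Segments and the edges kept by a rebuilt level

 fl≤L : ∀ j e → fl j e ≤ L
 fl≤L j e = fl≤bb j e » bb≤L j

 quarter>0 : 0 < quarter
 quarter>0 = z<s » m≤n+m 3 (3 * L) » quarter>L

 hi-tally : ∀ hi lo f → hi ≤ fst (tally hi lo f) × fst (tally hi lo f) ≤ suc hi × snd (tally hi lo f) < quarter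
 hi-tally hi lo f with lo + f <ᵇ quarter in lt≡
 ... | true = ≤-refl , n≤1+n hi , <ᵇ⇒< _ _ (subst T (sym lt≡) tt)
 ... | false = n≤1+n hi , ≤-refl , quarter>0

 -- The tally ignores which edges are kept. Thus the second walk ends with the same number of
 -- segments as the first.
 foldA-hi : ∀ hf hf' j rst hi lo z z' x x' → Acc.hi (foldA hf j (acc hi lo z x) rst) ≡ Acc.hi (foldA hf' j (acc hi lo z' x') rst)
 foldA-hi hf hf' j [] hi lo z z' x x' = refl
 foldA-hi hf hf' j (e ∷ rst) hi lo z z' x x' = foldA-hi hf hf' j rst _ _ _ _ _ _

 foldA-mono : ∀ hf j rst a → Acc.hi a ≤ Acc.hi (foldA hf j a rst)
 foldA-mono hf j [] a = ≤-refl
 foldA-mono hf j (e ∷ rst) (acc hi lo z x) = fst (hi-tally hi lo (fl j e)) » foldA-mono hf j rst _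

 foldA-length : ∀ hf j rst a → Acc.hi (foldA hf j a rst) ≤ Acc.hi a + length rst
 foldA-length hf j [] a = m≤m+n _ 0
 foldA-length hf j (e ∷ rst) (acc hi lo z x) = foldA-length hf j rst (stepA hf j (acc hi lo z x) e) » +ˡ≤ (length rst) (fst (snd (hi-tally hi lo (fl j e)))) » =≥ (+-suc hi (length rst))

 -- The counting walk drops every edge.
 fit1 : ∀ j rst hi lo x → hi + length rst < n → lo < quarter → Fit n j (acc hi lo [] x) rst × Acc.zone (foldA n j (acc hi lo [] x) rst) ≡ []
 fit1 j [] hi lo x h lo< = tt , refl
 fit1 j (e ∷ rst) hi lo x h lo< = (((λ _ → refl) , (λ n≤hi → ⊥! (<⇒≱ hi<n n≤hi)) , lo< , hi<n) , fst rest) , snd rest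
  where
  hi<n : hi < n
  hi<n = s≤s (m≤m+n hi _) » h
  next-length : fst (tally hi lo (fl j e)) + length rst < n
  next-length = s≤s (+ˡ≤ (length rst) (fst (snd (hi-tally hi lo (fl j e))))) » ≡< (sym (+-suc hi (length rst))) h
  step≡ : stepA n j (acc hi lo [] x) e ≡ acc (fst (tally hi lo (fl j e))) (snd (tally hi lo (fl j e))) [] (hd e)
  step≡ = cong₂ (acc (fst (tally hi lo (fl j e))) (snd (tally hi lo (fl j e)))) (if-true (<ᵇ-true hi<n)) (if-true (<ᵇ-true hi<n))
  rest : Fit n j (stepA n j (acc hi lo [] x) e) rst × Acc.zone (foldA n j (stepA n j (acc hi lo [] x) e) rst) ≡ []
  rest = subst (λ a → Fit n j a rst × Acc.zone (foldA n j a rst) ≡ []) (sym step≡) (fit1 j rst _ _ (hd e) next-length (snd (snd (hi-tally hi lo (fl j e)))))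

 -- Every complete segment that is kept contributes between `quarter` and `quarter + L` bits, the
 -- current one exactly `lo`. With `hf = 0` nothing is ever dropped.
 record RInv (hf j : ℕ) (a : Acc) (past : List Edge) : Set where
  field
   lo<q : Acc.lo a < quarter
   dropped : Acc.hi a < hf → Acc.zone a ≡ []
   upper : hf ≤ Acc.hi a → size j (Acc.zone a) ≤ (Acc.hi a ∸ hf) * (quarter + L) + Acc.lo a
   lower : hf ≢ 0 → hf ≤ Acc.hi a → (Acc.hi a ∸ hf) * quarter + Acc.lo a ≤ size j (Acc.zone a)
   whole : hf ≡ 0 → Acc.zone a ≡ past
   prefix : Σ[ d ∈ List Edge ] Acc.zone a ++ d ≡ past

 rinv-step : ∀ hf j a past e → RInv hf j a past → RInv hf j (stepA hf j a e) (e ∷ past)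
 rinv-step hf j (acc hi lo z x) past e ri with hi <ᵇ hf in drop≡ | lo + fl j e <ᵇ quarter in lt≡
 ... | true | true = record { lo<q = <ᵇ⇒< _ _ (subst T (sym lt≡) tt); dropped = λ _ → refl ; upper = λ hf≤ → ⊥! (<⇒≱ hi<hf hf≤); lower = λ _ hf≤ → ⊥! (<⇒≱ hi<hf hf≤)
  ; whole = λ e → ⊥! (n≮0 (subst (hi <_) e hi<hf)); prefix = _ , refl }
  where
  hi<hf : hi < hf
  hi<hf = <ᵇ⇒< _ _ (subst T (sym drop≡) tt)
 ... | true | false = record { lo<q = quarter>0; dropped = λ _ → refl; upper = λ _ → z≤n ; lower = λ _ hf≤ → =≤ (+0 _ · cong (_* quarter) (m≤n⇒m∸n≡0 hi<hf))
  ; whole = λ e → ⊥! (n≮0 (subst (hi <_) e hi<hf)); prefix = _ , refl }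
  where
  hi<hf : hi < hf
  hi<hf = <ᵇ⇒< _ _ (subst T (sym drop≡) tt)
 ... | false | true = record { lo<q = <ᵇ⇒< _ _ (subst T (sym lt≡) tt); dropped = λ hi<hf → ⊥! (subst T drop≡ (<⇒<ᵇ hi<hf))
  ; upper = λ hf≤ → +ʳ≤ (fl j e) (RInv.upper ri hf≤) » =≤ (swap3 (fl j e) ((hi ∸ hf) * (quarter + L)) lo)
  ; lower = λ hf≢0 hf≤ → =≥ (swap3 (fl j e) ((hi ∸ hf) * quarter) lo) » +ʳ≤ (fl j e) (RInv.lower ri hf≢0 hf≤)
  ; whole = λ e' → cong (e ∷_) (RInv.whole ri e'); prefix = fst (RInv.prefix ri) , cong (e ∷_) (snd (RInv.prefix ri)) }
  where
  swap3 : ∀ a b c → a + (b + c) ≡ b + (c + a)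
  swap3 = ring
 ... | false | false = record { lo<q = quarter>0; dropped = λ shi<hf → ⊥! (<⇒≱ shi<hf (m≤n⇒m≤1+n hf≤hi)) ; upper = λ _ → +≤+ (fl≤L j e) (RInv.upper ri hf≤hi » +ʳ≤ _ (<⇒≤ (RInv.lo<q ri))) »
   =≤ (e1 L (hi ∸ hf) quarter · cong (λ z → z * (quarter + L) + 0) (sym (+-∸-assoc 1 hf≤hi)))
  ; lower = λ hf≢0 _ → =≤ (cong (λ z → z * quarter + 0) (+-∸-assoc 1 hf≤hi)) » =≤ (e2 (hi ∸ hf) quarter) »
   +ʳ≤ ((hi ∸ hf) * quarter) (≮⇒≥ (λ h → subst T lt≡ (<⇒<ᵇ h))) » =≤ (e3 ((hi ∸ hf) * quarter) lo (fl j e)) » +ʳ≤ (fl j e) (RInv.lower ri hf≢0 hf≤hi)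
  ; whole = λ e' → cong (e ∷_) (RInv.whole ri e'); prefix = fst (RInv.prefix ri) , cong (e ∷_) (snd (RInv.prefix ri)) }
  where
  hf≤hi : hf ≤ hi
  hf≤hi = ≮⇒≥ (λ h → subst T drop≡ (<⇒<ᵇ h))
  e1 : ∀ L h q → L + (h * (q + L) + q) ≡ (1 + h) * (q + L) + 0
  e1 = ring
  e2 : ∀ h q → (1 + h) * q + 0 ≡ h * q + q
  e2 = ring
  e3 : ∀ a l f → a + (l + f) ≡ f + (a + l)
  e3 = ring

 two-quarters : ∀ {s f} → s ≤ (quarter + L) + quarter → f ≤ L → f + s ≤ n
 two-quarters {s} {f} h hf≤ = begin
  f + s ≤⟨ +≤+ hf≤ h ⟩
  L + (quarter + L + quarter) ≡⟨ e L quarter ⟩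
  2 * L + quarter * 2 ≤⟨ +ˡ≤ _ (*ˡ≤ L (≤! {2} {3}) » m≤m+n (3 * L) 3 » quarter>L) ⟩
  quarter + quarter * 2 ≡⟨ e' quarter ⟩
  quarter * 3 ≤⟨ *ʳ≤ quarter ≤! ⟩
  quarter * 4 ≤⟨ quarter*4≤n ⟩
  n ∎
  where
  open ≤-Reasoning
  e : ∀ L q → L + (q + L + q) ≡ 2 * L + q * 2
  e = ring
  e' : ∀ q → q + q * 2 ≡ q * 3
  e' = ring

 upper-bound : ∀ hf j a past → RInv hf j a past → Acc.hi a ≤ suc hf → hf ≤ Acc.hi a → size j (Acc.zone a) ≤ (quarter + L) + quarter
 upper-bound hf j a past ri hi≤ hf≤ = RInv.upper ri hf≤ » +≤+ (*ˡ≤ (quarter + L) (∸-monoˡ-≤ hf hi≤ » =≤ (m+n∸n≡m 1 hf)) » =≤ (*-identityˡ _)) (<⇒≤ (RInv.lo<q ri))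

 -- The final `hi` is known from the first walk. Since `hi` never decreases, this limits the kept
 -- segments, and hence the zone, at every earlier edge as well.
 fit2 : ∀ hf j rst a past → RInv hf j a past → Acc.hi (foldA hf j a rst) ≤ suc hf → Acc.hi (foldA hf j a rst) < n → Fit hf j a rst × RInv hf j (foldA hf j a rst) (rst ʳ++ past)
 fit2 hf j [] a past ri h≤ h< = tt , ri
 fit2 hf j (e ∷ rst) a@(acc hi lo z x) past ri h≤ h< =
  let (fit , ri') = fit2 hf j rst (stepA hf j a e) (e ∷ past) (rinv-step hf j a past e ri) h≤ h<
  in ((RInv.dropped ri , (λ hf≤ → two-quarters {size j z} {fl j e} (upper-bound hf j a past ri (foldA-mono hf j (e ∷ rst) a » h≤) hf≤) (fl≤L j e)) ,
   RInv.lo<q ri , (s≤s (foldA-mono hf j (e ∷ rst) a) » h<)) , fit) , ri'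

 module _ {c r u ps} (inv : PathInv c r u ps) {zone d : List Edge} (eqn : zone ++ d ≡ ps) (ℓ : ℕ) (ℓ<K : ℓ < K) (x : Fin n) where

  j1 : ℕ
  j1 = suc ℓ

  rev : List Edge
  rev = zone ʳ++ []

  walk-ticks : ℕ
  walk-ticks = sumF (λ v → suc (gap ℓ v))

  record Walked (hf : ℕ) (s s' : State R2) : Set where
   field
    HI≡ : reg s' HI ≡ Acc.hi (foldA hf j1 (acc 0 0 [] x) rev)
    lvl : Level s' j1 (Acc.zone (foldA hf j1 (acc 0 0 [] x) rev)) u (Acc.from (foldA hf j1 (acc 0 0 [] x) rev))
    chg : Change 11 (planesOf j1) (wordsOf j1) s s'
    tick≤ : ticks s' ≤ n + walk-ticks + ticks s

  walk-spec : ∀ hf s → Level s ℓ zone u x → Levels s → reg s ELL ≡ ℓ → reg s LEV ≡ j1 → reg s U ≡ ν u → reg s HF ≡ hf →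
   Marks (pl s (inP + j1)) [] → Fit hf j1 (acc 0 0 [] x) rev → Runs walk s (Walked hf s)
  walk-spec hf s lvl lvs ELL≡ LEV≡ U≡ HF≡ unmarked fit =
   let (s1 , ex1 , r1) = clear-spec (lit visP) visP s (plane<NR ≤!) (λ _ _ → lit! , refl) in after-clear s1 ex1 r1
   where
   open WalkLoop inv eqn ℓ ℓ<K hf x s lvl lvs ELL≡ LEV≡ U≡ HF≡
   Result = Runs walk s (Walked hf s)
   after-clear : ∀ s1 → Exec (clear (lit visP)) s s1 → Cleared visP s s1 → Result
   after-clear s1 ex1 r1 = let (s3 , ex3 , ws , t) = loop-spec rev [] x (acc 0 0 [] x) s2 (sym (ʳ++-ʳ++-[] zone)) initial fit in
    s3 , (ex1 ▸ blk ok-2 ▸ ex3) , record { HI≡ = WState.HI≡ ws; lvl = WState.lvl ws; chg = WState.chg ws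
     ; tick≤ = t » +≤+ (=≤ (cong sum (cong (map (λ v → suc (gap ℓ v))) (map-ʳ++ tl zone)) · sum-ʳ++ (λ v → suc (gap ℓ v)) (tails zone) · +0 _) »
      sum-tails≤ inv (λ v → suc (gap ℓ v)) {zone} {d} eqn) (=≤ ticks≡) » =≤ (x+yz≡yx+z walk-ticks n (ticks s)) }
    where
    open Cleared r1
    s2 = runs walk-start s1
    ELL1 = below frame ELL · ELL≡
    LEV1 = below frame LEV · LEV≡
    Y1 : lev s1 (xA + reg s1 ELL) ≡ ν x
    Y1 = lev≡ ∙ (xA + reg s1 ELL) · cong (λ z → lev s (xA + z)) ELL1 · Level.start lvl
    ok-2 : oks walk-start s1
    ok-2 = ld-ok (cong (xA +_) ELL1) (x<w (<⇒≤ ℓ<K)) (x<PB (<⇒≤ ℓ<K)) , lit! , (≡< LEV1 (lin 0 0 z≤n z≤n ℓ<K) , lit! , ≡< LEV1 (sp<PB ℓ<K) , fits) ,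
     st-ok (cong (xA +_) LEV1) (x<w ℓ<K) (x<PB ℓ<K) , lit! , lit! , tt
    lev2 : lev s2 ≡ updℕ (updℕ (lev s1) j1 0) (xA + j1) (lev s1 (xA + reg s1 ELL))
    lev2 = cong (λ z → updℕ (updℕ (lev s1) z 0) (xA + z) (lev s1 (xA + reg s1 ELL))) LEV1
    initial : WState [] x (acc 0 0 [] x) s2
    initial = record { chainY = refl; YY≡ = Y1; QQ≡ = λ _ → refl; HI≡ = refl; LO≡ = refl; vis = cleared
     ; lvl = level refl (lev2 ∙ (xA + j1) · updℕ-≡ (updℕ (lev s1) j1 0) (xA + j1) _ · Y1) (λ v → others (inP + j1) (ν v) (in≢low j1 ≤!) · unmarked v) tt
      (λ _ → lev2 ∙ j1 · updℕ-≢ (updℕ (lev s1) j1 0) (xA + j1) _ j1 (λ e → sp≢x ℓ<K (sym e)) · updℕ-≡ (lev s1) j1 0 , z≤n)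
     ; chg = change (λ k k< → runs-frame {11} walk-start s1 refl k k< · frame k (k< » ≤!)) (λ { r (r≢ ∷ _) o → others r o r≢ })
      (λ { a (a≢sp ∷ a≢x ∷ []) → lev2 ∙ a · updℕ-≢ (updℕ (lev s1) j1 0) (xA + j1) _ a (≢-sym a≢x) · updℕ-≢ (lev s1) j1 0 a (≢-sym a≢sp) · lev≡ ∙ a })
      sl≡ out≡ }

  -- The target is the middle of the range: Ω(n) bits have to be pushed before the level overflows,
  -- and Ω(n) bits popped before it is exhausted, unless the whole zone below has been copied.
  record Refilled (s s' : State R2) : Set where
   field
    z' d' : List Edge
    x' : Fin n
    lvl : Level s' j1 z' u x'
    prefix : z' ++ d' ≡ zone
    upper : size j1 z' ≤ (quarter + L) + quarter
    lower : z' ≡ zone ⊎ quarter ≤ size j1 z'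
    chg : Change 9 (planesOf j1) (wordsOf j1) s s'
    tick≤ : ticks s' ≤ 3 * n + 2 * walk-ticks + ticks s

  length-zone : length rev < n
  length-zone = s≤s (=≤ (length-ʳ++ zone · +0 _) » m≤m+n (length zone) (length d) » =≤ (sym (length-++ zone) · cong length eqn · sym (length-map tl ps))) »
   length-unique (stackOf u ps) (PathInv.uniq inv)

  refill-spec : ∀ s → Level s ℓ zone u x → Levels s → reg s LEV ≡ j1 → reg s U ≡ ν u → Runs refill s (Refilled s)
  refill-spec s lvl lvs LEV≡ U≡ =
   let (s2 , ex2 , r2) = clear-spec (off inP LEV) (inP + j1) s1 (in<NR ℓ<K)
        (λ t f → subst (λ z → inP + z < 2 ^ w) (sym (below f LEV · LEV≡)) (in<w ℓ<K) , cong (inP +_) (below f LEV · LEV≡))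
   in after-clear s2 ex2 r2
   where
   Result = Runs refill s (Refilled s)
   sub-block = alu sub ELL (var LEV) (lit 1) ∷ []
   s1 = runs sub-block s
   ok-1 : oks sub-block s
   ok-1 = (tt , lit! , subst (1 ≤_) (sym LEV≡) z<s) , tt
   q1 : Quiet 9 s s1
   q1 = runs-quiet {9} sub-block s refl
   ELL1 : reg s1 ELL ≡ ℓ
   ELL1 = cong (_∸ 1) LEV≡
   H : ℕ
   H = Acc.hi (foldA n j1 (acc 0 0 [] x) rev)
   HF2 : ℕ
   HF2 = H ∸ bit (0 <ᵇ H)
   H<n : H < n
   H<n = s≤s (foldA-length n j1 rev (acc 0 0 [] x)) » length-zone
   fits1 = fit1 j1 rev 0 0 x length-zone quarter>0
   same-hi : Acc.hi (foldA HF2 j1 (acc 0 0 [] x) rev) ≡ H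
   same-hi = foldA-hi HF2 n j1 rev 0 0 [] [] x x
   H≤suc : H ≤ suc HF2
   H≤suc = m≤n+m∸n H (bit (0 <ᵇ H)) » +ˡ≤ HF2 (bit≤1 (0 <ᵇ H))
   rinv0 : RInv HF2 j1 (acc 0 0 [] x) []
   rinv0 = record { lo<q = quarter>0; dropped = λ _ → refl; upper = λ _ → z≤n; lower = λ ≢0 ≤0 → ⊥! (≢0 (n≤0⇒n≡0 ≤0)); whole = λ _ → refl; prefix = [] , refl }
   fits2 = fit2 HF2 j1 rev (acc 0 0 [] x) [] rinv0 (=≤ same-hi » H≤suc) (≡< same-hi H<n)
   final = foldA HF2 j1 (acc 0 0 [] x) rev
   rinv : RInv HF2 j1 final zone
   rinv = subst (RInv HF2 j1 final) (ʳ++-ʳ++-[] zone) (snd fits2)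
   HF2≤ : HF2 ≤ Acc.hi final
   HF2≤ = m∸n≤m H (bit (0 <ᵇ H)) » =≥ same-hi
   lower' : Acc.zone final ≡ zone ⊎ quarter ≤ size j1 (Acc.zone final)
   lower' with HF2 ≟ 0
   ... | yes e = inl (RInv.whole rinv e)
   ... | no ≢0 = inr (=≥ (*-identityˡ quarter) » *ˡ≤ quarter one » m≤m+n _ (Acc.lo final) » RInv.lower rinv ≢0 HF2≤)
    where
    bit-pos : ∀ h → h ∸ bit (0 <ᵇ h) ≢ 0 → 1 ≤ h ∸ (h ∸ bit (0 <ᵇ h))
    bit-pos zero h = ⊥! (h refl)
    bit-pos (suc h) _ = =≥ (m+n∸n≡m 1 h)
    one : 1 ≤ Acc.hi final ∸ HF2
    one = subst (λ z → 1 ≤ z ∸ HF2) (sym same-hi) (bit-pos H ≢0)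
   after-clear : ∀ s2 → Exec (clear (off inP LEV)) s1 s2 → Cleared (inP + j1) s1 s2 → Result
   after-clear s2 ex2 r2 =
    let (s4 , ex4 , r4) = walk-spec n s3 lvl3 lvs3 (Change.kept c3 ELL · ELL1) (Change.kept c3 LEV · Quiet.kept q1 LEV · LEV≡)
         (Change.kept c3 U · Quiet.kept q1 U · U≡) refl (Cleared.cleared r2) (fst fits1)
    in after-walk s4 ex4 r4
    where
    s3 = runs (getN HF ∷ []) s2
    c3 : Change 10 (planesOf j1) (wordsOf j1) s1 s3
    c3 = change-trans (change (λ k k< → Cleared.frame r2 k (k< » ≤!)) (λ { r (_ ∷ r≢ ∷ _) o → Cleared.others r2 r o r≢ }) (λ a _ → Cleared.lev≡ r2 ∙ a) (Cleared.sl≡ r2) (Cleared.out≡ r2))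
     (quiet→change (runs-quiet {10} (getN HF ∷ []) s2 refl))
    lvs3 : Levels s3
    lvs3 = levels-change ℓ<K c3 (levels-keep refl lvs)
    lvl3 = level-change c3 (≢-sym 1+n≢n) (<⇒≤ ℓ<K) ℓ<K (level-quiet q1 lvl)
    after-walk : ∀ s4 → Exec walk s3 s4 → Walked n s3 s4 → Result
    after-walk s4 ex4 r4 =
     let (s6 , ex6 , r6) = walk-spec HF2 s5 lvl5 lvs5 (Change.kept c5 ELL · Change.kept c3 ELL · ELL1)
          (Change.kept c5 LEV · Change.kept c3 LEV · Quiet.kept q1 LEV · LEV≡)
          (Change.kept c5 U · Change.kept c3 U · Quiet.kept q1 U · U≡) HF5
          (subst (Marks (pl s4 (inP + j1))) (snd fits1) (Level.marks (Walked.lvl r4))) (fst fits2)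
     in finish s6 ex6 r6
     where
     s5 = runs half-block s4
     c5 : Change 10 (planesOf j1) (wordsOf j1) s3 s5
     c5 = change-trans (change-weaken ≤! (λ h → h) (λ h → h) (Walked.chg r4)) (quiet→change (runs-quiet {10} half-block s4 refl))
     HF5 : reg s5 HF ≡ HF2
     HF5 = cong (λ z → z ∸ bit (0 <ᵇ z)) (Walked.HI≡ r4)
     lvs5 = levels-change ℓ<K c5 lvs3
     lvl5 = level-change c5 (≢-sym 1+n≢n) (<⇒≤ ℓ<K) ℓ<K lvl3
     ok-5 : oks half-block s4
     ok-5 = (lit! , tt , tt) , (tt , tt , bit≤self (reg s4 HI)) , tt
      where
      bit≤self : ∀ h → bit (0 <ᵇ h) ≤ h
      bit≤self zero = z≤n
      bit≤self (suc h) = z<s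
     finish : ∀ s6 → Exec walk s5 s6 → Walked HF2 s5 s6 → Result
     finish s6 ex6 r6 = s6 , (blk ok-1 ▸ ex2 ▸ blk (tt , tt) ▸ ex4 ▸ blk ok-5 ▸ ex6) , record
      { z' = Acc.zone final; d' = fst (RInv.prefix rinv); x' = Acc.from final; lvl = Walked.lvl r6; prefix = snd (RInv.prefix rinv)
      ; upper = upper-bound HF2 j1 final zone rinv (=≤ same-hi » H≤suc) HF2≤; lower = lower'
      ; chg = change-trans (quiet→change q1) (change-trans (w9 c3) (change-trans (w9 c5) (change-weaken ≤! (λ h → h) (λ h → h) (Walked.chg r6))))
      ; tick≤ = Walked.tick≤ r6 » +ʳ≤ (n + walk-ticks) (Walked.tick≤ r4 » +ʳ≤ (n + walk-ticks) (=≤ (Cleared.ticks≡ r2))) » =≤ (e n walk-ticks (ticks s)) }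
      where
      w9 : ∀ {t t'} → Change 10 (planesOf j1) (wordsOf j1) t t' → Change 9 (planesOf j1) (wordsOf j1) t t'
      w9 = change-weaken ≤! (λ h → h) (λ h → h)
      e : ∀ n W t → n + W + (n + W + (n + t)) ≡ 3 * n + 2 * W + t
      e = ring

 -- Amortization of the refills

 -- The credit that a level has to collect between two refills.
 credit : ℕ
 credit = quarter ∸ L

 -- Field lengths are charged to the far endpoints of the edges instead of to the near ones (see telescope).
 charge : ℕ → List Edge → ℕ
 charge j z = sum (map (weight j) (heads z))

 weight≤L : ∀ j v → weight j v ≤ L
 weight≤L j v = m⊓n≤m (bb j) _ » bb≤L j

 size≡tails : ∀ j → j ≢ K → ∀ z → size j z ≡ sum (map (weight j) (tails z))
 size≡tails j j≢K [] = refl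
 size≡tails j j≢K (e ∷ z) = cong₂ _+_ (cong (bb j ⊓_) (if-false j≢ᵇK · sym (if-false j≢ᵇK))) (size≡tails j j≢K z)
  where
  j≢ᵇK = ≡ᵇ-≢ j K j≢K

 size≡heads : ∀ z → size K z ≡ charge K z
 size≡heads [] = refl
 size≡heads (e ∷ z) = cong₂ _+_ (cong (bb K ⊓_) (if-true (≡ᵇ-refl K) · sym (if-true (≡ᵇ-refl K)))) (size≡heads z)

 charge-size : ∀ j z {u x} → Chain u z x → charge j z ≤ size j z + L × size j z ≤ charge j z + L
 charge-size j z {u} {x} ch with j ≟ K
 ... | yes refl = =≥ (size≡heads z) » m≤m+n _ L , =≤ (size≡heads z) » m≤m+n _ L
 ... | no j≢K = m≤m+n _ (weight j x) » =≤ (telescope (weight j) z ch) » +≤+ (=≥ (size≡tails j j≢K z)) (weight≤L j u) ,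
  =≤ (size≡tails j j≢K z) » m≤m+n _ (weight j u) » =≥ (telescope (weight j) z ch) » +ʳ≤ (charge j z) (weight≤L j x)

 -- The bound on the size after a refill, plus `L` for the passage from sizes to charges.
 ceiling : ℕ
 ceiling = (quarter + L) + quarter + L

 -- The excess measures pushes since the last refill, the deficit measures pops. The deficit counts
 -- only if the zone below reaches deeper (`d` is nonempty): otherwise this zone is not exhausted
 -- before the one below it.
 potential : ℕ → List Edge → List Edge → ℕ
 potential j z [] = charge j z ∸ ceiling
 potential j z (_ ∷ _) = (charge j z ∸ ceiling) + (credit ∸ charge j z)

 ++-self : ∀ {A : Set} (xs : List A) {ys} → xs ++ ys ≡ xs → ys ≡ []
 ++-self [] e = e
 ++-self (x ∷ xs) e = ++-self xs (∷-injectiveʳ e)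

 potential-refilled : ∀ j z d {zone u x} → Chain u z x → z ++ d ≡ zone → size j z ≤ (quarter + L) + quarter → (z ≡ zone ⊎ quarter ≤ size j z) → potential j z d ≡ 0
 potential-refilled j z d ch eqn up low = cases d refl
  where
  no-excess = m≤n⇒m∸n≡0 (fst (charge-size j z ch) » +ˡ≤ L up)
  cases : ∀ d' → d ≡ d' → potential j z d' ≡ 0
  cases [] e = no-excess
  cases (_ ∷ _) e = Sum.[ (λ z≡ → ⊥! (absurd (sym (++-self z (eqn · sym z≡)) · e)))
   , (λ q≤ → cong₂ _+_ no-excess (m≤n⇒m∸n≡0 (m≤n+o⇒m∸n≤o quarter L (q≤ » snd (charge-size j z ch) » =≤ (+-comm (charge j z) L))))) ] low
   where
   absurd : ∀ {x : Edge} {xs : List Edge} → _≡_ {A = List Edge} [] (x ∷ xs) → ⊥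
   absurd ()

 -- Data of the proof that the machine does not store. `below' g (suc j)` is the part of zone `j`
 -- beneath zone `suc j`, and `refills` counts the refills of each level.
 record Ghost : Set where
  constructor ghost
  field
   zone : ℕ → List Edge
   from : ℕ → Fin n
   below' : ℕ → List Edge
   refills : ℕ → ℕ
 open Ghost public

 record Zones (k : ℕ) (g : Ghost) (s : State R2) (u : Fin n) : Set where
  field
   lvl : ∀ j → j < k → Level s j (zone g j) u (from g j)
   nest : ∀ j → suc j < k → zone g (suc j) ++ below' g (suc j) ≡ zone g j

 -- Every refill of level `suc j` is paid either by the tolls `E (suc j)` of the fields moved on
 -- that level or by a refill of level `j` in the same cascade.
 Paid : ℕ → Ghost → (ℕ → ℕ) → Set
 Paid j g E = credit * refills g (suc j) + potential (suc j) (zone g (suc j)) (below' g (suc j)) ≤ E (suc j) + credit * refills g j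

 -- Only the levels below `k` are in order. Level `k` owns the credit for one refill already; the
 -- levels above it are merely not in debt, and each receives its credit from the refill of the
 -- level below it.
 record Pending (k : ℕ) (g : Ghost) (E : ℕ → ℕ) (s : State R2) (u : Fin n) : Set where
  field
   zones : Zones k g s u
   full : ∀ j → j < k → zone g j ≢ []
   paid : ∀ j → suc j < k → Paid j g E
   stale : ∀ j → k ≤ j → j ≤ K → lev s (xA + j) ≡ ν u
   prepaid : ∀ j → suc j ≡ k → suc j ≤ K → credit * suc (refills g (suc j)) ≤ E (suc j) + credit * refills g j
   backlog : ∀ j → k ≤ j → suc j ≤ K → credit * refills g (suc j) ≤ E (suc j) + credit * refills g j

 cost : ℕ → ℕ
 cost ℓ = 3 * n + 2 * sumF (λ v → suc (gap ℓ v))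

 total : ℕ → (ℕ → ℕ) → ℕ
 total zero N = 0
 total (suc k) N = N (suc k) * cost k + total k N

 total-upd : ∀ k N j v → k < j → total k (updℕ N j v) ≡ total k N
 total-upd zero N j v k<j = refl
 total-upd (suc k) N j v k<j = cong₂ (λ a b → a * cost k + b) (updℕ-≢ N j v (suc k) (>⇒≢ k<j)) (total-upd k N j v (<-trans (n<1+n k) k<j))

 total-suc : ∀ k N ℓ → ℓ < k → total k (updℕ N (suc ℓ) (suc (N (suc ℓ)))) ≡ cost ℓ + total k N
 total-suc (suc k) N ℓ (s≤s ℓ≤k) with ℓ ≟ k
 ... | yes refl = cong₂ (λ a b → a * cost ℓ + b) (updℕ-≡ N (suc ℓ) (suc (N (suc ℓ)))) (total-upd ℓ N (suc ℓ) _ (n<1+n ℓ)) · +-assoc (cost ℓ) _ _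
 ... | no ℓ≢k = cong₂ (λ a b → a * cost k + b) (updℕ-≢ N (suc ℓ) _ (suc k) (λ e → ℓ≢k (suc-injective e))) (total-suc k N ℓ (≤∧≢⇒< ℓ≤k ℓ≢k)) ·
  x+yz≡y+xz (N (suc k) * cost k) (cost ℓ) (total k N)

 record Outer (s s' : State R2) : Set where
  constructor outer
  field
   frame : Frame 8 s s'
   colours : ∀ r → r < 2 → ∀ o → pl s' r o ≡ pl s r o
   out≡ : out s' ≡ out s
  kept = below frame

 outer-trans : ∀ {s s1 s2} → Outer s s1 → Outer s1 s2 → Outer s s2
 outer-trans (outer f c o) (outer f' c' o') = outer (λ x l → f' x l · f x l) (λ r h i → c' r h i · c r h i) (o' · o)

 quiet→outer : ∀ {s s'} → Quiet 8 s s' → Outer s s'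
 quiet→outer (quiet f _ p _ o) = outer f (λ r _ i → p ∙ r ∙ i) o

 low≢planes : ∀ {r} j → r < 2 → All (r ≢_) (planesOf j)
 low≢planes j r<2 = <⇒≢ r<2 ∷ (λ e → in≢low j (<-trans r<2 ≤!) (sym e)) ∷ (λ e → st≢low j (<-trans r<2 ≤!) (sym e)) ∷ []

 change→outer : ∀ {s s'} j → Change 8 (planesOf j) (wordsOf j) s s' → Outer s s'
 change→outer j (change f p a σ o) = outer f (λ r r<2 → p r (low≢planes j r<2)) o

 zones-prefix : ∀ {k g s u} → Zones k g s u → ∀ j → j < k → Σ[ D ∈ List Edge ] zone g j ++ D ≡ zone g 0
 zones-prefix zs zero j<k = [] , ++-identityʳ _
 zones-prefix {g = g} zs (suc j) j<k =
  let (D , e) = zones-prefix zs j (<-trans (n<1+n j) j<k)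
  in below' g (suc j) ++ D , sym (++-assoc (zone g (suc j)) (below' g (suc j)) D) · cong (_++ D) (Zones.nest zs j j<k) · e

 zones-quiet : ∀ {k m g s s' u} → Quiet m s s' → Zones k g s u → Zones k g s' u
 zones-quiet q zs = record { lvl = λ j h → level-quiet q (Zones.lvl zs j h); nest = Zones.nest zs }

 pending-quiet : ∀ {k m g E s s' u} → Quiet m s s' → Pending k g E s u → Pending k g E s' u
 pending-quiet q p = record { zones = zones-quiet q zones; full = full; paid = paid; stale = λ j h h' → Quiet.lev≡ q ∙ (xA + j) · stale j h h'; prepaid = prepaid; backlog = backlog }
  where open Pending p

 refill-ghost : ℕ → List Edge → Fin n → List Edge → Ghost → Ghost
 refill-ghost j z x d g = ghost (updℕ (zone g) j z) (updℕ (from g) j x) (updℕ (below' g) j d) (updℕ (refills g) j (suc (refills g j)))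

 -- One more level is in order after its refill; the refill has been prepaid.
 pending-refill : ∀ {ℓ g E s s' u} (z : List Edge) (x : Fin n) (d : List Edge) → ℓ < K → Pending (suc ℓ) g E s u → Change 8 (planesOf (suc ℓ)) (wordsOf (suc ℓ)) s s' →
  Level s' (suc ℓ) z u x → z ++ d ≡ zone g ℓ → z ≢ [] → potential (suc ℓ) z d ≡ 0 → Pending (suc (suc ℓ)) (refill-ghost (suc ℓ) z x d g) E s' u
 pending-refill {ℓ} {g} {E} {s} {s'} {u} z x d ℓ<K p chg lv eqn z≢[] pot = record { zones = record { lvl = λ j h → lvls j (≤-split (≤-pred h)) ; nest = λ j h → nests j (≤-split (≤-pred h)) }
  ; full = λ j h → fulls j (≤-split (≤-pred h))
  ; paid = λ j h → paids j (≤-split (≤-pred h))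
  ; stale = λ j k≤j j≤K → Change.words chg (xA + j) ((λ e → sp≢x ℓ<K (sym e)) ∷ x-inj (>⇒≢ k≤j) ∷ []) · stale j (<⇒≤ k≤j) j≤K
  -- The refill just counted on level `suc ℓ` raises the right-hand side by one credit and so
  -- prepays the refill of the next level.
  ; prepaid = λ { .(suc ℓ) refl h → =≤ (cong (λ z → credit * suc z) (same (suc (suc ℓ)) (≢-sym 1+n≢n))) »
   =≤ (*-suc credit (refills g (suc (suc ℓ)))) » +ʳ≤ credit (backlog (suc ℓ) ≤-refl h) »
   =≤ (x+yz≡y+xz credit (E (suc (suc ℓ))) (credit * refills g (suc ℓ)) · cong (E (suc (suc ℓ)) +_) (sym (*-suc credit (refills g (suc ℓ))) · cong (credit *_) (sym (updℕ-≡ (refills g) (suc ℓ) _)))) }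
  ; backlog = λ j k≤j h → subst₂ (λ a b → credit * a ≤ E (suc j) + credit * b) (sym (same (suc j) (λ e → <⇒≢ (<-trans k≤j (n<1+n j)) e))) (sym (same j (λ e → <⇒≢ k≤j e))) (backlog j (<⇒≤ k≤j) h) }
  where
  open Pending p
  same : ∀ i → suc ℓ ≢ i → updℕ (refills g) (suc ℓ) (suc (refills g (suc ℓ))) i ≡ refills g i
  same i = updℕ-≢ (refills g) (suc ℓ) _ i
  lvls : ∀ j → j < suc ℓ ⊎ j ≡ suc ℓ → Level s' j (updℕ (zone g) (suc ℓ) z j) u (updℕ (from g) (suc ℓ) x j)
  lvls j (inl j<) = subst₂ (λ a b → Level s' j a u b) (sym (updℕ-≢ (zone g) (suc ℓ) z j (>⇒≢ j<))) (sym (updℕ-≢ (from g) (suc ℓ) x j (>⇒≢ j<)))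
   (level-change chg (<⇒≢ j<) (≤-pred j< » <⇒≤ ℓ<K) ℓ<K (Zones.lvl zones j j<))
  lvls .(suc ℓ) (inr refl) = subst₂ (λ a b → Level s' (suc ℓ) a u b) (sym (updℕ-≡ (zone g) (suc ℓ) z)) (sym (updℕ-≡ (from g) (suc ℓ) x)) lv
  nests : ∀ j → suc j < suc ℓ ⊎ suc j ≡ suc ℓ → updℕ (zone g) (suc ℓ) z (suc j) ++ updℕ (below' g) (suc ℓ) d (suc j) ≡ updℕ (zone g) (suc ℓ) z j
  nests j (inl j<) = (cong₂ _++_ (updℕ-≢ (zone g) (suc ℓ) z (suc j) (>⇒≢ j<)) (updℕ-≢ (below' g) (suc ℓ) d (suc j) (>⇒≢ j<))) ·
   Zones.nest zones j j< · sym (updℕ-≢ (zone g) (suc ℓ) z j (λ e → <⇒≢ (<-trans (n<1+n j) j<) (sym e)))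
  nests .ℓ (inr refl) = (cong₂ _++_ (updℕ-≡ (zone g) (suc ℓ) z) (updℕ-≡ (below' g) (suc ℓ) d)) · eqn · sym (updℕ-≢ (zone g) (suc ℓ) z ℓ 1+n≢n)
  fulls : ∀ j → j < suc ℓ ⊎ j ≡ suc ℓ → updℕ (zone g) (suc ℓ) z j ≢ []
  fulls j (inl j<) e = full j j< (sym (updℕ-≢ (zone g) (suc ℓ) z j (>⇒≢ j<)) · e)
  fulls .(suc ℓ) (inr refl) e = z≢[] (sym (updℕ-≡ (zone g) (suc ℓ) z) · e)
  paids : ∀ j → suc j < suc ℓ ⊎ suc j ≡ suc ℓ → Paid j (refill-ghost (suc ℓ) z x d g) E
  paids j (inl j<) = subst₂ _≤_ (cong₂ _+_ (cong (credit *_) (sym (same (suc j) (>⇒≢ j<))))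
   (cong₂ (potential (suc j)) (sym (updℕ-≢ (zone g) (suc ℓ) z (suc j) (>⇒≢ j<))) (sym (updℕ-≢ (below' g) (suc ℓ) d (suc j) (>⇒≢ j<)))))
   (cong (λ a → E (suc j) + credit * a) (sym (same j (λ e → <⇒≢ (<-trans (n<1+n j) j<) (sym e))))) (paid j j<)
  paids .ℓ (inr refl) = subst₂ _≤_ (sym (+0 _) · (cong₂ _+_ (cong (credit *_) (sym (updℕ-≡ (refills g) (suc ℓ) _)))
   (sym pot · cong₂ (potential (suc ℓ)) (sym (updℕ-≡ (zone g) (suc ℓ) z)) (sym (updℕ-≡ (below' g) (suc ℓ) d)))))
   (cong (λ a → E (suc ℓ) + credit * a) (sym (same ℓ 1+n≢n))) (prepaid ℓ refl ℓ<K)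

 -- The induction rule for `levels`: in `Inv J` the levels below `J` are done. The increment and the
 -- tick that end an iteration belong to the step.
 module Levelwise (c : Cmd (Query kind) R2) (Inv : ℕ → State R2 → Set) where

  suc-K<w : suc K < 2 ^ w
  suc-K<w = lin 1 0 z<s z≤n ≤-refl

  module _ (test : ∀ {J s} → Inv J s → Inv J (runs test-block s))
   (step-level : ∀ J s → J < K → reg s LEV ≡ suc J → Inv (suc J) s →
    Σ[ s' ∈ State R2 ] Exec c s s' × reg s' LEV ≡ suc J × Inv (suc (suc J)) (tick (runs next-block s'))) where

   levels-spec : ∀ s → Inv 1 (runs first-level s) → Runs (levels c) s (Inv (suc K))
   levels-spec s i = let (s' , ex , r) = go K 0 (runs first-level s) (+0 K) refl i in s' , (blk (lit! , tt) ▸ ex) , r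
    where
    go : ∀ m J t → m + J ≡ K → reg t LEV ≡ suc J → Inv (suc J) t → Runs (loop (block test-block) P1 (c ⨾ block next-block)) t (Inv (suc K))
    go zero J t refl L≡ i = runs test-block t , stop (blk ((tt , suc-K<w , tt) , tt)) (cong bit (<ᵇ-false (=≥ L≡))) , test i
    go (suc m) J t m+J L≡ i = after (step-level J (runs test-block t) J<K L≡ (test i))
     where
     J<K : J < K
     J<K = s≤s (m≤n+m J m) » =≤ m+J
     after : Σ[ s' ∈ State R2 ] Exec c (runs test-block t) s' × reg s' LEV ≡ suc J × Inv (suc (suc J)) (tick (runs next-block s')) →
      Runs (loop (block test-block) P1 (c ⨾ block next-block)) t (Inv (suc K))
     after (t-1 , ex , L1 , i1) =
      let (s' , ex' , r) = go m (suc J) (tick (runs next-block t-1)) (+-suc m J · m+J) (cong (_+ 1) L1 · +-comm (suc J) 1) i1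
      in s' , again (blk ((tt , suc-K<w , tt) , tt)) (λ z → 1+n≢0 (sym (cong bit (<ᵇ-true (≡< L≡ (s≤s J<K)))) · z))
       (ex ▸ blk ((tt , lit! , ≡< (sym (+-comm 1 (suc J) · cong (_+ 1) (sym L1))) (lin 2 0 (s≤s z<s) z≤n (<⇒≤ J<K))) , tt)) ex' , r

 levels-quiet : ∀ {k s s'} → Quiet k s s' → Levels s → Levels s'
 levels-quiet q = levels-keep (Quiet.lev≡ q)

 -- Rebuilding the stale levels

 module Fixing {c r u ps} (inv : PathInv c r u ps) (E : ℕ → ℕ) where

  -- Makes the staleness test sound: a nonempty zone starts at a tail on the path, and the current
  -- vertex is not among the tails.
  start≢u : ∀ {z d x} → z ++ d ≡ ps → z ≢ [] → Chain u z x → x ≢ u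
  start≢u {[]} eqn z≢ ch = ⊥! (z≢ refl)
  start≢u {e ∷ z} {d} {x} eqn z≢ (_ , ch) x≡u with PathInv.uniq inv | last-tail (tl e) z ch
   where
   last-tail : ∀ y z → Chain y z x → x ∈ (y ∷ tails z)
   last-tail y [] refl = here refl
   last-tail y (e ∷ z) (_ , ch) = there (last-tail (tl e) z ch)
  ... | u∉ ∷ _ | x∈ = All.lookup u∉ (subst (λ p → x ∈ tails p) eqn (∈-++ˡ' (tails (e ∷ z)) x∈)) (sym x≡u)
   where
   ∈-++ˡ' : ∀ ys → x ∈ ys → x ∈ tails ((e ∷ z) ++ d)
   ∈-++ˡ' ys _ = subst (x ∈_) (sym (map-++ tl (e ∷ z) d)) (∈-++⁺ˡ x∈)

  -- `tick≤` bills the walks to the increase of `total`, so that just one tick per level remains.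
  record FixInv (g0 : Ghost) (s0 : State R2) (J : ℕ) (s : State R2) : Set where
   field
    k0 : ℕ
    gh : Ghost
    J≤k0 : J ≤ k0
    k0≤ : k0 ≤ suc K
    z0 : zone gh 0 ≡ ps
    x0 : from gh 0 ≡ r
    N0 : refills gh 0 ≡ 0
    pend : Pending k0 gh E s u
    lvs : Levels s
    outerF : Outer s0 s
    U≡ : reg s U ≡ ν u
    tick≤ : suc (ticks s + total K (refills g0)) ≤ J + ticks s0 + total K (refills gh)

  fix-quiet : ∀ {g0 s0 J s s'} → Quiet 8 s s' → ticks s' ≡ ticks s → FixInv g0 s0 J s → FixInv g0 s0 J s'
  fix-quiet {g0} q t f = record { k0 = k0; gh = gh; J≤k0 = J≤k0; k0≤ = k0≤; z0 = z0; x0 = x0; N0 = N0; pend = pending-quiet q pend; lvs = levels-quiet q lvs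
   ; outerF = outer-trans outerF (quiet→outer q); U≡ = Quiet.kept q U · U≡
   ; tick≤ = =≤ (cong (λ z → suc (z + total K (refills g0))) t) » tick≤ }
    where open FixInv f

  fix-advance : ∀ {g0 s0 J s} (f : FixInv g0 s0 J s) → J < FixInv.k0 f → FixInv g0 s0 (suc J) (tick (runs next-block s))
  fix-advance {s = s} f J<k0 = record { k0 = k0; gh = gh; J≤k0 = J<k0; k0≤ = k0≤; z0 = z0; x0 = x0; N0 = N0; pend = pending-quiet q pend; lvs = levels-quiet q lvs
   ; outerF = outer-trans outerF (quiet→outer q); U≡ = Quiet.kept q U · U≡; tick≤ = s≤s tick≤ }
    where
    open FixInv f
    q : Quiet 8 s (tick (runs next-block s))
    q = quiet-tick (runs-quiet {8} next-block s refl)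

  fix-level-spec : ∀ g0 s0 J s → J < K → reg s LEV ≡ suc J → FixInv g0 s0 (suc J) s →
   Σ[ s' ∈ State R2 ] Exec fix-level s s' × reg s' LEV ≡ suc J × FixInv g0 s0 (suc (suc J)) (tick (runs next-block s'))
  fix-level-spec g0 s0 J s J<K L≡ f = cases (≤-split J≤k0)
   where
   open FixInv f
   Result = Σ[ s' ∈ State R2 ] Exec fix-level s s' × reg s' LEV ≡ suc J × FixInv g0 s0 (suc (suc J)) (tick (runs next-block s'))
   s1 = runs stale-test s
   f1 : FixInv g0 s0 (suc J) s1
   f1 = fix-quiet (runs-quiet {8} stale-test s refl) refl f
   ok-1 : oks stale-test s
   ok-1 = ld-ok (cong (xA +_) L≡) (x<w J<K) (x<PB J<K) , (tt , tt , tt) , tt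
   test≡ : ∀ {x} → lev s (xA + suc J) ≡ x → reg s1 P1 ≡ bit (x ≡ᵇ ν u)
   test≡ e = cong₂ (λ a b → bit (a ≡ᵇ b)) (cong (λ z → lev s (xA + z)) L≡ · e) U≡
   cases : suc J < k0 ⊎ suc J ≡ k0 → Result
   cases (inl J<k0) = s1 , (blk ok-1 ▸ ifF (test≡ (Level.start lv) · cong bit (≡ᵇ-≢ _ _ (λ e → from≢u (ν-inj e)))) (blk tt)) , L≡ , fix-advance f1 J<k0
    where
    lv : Level s (suc J) (zone gh (suc J)) u (from gh (suc J))
    lv = Zones.lvl (Pending.zones pend) (suc J) J<k0
    from≢u : from gh (suc J) ≢ u
    from≢u = let (D , e) = zones-prefix (Pending.zones pend) (suc J) J<k0 in start≢u {zone gh (suc J)} {D} (e · z0) (Pending.full pend (suc J) J<k0) (Level.chainL lv)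
   cases (inr J≡k0) = after-prefix (zones-prefix (Pending.zones pend1) J (n<1+n J))
    where
    pend1 : Pending (suc J) gh E s1 u
    pend1 = subst (λ k → Pending k gh E s1 u) (sym J≡k0) (FixInv.pend f1)
    after-prefix : Σ[ D ∈ List Edge ] zone gh J ++ D ≡ zone gh 0 → Result
    after-prefix (D , e) = after-refill (refill-spec inv {zone gh J} {D} (e · z0) J J<K (from gh J) s1 (Zones.lvl (Pending.zones pend1) J (n<1+n J)) (FixInv.lvs f1) L≡ (FixInv.U≡ f1))
     where
     after-refill : Σ[ s2 ∈ State R2 ] Exec refill s1 s2 × Refilled inv {zone gh J} {D} (e · z0) J J<K (from gh J) s1 s2 → Result
     after-refill (s2 , ex2 , rf) = s2 , (blk ok-1 ▸ ifT (λ z → 1+n≢0 (sym (cong bit (≡ᵇ-refl (ν u))) · sym (test≡ (Pending.stale pend (suc J) (=≥ J≡k0) J<K)) · z)) ex2) ,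
      Change.kept chg LEV · L≡ , fix-advance f2 (s≤s (=≤ refl))
      where
      open Refilled rf
      chg8 : Change 8 (planesOf (suc J)) (wordsOf (suc J)) s1 s2
      chg8 = change-weaken (n≤1+n 8) (λ h → h) (λ h → h) chg
      z≢[] : z' ≢ []
      z≢[] z≡ with lower
      ... | inl same = Pending.full pend1 J (n<1+n J) (sym same · z≡)
      ... | inr q≤ = <⇒≱ quarter>0 (subst (λ z → quarter ≤ size (suc J) z) z≡ q≤)
      f2 : FixInv g0 s0 (suc J) s2
      f2 = record { k0 = suc (suc J); gh = refill-ghost (suc J) z' x' d' gh; J≤k0 = n≤1+n (suc J); k0≤ = s≤s J<K ; z0 = z0; x0 = x0; N0 = N0
       ; pend = pending-refill z' x' d' J<K pend1 chg8 lvl prefix z≢[] (potential-refilled (suc J) z' d' (Level.chainL lvl) prefix upper lower)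
       ; lvs = levels-change J<K chg (FixInv.lvs f1); outerF = outer-trans (FixInv.outerF f1) (change→outer (suc J) chg8)
       ; U≡ = Change.kept chg U · FixInv.U≡ f1
       ; tick≤ = s≤s (+ˡ≤ (total K (refills g0)) (Refilled.tick≤ rf)) » =≤ (sym-cost (cost J) (ticks s) (total K (refills g0))) »
        +ʳ≤ (cost J) (FixInv.tick≤ f) » =≤ (x+yz≡y+xz (cost J) (suc J + ticks s0) (total K (refills gh)) · cong (suc J + ticks s0 +_) (sym (total-suc K (refills gh) J J<K))) }
        where
        sym-cost : ∀ a b c → suc (a + b + c) ≡ a + suc (b + c)
        sym-cost = ring

  record Settled (g : Ghost) (s : State R2) : Set where
   field
    z0 : zone g 0 ≡ ps
    x0 : from g 0 ≡ r
    N0 : refills g 0 ≡ 0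
    zones : Zones (suc K) g s u
    full : ps ≢ [] → ∀ j → j ≤ K → zone g j ≢ []
    paid : ∀ j → j < K → Paid j g E
    lvs : Levels s

  record Fixed (g0 : Ghost) (s s' : State R2) : Set where
   field
    gh : Ghost
    settled : Settled gh s'
    outerF : Outer s s'
    tick≤ : ticks s' + total K (refills g0) ≤ K + ticks s + total K (refills gh)

  fix-spec : ∀ {g k} s → ps ≢ [] → 1 ≤ k → k ≤ suc K → Pending k g E s u → Levels s → zone g 0 ≡ ps → from g 0 ≡ r → refills g 0 ≡ 0 → reg s U ≡ ν u → reg s RT ≡ ν r → Runs fix s (Fixed g s)
  fix-spec {g} {k} s ps≢ 1≤k k≤ pend lvs z0 x0 N0 U≡ R≡ =
   let (s' , ex , f) = levels-spec (λ {J} {s} f → fix-quiet {g} {s0} {J} {s} (runs-quiet {8} test-block s refl) refl f) (fix-level-spec g s0) s1 init in after s' ex f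
   where
   s0 = s
   s1 = runs root-test s
   open Levelwise fix-level (FixInv g s0)
   q1 : Quiet 8 s (runs first-level s1)
   q1 = runs-quiet {8} (alu eq P1 (var U) (var RT) ∷ mov LEV (lit 1) ∷ []) s refl
   init : FixInv g s0 1 (runs first-level s1)
   init = record { k0 = k; gh = g; J≤k0 = 1≤k; k0≤ = k≤; z0 = z0; x0 = x0; N0 = N0; pend = pending-quiet q1 pend; lvs = levels-quiet q1 lvs
    ; outerF = quiet→outer q1; U≡ = U≡; tick≤ = ≤-refl }
   r≢u : r ≢ u
   r≢u = start≢u {ps} {[]} (++-identityʳ ps) ps≢ (PathInv.chain inv)
   after : ∀ s' → Exec (levels fix-level) s1 s' → FixInv g s0 (suc K) s' → Runs fix s (Fixed g s)
   after s' ex f = s' , (blk ((tt , tt , tt) , tt) ▸ ifF (cong₂ (λ a b → bit (a ≡ᵇ b)) U≡ R≡ · cong bit (≡ᵇ-≢ _ _ (λ e → r≢u (sym (ν-inj e))))) ex) , record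
    { gh = FixInv.gh f; outerF = FixInv.outerF f; tick≤ = ≤-pred (FixInv.tick≤ f)
    ; settled = record { z0 = FixInv.z0 f; x0 = FixInv.x0 f; N0 = FixInv.N0 f; zones = Pending.zones pend'; full = λ _ j j≤K → Pending.full pend' j (s≤s j≤K)
     ; paid = λ j j<K → Pending.paid pend' j (s≤s j<K); lvs = FixInv.lvs f } }
    where
    pend' : Pending (suc K) (FixInv.gh f) E s' u
    pend' = subst (λ k → Pending k (FixInv.gh f) E s' u) (≤-antisym (FixInv.k0≤ f) (FixInv.J≤k0 f)) (FixInv.pend f)

 -- Pushing an edge

 store-spec : ∀ e z x s → reg s LEV ≤ K → reg s LEV ≢ 0 → Level s (reg s LEV) z (tl e) x → reg s V ≡ ν (hd e) →
  reg s FL ≡ fl (reg s LEV) e → reg s FV ≡ fv (reg s LEV) e → reg s P2 ≡ size (reg s LEV) z → size (reg s LEV) (e ∷ z) ≤ n →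
  oks store-block s × Change 8 (planesOf (reg s LEV)) (wordsOf (reg s LEV)) s (runs store-block s) × Level (runs store-block s) (reg s LEV) (e ∷ z) (hd e) x
 store-spec e z x s j≤K j≢0 (level ch sr mk sd rm) V≡ FL≡ FV≡ sp≡ fits' = oks-2 , change (runs-frame {8} store-block s refl)
   (λ { r (_ ∷ r≢in ∷ r≢st ∷ []) o → wrP-plane f1 (inP + j) (reg s V) 1 1 r o (≢-sym r≢in) · wrP-plane (pl s) (stP + j) (reg s P2) (reg s FL) (reg s FV) r o (≢-sym r≢st) })
   (λ { a (a≢ ∷ _ ∷ []) → updℕ-≢ (lev s) j _ a (≢-sym a≢) }) refl refl ,
  level (refl , ch) (updℕ-≢ (lev s) j _ (xA + j) (sp≢x j≤K) · sr) (marks-set (pl s (inP + j)) (pl s2 (inP + j)) e z (λ v → set-bit f1 (inP + j) (reg s V) true (ν v) ·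
    cong (λ o → if o ≡ᵇ ν v then true else f1 (inP + j) (ν v)) V≡ ·
     cong (λ b → if ν (hd e) ≡ᵇ ν v then true else b) (wrP-plane (pl s) (stP + j) (reg s P2) (reg s FL) (reg s FV) (inP + j) (ν v) (λ e → in≢st j≤K (sym e)))) mk)
   (to-stored s2 j (e ∷ z) j≢0 (enc-cong (wrP (pl s) (stP + j) (size j z) (fl j e) (fv j e) (stP + j)) (pl s2 (stP + j)) j (e ∷ z)
    (λ o _ → wrP-plane f1 (inP + j) (reg s V) 1 1 (stP + j) o (in≢st j≤K) · wrP-cong (pl s) {stP + j} {stP + j} (stP + j) o refl sp≡ FL≡ FV≡)
    (enc-push (pl s) (stP + j) j e z j≤K (to-enc s j z j≢0 sd))))
   (λ _ → updℕ-≡ (lev s) j _ · (cong₂ _+_ sp≡ FL≡) · +-comm (size j z) _ , fits')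
  where
  j = reg s LEV
  f1 = wrP (pl s) (stP + j) (reg s P2) (reg s FL) (reg s FV)
  s2 = runs store-block s
  oks-2 : oks store-block s
  oks-2 = (st<w j≤K , tt , tt , tt , st<NR j≤K , ≡≤ sp≡ (m≤n+m _ (fl j e) » fits') ,
   ≡≤ FL≡ (fl≤bb j e » bb≤L j » L≤w) , subst₂ (λ a b → a < 2 ^ b) (sym FV≡) (sym FL≡) (fv-< j e j≤K) , fits) ,
   (tt , tt , ≡< (sym (+-comm (fl j e) (size j z) · sym (cong₂ _+_ sp≡ FL≡))) (n<w fits')) ,
   (lin 0 0 z≤n z≤n j≤K , tt , sp<PB j≤K , fits) ,
   (in<w j≤K , tt , lit! , lit! , in<NR j≤K , num≤n V≡ , w>0 , s≤s z<s , fits) , tt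

 level-above : ∀ {j z u x s s'} → lev s' ≡ lev s → (∀ r o → r ≢ inP → pl s' r o ≡ pl s r o) → Level s (suc j) z u x → Level s' (suc j) z u x
 level-above {j} {z} {u} {x} {s} {s'} l p (level ch sr mk sd rm) = level ch (l ∙ (xA + suc j) · sr) (λ v → p (inP + suc j) (ν v) (λ e → 1+n≢0 (+-cancelˡ-≡ inP (suc j) 0 e)) · mk v)
  (enc-cong (pl s (stP + suc j)) (pl s' (stP + suc j)) (suc j) z (λ o _ → p (stP + suc j) o (λ e → in≢st {0} {suc j} z≤n (sym e))) sd)
  (λ h → l ∙ (spA + suc j) · fst (rm h) , snd (rm h))

 module Pushing (e : Edge) (gh : Ghost) (s0 : State R2) where

  private
   u v : Fin n
   u = tl e
   v = hd e

  -- `k` is the first level that lacked room for its field, or `J` if there has been none so far.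
  record PushInv (J : ℕ) (s : State R2) : Set where
   field
    k : ℕ
    1≤k : 1 ≤ k
    k≤J : k ≤ J
    flag : reg s P3 ≡ bit (k <ᵇ J)
    new : ∀ j → j < k → Level s j (e ∷ zone gh j) v (from gh j)
    stale : ∀ j → k ≤ j → j < J → lev s (xA + j) ≡ ν v
    old : ∀ j → J ≤ j → j ≤ K → Level s j (zone gh j) u (from gh j)
    over : k < J → n < fl k e + size k (zone gh k)
    V≡ : reg s V ≡ ν v
    PY≡ : reg s PY ≡ ν u
    PI≡ : reg s PI ≡ toℕ (snd e)
    PZ≡ : reg s PZ ≡ ν v
    lvs : Levels s
    outerF : Outer s0 s
    tick≡ : suc (ticks s) ≡ J + ticks s0

  push-quiet : ∀ {J s s'} → Quiet 8 s s' → (∀ r → r ≡ P3 ⊎ r ≡ PY ⊎ r ≡ PI ⊎ r ≡ PZ → reg s' r ≡ reg s r) → ticks s' ≡ ticks s → PushInv J s → PushInv J s'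
  push-quiet {J} q h t i = record { k = k; 1≤k = 1≤k; k≤J = k≤J; flag = h P3 (inl refl) · flag; new = λ j l → level-quiet q (new j l)
   ; stale = λ j a b → Quiet.lev≡ q ∙ (xA + j) · stale j a b; old = λ j a b → level-quiet q (old j a b); over = over
   ; V≡ = Quiet.kept q V · V≡; PY≡ = h PY (inr (inl refl)) · PY≡; PI≡ = h PI (inr (inr (inl refl))) · PI≡
   ; PZ≡ = h PZ (inr (inr (inr refl))) · PZ≡; lvs = levels-quiet q lvs; outerF = outer-trans outerF (quiet→outer q)
   ; tick≡ = cong suc t · tick≡ }
    where open PushInv i

  ghost-regs : ∀ {s s'} → Quiet 27 s s' → ∀ r → r ≡ P3 ⊎ r ≡ PY ⊎ r ≡ PI ⊎ r ≡ PZ → reg s' r ≡ reg s r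
  ghost-regs q .P3 (inl refl) = Quiet.kept q P3
  ghost-regs q .PY (inr (inl refl)) = Quiet.kept q PY
  ghost-regs q .PI (inr (inr (inl refl))) = Quiet.kept q PI
  ghost-regs q .PZ (inr (inr (inr refl))) = Quiet.kept q PZ

  push-level-spec : ∀ J s → J < K → reg s LEV ≡ suc J → PushInv (suc J) s → Σ[ s' ∈ State R2 ] Exec push-level s s' × reg s' LEV ≡ suc J × PushInv (suc (suc J)) (tick (runs next-block s'))
  push-level-spec J s J<K L≡ i = let (s1 , ex1 , p1) = params-spec e (suc J) s J<K (edge-in PY≡ PI≡ PZ≡ L≡) lvs in after-params s1 ex1 p1
   where
   open PushInv i
   Result = Σ[ s' ∈ State R2 ] Exec push-level s s' × reg s' LEV ≡ suc J × PushInv (suc (suc J)) (tick (runs next-block s'))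
   z = zone gh (suc J)
   after-params : ∀ s1 → Exec params s s1 → Params e (suc J) s s1 → Result
   after-params s1 ex1 p1 = cases (≤-split k≤J)
    where
    open Params p1
    i1 : PushInv (suc J) s1
    i1 = push-quiet (quiet-weaken ≤! still) (ghost-regs still) (Params.tick≡ p1) i
    module i1 = PushInv i1
    L1 = Quiet.kept still LEV · L≡
    lv1 : Level s1 (suc J) z u (from gh (suc J))
    lv1 = i1.old (suc J) ≤-refl J<K
    s2 = runs room-test s1
    q2 : Quiet 8 s1 s2
    q2 = runs-quiet {8} room-test s1 refl
    sp≡ : lev s1 (spA + reg s1 LEV) ≡ size (suc J) z
    sp≡ = cong (lev s1) L1 · fst (Level.room lv1 1+n≢0)
    tight : Bool
    tight = n ∸ size (suc J) z <ᵇ fl (suc J) e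
    flag2 : reg s2 P3 ≡ bit ((k <ᵇ suc J) ∨ tight)
    flag2 = cong₂ (bitwise _∨_ w) i1.flag (cong₂ (λ a b → bit (n ∸ a <ᵇ b)) sp≡ fl≡) · bitwise-∨-bit w (k <ᵇ suc J) tight w>0
    ok-2 : oks room-test s1
    ok-2 = (≡< L1 (lin 0 0 z≤n z≤n J<K) , ≡< L1 (sp<PB J<K) , fits) , tt , (tt , tt , ≡≤ sp≡ (snd (Level.room lv1 1+n≢0))) , (tt , tt , tt) , (tt , tt , tt) , tt
    qₙ : ∀ s3 → Quiet 8 s3 (tick (runs next-block s3))
    qₙ s3 = quiet-tick (runs-quiet {8} next-block s3 refl)
    olds : ∀ {s3} → Change 8 (planesOf (suc J)) (wordsOf (suc J)) s2 s3 → ∀ j → suc (suc J) ≤ j → j ≤ K → Level (tick (runs next-block s3)) j (zone gh j) u (from gh j)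
    olds c3 j J≤j j≤K = level-quiet (qₙ _) (level-change c3 (>⇒≢ J≤j) j≤K J<K (level-quiet q2 (i1.old j (<⇒≤ J≤j) j≤K)))
    outers : ∀ {s3} → Change 8 (planesOf (suc J)) (wordsOf (suc J)) s2 s3 → Outer s0 (tick (runs next-block s3))
    outers c3 = outer-trans i1.outerF (outer-trans (quiet→outer q2) (outer-trans (change→outer (suc J) c3) (quiet→outer (qₙ _))))
    go-stale : k < suc (suc J) → (k <ᵇ suc J) ∨ tight ≡ true → n < fl k e + size k (zone gh k) → Result
    go-stale k< on ov = s3 , (ex1 ▸ blk ok-2 ▸ ifT (λ z → bit≢0 on (sym flag2 · z)) (blk (st-ok (cong (xA +_) L1) (x<w J<K) (x<PB J<K) , tt))) , L1 ,
     record { k = k; 1≤k = 1≤k; k≤J = <⇒≤ k<; flag = flag2 · cong bit (on · sym (<ᵇ-true k<))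
      ; new = λ j j<k → level-quiet (qₙ s3) (level-change c3 (<⇒≢ (j<k » k≤J)) ((<⇒≤ j<k) » k≤J » J<K) J<K (level-quiet q2 (i1.new j j<k)))
      ; stale = λ j k≤j j< → stales j k≤j (≤-split (≤-pred j<))
      ; old = olds c3
      ; over = λ _ → ov
      ; V≡ = i1.V≡; PY≡ = i1.PY≡; PI≡ = i1.PI≡; PZ≡ = i1.PZ≡
      ; lvs = levels-quiet (qₙ s3) (levels-change J<K c3 (levels-quiet q2 i1.lvs))
      ; outerF = outers c3
      ; tick≡ = cong suc i1.tick≡ }
     where
     stale-block = ST (off xA LEV) (var V) ∷ []
     s3 = runs stale-block s2
     c3 : Change 8 (planesOf (suc J)) (wordsOf (suc J)) s2 s3
     c3 = change (λ _ _ → refl) (λ _ _ _ → refl) (λ { a (_ ∷ a≢ ∷ []) → updℕ-≢ (lev s1) (xA + reg s1 LEV) _ a (λ e → a≢ (sym e · cong (xA +_) L1)) }) refl refl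
     stales : ∀ j → k ≤ j → j < suc J ⊎ j ≡ suc J → lev s3 (xA + j) ≡ ν v
     stales j k≤j (inl j<) = updℕ-≢ (lev s1) (xA + reg s1 LEV) _ (xA + j) (λ e → x-inj (<⇒≢ j<) (sym e · cong (xA +_) L1)) · i1.stale j k≤j j<
     stales .(suc J) k≤j (inr refl) = cong (λ l → updℕ (lev s1) (xA + l) (reg s1 V) (xA + suc J)) L1 · updℕ-≡ (lev s1) (xA + suc J) _ · i1.V≡
    go-push : k ≡ suc J → tight ≡ false → Result
    go-push k≡ loose = s3 , (ex1 ▸ blk ok-2 ▸ ifF (flag2 · cong bit off2) (blk (fst stored))) , L1 ,
     record { k = suc (suc J); 1≤k = z<s; k≤J = ≤-refl; flag = flag2 · cong bit off2 · sym (cong bit (<ᵇ-false {suc (suc J)} ≤-refl))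
      ; new = λ j j< → level-quiet (qₙ s3) (news j (≤-split (≤-pred j<)))
      ; stale = λ j a b → ⊥! (<⇒≱ b a)
      ; old = olds c3
      ; over = λ h → ⊥! (<⇒≱ h ≤-refl)
      ; V≡ = i1.V≡; PY≡ = i1.PY≡; PI≡ = i1.PI≡; PZ≡ = i1.PZ≡
      ; lvs = levels-quiet (qₙ s3) (levels-change J<K c3 (levels-quiet q2 i1.lvs))
      ; outerF = outers c3
      ; tick≡ = cong suc i1.tick≡ }
     where
     off2 : (k <ᵇ suc J) ∨ tight ≡ false
     off2 = cong₂ _∨_ (<ᵇ-false (=≥ k≡)) loose
     fits' : size (suc J) (e ∷ z) ≤ n
     fits' = +ˡ≤ (size (suc J) z) (≮⇒≥ (λ h → subst T loose (<⇒<ᵇ h))) » =≤ (m∸n+n≡m (snd (Level.room lv1 1+n≢0)))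
     s3 = runs store-block s2
     stored : oks store-block s2 × Change 8 (planesOf (suc J)) (wordsOf (suc J)) s2 s3 × Level s3 (suc J) (e ∷ z) v (from gh (suc J))
     stored = subst (λ j → oks store-block s2 × Change 8 (planesOf j) (wordsOf j) s2 s3 × Level s3 j (e ∷ z) v (from gh (suc J))) L1
      (store-spec e z (from gh (suc J)) s2 (≡≤ L1 J<K) (≢0 L1) (subst (λ j → Level s2 j z u (from gh (suc J))) (sym L1) (level-quiet q2 lv1)) i1.V≡
       (fl≡ · cong (λ j → fl j e) (sym L1)) (fv≡ · cong (λ j → fv j e) (sym L1)) (sp≡ · cong (λ j → size j z) (sym L1))
       (subst (λ j → size j (e ∷ z) ≤ n) (sym L1) fits'))
     c3 = fst (snd stored)
     news : ∀ j → j < suc J ⊎ j ≡ suc J → Level s3 j (e ∷ zone gh j) v (from gh j)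
     news j (inl j<) = level-change c3 (<⇒≢ j<) ((<⇒≤ j<) » J<K) J<K (level-quiet q2 (i1.new j (j< » =≥ k≡)))
     news .(suc J) (inr refl) = snd (snd stored)
    cases : k < suc J ⊎ k ≡ suc J → Result
    cases (inl k<) = go-stale (<-trans k< (n<1+n (suc J))) (cong (_∨ tight) (<ᵇ-true k<)) (over k<)
    cases (inr k≡) = on-tight tight refl
     where
     on-tight : ∀ b → tight ≡ b → Result
     on-tight true t = go-stale (=≤ (cong suc k≡)) (cong₂ _∨_ (<ᵇ-false (=≥ k≡)) t) (subst (λ j → n < fl j e + size j (zone gh j)) (sym k≡)
       (s≤s (m≤n+m∸n n (size (suc J) z)) » +ʳ< (size (suc J) z) (<ᵇ⇒< _ _ (subst T (sym t) tt)) » =≤ (+-comm (size (suc J) z) _)))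
     on-tight false t = go-push k≡ t

  enc0-upd : ∀ f x z → All (u ≢_) (tails z) → Enc0 f z → Enc0 (updℕ f (ν u) x) z
  enc0-upd f x [] _ _ = tt
  enc0-upd f x (d ∷ z) (u≢ ∷ us) (eqn , r) = updℕ-≢ f (ν u) x (ν (tl d)) (λ e → u≢ (ν-inj e)) · eqn , enc0-upd f x z us r

  prelude-spec : ∀ {z x} → All (u ≢_) (tails z) → Level s0 0 z u x → Levels s0 → reg s0 U ≡ ν u → reg s0 I ≡ toℕ (snd e) → reg s0 V ≡ ν v →
   oks enter-block s0 × Level (runs enter-block s0) 0 (e ∷ z) v x
  prelude-spec {z} {x} fresh (level ch sr mk sd rm) lvs U≡ I≡ V≡ =
   ((tt , lit! , outdeg u , outdeg-ask u U≡ , outdeg<w u) , (bA<w , bA<PB , fits) , (tt , tt , tt) , (tt , lit! , ≡< gap≡ (n<w (gap≤n 0 u))) , (tt , tt , tt) ,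
    (tt , tt , tt , num≤n U≡ , b≡ , ≡< val≡ (quot-gap< 0 u (snd e)) , fits) ,
    mark-ok ≤-refl (s≤s z<s) V≡ ,
    lit! , tt , tt , tt , tt) ,
   level (refl , ch) sr (marks-set (pl s0 inP) (pl s1 inP) e z (λ v' → set-bit (pl s0) inP (reg s0 V) true (ν v') · cong (λ o → if o ≡ᵇ ν v' then true else pl s0 inP (ν v')) V≡) mk)
    (cong₂ (λ a b → updℕ (sl s0) a b (ν u)) U≡ val≡ · updℕ-≡ (sl s0) (ν u) _ · sym (fv-low {0} e K≥1) ,
     subst (λ f → Enc0 f z) (sym (cong₂ (updℕ (sl s0)) U≡ refl)) (enc0-upd (sl s0) _ z fresh sd))
    (λ h → ⊥! (h refl))
   where
   s1 = runs enter-block s0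
   bA<w : bA < 2 ^ w
   bA<w = ≡< (sym (+0 bA)) (b<w {0} z≤n)
   bA<PB : bA < PB2
   bA<PB = ≡< (sym (+0 bA)) (b<PB {0} z≤n)
   b≡ : lev s0 bA ≡ bb 0
   b≡ = cong (lev s0) (sym (+0 bA)) · lengths lvs {0} z≤n
   deg≡ : fromMaybe 0 (answer kind G (outdegQ kind) (reg s0 U) 0) ≡ outdeg u
   deg≡ = cong (fromMaybe 0) (outdeg-ask u U≡)
   gap≡ : fromMaybe 0 (answer kind G (outdegQ kind) (reg s0 U) 0) /2^ lev s0 bA + 1 ≡ gap 0 u
   gap≡ = cong₂ (λ d b → d /2^ b + 1) deg≡ b≡
   val≡ : div (reg s0 I) (fromMaybe 0 (answer kind G (outdegQ kind) (reg s0 U) 0) /2^ lev s0 bA + 1) ≡ div (toℕ (snd e)) (gap 0 u)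
   val≡ = cong₂ div I≡ gap≡

  push-ghost : Ghost
  push-ghost = ghost (λ j → e ∷ zone gh j) (from gh) (below' gh) (refills gh)

  grow : ∀ a b c → a + b ∸ c ≤ a + (b ∸ c)
  grow a b c with ≤-total c b
  ... | inl c≤b = =≤ (+-∸-assoc a c≤b)
  ... | inr b≤c = ∸-monoʳ-≤ (a + b) b≤c » =≤ (m+n∸n≡m a b) » m≤m+n a _

  potential-push : ∀ j z d → potential j (e ∷ z) d ≤ weight j v + potential j z d
  potential-push j z [] = grow (weight j v) (charge j z) ceiling
  potential-push j z (d ∷ ds) = +≤+ (grow (weight j v) (charge j z) ceiling) (∸-monoʳ-≤ credit (m≤n+m (charge j z) (weight j v))) » =≤ (+-assoc (weight j v) _ _)

  excess≤potential : ∀ j z d → charge j z ∸ ceiling ≤ potential j z d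
  excess≤potential j z [] = ≤-refl
  excess≤potential j z (_ ∷ _) = m≤m+n _ _

  -- A level without room has more than `n` minus `L` bits, that is, more than four quarters minus
  -- `L`. The ceiling is two quarters plus `2 * L`; passing to charges costs another `L`, and
  -- `3 * L ≤ quarter` absorbs all of this.
  overflow-credit : ∀ j z d {x} → Chain u z x → n < fl j e + size j z → credit ≤ potential j z d
  overflow-credit j z d ch ov = m≤n+o⇒m∸n≤o quarter L (+-cancelʳ-≤ (ceiling + L + L) quarter _ (begin
   quarter + (ceiling + L + L) ≡⟨ e1 quarter L ⟩
   quarter * 3 + 4 * L ≤⟨ +ʳ≤ (quarter * 3) 4L≤ ⟩
   quarter * 3 + (quarter + L) ≡⟨ e2 quarter L ⟩
   quarter * 4 + L ≤⟨ +ˡ≤ L (quarter*4≤n » <⇒≤ ov) ⟩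
   fl j e + size j z + L ≤⟨ +ˡ≤ L (+≤+ (fl≤L j e) (snd (charge-size j z ch))) ⟩
   L + (charge j z + L) + L ≤⟨ +ˡ≤ L (+ʳ≤ L (+ˡ≤ L (m≤n+m∸n (charge j z) ceiling))) ⟩
   L + (ceiling + (charge j z ∸ ceiling) + L) + L ≡⟨ e3 L ceiling (charge j z ∸ ceiling) ⟩
   L + (charge j z ∸ ceiling) + (ceiling + L + L) ∎)) » excess≤potential j z d
   where
   open ≤-Reasoning
   4L≤ : 4 * L ≤ quarter + L
   4L≤ = =≤ (e0 L) » +ˡ≤ L (m≤m+n (3 * L) 3 » quarter>L)
    where
    e0 : ∀ L → 4 * L ≡ 3 * L + L
    e0 = ring
   e1 : ∀ q L → q + ((q + L + q + L) + L + L) ≡ q * 3 + 4 * L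
   e1 = ring
   e2 : ∀ q L → q * 3 + (q + L) ≡ q * 4 + L
   e2 = ring
   e3 : ∀ L c x → L + (c + x + L) + L ≡ L + x + (c + L + L)
   e3 = ring

  record Pushed (E' : ℕ → ℕ) (s' : State R2) : Set where
   field
    k : ℕ
    1≤k : 1 ≤ k
    k≤ : k ≤ suc K
    pend : Pending k push-ghost E' s' v
    lvs : Levels s'
    outerF : Outer s0 s'
    tick≡ : ticks s' ≡ K + ticks s0

  push-spec : ∀ {c r ps E E'} (inv : PathInv c r u ps) → Fixing.Settled inv E gh s0 → (∀ j → E j + weight j v ≤ E' j) →
   reg s0 U ≡ ν u → reg s0 I ≡ toℕ (snd e) → reg s0 V ≡ ν v → Runs push s0 (Pushed E')
  push-spec {ps = ps} {E} {E'} inv settled E≤ U≡ I≡ V≡ = after-prelude (prelude-spec fresh (Zones.lvl zones 0 z<s) lvs U≡ I≡ V≡)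
   where
   open Fixing inv E using (module Settled)
   open Settled settled
   fresh : All (u ≢_) (tails (zone gh 0))
   fresh with PathInv.uniq inv
   ... | u∉ ∷ _ = subst (λ z → All (u ≢_) (tails z)) (sym z0) u∉
   Result = Runs push s0 (Pushed E')
   s1 = runs enter-block s0
   q : ∀ {s} → Quiet 8 s (runs first-level s)
   q {s} = runs-quiet {8} first-level s refl
   planes1 : ∀ r o → r ≢ inP → pl s1 r o ≡ pl s0 r o
   planes1 r o r≢ = wrP-plane (pl s0) inP (reg s0 V) 1 1 r o (≢-sym r≢)
   after-prelude : oks enter-block s0 × Level s1 0 (e ∷ zone gh 0) v (from gh 0) → Result
   after-prelude (ok-1 , lv0) = let (s2 , ex , i) = levels-spec (λ {J} {s} i → push-quiet {J} {s} (runs-quiet {8} test-block s refl) (λ { .P3 (inl refl) → refl; .PY (inr (inl refl)) → refl; .PI (inr (inr (inl refl))) → refl; .PZ (inr (inr (inr refl))) → refl }) refl i) push-level-spec s1 init in after-levels s2 ex i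
    where
    open Levelwise push-level PushInv
    init : PushInv 1 (runs first-level s1)
    init = record { k = 1; 1≤k = ≤-refl; k≤J = ≤-refl; flag = refl; new = λ { zero _ → level-quiet (q {s1}) lv0; (suc j) (s≤s ()) } ; stale = λ j a b → ⊥! (<⇒≱ b a)
     ; old = λ { (suc j) _ j≤K → level-quiet (q {s1}) (level-above refl planes1 (Zones.lvl zones (suc j) (s≤s j≤K))) }
     ; over = λ h → ⊥! (<⇒≱ h ≤-refl); V≡ = V≡; PY≡ = U≡; PI≡ = I≡; PZ≡ = V≡; lvs = levels-keep refl lvs
     ; outerF = outer-trans (outer (runs-frame {8} enter-block s0 refl) (λ r r<2 o → planes1 r o (<⇒≢ (<-trans r<2 ≤!))) refl) (quiet→outer (q {s1})); tick≡ = refl }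
    after-levels : ∀ s2 → Exec (levels push-level) s1 s2 → PushInv (suc K) s2 → Result
    after-levels s2 ex i = s2 , (blk ok-1 ▸ ex) , record { k = k; 1≤k = 1≤k; k≤ = k≤J; lvs = PushInv.lvs i; outerF = outerF; tick≡ = suc-injective tick≡
     ; pend = record { zones = record { lvl = new; nest = λ j j<k → cong (e ∷_) (Zones.nest zones j (j<k » k≤J)) } ; full = λ j _ () ; paid = λ j sj<k → payment j (≤-pred (sj<k » k≤J))
      ; stale = λ j k≤j j≤K → PushInv.stale i j k≤j (s≤s j≤K)
      -- Level `k` is the one that overflowed, so its potential before the push already contains the
      -- credit.
      ; prepaid = λ { j refl sj≤K → =≤ (*-suc credit (refills gh (suc j))) » =≤ (+-comm credit _) »
       +ʳ≤ (credit * refills gh (suc j)) (overflow-credit (suc j) (zone gh (suc j)) (below' gh (suc j)) (Level.chainL (Zones.lvl zones (suc j) (s≤s sj≤K))) (over (s≤s sj≤K))) »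
       paid j sj≤K » +ˡ≤ _ (m≤m+n (E (suc j)) _ » E≤ (suc j)) }
      ; backlog = λ j k≤j sj≤K → m≤m+n _ (potential (suc j) (zone gh (suc j)) (below' gh (suc j))) » paid j sj≤K » +ˡ≤ _ (m≤m+n (E (suc j)) _ » E≤ (suc j)) } }
      where
      open PushInv i
      payment : ∀ j → j < K → Paid j push-ghost E'
      payment j j<K = begin
       credit * refills gh (suc j) + potential (suc j) (e ∷ zone gh (suc j)) (below' gh (suc j))
        ≤⟨ +ʳ≤ (credit * refills gh (suc j)) (potential-push (suc j) (zone gh (suc j)) (below' gh (suc j))) ⟩
       credit * refills gh (suc j) + (weight (suc j) v + potential (suc j) (zone gh (suc j)) (below' gh (suc j)))
        ≡⟨ x+yz≡y+xz (credit * refills gh (suc j)) (weight (suc j) v) _ ⟩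
       weight (suc j) v + (credit * refills gh (suc j) + potential (suc j) (zone gh (suc j)) (below' gh (suc j)))
        ≤⟨ +ʳ≤ (weight (suc j) v) (paid j j<K) ⟩
       weight (suc j) v + (E (suc j) + credit * refills gh j)
        ≡⟨ x+yz≡yx+z (weight (suc j) v) (E (suc j)) _ ⟩
       E (suc j) + weight (suc j) v + credit * refills gh j
        ≤⟨ +ˡ≤ _ (E≤ (suc j)) ⟩
       E' (suc j) + credit * refills gh j ∎
       where
       open ≤-Reasoning

 -- Popping an edge

 marks-unset : ∀ f f' e z → (∀ v → f' (ν v) ≡ (if ν (hd e) ≡ᵇ ν v then false else f (ν v))) → All (hd e ≢_) (heads z) → Marks f (e ∷ z) → Marks f' z
 marks-unset f f' e z h fresh mk v with v ≟ᶠ hd e | mk v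
 ... | yes refl | _ = h v · if-true (≡ᵇ-refl (ν v)) · sym (membF-false (λ v∈ → All.lookup fresh v∈ refl))
 ... | no v≢ | m = h v · if-false (≡ᵇ-≢ _ _ (λ e' → v≢ (sym (ν-inj e')))) · m

 drop-spec : ∀ e z x s → reg s LEV ≤ K → reg s LEV ≢ 0 → All (hd e ≢_) (heads z) → Level s (reg s LEV) (e ∷ z) (hd e) x → reg s U ≡ ν (hd e) → reg s FL ≡ fl (reg s LEV) e →
  oks drop-block s × Change 8 (planesOf (reg s LEV)) (wordsOf (reg s LEV)) s (runs drop-block s) × Level (runs drop-block s) (reg s LEV) z (tl e) x
 drop-spec e z x s j≤K j≢0 fresh (level (_ , ch) sr mk sd rm) U≡ FL≡ =
  ((lin 0 0 z≤n z≤n j≤K , sp<PB j≤K , fits) , (tt , tt , subst₂ _≤_ (sym FL≡) (sym sp≡) (m≤m+n _ _)) , (lin 0 0 z≤n z≤n j≤K , tt , sp<PB j≤K , fits) ,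
   (in<w j≤K , tt , lit! , lit! , in<NR j≤K , num≤n U≡ , w>0 , z<s , fits) , tt) ,
  change (runs-frame {8} drop-block s refl) (λ { r (_ ∷ r≢in ∷ _) o → wrP-plane (pl s) (inP + j) (reg s U) 1 0 r o (≢-sym r≢in) })
   (λ { a (a≢ ∷ _ ∷ []) → updℕ-≢ (lev s) j _ a (≢-sym a≢) }) refl refl ,
  level ch (updℕ-≢ (lev s) j _ (xA + j) (sp≢x j≤K) · sr) (marks-unset (pl s (inP + j)) (pl s2 (inP + j)) e z (λ v → set-bit (pl s) (inP + j) (reg s U) false (ν v) ·
    cong (λ o → if o ≡ᵇ ν v then false else pl s (inP + j) (ν v)) U≡) fresh mk)
   (to-stored s2 j z j≢0 (enc-cong (pl s (stP + j)) (pl s2 (stP + j)) j z (λ o _ → wrP-plane (pl s) (inP + j) (reg s U) 1 0 (stP + j) o (in≢st j≤K)) (snd (to-enc s j (e ∷ z) j≢0 sd))))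
   (λ h → updℕ-≡ (lev s) j _ · (cong₂ _∸_ sp≡ FL≡) · m+n∸m≡n (fl j e) (size j z) , m≤n+m _ (fl j e) » snd (rm h))
  where
  j = reg s LEV
  s2 = runs drop-block s
  sp≡ = fst (rm j≢0)

 same-position : ∀ {p p'} → p' ≡ p → (k : Fin (outdeg p')) (i : Fin (outdeg p)) → outhead p' k ≡ outhead p i → toℕ k ≡ toℕ i
 same-position refl k i e = cong toℕ (outhead-inj _ k i e)

 module Popping (e : Edge) (y : ℕ → List Edge) (from0 : ℕ → Fin n) (s0 : State R2) (fresh : ∀ j → j ≤ K → All (hd e ≢_) (heads (y j))) where

  private
   u : Fin n
   u = hd e

  record PopInv (J : ℕ) (s : State R2) : Set where
   field
    new : ∀ j → j < J → Level s j (y j) (tl e) (from0 j)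
    old : ∀ j → J ≤ j → j ≤ K → Level s j (e ∷ y j) u (from0 j)
    U≡ : reg s U ≡ ν u
    PY≡ : reg s PY ≡ ν (tl e)
    PI≡ : reg s PI ≡ toℕ (snd e)
    PZ≡ : reg s PZ ≡ ν u
    lvs : Levels s
    outerF : Outer s0 s
    tick≡ : suc (ticks s) ≡ J + ticks s0

  pop-quiet : ∀ {J s s'} → Quiet 8 s s' → (∀ r → r ≡ PY ⊎ r ≡ PI ⊎ r ≡ PZ → reg s' r ≡ reg s r) → ticks s' ≡ ticks s → PopInv J s → PopInv J s'
  pop-quiet {J} q h t i = record { new = λ j l → level-quiet q (new j l); old = λ j a b → level-quiet q (old j a b); U≡ = Quiet.kept q U · U≡
   ; PY≡ = h PY (inl refl) · PY≡; PI≡ = h PI (inr (inl refl)) · PI≡; PZ≡ = h PZ (inr (inr refl)) · PZ≡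
   ; lvs = levels-quiet q lvs; outerF = outer-trans outerF (quiet→outer q); tick≡ = cong suc t · tick≡ }
    where open PopInv i

  pop-level-spec : ∀ J s → J < K → reg s LEV ≡ suc J → PopInv (suc J) s → Σ[ s' ∈ State R2 ] Exec pop-level s s' × reg s' LEV ≡ suc J × PopInv (suc (suc J)) (tick (runs next-block s'))
  pop-level-spec J s J<K L≡ i = let (s1 , ex1 , p1) = params-spec e (suc J) s J<K (edge-in PY≡ PI≡ PZ≡ L≡) lvs in after-params s1 ex1 p1
   where
   open PopInv i
   Result = Σ[ s' ∈ State R2 ] Exec pop-level s s' × reg s' LEV ≡ suc J × PopInv (suc (suc J)) (tick (runs next-block s'))
   after-params : ∀ s1 → Exec params s s1 → Params e (suc J) s s1 → Result
   after-params s1 ex1 p1 = s2 , (ex1 ▸ blk (fst dropped)) , L1 , record { new = λ j j< → level-quiet qₙ (news j (≤-split (≤-pred j<)))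
    ; old = λ j J≤j j≤K → level-quiet qₙ (level-change c2 (>⇒≢ J≤j) j≤K J<K (i1.old j (<⇒≤ J≤j) j≤K))
    ; U≡ = i1.U≡; PY≡ = i1.PY≡; PI≡ = i1.PI≡; PZ≡ = i1.PZ≡
    ; lvs = levels-quiet qₙ (levels-change J<K c2 i1.lvs)
    ; outerF = outer-trans i1.outerF (outer-trans (change→outer (suc J) c2) (quiet→outer qₙ))
    ; tick≡ = cong suc i1.tick≡ }
    where
    open Params p1
    i1 : PopInv (suc J) s1
    i1 = pop-quiet (quiet-weaken ≤! still) (λ { .PY (inl refl) → Quiet.kept still PY; .PI (inr (inl refl)) → Quiet.kept still PI; .PZ (inr (inr refl)) → Quiet.kept still PZ })
     (Params.tick≡ p1) i
    module i1 = PopInv i1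
    L1 = Quiet.kept still LEV · L≡
    s2 = runs drop-block s1
    dropped : oks drop-block s1 × Change 8 (planesOf (suc J)) (wordsOf (suc J)) s1 s2 × Level s2 (suc J) (y (suc J)) (tl e) (from0 (suc J))
    dropped = subst (λ j → oks drop-block s1 × Change 8 (planesOf j) (wordsOf j) s1 s2 × Level s2 j (y (suc J)) (tl e) (from0 (suc J))) L1
     (drop-spec e (y (suc J)) (from0 (suc J)) s1 (≡≤ L1 J<K) (≢0 L1) (fresh (suc J) J<K)
      (subst (λ j → Level s1 j (e ∷ y (suc J)) u (from0 (suc J))) (sym L1) (i1.old (suc J) ≤-refl J<K)) i1.U≡
      (fl≡ · cong (λ j → fl j e) (sym L1)))
    c2 = fst (snd dropped)
    qₙ : Quiet 8 s2 (tick (runs next-block s2))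
    qₙ = quiet-tick (runs-quiet {8} next-block s2 refl)
    news : ∀ j → j < suc J ⊎ j ≡ suc J → Level s2 j (y j) (tl e) (from0 j)
    news j (inl j<) = level-change c2 (<⇒≢ j<) ((<⇒≤ j<) » J<K) J<K (i1.new j j<)
    news .(suc J) (inr refl) = snd (snd dropped)

  Popped : State R2 → Set
  Popped s' = PopInv (suc K) s'

  fl-top : fl K e ≡ bb K ⊓ indeg u
  fl-top = cong (λ z → bb K ⊓ (if z then indeg u else outdeg (tl e))) (≡ᵇ-refl K)

  fv-top : fv K e ≡ toℕ (outmate (tl e) (snd e))
  fv-top = if-true (≡ᵇ-refl K)

  -- The field on top of level `K` is the position of the edge in the in-array of `u`. From it
  -- `inhead` yields the parent and `inmate` the position there, the mates being inverse to each
  -- other.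
  pop-spec : (∀ j → j ≤ K → Level s0 j (e ∷ y j) u (from0 j)) → Levels s0 → reg s0 U ≡ ν u → Runs pop s0 Popped
  pop-spec lvl lvs U≡ = minimum (bb K <ᵇ indeg u) refl
   where
   Result = Runs pop s0 Popped
   s1 = runs length-block s0
   q1 : Quiet 8 s0 s1
   q1 = runs-quiet {8} length-block s0 refl
   D≡ : reg s1 P1 ≡ indeg u
   D≡ = cong (fromMaybe 0) (indeg-ask u U≡)
   b≡ : reg s1 P2 ≡ bb K
   b≡ = lengths lvs ≤-refl
   ok-1 : oks length-block s0
   ok-1 = (tt , lit! , indeg u , indeg-ask u U≡ , indeg<w u) , (b<w ≤-refl , b<PB ≤-refl , fits) , (tt , tt , tt) , tt
   after-length : ∀ s2 → Exec (ifnz P3 (block (mov P3 (var P2) ∷ [])) (block (mov P3 (var P1) ∷ []))) s1 s2 → Quiet 8 s1 s2 → ticks s2 ≡ ticks s0 → reg s2 P3 ≡ fl K e → Result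
   minimum : ∀ b → (bb K <ᵇ indeg u) ≡ b → Result
   minimum true t = after-length (runs (mov P3 (var P2) ∷ []) s1) (ifT (λ z → bit≢0 t (sym (cong₂ (λ a b → bit (a <ᵇ b)) b≡ D≡) · z)) (blk (tt , tt)))
    (runs-quiet {8} (mov P3 (var P2) ∷ []) s1 refl) refl (b≡ · sym (min-true t) · sym fl-top)
   minimum false t = after-length (runs (mov P3 (var P1) ∷ []) s1) (ifF (cong₂ (λ a b → bit (a <ᵇ b)) b≡ D≡ · cong bit t) (blk (tt , tt)))
    (runs-quiet {8} (mov P3 (var P1) ∷ []) s1 refl) refl (D≡ · sym (min-false t) · sym fl-top)
   after-length s2 ex2 q2 tick2 F≡ = let (s4 , ex4 , i) = levels-spec (λ {J} {s} i → pop-quiet {J} {s} (runs-quiet {8} test-block s refl) (λ { .PY (inl refl) → refl; .PI (inr (inl refl)) → refl; .PZ (inr (inr refl)) → refl }) refl i) pop-level-spec s3 init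
    in s4 , (blk ok-1 ▸ ex2 ▸ blk ok-3 ▸ ex4) , i
    where
    open Levelwise pop-level PopInv
    K≢0 : K ≢ 0
    K≢0 h = <⇒≢ K≥1 (sym h)
    q = quiet-trans q1 q2
    top : Level s2 K (e ∷ y K) u (from0 K)
    top = level-quiet q (lvl K ≤-refl)
    U2 = Quiet.kept q U · U≡
    s3 = runs parent-block s2
    sp≡ = fst (Level.room top K≢0)
    rest≡ : lev s2 (spA + K) ∸ reg s2 P3 ≡ size K (y K)
    rest≡ = (cong₂ _∸_ sp≡ F≡) · m+n∸m≡n (fl K e) (size K (y K))
    back : Fin (indeg u)
    back = outmate (tl e) (snd e)
    back≡ : num (pl s2 (stP + K)) (lev s2 (spA + K) ∸ reg s2 P3) (reg s2 P3) ≡ toℕ back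
    back≡ = cong₂ (num (pl s2 (stP + K))) rest≡ F≡ · fst (to-enc s2 K (e ∷ y K) K≢0 (Level.stored top)) · fv-top
    parent≡ = inhead-outmate (tl e) (snd e)
    position≡ = same-position parent≡ (inmate u back) (snd e) (outhead-inmate u back)
    ok-3 : oks parent-block s2
    ok-3 = (lin 0 0 z≤n z≤n ≤-refl , sp<PB ≤-refl , fits) , (tt , tt , subst₂ _≤_ (sym F≡) (sym sp≡) (m≤m+n _ _)) ,
     (st<w ≤-refl , tt , tt , st<NR ≤-refl , =≤ rest≡ » m≤n+m _ (fl K e) » snd (Level.room top K≢0) , ≡≤ F≡ (fl≤bb K e » bb≤L K » L≤w) , fits) ,
     (tt , tt , ν (inhead u back) , inhead-ask u back U2 back≡ , ν<w (inhead u back)) ,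
     (tt , tt , toℕ (inmate u back) , inmate-ask u back U2 back≡ , pos<w (inmate u back)) , tt ,
     mark-ok ≤-refl z<s U2 , tt
    planes3 : ∀ r o → r ≢ inP → pl s3 r o ≡ pl s2 r o
    planes3 r o r≢ = wrP-plane (pl s2) inP (reg s2 U) 1 0 r o (≢-sym r≢)
    qₘ : Quiet 8 s3 (runs first-level s3)
    qₘ = runs-quiet {8} first-level s3 refl
    bottom : Level s2 0 (e ∷ y 0) u (from0 0) → Level s3 0 (y 0) (tl e) (from0 0)
    bottom (level (_ , ch) sr mk (_ , sd) rm) = level ch sr (marks-unset (pl s2 inP) (pl s3 inP) e (y 0) (λ v → set-bit (pl s2) inP (reg s2 U) false (ν v) ·
      cong (λ o → if o ≡ᵇ ν v then false else pl s2 inP (ν v)) U2) (fresh 0 z≤n) mk)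
     sd (λ h → ⊥! (h refl))
    init : PopInv 1 (runs first-level s3)
    init = record { new = λ { zero _ → level-quiet qₘ (bottom (level-quiet q (lvl 0 z≤n))); (suc j) (s≤s ()) }
     ; old = λ { (suc j) _ j≤K → level-quiet qₘ (level-above refl planes3 (level-quiet q (lvl (suc j) j≤K))) }
     ; U≡ = U2; PY≡ = cong (fromMaybe 0) (inhead-ask u back U2 back≡) · cong ν parent≡
     ; PI≡ = cong (fromMaybe 0) (inmate-ask u back U2 back≡) · position≡; PZ≡ = U2
     ; lvs = levels-keep refl (levels-quiet q lvs)
     ; outerF = outer-trans (quiet→outer q) (outer-trans (outer (runs-frame {8} parent-block s2 refl) (λ r r<2 o → planes3 r o (<⇒≢ (<-trans r<2 ≤!))) refl) (quiet→outer qₘ))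
     ; tick≡ = cong suc tick2 }

 rest : List Edge → List Edge
 rest = drop 1

 rest≡ : ∀ {z e es} → z ≢ [] → Σ[ D ∈ List Edge ] z ++ D ≡ e ∷ es → z ≡ e ∷ rest z
 rest≡ {[]} z≢ _ = ⊥! (z≢ refl)
 rest≡ {x ∷ z} z≢ (D , refl) = refl

 first-empty : (y : ℕ → List Edge) → ∀ m → (y 0 ≢ []) → Σ[ k ∈ ℕ ] 1 ≤ k × k ≤ suc m × (∀ j → j < k → y j ≢ []) × (k ≤ m → y k ≡ [])
 first-empty y zero h = 1 , ≤-refl , ≤-refl , (λ { zero _ → h; (suc j) (s≤s ()) }) , λ ()
 first-empty y (suc m) h with first-empty y m h
 ... | k , 1≤k , k≤ , full , empty with ≤-split k≤
 ... | inl k< = k , 1≤k , m≤n⇒m≤1+n k≤ , full , λ _ → empty (≤-pred k<)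
 ... | inr refl with y (suc m) in eqn
 ... | [] = suc m , 1≤k , n≤1+n _ , full , λ _ → eqn
 ... | _ ∷ _ = suc (suc m) , z<s , ≤-refl , (λ j j< → all j (≤-split (≤-pred j<))) , λ h → ⊥! (<⇒≱ h ≤-refl)
  where
  nonempty : ∀ {z : List Edge} {x xs} → z ≡ x ∷ xs → z ≢ []
  nonempty refl ()
  all : ∀ j → j < suc m ⊎ j ≡ suc m → y j ≢ []
  all j (inl j<) = full j j<
  all _ (inr refl) = nonempty eqn

 excess-shrink : ∀ a b c → b ∸ c ≤ a + b ∸ c
 excess-shrink a b c = ∸-monoˡ-≤ c (m≤n+m b a)

 deficit-grow : ∀ a b c → c ∸ b ≤ a + (c ∸ (a + b))
 deficit-grow a b c = m≤n+m∸n (c ∸ b) a » +ʳ≤ a (=≤ (∸-+-assoc c b a · cong (c ∸_) (+-comm b a)))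

 potential-pop : ∀ j e z d → potential j z d ≤ weight j (hd e) + potential j (e ∷ z) d
 potential-pop j e z [] = excess-shrink (weight j (hd e)) (charge j z) ceiling » m≤n+m _ (weight j (hd e))
 potential-pop j e z (_ ∷ _) = +≤+ (excess-shrink (weight j (hd e)) (charge j z) ceiling) (deficit-grow (weight j (hd e)) (charge j z) credit) »
  =≤ (x+yz≡y+xz (weight j (hd e) + charge j z ∸ ceiling) (weight j (hd e)) _)

 pop-ghost : Ghost → Ghost
 pop-ghost g = ghost (λ j → rest (zone g j)) (from g) (below' g) (refills g)

 module AfterPop (e : Edge) {c r ps E} (inv : PathInv c r (hd e) (e ∷ ps)) {gh s0} (settled : Fixing.Settled inv E gh s0)
  (E' : ℕ → ℕ) (E≤ : ∀ j → E j + weight j (hd e) ≤ E' j) where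
  open Fixing.Settled settled

  -- Every zone is a nonempty top part of the same path, so all zones have the edge to be popped in
  -- front.
  zone≡ : ∀ j → j ≤ K → zone gh j ≡ e ∷ rest (zone gh j)
  zone≡ j j≤K = let (D , eqn) = zones-prefix zones j (s≤s j≤K) in rest≡ (full (λ ()) j j≤K) (D , eqn · z0)

  lvl : ∀ j → j ≤ K → Level s0 j (e ∷ rest (zone gh j)) (hd e) (from gh j)
  lvl j j≤K = subst (λ z → Level s0 j z (hd e) (from gh j)) (zone≡ j j≤K) (Zones.lvl zones j (s≤s j≤K))

  fresh : ∀ j → j ≤ K → All (hd e ≢_) (heads (rest (zone gh j)))
  fresh j j≤K = let (D , eqn) = zones-prefix zones j (s≤s j≤K) in
   first (subst (λ z → AllPairs _≢_ (heads z)) (zone≡ j j≤K) (unique-++ˡ (heads (zone gh j))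
    (subst (AllPairs _≢_) (cong heads (sym (eqn · z0)) · map-++ hd (zone gh j) D) (unique-++ˡ (heads (e ∷ ps)) (uniq-heads inv)))))
   where
   first : ∀ {x xs} → AllPairs {A = Fin n} _≢_ (x ∷ xs) → All (x ≢_) xs
   first (h ∷ _) = h

  nest : ∀ j → j < K → rest (zone gh (suc j)) ++ below' gh (suc j) ≡ rest (zone gh j)
  nest j j<K = ∷-injectiveʳ (cong (_++ below' gh (suc j)) (sym (zone≡ (suc j) j<K)) · Zones.nest zones j (s≤s j<K) · zone≡ j (<⇒≤ j<K))

  -- Zones are nested, hence the levels with exhausted zones are exactly those from some `k` on,
  -- which is the form required by `Pending`.
  empty-above : ∀ m j → rest (zone gh j) ≡ [] → m + j ≤ K → rest (zone gh (m + j)) ≡ []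
  empty-above zero j h m≤ = h
  empty-above (suc m) j h m≤ = ++-[] _ (nest (m + j) m≤ · empty-above m j h (<⇒≤ m≤))
   where
   ++-[] : ∀ (xs : List Edge) {ys} → xs ++ ys ≡ [] → xs ≡ []
   ++-[] [] _ = refl

  payment : ∀ j → j < K → Paid j (pop-ghost gh) E'
  payment j j<K = begin
   credit * refills gh (suc j) + potential (suc j) y (below' gh (suc j))
    ≤⟨ +ʳ≤ (credit * refills gh (suc j)) (potential-pop (suc j) e y (below' gh (suc j))) ⟩
   credit * refills gh (suc j) + (weight (suc j) (hd e) + potential (suc j) (e ∷ y) (below' gh (suc j)))
    ≡⟨ cong (λ z → credit * refills gh (suc j) + (weight (suc j) (hd e) + potential (suc j) z (below' gh (suc j)))) (sym (zone≡ (suc j) j<K)) ⟩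
   credit * refills gh (suc j) + (weight (suc j) (hd e) + potential (suc j) (zone gh (suc j)) (below' gh (suc j)))
    ≡⟨ x+yz≡y+xz (credit * refills gh (suc j)) (weight (suc j) (hd e)) _ ⟩
   weight (suc j) (hd e) + (credit * refills gh (suc j) + potential (suc j) (zone gh (suc j)) (below' gh (suc j)))
    ≤⟨ +ʳ≤ (weight (suc j) (hd e)) (paid j j<K) ⟩
   weight (suc j) (hd e) + (E (suc j) + credit * refills gh j)
    ≡⟨ x+yz≡yx+z (weight (suc j) (hd e)) (E (suc j)) _ ⟩
   E (suc j) + weight (suc j) (hd e) + credit * refills gh j
    ≤⟨ +ˡ≤ _ (E≤ (suc j)) ⟩
   E' (suc j) + credit * refills gh j ∎
   where
   open ≤-Reasoning
   y = rest (zone gh (suc j))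

  backlog : ∀ j → j < K → credit * refills gh (suc j) ≤ E' (suc j) + credit * refills gh j
  backlog j j<K = m≤m+n _ (potential (suc j) (rest (zone gh (suc j))) (below' gh (suc j))) » payment j j<K

  module _ {s'} (new : ∀ j → j ≤ K → Level s' j (rest (zone gh j)) (tl e) (from gh j)) (lvs' : Levels s') where

   zones' : ∀ k → k ≤ suc K → Zones k (pop-ghost gh) s' (tl e)
   zones' k k≤ = record { lvl = λ j j<k → new j (≤-pred (j<k » k≤)); nest = λ j j<k → nest j (≤-pred (j<k » k≤)) }

   pop-settled : ∀ {c' E''} (inv' : PathInv c' r (tl e) ps) → (∀ j → E' j ≤ E'' j) → ps ≡ [] → Fixing.Settled inv' E'' (pop-ghost gh) s'
   pop-settled inv' E'≤ ps≡ = record { z0 = cong rest z0; x0 = x0; N0 = N0; zones = zones' (suc K) ≤-refl; full = λ h → ⊥! (h ps≡)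
    ; paid = λ j j<K → payment j j<K » +ˡ≤ _ (E'≤ (suc j)); lvs = lvs' }

   pop-pending : ps ≢ [] → Σ[ k ∈ ℕ ] 1 ≤ k × k ≤ suc K × Pending k (pop-ghost gh) E' s' (tl e)
   pop-pending ps≢ with first-empty (λ j → rest (zone gh j)) K (λ h → ps≢ (sym (cong rest z0) · h))
   ... | k , 1≤k , k≤ , nonempty , empty = k , 1≤k , k≤ , record { zones = zones' k k≤; full = nonempty; paid = λ j sj<k → payment j (≤-pred (sj<k » k≤))
    -- Nothing has to be written: an exhausted zone starts at the current vertex, which is just how
    -- staleness is encoded.
    ; stale = λ j k≤j j≤K → Level.start (new j j≤K) · cong ν (sym (subst (λ z → Chain (tl e) z (from gh j))
     (cong (λ i → rest (zone gh i)) (sym (m∸n+n≡m k≤j)) · empty-above (j ∸ k) k (empty (k≤j » j≤K)) (=≤ (m∸n+n≡m k≤j) » j≤K)) (Level.chainL (new j j≤K))))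
    ; prepaid = λ { j refl sj≤K → =≤ (*-suc credit _ · +-comm credit _) » +ʳ≤ (credit * refills gh (suc j)) (deficit j (empty sj≤K) (nonempty j ≤-refl) sj≤K) » payment j sj≤K }
    ; backlog = λ j _ j<K → backlog j j<K }
    where
    -- The exhausted zone has charge 0. As the zone below it is nonempty, `below'` is nonempty, so
    -- the deficit counts and equals the full credit.
    deficit : ∀ j → rest (zone gh (suc j)) ≡ [] → rest (zone gh j) ≢ [] → j < K → credit ≤ potential (suc j) (rest (zone gh (suc j))) (below' gh (suc j))
    deficit j emp non j<K = go (rest (zone gh (suc j))) (below' gh (suc j)) emp (λ d≡ → non (sym (nest j j<K) · (cong₂ _++_ emp d≡)))
     where
     go : ∀ z d → z ≡ [] → d ≢ [] → credit ≤ potential (suc j) z d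
     go .[] [] refl h = ⊥! (h refl)
     go .[] (_ ∷ _) refl h = m≤n+m credit _

 -- Back edges and nontree edges

 record Keeps (s s' : State R2) : Set where
  constructor keeps
  field
   lev≡ : lev s' ≡ lev s
   sl≡ : sl s' ≡ sl s
   planes : ∀ r → 3 ≤ r → ∀ o → pl s' r o ≡ pl s r o

 record Hues (c : Vec Colour n) (s : State R2) : Set where
  constructor hues
  field
   nw : ∀ v → pl s nwP (ν v) ≡ nonWhite (lookup c v)
   gr : ∀ v → pl s grP (ν v) ≡ isGray (lookup c v)

 hues-pl : ∀ {c s s'} → pl s' ≡ pl s → Hues c s → Hues c s'
 hues-pl p (hues a b) = hues (λ v → p ∙ nwP ∙ ν v · a v) (λ v → p ∙ grP ∙ ν v · b v)

 hues-outer : ∀ {c s s'} → Outer s s' → Hues c s → Hues c s'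
 hues-outer o (hues a b) = hues (λ v → Outer.colours o nwP z<s (ν v) · a v) (λ v → Outer.colours o grP (s≤s z<s) (ν v) · b v)

 record Backed (rs stk : List (Fin n)) (c : Vec Colour n) (prog : Fin n → ℕ) (v : Fin n) (s s' : State R2) : Set where
  field
   es' : List (Fin n × Fin n)
   frame : Frame 9 s s'
   lev≡ : lev s' ≡ lev s
   pl≡ : pl s' ≡ pl s
   sl≡ : sl s' ≡ sl s
   explored : Explored kind G c es' prog
   trace : Trace kind G ⟨ rs , v ∷ stk , c , es' ⟩ (out s')
   tick≤ : ticks s' ≤ outdeg v + ticks s
  kept = below frame

 back-edges-spec : ∀ {rs stk c es prog} v q s → reg s U ≡ ν v → reg s PAR ≡ q → Hues c s → lookup c v ≡ gray → (kind ≡ undir → ∀ k → lookup c (outhead v k) ≢ black) →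
  Mid kind G v q 0 c es prog → Trace kind G ⟨ rs , v ∷ stk , c , es ⟩ (out s) → Runs (back-edges kind) s (Backed rs stk c prog v s)
 back-edges-spec {rs} {stk} {c} {es} {prog} v q s U≡ PAR≡ h gv fr bef tr = on kind refl
  where
  on : ∀ κ → kind ≡ κ → Runs (back-edges κ) s (Backed rs stk c prog v s)
  on dir e = s , blk tt , record { frame = λ _ _ → refl; lev≡ = refl; pl≡ = refl; sl≡ = refl; explored = mid-directed kind G e bef; trace = tr; tick≤ = m≤n+m (ticks s) _ }
  on undir und = let (s' , ex , b) = go (outdeg v) 0 s1 es (+0 _) (runs-frame {9} ask-block s refl) refl refl refl refl D≡ refl bef tr
   in s' , (blk (lit! , (tt , lit! , outdeg v , outdeg-ask v U≡ , outdeg<w v) , tt) ▸ ex) , b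
   where
   ask-block = mov P1 (lit 0) ∷ ask (outdegQ kind) P2 (var U) (lit 0) ∷ []
   pick-block = ask (outheadQ kind) LO (var U) (var P1) ∷ RD YY (lit grP) (var LO) (lit 1) ∷ alu eq QQ (var LO) (var PAR) ∷ alu lt P3 (var QQ) (var YY) ∷ []
   test next : List (Prim (Query kind) R2)
   test = alu lt P3 (var P1) (var P2) ∷ []
   next = alu add P1 (var P1) (lit 1) ∷ []
   s1 = runs ask-block s
   D≡ : reg s1 P2 ≡ outdeg v
   D≡ = cong (fromMaybe 0) (outdeg-ask v U≡)
   Loop = loop (block test) P3 (block pick-block ⨾ ifnz P3 (block (call (exploresNontree U LO) ∷ [])) skip ⨾ block next)
   go : ∀ m k t es → m + k ≡ outdeg v → Frame 9 s t → lev t ≡ lev s → pl t ≡ pl s → sl t ≡ sl s → ticks t ≡ k + ticks s → reg t P2 ≡ outdeg v → reg t P1 ≡ k →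
    Mid kind G v q k c es prog → Trace kind G ⟨ rs , v ∷ stk , c , es ⟩ (out t) → Runs Loop t (Backed rs stk c prog v s)
   go zero k t es refl fr0 l p σ tk P2≡ P1≡ mid tr = runs test t , stop (blk ((tt , tt , tt) , tt)) (cong bit ((cong₂ _<ᵇ_ P1≡ P2≡) · <ᵇ-false (≤-refl {outdeg v}))) , record
    { es' = es; frame = λ x x< → runs-frame {9} test t refl x x< · fr0 x x<; lev≡ = l; pl≡ = p; sl≡ = σ; explored = mid-end kind G und ≤-refl mid; trace = tr
    ; tick≤ = =≤ tk }
   go (suc m) k t es m+k fr0 l p σ tk P2≡ P1≡ mid tr = choose (isGray (lookup c x)) (ν x ≡ᵇ q) refl refl
    where
    k<d : k < outdeg v
    k<d = s≤s (m≤n+m k m) » =≤ m+k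
    i = fromℕ< k<d
    i≡ : toℕ i ≡ k
    i≡ = toℕ-fromℕ< k<d
    mid' : Mid kind G v q (toℕ i) c es prog
    mid' = subst (λ j → Mid kind G v q j c es prog) (sym i≡) mid
    x = outhead v i
    t-1 = runs test t
    t-2 = runs pick-block t-1
    U1 : reg t-1 U ≡ ν v
    U1 = below {9} {reg s} {reg t} fr0 U · U≡
    LO2 : reg t-2 LO ≡ ν x
    LO2 = cong (fromMaybe 0) (outhead-ask v i U1 (P1≡ · sym i≡))
    P32 : reg t-2 P3 ≡ bit (isGray (lookup c x) ∧ not (ν x ≡ᵇ q))
    P32 = cong bit ((cong₂ _<ᵇ_ (cong₂ (λ a b → bit (a ≡ᵇ b)) LO2 (below {9} {reg s} {reg t} fr0 PAR · PAR≡))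
     (cong₂ (λ f o → num (f grP) o 1) p LO2 · num-1 (pl s grP) (ν x) · cong bit (Hues.gr h x))) · bit-<ᵇ (ν x ≡ᵇ q) (isGray (lookup c x)))
    ok-1 : oks pick-block t-1
    ok-1 = (tt , tt , ν x , outhead-ask v i U1 (P1≡ · sym i≡) , ν<w x) , test-ok z<s LO2 , (tt , tt , tt) , (tt , tt , tt) , tt
    frame2 : Frame 9 s (runs next t-2)
    frame2 y y< = runs-frame {9} (test ++ pick-block ++ next) t refl y y< · fr0 y y<
    continue : ∀ (t-3 : State R2) es' → Exec (ifnz P3 (block (call (exploresNontree U LO) ∷ [])) skip) t-2 t-3 → Frame 9 s (runs next t-3) → lev t-3 ≡ lev s → pl t-3 ≡ pl s → sl t-3 ≡ sl s →
     ticks t-3 ≡ ticks t → reg t-3 P2 ≡ outdeg v → reg t-3 P1 ≡ k → Mid kind G v q (suc (toℕ i)) c es' prog → Trace kind G ⟨ rs , v ∷ stk , c , es' ⟩ (out t-3) → Runs Loop t (Backed rs stk c prog v s)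
    continue t-3 es' ex fr3 l3 p3 σ3 tk3 P23 P13 mid3 tr3 =
     let (s' , ex' , b) = go m (suc k) (tick (runs next t-3)) es' (+-suc m k · m+k) fr3 l3 p3 σ3 (cong suc (tk3 · tk)) P23 (cong (_+ 1) P13 · +-comm k 1)
          (subst (λ j → Mid kind G v q (suc j) c es' prog) i≡ mid3) tr3
     in s' , again (blk ((tt , tt , tt) , tt)) (bit≢0 ((cong₂ _<ᵇ_ P1≡ P2≡) · <ᵇ-true k<d))
      (blk ok-1 ▸ ex ▸ blk ((tt , lit! , subst (λ z → z + 1 < 2 ^ w) (sym P13) (n<w (=≤ (+-comm k 1) » k<d » outdeg≤n (net kind G) v))) , tt)) ex' , b
    choose : ∀ b b' → isGray (lookup c x) ≡ b → (ν x ≡ᵇ q) ≡ b' → Runs Loop t (Backed rs stk c prog v s)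
    choose true false gray? par? =
     let (un , mid3) = mid-explore kind G und i (λ w → gray≢white (sym gv · w)) nx (λ e → true≢false (sym (cong (_≡ᵇ q) e · ≡ᵇ-refl q) · par?)) mid'
     in continue (runs (call (exploresNontree U LO) ∷ []) t-2) ((v , x) ∷ es) (ifT (λ z → bit≢0 (cong₂ (λ a b → a ∧ not b) gray? par?) (sym P32 · z)) (blk (tt , tt)))
      frame2 l p σ refl P2≡ P1≡ mid3 (trace-step kind G tr (exploreNontree un nx) (cong₂ (λ a b → out t ++ exploresNontree a b ∷ []) U1 LO2))
     where
     nx : NonWhite c x
     nx w = true≢false (sym gray? · cong isGray w)
    choose true true gray? par? = continue t-2 es (ifF (P32 · cong bit (cong₂ (λ a b → a ∧ not b) gray? par?)) (blk tt)) frame2 l p σ refl P2≡ P1≡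
     (mid-skip kind G und i (inr (≡ᵇ-true⇒≡ par?)) mid') tr
    choose false b' gray? par? = continue t-2 es (ifF (P32 · cong (λ a → bit (a ∧ not (ν x ≡ᵇ q))) gray?) (blk tt)) frame2 l p σ refl P2≡ P1≡
     (mid-skip kind G und i (inl (is-white (fr und i) gray?)) mid') tr
     where
     is-white : ∀ {h} → h ≢ black → isGray h ≡ false → h ≡ white
     is-white {white} _ _ = refl
     is-white {black} b _ = ⊥! (b refl)

 nontree-spec : ∀ {rs stk c es prog} u k s → reg s U ≡ ν u → reg s V ≡ ν (outhead u k) → NonWhite c (outhead u k) → prog u ≡ toℕ k →
  Explored kind G c es prog → Trace kind G ⟨ rs , u ∷ stk , c , es ⟩ (out s) →
  Σ[ s' ∈ State R2 ] Σ[ es' ∈ List (Fin n × Fin n) ] Exec (nontree kind) s s' × (reg s' ≡ reg s × lev s' ≡ lev s × pl s' ≡ pl s × sl s' ≡ sl s × ticks s' ≡ ticks s) ×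
   Explored kind G c es' (updF prog u (suc (toℕ k))) × Trace kind G ⟨ rs , u ∷ stk , c , es' ⟩ (out s')
 nontree-spec {rs} {stk} {c} {es} {prog} u k s U≡ V≡ nv pr ex tr = on kind refl
  where
  on : ∀ κ → kind ≡ κ → Σ[ s' ∈ State R2 ] Σ[ es' ∈ List (Fin n × Fin n) ] Exec (nontree κ) s s' × (reg s' ≡ reg s × lev s' ≡ lev s × pl s' ≡ pl s × sl s' ≡ sl s × ticks s' ≡ ticks s) ×
   Explored kind G c es' (updF prog u (suc (toℕ k))) × Trace kind G ⟨ rs , u ∷ stk , c , es' ⟩ (out s')
  on undir e = s , es , blk tt , (refl , refl , refl , refl , refl) , explored-same kind G e ex , tr
  on dir e = let (un , ex') = nontree-directed kind G {c} {es} {prog} u k e pr ex in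
   runs (call (exploresNontree U V) ∷ []) s , _ , blk (tt , tt) , (refl , refl , refl , refl , refl) , ex' ,
   trace-step kind G tr (exploreNontree un nv) (cong₂ (λ a b → out s ++ exploresNontree a b ∷ []) U≡ V≡)

 open PathSteps (net kind G) public

 planes-in : ∀ {s s'} → Keeps s s' → ∀ j o → pl s' (inP + j) o ≡ pl s (inP + j) o
 planes-in h j = Keeps.planes h (inP + j) (m≤m+n 3 j)

 level-keeps : ∀ {s s' j z u x} → Keeps s s' → Level s j z u x → Level s' j z u x
 level-keeps {j = j} h = level-keep (planes-in h j) (Keeps.planes h (stP + j) (m≤m+n 3 (suc K) » m≤m+n _ j)) (Keeps.lev≡ h) (Keeps.sl≡ h)

 zones-keeps : ∀ {s s' k gh u} → Keeps s s' → Zones k gh s u → Zones k gh s' u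
 zones-keeps h zs = record { lvl = λ j j< → level-keeps h (Zones.lvl zs j j<); nest = Zones.nest zs }

 pending-keeps : ∀ {s s' k gh E u} → Keeps s s' → Pending k gh E s u → Pending k gh E s' u
 pending-keeps h p = record { zones = zones-keeps h zones; full = full; paid = paid; stale = λ j a b → Keeps.lev≡ h ∙ (xA + j) · stale j a b; prepaid = prepaid; backlog = backlog }
  where open Pending p

 settled-keeps : ∀ {s s' c r u ps E gh} {inv : PathInv c r u ps} → Keeps s s' → Fixing.Settled inv E gh s → Fixing.Settled inv E gh s'
 settled-keeps h st' = record { z0 = z0; x0 = x0; N0 = N0; zones = zones-keeps h zones; full = full; paid = paid; lvs = levels-keep (Keeps.lev≡ h) lvs }
  where open Fixing.Settled st'

 quiet→keeps : ∀ {k s s'} → Quiet k s s' → Keeps s s'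
 quiet→keeps (quiet _ l p σ _) = keeps l σ (λ r _ o → p ∙ r ∙ o)

 hue-upd : ∀ {c : Vec Colour n} (f : ℕ → ℕ → Bool) r (φ : Colour → Bool) {o} v x b → o ≡ ν v → (∀ w → f r (ν w) ≡ φ (lookup c w)) → φ x ≡ b →
  ∀ w → wrP f r o 1 (bit b) r (ν w) ≡ φ (lookup (c [ v ]≔ x) w)
 hue-upd {c} f r φ v x b refl h e w with w ≟ᶠ v
 ... | yes refl = set-bit f r (ν w) b (ν w) · if-true (≡ᵇ-refl (ν w)) · sym (cong φ (lookup-≡ w c x) · e)
 ... | no w≢v = set-bit f r (ν v) b (ν w) · if-false (≡ᵇ-≢ _ _ (λ e → w≢v (sym (ν-inj e)))) · h w · cong φ (sym (lookup-≢ w≢v c x))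

 nonWhite-false⇒≡ : ∀ {h} → nonWhite h ≡ false → h ≡ white
 nonWhite-false⇒≡ {white} _ = refl

 nonWhite-true⇒≢ : ∀ {h} → nonWhite h ≡ true → h ≢ white
 nonWhite-true⇒≢ {white} () refl

 nonWhite-gray→black : ∀ {c : Vec Colour n} u → lookup c u ≡ gray → ∀ w → nonWhite (lookup c w) ≡ nonWhite (lookup (c [ u ]≔ black) w)
 nonWhite-gray→black {c} u g w with w ≟ᶠ u
 ... | yes refl = cong nonWhite g · sym (cong nonWhite (lookup-≡ w c black))
 ... | no w≢u = cong nonWhite (sym (lookup-≢ w≢u c black))

 -- Budgets and the invariant of the search

 -- Every vertex is pushed and popped at most once.
 toll : ℕ → Colour → Fin n → ℕ
 toll j white v = 0
 toll j gray v = weight j v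
 toll j black v = 2 * weight j v

 tolls : Vec Colour n → ℕ → ℕ
 tolls c j = sumF (λ v → toll j (lookup c v) v)

 tolls-gray : ∀ c v → lookup c v ≡ white → ∀ j → tolls c j + weight j v ≤ tolls (c [ v ]≔ gray) j
 tolls-gray c v wh j = =≤ (sym (sumF-weight (toll j) c v gray) · cong (λ z → tolls (c [ v ]≔ gray) j + toll j z v) wh · +0 _)

 tolls-black : ∀ c v → lookup c v ≡ gray → ∀ j → tolls c j + weight j v ≤ tolls (c [ v ]≔ black) j
 tolls-black c v g j = =≤ (+-cancelʳ-≡ (weight j v) _ _ (e (tolls c j) (weight j v) · sym (sumF-weight (toll j) c v black) · cong (λ z → tolls (c [ v ]≔ black) j + toll j z v) g))
  where
  e : ∀ a b → a + b + b ≡ a + 2 * b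
  e = ring

 -- The cost of one search step, apart from back edges and refills.
 unit : ℕ
 unit = 2 * K + 1

 -- A white vertex will need a search step per out-neighbour and one to finish, and in addition a
 -- tick per neighbour in `back-edges`.
 worth : Colour → Fin n → ℕ
 worth white v = unit * (outdeg v + 1) + outdeg v
 worth _ v = 0

 undiscovered : Vec Colour n → ℕ
 undiscovered c = sumF (λ v → worth (lookup c v) v)

 undiscovered-gray : ∀ c v → lookup c v ≡ white → undiscovered c ≡ undiscovered (c [ v ]≔ gray) + (unit * (outdeg v + 1) + outdeg v)
 undiscovered-gray c v wh = sym (+0 _) · sym (sumF-weight worth c v gray) · cong (λ z → undiscovered (c [ v ]≔ gray) + worth z v) wh

 undiscovered-black : ∀ c v → lookup c v ≡ gray → undiscovered (c [ v ]≔ black) ≡ undiscovered c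
 undiscovered-black c v g = sym (+0 _) · cong (λ z → undiscovered (c [ v ]≔ black) + worth z v) (sym g) · sumF-weight worth c v black · +0 _

 -- The steps that the suspended vertices still need: the positions after the edge taken, and one to
 -- finish.
 trail : List Edge → ℕ
 trail [] = 0
 trail (e ∷ ps) = (outdeg (tl e) ∸ suc (toℕ (snd e))) + 1 + trail ps

 record View : Set where
  constructor view
  field
   c : Vec Colour n
   es : List (Fin n × Fin n)
   u : Fin n
   i : ℕ
   ps : List Edge
   prog : Fin n → ℕ

 remaining : View → ℕ
 remaining (view c es u i ps prog) = undiscovered c + unit * ((outdeg u ∸ i) + 1 + trail ps)

 record Core (rs : List (Fin n)) (r : Fin n) (κ : ℕ) (q : View) (s : State R2) : Set where
  open View q
  field
   inv : PathInv c r u ps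
   hues-ok : Hues c s
   RT≡ : reg s RT ≡ ν r
   U≡ : reg s U ≡ ν u
   I≡ : reg s I ≡ i
   RUN≡ : reg s RUN ≡ 1
   CNT≡ : reg s CNT ≡ κ
   i≤ : i ≤ outdeg u
   seen : ∀ k → toℕ k < i → NonWhite c (outhead u k)
   closed : Closed (net kind G) c
   explored : Explored kind G c es prog
   prog-u : prog u ≡ i
   prog-ps : All (λ e → prog (tl e) ≡ suc (toℕ (snd e))) ps
   prog-white : ∀ v → lookup c v ≡ white → prog v ≡ 0
   trace : Trace kind G ⟨ rs , stackOf u ps , c , es ⟩ (out s)

 core-outer : ∀ {rs r κ q s s'} → Outer s s' → Core rs r κ q s → Core rs r κ q s'
 core-outer {rs} {q = q} {s} {s'} o co = record { inv = inv; hues-ok = hues-outer o hues-ok ; RT≡ = Outer.kept o RT · RT≡; U≡ = Outer.kept o U · U≡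
  ; I≡ = Outer.kept o I · I≡; RUN≡ = Outer.kept o RUN · RUN≡
  ; CNT≡ = Outer.kept o CNT · CNT≡
  ; i≤ = i≤; seen = seen; closed = closed; explored = explored; prog-u = prog-u; prog-ps = prog-ps; prog-white = prog-white
  ; trace = subst (Trace kind G ⟨ rs , stackOf (View.u q) (View.ps q) , View.c q , View.es q ⟩) (sym (Outer.out≡ o)) trace }
  where open Core co

 -- `m` reserves the tick that ends the current iteration, and `ρ` what is set aside for later
 -- roots. The steps also lower `remaining` strictly, so that it serves as the fuel of the search
 -- loop.
 record Running (rs : List (Fin n)) (r : Fin n) (κ ρ m : ℕ) (q : View) (s : State R2) : Set where
  open View q
  field
   core : Core rs r κ q s
   gh : Ghost
   settled : Fixing.Settled (Core.inv core) (tolls c) gh s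
   budget : m + ticks s + (remaining q + ρ) ≤ B0 + total K (refills gh)

 running-tick : ∀ {rs r κ ρ m q s} → Running rs r κ ρ (suc m) q s → Running rs r κ ρ m q (tick s)
 running-tick {m = m} {s = s} ru = record { core = core-outer same core; gh = gh; settled = settled-keeps (keeps refl refl (λ _ _ _ → refl)) settled
  ; budget = +ˡ≤ _ (=≤ (+-suc m (ticks s))) » budget }
  where
  open Running ru
  same : Outer s (tick s)
  same = outer (λ _ _ → refl) (λ _ _ _ → refl) refl

 settle : ∀ {rs r κ q s k gh} ρ m (co : Core rs r κ q s) → View.ps q ≢ [] → 1 ≤ k → k ≤ suc K → Pending k gh (tolls (View.c q)) s (View.u q) → Levels s →
  zone gh 0 ≡ View.ps q → from gh 0 ≡ r → refills gh 0 ≡ 0 → m + (K + ticks s) + (remaining q + ρ) ≤ B0 + total K (refills gh) →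
  Runs fix s (Running rs r κ ρ m q)
 settle {rs} {r} {κ} {q} {s} {k} {gh} ρ m co ps≢ 1≤k k≤ pend lvs z0 x0 N0 bud =
  let (s' , ex , fx) = fix-spec s ps≢ 1≤k k≤ pend lvs z0 x0 N0 (Core.U≡ co) (Core.RT≡ co) in s' , ex , finish s' fx
  where
  open Fixing (Core.inv co) (tolls (View.c q))
  finish : ∀ s' → Fixed gh s s' → Running rs r κ ρ m q s'
  finish s' fx = record { core = core-outer (Fixed.outerF fx) co; gh = Fixed.gh fx; settled = Fixed.settled fx
   ; budget = +-cancelʳ-≤ (total K (refills gh)) _ _ (begin
    m + ticks s' + (remaining q + ρ) + total K (refills gh) ≡⟨ e1 m (ticks s') (remaining q + ρ) _ ⟩
    m + (ticks s' + total K (refills gh)) + (remaining q + ρ) ≤⟨ +ˡ≤ _ (+ʳ≤ m (Fixed.tick≤ fx)) ⟩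
    m + (K + ticks s + T') + (remaining q + ρ) ≡⟨ e2 m (K + ticks s) T' (remaining q + ρ) ⟩
    m + (K + ticks s) + (remaining q + ρ) + T' ≤⟨ +ˡ≤ T' bud ⟩
    B0 + total K (refills gh) + T' ≡⟨ e3 B0 (total K (refills gh)) T' ⟩
    B0 + T' + total K (refills gh) ∎) }
    where
    open ≤-Reasoning
    T' = total K (refills (Fixed.gh fx))
    e1 : ∀ m t r N → m + t + r + N ≡ m + (t + N) + r
    e1 = ring
    e2 : ∀ m t N r → m + (t + N) + r ≡ m + t + r + N
    e2 = ring
    e3 : ∀ b N M → b + N + M ≡ b + M + N
    e3 = ring

 settle-root : ∀ {rs r κ q s gh} ρ m (co : Core rs r κ q s) → View.u q ≡ r → Fixing.Settled (Core.inv co) (tolls (View.c q)) gh s →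
  m + ticks s + (remaining q + ρ) ≤ B0 + total K (refills gh) → Runs fix s (Running rs r κ ρ m q)
 settle-root {q = q} {s} {gh} ρ m co u≡r se bud = runs root-test s ,
  (blk ((tt , tt , tt) , tt) ▸ ifT (λ z → 1+n≢0 (sym (cong₂ (λ a b → bit (a ≡ᵇ b)) (Core.U≡ co) (Core.RT≡ co · cong ν (sym u≡r)) · cong bit (≡ᵇ-refl (ν (View.u q)))) · z)) (blk tt)) ,
  record { core = core-outer (quiet→outer q1) co; gh = gh; settled = settled-keeps (quiet→keeps q1) se; budget = bud }
  where
  q1 : Quiet 8 s (runs root-test s)
  q1 = runs-quiet {8} root-test s refl

 forward : Cmd (Query kind) R2
 forward = block look-block ⨾ ifnz CC (nontree kind ⨾ block advance-block) (block discover-block ⨾ push ⨾ block descend-block ⨾ back-edges kind ⨾ fix)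

 prog-upd : ∀ {prog : Fin n → ℕ} {u x} ps → All (u ≢_) (tails ps) → All (λ e → prog (tl e) ≡ suc (toℕ (snd e))) ps → All (λ e → updF prog u x (tl e) ≡ suc (toℕ (snd e))) ps
 prog-upd [] _ _ = []
 prog-upd {prog} {u} {x} (e ∷ ps) (u≢ ∷ us) (p ∷ h) = updF-≢ prog u x (tl e) (≢-sym u≢) · p ∷ prog-upd ps us h

 seen-suc : ∀ {c u} (k : Fin (outdeg u)) → (∀ j → toℕ j < toℕ k → NonWhite c (outhead u j)) → NonWhite c (outhead u k) → ∀ j → toℕ j < suc (toℕ k) → NonWhite c (outhead u j)
 seen-suc {c} {u} k h nk j j< with ≤-split (≤-pred j<)
 ... | inl l = h j l
 ... | inr e = subst (λ i → NonWhite c (outhead u i)) (toℕ-injective (sym e)) nk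

 Next : List (Fin n) → Fin n → ℕ → ℕ → View → Cmd (Query kind) R2 → State R2 → Set
 Next rs r κ ρ q c s = Σ[ q' ∈ View ] Σ[ s' ∈ State R2 ] Exec c s s' × Running rs r κ ρ 1 q' s' × remaining q' < remaining q

 drop-unit : ∀ {a b} → a ≡ unit + b → b < a
 drop-unit {a} {b} refl = +ˡ≤ b (=≤ (+-comm 0 1) » m≤n+m 1 (2 * K)) » ≤-refl

 module _ {rs r κ ρ c es u i ps prog s} (ru : Running rs r κ ρ 0 (view c es u i ps prog) s) where
  open Running ru
  open Core core

  private
   uniq-tail : All (u ≢_) (tails ps)
   uniq-tail with PathInv.uniq inv
   ... | u∉ ∷ _ = u∉

   gray-u : lookup c u ≡ gray
   gray-u = PathInv.∈→gray inv (here refl)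

   nonwhite-u : NonWhite c u
   nonwhite-u e = gray≢white (sym gray-u · e)

  prog-white-upd : ∀ {x} v → lookup c v ≡ white → updF prog u x v ≡ 0
  prog-white-upd v wh = updF-≢ prog u _ v (λ { refl → nonwhite-u wh }) · prog-white v wh

  remaining-unit : ∀ {es' prog'} → i < outdeg u → remaining (view c es u i ps prog) ≡ unit + remaining (view c es' u (suc i) ps prog')
  remaining-unit i<d = cong (λ z → undiscovered c + unit * (z + 1 + trail ps)) (∸-suc i<d) · e (undiscovered c) unit (outdeg u ∸ suc i) (trail ps)
   where
   e : ∀ a b d t → a + b * (suc d + 1 + t) ≡ b + (a + b * (d + 1 + t))
   e = ring

  step-nontree : ∀ s1 (k : Fin (outdeg u)) → toℕ k ≡ i → Quiet 3 s s1 → reg s1 RUN ≡ reg s RUN → reg s1 CNT ≡ reg s CNT → ticks s1 ≡ ticks s → reg s1 V ≡ ν (outhead u k) → NonWhite c (outhead u k) →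
   Next rs r κ ρ (view c es u i ps prog) (nontree kind ⨾ block advance-block) s1
  step-nontree s1 k refl q RUN1 CNT1 tk V≡ nv =
   let (s2 , es' , ex , same , expl , tr) = nontree-spec {prog = prog} u k s1 (Quiet.kept q U · U≡) V≡ nv prog-u explored
        (subst (Trace kind G _) (sym (Quiet.out≡ q)) trace)
   in after s2 es' ex same expl tr
   where
   after : ∀ s2 es' → Exec (nontree kind) s1 s2 → (reg s2 ≡ reg s1 × lev s2 ≡ lev s1 × pl s2 ≡ pl s1 × sl s2 ≡ sl s1 × ticks s2 ≡ ticks s1) →
    Explored kind G c es' (updF prog u (suc (toℕ k))) → Trace kind G ⟨ rs , u ∷ tails ps , c , es' ⟩ (out s2) → Next rs r κ ρ (view c es u (toℕ k) ps prog) (nontree kind ⨾ block advance-block) s1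
   after s2 es' ex (r≡ , l≡ , p≡ , σ≡ , t≡) expl tr = view c es' u (suc (toℕ k)) ps (updF prog u (suc (toℕ k))) , s3 ,
    (ex ▸ blk ((tt , lit! , n<w (=≤ I+1 » toℕ<n k » outdeg≤n (net kind G) u)) , tt)) ,
    record { core = record
      { inv = inv; hues-ok = hues-pl P3≡ hues-ok
      ; RT≡ = r≡ ∙ RT · Quiet.kept q RT · RT≡
      ; U≡ = r≡ ∙ U · Quiet.kept q U · U≡
      ; I≡ = I+1; RUN≡ = r≡ ∙ RUN · RUN1 · RUN≡; CNT≡ = r≡ ∙ CNT · CNT1 · CNT≡
      ; i≤ = toℕ<n k; seen = seen-suc {c} k seen nv; closed = closed; explored = expl; prog-u = updF-≡ prog u _
      ; prog-ps = prog-upd {prog} ps uniq-tail prog-ps; prog-white = prog-white-upd; trace = tr }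
     ; gh = gh
     ; settled = settled-keeps (keeps (l≡ · Quiet.lev≡ q) (σ≡ · Quiet.sl≡ q) (λ r _ o → P3≡ ∙ r ∙ o)) settled
     ; budget = +ˡ≤ _ (+ʳ≤ 1 (=≤ (t≡ · tk))) » m≤m+n _ (2 * K) » =≤
      (e (ticks s) (remaining (view c es' u (suc (toℕ k)) ps (updF prog u (suc (toℕ k))))) ρ K · cong (λ z → ticks s + (z + ρ)) (sym (remaining-unit {es'} {updF prog u (suc (toℕ k))} (toℕ<n k)))) » budget } ,
    drop-unit (remaining-unit {es'} {updF prog u (suc (toℕ k))} (toℕ<n k))
    where
    s3 = runs advance-block s2
    P3≡ = p≡ · Quiet.pl≡ q
    I+1 : reg s2 I + 1 ≡ suc (toℕ k)
    I+1 = cong (_+ 1) (r≡ ∙ I · Quiet.kept q I · I≡) · +-comm (toℕ k) 1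
    e : ∀ t r ρ K → 1 + t + (r + ρ) + 2 * K ≡ t + ((2 * K + 1) + r + ρ)
    e = ring

  step-tree : ∀ s1 (k : Fin (outdeg u)) → toℕ k ≡ i → Quiet 3 s s1 → reg s1 RUN ≡ reg s RUN → reg s1 CNT ≡ reg s CNT → ticks s1 ≡ ticks s → reg s1 V ≡ ν (outhead u k) → lookup c (outhead u k) ≡ white →
   Next rs r κ ρ (view c es u i ps prog) (block discover-block ⨾ push ⨾ block descend-block ⨾ back-edges kind ⨾ fix) s1
  step-tree s1 k refl q RUN1 CNT1 tk V≡ wh =
   let (s3 , ex , pu) = push-spec inv (settled-keeps keeps2 settled) (tolls-gray c v wh) U2 I2 V≡ in after-push s3 ex pu
   where
   v : Fin n
   v = outhead u k
   c' : Vec Colour n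
   c' = c [ v ]≔ gray
   ps' : List Edge
   ps' = (u , k) ∷ ps
   prog' : Fin n → ℕ
   prog' = updF prog u (suc (toℕ k))
   Result = Next rs r κ ρ (view c es u (toℕ k) ps prog) (block discover-block ⨾ push ⨾ block descend-block ⨾ back-edges kind ⨾ fix) s1
   s2 = runs discover-block s1
   open Pushing (u , k) gh s2
   inv' = path-push u k inv wh seen
   U2 = Quiet.kept q U · U≡
   I2 = Quiet.kept q I · I≡
   pl1 = Quiet.pl≡ q
   f1 : ℕ → ℕ → Bool
   f1 = wrP (pl s1) nwP (reg s1 V) 1 1
   keeps2 : Keeps s s2
   keeps2 = keeps (Quiet.lev≡ q) (Quiet.sl≡ q) (λ r 3≤r o → wrP-plane f1 grP (reg s1 V) 1 1 r o (<⇒≢ (s≤s z<s » 3≤r)) ·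
    wrP-plane (pl s1) nwP (reg s1 V) 1 1 r o (<⇒≢ (z<s » 3≤r)) · pl1 ∙ r ∙ o)
   hues2 : Hues c' s2
   hues2 = hues (λ x → wrP-plane f1 grP (reg s1 V) 1 1 nwP (ν x) (λ ()) · hue-upd {c} (pl s1) nwP nonWhite v gray true V≡ (λ x → pl1 ∙ nwP ∙ ν x · Hues.nw hues-ok x) refl x)
    (hue-upd {c} f1 grP isGray v gray true V≡ (λ x → wrP-plane (pl s1) nwP (reg s1 V) 1 1 grP (ν x) (λ ()) · pl1 ∙ grP ∙ ν x · Hues.gr hues-ok x) refl)
   trace2 : Trace kind G ⟨ rs , v ∷ stackOf u ps , c' , (u , v) ∷ es ⟩ (out s2)
   trace2 = trace-step kind G trace (exploreTree (unexplored-tree kind G u k explored prog-u wh) wh)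
    (++-assoc (out s1) _ _ · cong₂ (λ a b → a ++ b) (Quiet.out≡ q) (cong₂ (λ a b → exploresTree a b ∷ turnsGray b ∷ []) (Quiet.kept q U · U≡) V≡))
   ok-1 : oks discover-block s1
   ok-1 = tt , tt , mark-ok z≤n (s≤s z<s) V≡ , mark-ok z<s (s≤s z<s) V≡ , tt
   after-push : ∀ s3 → Exec push s2 s3 → Pushed (tolls c') s3 → Result
   after-push s3 ex3 pu = let (s5 , ex , b) = back-edges-spec {rs} {stackOf u ps} {c'} {(u , v) ∷ es} {prog'} v (ν u) s4 U4 PAR4 hues4 (lookup-≡ v c gray) (fair kind G {c} v closed wh) (before-tree kind G u k explored prog-u wh nonwhite-u) (subst (Trace kind G _) (sym (Outer.out≡ (Pushed.outerF pu))) trace2)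
    in after-back s5 ex b
    where
    open Pushed pu using (outerF; pend; lvs)
    s4 = runs descend-block s3
    fr = Outer.kept outerF
    U4 = fr V · V≡
    PAR4 = fr U · U2
    hues4 : Hues c' s4
    hues4 = hues-pl {s = s3} refl (hues-outer outerF hues2)
    after-back : ∀ s5 → Exec (back-edges kind) s4 s5 → Backed rs (stackOf u ps) c' prog' v s4 s5 → Result
    after-back s5 ex5 b =
     let (s6 , ex6 , ru') = settle ρ 1 core5 (λ ()) (Pushed.1≤k pu) (Pushed.k≤ pu) (pending-keeps keeps5 pend) (levels-keep (Keeps.lev≡ keeps5) lvs)
          (cong ((u , k) ∷_) (Fixing.Settled.z0 settled)) (Fixing.Settled.x0 settled) (Fixing.Settled.N0 settled) budget5
     in q' , s6 , (blk ok-1 ▸ ex3 ▸ blk (tt , tt , lit! , tt) ▸ ex5 ▸ ex6) , ru' , drop-unit'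
     where
     q' : View
     q' = view c' (Backed.es' b) v 0 ps' prog'
     keeps5 : Keeps s3 s5
     keeps5 = keeps (Backed.lev≡ b) (Backed.sl≡ b) (λ r _ o → Backed.pl≡ b ∙ r ∙ o)
     fr5 = Backed.kept b
     fr2 = Quiet.kept q
     prog-v = prog-white-upd v wh
     core5 : Core rs r κ q' s5
     core5 = record { inv = inv' ; hues-ok = hues-pl (Backed.pl≡ b) hues4 ; RT≡ = fr5 RT · fr RT · fr2 RT · RT≡; U≡ = fr5 U · U4; I≡ = fr5 I
      ; RUN≡ = fr5 RUN · fr RUN · RUN1 · RUN≡; CNT≡ = fr5 CNT · fr CNT · CNT1 · CNT≡
      ; i≤ = z≤n; seen = λ _ (); closed = closed-gray (net kind G) {c} v closed; explored = Backed.explored b; prog-u = prog-v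
      ; prog-ps = updF-≡ prog u _ ∷ prog-upd {prog} ps uniq-tail prog-ps
      ; prog-white = λ x wx → prog-white-upd x (white-upd⁻ c v x gray≢white wx); trace = Backed.trace b }
     -- The worth of the new vertex is converted into its own search steps and the ticks of its
     -- `back-edges`.
     spend : remaining (view c es u (toℕ k) ps prog) ≡ unit + (remaining q' + outdeg v)
     spend = cong₂ (λ a b → a + unit * (b + 1 + trail ps)) (undiscovered-gray c v wh) (∸-suc (toℕ<n k)) · e (undiscovered c') unit (outdeg v) (outdeg u ∸ suc (toℕ k)) (trail ps)
      where
      e : ∀ W b D d t → W + (b * (D + 1) + D) + b * (suc d + 1 + t) ≡ b + (W + b * (D + 1 + (d + 1 + t)) + D)
      e = ring
     drop-unit' : remaining q' < remaining (view c es u (toℕ k) ps prog)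
     drop-unit' = s≤s (m≤m+n _ (outdeg v)) » drop-unit spend
     budget5 : 1 + (K + ticks s5) + (remaining q' + ρ) ≤ B0 + total K (refills gh)
     budget5 = begin
      1 + (K + ticks s5) + (remaining q' + ρ) ≤⟨ +ˡ≤ _ (+ʳ≤ 1 (+ʳ≤ K (Backed.tick≤ b))) ⟩
      1 + (K + (outdeg v + ticks s3)) + (remaining q' + ρ) ≡⟨ cong (λ z → 1 + (K + (outdeg v + z)) + (remaining q' + ρ)) (Pushed.tick≡ pu · cong (K +_) tk) ⟩
      1 + (K + (outdeg v + (K + ticks s))) + (remaining q' + ρ) ≡⟨ e K (outdeg v) (ticks s) (remaining q') ρ ⟩
      ticks s + ((2 * K + 1) + (remaining q' + outdeg v) + ρ) ≡⟨ cong (λ z → ticks s + (z + ρ)) (sym spend) ⟩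
      ticks s + (remaining (view c es u (toℕ k) ps prog) + ρ) ≤⟨ budget ⟩
      B0 + total K (refills gh) ∎
      where
      open ≤-Reasoning
      e : ∀ K D t r ρ → 1 + (K + (D + (K + t))) + (r + ρ) ≡ t + ((2 * K + 1) + (r + D) + ρ)
      e = ring

  step-forward : ∀ s1 → i < outdeg u → Quiet 3 s s1 → reg s1 RUN ≡ reg s RUN → reg s1 CNT ≡ reg s CNT → ticks s1 ≡ ticks s → Next rs r κ ρ (view c es u i ps prog) forward s1
  step-forward s1 i<d q RUN1 CNT1 tk = colour (nonWhite (lookup c v)) refl
   where
   k : Fin (outdeg u)
   k = fromℕ< i<d
   k≡ : toℕ k ≡ i
   k≡ = toℕ-fromℕ< i<d
   v : Fin n
   v = outhead u k
   asked = outhead-ask u k (Quiet.kept q U · U≡) (Quiet.kept q I · I≡ · sym k≡)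
   s2 = runs look-block s1
   V2 : reg s2 V ≡ ν v
   V2 = cong (fromMaybe 0) asked
   CC2 : reg s2 CC ≡ bit (nonWhite (lookup c v))
   CC2 = cong₂ (λ f o → num (f nwP) o 1) (Quiet.pl≡ q) V2 · num-1 (pl s nwP) (ν v) · cong bit (Hues.nw hues-ok v)
   ok-1 : oks look-block s1
   ok-1 = (tt , tt , ν v , asked , ν<w v) , test-ok z≤n V2 , tt
   q2 : Quiet 3 s s2
   q2 = quiet-trans q (runs-quiet {3} look-block s1 refl)
   colour : ∀ b → nonWhite (lookup c v) ≡ b → Next rs r κ ρ (view c es u i ps prog) forward s1
   colour true h = let (q' , s' , ex , ru' , dec<') = step-nontree s2 k k≡ q2 RUN1 CNT1 tk V2 (nonWhite-true⇒≢ h) in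
    q' , s' , (blk ok-1 ▸ ifT (λ z → bit≢0 h (sym CC2 · z)) ex) , ru' , dec<'
   colour false h = let (q' , s' , ex , ru' , dec<') = step-tree s2 k k≡ q2 RUN1 CNT1 tk V2 (nonWhite-false⇒≡ h) in
    q' , s' , (blk ok-1 ▸ ifF (CC2 · cong bit h) ex) , ru' , dec<'

 -- From one tree to the next

 record Resting (rs : List (Fin n)) (κ ρ m : ℕ) (s : State R2) : Set where
  field
   c : Vec Colour n
   es : List (Fin n × Fin n)
   prog : Fin n → ℕ
   N : ℕ → ℕ
   N0 : N 0 ≡ 0
   hues-ok : Hues c s
   CNT≡ : reg s CNT ≡ κ
   no-gray : ∀ v → lookup c v ≢ gray
   closed : Closed (net kind G) c
   explored : Explored kind G c es prog
   prog-white : ∀ v → lookup c v ≡ white → prog v ≡ 0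
   trace : Trace kind G ⟨ rs , [] , c , es ⟩ (out s)
   lvs : Levels s
   blank : ∀ j → j ≤ K → Marks (pl s (inP + j)) []
   sp≡ : ∀ j → j ≤ K → j ≢ 0 → lev s (spA + j) ≡ 0
   paid : ∀ j → j < K → credit * N (suc j) ≤ tolls c (suc j) + credit * N j
   budget : m + ticks s + (undiscovered c + ρ) ≤ B0 + total K N

 resting-move : ∀ {rs κ κ' ρ ρ' m m' s s'} → lev s' ≡ lev s → pl s' ≡ pl s → out s' ≡ out s → reg s' CNT ≡ κ' → m' + ticks s' + ρ' ≤ m + ticks s + ρ →
  Resting rs κ ρ m s → Resting rs κ' ρ' m' s'
 resting-move {rs} {ρ = ρ} {ρ'} {m} {m'} {s} {s'} l p o cnt le re = record { c = c; es = es; prog = prog; N = N; N0 = N0; hues-ok = hues-pl p hues-ok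
  ; CNT≡ = cnt; no-gray = no-gray; closed = closed; explored = explored; prog-white = prog-white; trace = subst (Trace kind G ⟨ rs , [] , c , es ⟩) (sym o) trace
  ; lvs = levels-keep l lvs; blank = λ j j≤K v → p ∙ (inP + j) ∙ ν v · blank j j≤K v; sp≡ = λ j j≤K h → l ∙ (spA + j) · sp≡ j j≤K h
  ; paid = paid; budget = =≤ (e (m' + ticks s') (undiscovered c) ρ') » +ˡ≤ (undiscovered c) le » =≥ (e (m + ticks s) (undiscovered c) ρ) » budget }
  where
  open Resting re
  e : ∀ a b c → a + (b + c) ≡ a + c + b
  e = ring

 backward : Cmd (Query kind) R2
 backward = block finish-block ⨾ ifnz CC (block (mov RUN (lit 0) ∷ [])) (pop ⨾ block rise-block ⨾ fix)

 Ends : List (Fin n) → ℕ → ℕ → Cmd (Query kind) R2 → State R2 → Set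
 Ends rs κ ρ c s = Σ[ s' ∈ State R2 ] Exec c s s' × Resting rs κ ρ 1 s' × reg s' RUN ≡ 0

 module _ {rs r κ ρ c es u ps prog s} (ru : Running rs r κ ρ 0 (view c es u (outdeg u) ps prog) s) where
  open Running ru
  open Core core

  private
   gray-u : lookup c u ≡ gray
   gray-u = PathInv.∈→gray inv (here refl)

   nonwhite-u : NonWhite c u
   nonwhite-u e = gray≢white (sym gray-u · e)

   seen-all : ∀ k → NonWhite c (outhead u k)
   seen-all k = seen k (toℕ<n k)

   finished : ∀ v → ¬ Unexplored kind G es u v
   finished = explored-all kind G u explored (=≥ prog-u) nonwhite-u seen-all

  module Finish (s1 : State R2) (q : Quiet 3 s s1) (RUN1 : reg s1 RUN ≡ reg s RUN) (CNT1 : reg s1 CNT ≡ reg s CNT) (tk : ticks s1 ≡ ticks s) where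

   c' : Vec Colour n
   c' = c [ u ]≔ black

   s2 = runs finish-block s1

   fr2 = Quiet.kept q

   U1 = fr2 U · U≡

   keeps2 : Keeps s s2
   keeps2 = keeps (Quiet.lev≡ q) (Quiet.sl≡ q) (λ r 3≤r o → wrP-plane (pl s1) grP (reg s1 U) 1 0 r o (<⇒≢ (s≤s z<s » 3≤r)) · Quiet.pl≡ q ∙ r ∙ o)

   hues2 : Hues c' s2
   hues2 = hues (λ x → wrP-plane (pl s1) grP (reg s1 U) 1 0 nwP (ν x) (λ ()) · Quiet.pl≡ q ∙ nwP ∙ ν x · Hues.nw hues-ok x · nonWhite-gray→black {c} u gray-u x)
    (hue-upd {c} (pl s1) grP isGray u black false U1 (λ x → Quiet.pl≡ q ∙ grP ∙ ν x · Hues.gr hues-ok x) refl)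

   ok-1 : oks finish-block s1
   ok-1 = tt , mark-ok z<s z<s U1 , (tt , tt , tt) , tt

   CC2 : reg s2 CC ≡ bit (ν u ≡ᵇ ν r)
   CC2 = cong₂ (λ a b → bit (a ≡ᵇ b)) U1 (fr2 RT · RT≡)

   closed2 : Closed (net kind G) c'
   closed2 = closed-black (net kind G) {c} u seen-all closed

   explored2 : Explored kind G c' es prog
   explored2 = explored-upd kind G {c} {es} {prog} u black≢white nonwhite-u explored

  finish-root : ∀ s1 → Quiet 3 s s1 → reg s1 RUN ≡ reg s RUN → reg s1 CNT ≡ reg s CNT → ticks s1 ≡ ticks s → ps ≡ [] → Ends rs κ ρ backward s1
  finish-root s1 q RUN1 CNT1 tk refl = runs (mov RUN (lit 0) ∷ []) s2 ,
   (blk ok-1 ▸ ifT (λ z → 1+n≢0 (sym (CC2 · cong (λ x → bit (ν u ≡ᵇ ν x)) (sym u≡r) · cong bit (≡ᵇ-refl (ν u))) · z)) (blk (lit! , tt))) ,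
   record { c = c'; es = es; prog = prog; N = refills gh; N0 = Fixing.Settled.N0 settled; hues-ok = hues (Hues.nw hues2) (Hues.gr hues2); CNT≡ = CNT1 · CNT≡; no-gray = no-gray-end inv
    ; closed = closed2; explored = explored2; prog-white = λ v wh → prog-white v (white-upd⁻ c u v black≢white wh)
    ; trace = trace-step kind G trace (finishRoot finished) (cong₂ (λ a b → a ++ turnsBlack b ∷ []) (Quiet.out≡ q) U1)
    ; lvs = levels-keep (Keeps.lev≡ keeps2) lvs
    ; blank = λ j j≤K v → planes-in keeps2 j (ν v) · subst (Marks (pl s (inP + j))) (empty j j≤K) (Level.marks (Zones.lvl zones j (s≤s j≤K))) v
    ; sp≡ = λ j j≤K h → Keeps.lev≡ keeps2 ∙ (spA + j) · fst (Level.room (Zones.lvl zones j (s≤s j≤K)) h) · cong (size j) (empty j j≤K)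
    ; paid = λ j j<K → m≤m+n _ (potential (suc j) (zone gh (suc j)) (below' gh (suc j))) » Fixing.Settled.paid settled j j<K »
     +ˡ≤ _ (m≤m+n _ (weight (suc j) u) » tolls-black c u gray-u (suc j))
    ; budget = =≤ (cong₂ (λ a b → 1 + a + (b + ρ)) tk (undiscovered-black c u gray-u)) » m≤m+n _ (2 * K) »
     =≤ (e (ticks s) (undiscovered c) ρ K · cong (λ z → ticks s + ((undiscovered c + unit * (z + 1 + 0)) + ρ)) (sym (n∸n≡0 (outdeg u)))) » budget } ,
   refl
   where
   open Finish s1 q RUN1 CNT1 tk
   open Fixing.Settled settled using (zones; z0; lvs)
   u≡r = PathInv.chain inv
   empty : ∀ j → j ≤ K → zone gh j ≡ []
   empty j j≤K = let (D , eqn) = zones-prefix zones j (s≤s j≤K) in ++-conicalˡ (zone gh j) D (eqn · z0)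
   e : ∀ t U ρ K → 1 + t + (U + ρ) + 2 * K ≡ t + ((U + (2 * K + 1) * (0 + 1 + 0)) + ρ)
   e = ring

 finish-child : ∀ {rs r κ ρ c es u e ps prog s} → hd e ≡ u → (ru : Running rs r κ ρ 0 (view c es u (outdeg u) (e ∷ ps) prog) s) → ∀ s1 → Quiet 3 s s1 → reg s1 RUN ≡ reg s RUN → reg s1 CNT ≡ reg s CNT → ticks s1 ≡ ticks s →
  Next rs r κ ρ (view c es u (outdeg u) (e ∷ ps) prog) backward s1
 finish-child {rs} {r} {κ} {ρ} {c} {es} {.(hd e)} {e} {ps} {prog} {s} refl ru s1 q RUN1 CNT1 tk =
  let (s3 , ex3 , po) = pop-spec (λ j j≤K → level-keeps keeps2 (lvl j j≤K)) (levels-keep (Keeps.lev≡ keeps2) (Fixing.Settled.lvs settled)) U1 in after-pop s3 ex3 po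
  where
  open Running ru
  open Core core
  u : Fin n
  u = hd e
  gray-u : lookup c u ≡ gray
  gray-u = PathInv.∈→gray inv (here refl)
  open Finish ru s1 q RUN1 CNT1 tk
  open AfterPop e inv settled (tolls c') (tolls-black c u gray-u)
  open Popping e (λ j → rest (zone gh j)) (from gh) s2 fresh
  Result = Next rs r κ ρ (view c es u (outdeg u) (e ∷ ps) prog) backward s1
  inv' = path-pop e inv
  q' : View
  q' = view c' es (tl e) (suc (toℕ (snd e))) ps prog
  r≢u : ν u ≢ ν r
  r≢u e' = Fixing.start≢u inv (tolls c) {e ∷ ps} {[]} (++-identityʳ _) (λ ()) (PathInv.chain inv) (sym (ν-inj e'))
  after-pop : ∀ s3 → Exec pop s2 s3 → Popped s3 → Result
  after-pop s3 ex3 po = on-rest ps refl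
   where
   open PopInv po using (outerF; PY≡; PI≡) renaming (U≡ to U3; lvs to lvs3; new to new3; tick≡ to tick3)
   s4 = runs rise-block s3
   fr = Outer.kept outerF
   keeps4 : Keeps s3 s4
   keeps4 = keeps refl refl (λ _ _ _ → refl)
   I4 : reg s3 PI + 1 ≡ suc (toℕ (snd e))
   I4 = cong (_+ 1) PI≡ · +-comm _ 1
   ok-4 : oks rise-block s3
   ok-4 = tt , tt , (tt , lit! , n<w (=≤ I4 » toℕ<n (snd e) » outdeg≤n (net kind G) (tl e))) , tt , tt
   finished : ∀ v → ¬ Unexplored kind G es u v
   finished = explored-all kind G u explored (=≥ prog-u) (λ w → gray≢white (sym gray-u · w)) (λ k → seen k (toℕ<n k))
   ticks3 : ticks s3 ≡ K + ticks s
   ticks3 = suc-injective tick3 · cong (K +_) tk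
   core4 : Core rs r κ q' s4
   core4 = record { inv = inv'; hues-ok = hues-pl {s = s3} refl (hues-outer outerF hues2)
    ; RT≡ = fr RT · fr2 RT · RT≡; U≡ = PY≡; I≡ = I4; RUN≡ = fr RUN · RUN1 · RUN≡; CNT≡ = fr CNT · CNT1 · CNT≡
    ; i≤ = toℕ<n (snd e); seen = seen-pop e inv; closed = closed2; explored = explored2
    ; prog-u = first prog-ps; prog-ps = others prog-ps; prog-white = λ v wh → prog-white v (white-upd⁻ c u v black≢white wh)
    ; trace = trace-step kind G trace (finishChild finished) (cong (_++ withdraws (reg s3 PY) (reg s3 U) ∷ []) (Outer.out≡ outerF · refl) · ++-assoc (out s1) _ _ ·
      (cong₂ _++_ (Quiet.out≡ q) (cong₂ (λ a b → a ∷ b ∷ []) (cong turnsBlack U1) (cong₂ withdraws PY≡ U3)))) }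
    where
    first : ∀ {x} {P : Edge → Set} {xs} → All P (x ∷ xs) → P x
    first (h ∷ _) = h
    others : ∀ {x} {P : Edge → Set} {xs} → All P (x ∷ xs) → All P xs
    others (_ ∷ h) = h
   spend : remaining (view c es u (outdeg u) (e ∷ ps) prog) ≡ unit + remaining q'
   spend = cong₂ (λ a b → a + unit * (b + 1 + trail (e ∷ ps))) (sym (undiscovered-black c u gray-u)) (n∸n≡0 (outdeg u)) ·
    arith (undiscovered c') unit (outdeg (tl e) ∸ suc (toℕ (snd e))) (trail ps)
    where
    arith : ∀ W b d t → W + b * (0 + 1 + (d + 1 + t)) ≡ b + (W + b * (d + 1 + t))
    arith = ring
   budget4 : 1 + (K + ticks s4) + (remaining q' + ρ) ≤ B0 + total K (refills gh)
   budget4 = =≤ (cong (λ z → 1 + (K + z) + (remaining q' + ρ)) ticks3 · arith K (ticks s) (remaining q') ρ · cong (λ z → ticks s + (z + ρ)) (sym spend)) » budget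
    where
    arith : ∀ K t r ρ → 1 + (K + (K + t)) + (r + ρ) ≡ t + ((2 * K + 1) + r + ρ)
    arith = ring
   run : ∀ {s5} → Exec fix s4 s5 → Exec backward s1 s5
   run ex = blk ok-1 ▸ ifF (CC2 · cong bit (≡ᵇ-≢ _ _ r≢u)) (ex3 ▸ blk ok-4 ▸ ex)
   new4 : ∀ j → j ≤ K → Level s4 j (rest (zone gh j)) (tl e) (from gh j)
   new4 j j≤K = level-keeps keeps4 (new3 j (s≤s j≤K))
   on-rest : ∀ qs → ps ≡ qs → Result
   on-rest [] ps≡ = let (s5 , ex , ru') = settle-root ρ 1 core4 (subst (λ z → Chain (tl e) z r) ps≡ (PathInv.chain inv')) (pop-settled new4 (levels-keep refl lvs3) inv' (λ _ → ≤-refl) ps≡)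
                         (+ˡ≤ _ (+ʳ≤ 1 (m≤n+m (ticks s4) K)) » budget4)
    in q' , s5 , run ex , ru' , drop-unit spend
   on-rest (_ ∷ _) ps≡ = let (k , 1≤k , k≤ , pend) = pop-pending new4 (levels-keep refl lvs3) ps≢
                             (s5 , ex , ru') = settle ρ 1 core4 ps≢ 1≤k k≤ pend (levels-keep refl lvs3) (cong rest (Fixing.Settled.z0 settled)) (Fixing.Settled.x0 settled) (Fixing.Settled.N0 settled) budget4
    in q' , s5 , run ex , ru' , drop-unit spend
    where ps≢ = cons≢[] ps≡

 search-step-spec : ∀ {rs r κ ρ q s} → Running rs r κ ρ 0 q s → Next rs r κ ρ q search-step s ⊎ Ends rs κ ρ search-step s
 search-step-spec {rs} {r} {κ} {ρ} {q} {s} ru = cases (≤-split i≤)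
  where
  open Running ru
  open Core core
  open View q
  s1 = runs degree-block s
  asked = outdeg-ask u U≡
  CC1 : reg s1 CC ≡ bit (i <ᵇ outdeg u)
  CC1 = cong₂ (λ a b → bit (a <ᵇ b)) I≡ (cong (fromMaybe 0) asked)
  ok-1 : oks degree-block s
  ok-1 = (tt , lit! , outdeg u , asked , outdeg<w u) , (tt , tt , tt) , tt
  q1 : Quiet 3 s s1
  q1 = runs-quiet {3} degree-block s refl
  up : Next rs r κ ρ q forward s1 → i < outdeg u → Next rs r κ ρ q search-step s
  up (q' , s' , ex , r' , d) i<d = q' , s' , (blk ok-1 ▸ ifT (λ z → bit≢0 (<ᵇ-true i<d) (sym CC1 · z)) ex) , r' , d
  off-test : i ≡ outdeg u → reg s1 CC ≡ 0
  off-test e = CC1 · cong bit (<ᵇ-false (=≥ e))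
  cases : i < outdeg u ⊎ i ≡ outdeg u → Next rs r κ ρ q search-step s ⊎ Ends rs κ ρ search-step s
  cases (inl i<d) = inl (up (step-forward ru s1 i<d q1 refl refl refl) i<d)
  cases (inr i≡) = path ps refl (PathInv.chain inv)
   where
   path : ∀ ps' → ps ≡ ps' → Chain u ps' r → Next rs r κ ρ q search-step s ⊎ Ends rs κ ρ search-step s
   path [] ps≡ _ = let (s' , ex , re , z) = finish-root (subst (λ d → Running rs r κ ρ 0 (view c es u d ps prog) s) i≡ ru) s1 q1 refl refl refl ps≡
    in inr (s' , (blk ok-1 ▸ ifF (off-test i≡) ex) , re , z)
   path (e ∷ ps') ps≡ (hd≡ , _) = let (q' , s' , ex , r' , d) = finish-child hd≡ (subst₂ (λ d p → Running rs r κ ρ 0 (view c es u d p prog) s) i≡ ps≡ ru) s1 q1 refl refl refl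
    in inl (q' , s' , (blk ok-1 ▸ ifF (off-test i≡) ex) , r' , (d » =≤ (cong₂ (λ d p → remaining (view c es u d p prog)) (sym i≡) (sym ps≡))))

 search-loop : ∀ f {rs r κ ρ q s} → remaining q ≤ f → Running rs r κ ρ 0 q s → Runs (loop skip RUN search-step) s (Resting rs κ ρ 0)
 search-loop f {rs} {r} {κ} {ρ} {q} {s} q≤f ru = Sum.[ onward f q≤f , end ] (search-step-spec ru)
  where
  running = λ z → 1+n≢0 (sym (Core.RUN≡ (Running.core ru)) · z)
  onward : ∀ f → remaining q ≤ f → Next rs r κ ρ q search-step s → Runs (loop skip RUN search-step) s (Resting rs κ ρ 0)
  onward zero q≤f (q' , s' , ex , ru' , d) = ⊥! (<⇒≱ d (q≤f » z≤n))
  onward (suc f) q≤f (q' , s' , ex , ru' , d) = let (s'' , ex' , re) = search-loop f (≤-pred (d » q≤f)) (running-tick ru') in s'' , again (blk tt) running ex ex' , re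
  end : Ends rs κ ρ search-step s → Runs (loop skip RUN search-step) s (Resting rs κ ρ 0)
  -- The final iteration ticks as well before the loop test fails; `Ends` has reserved this tick.
  end (s' , ex , re , z) = tick s' , again (blk tt) running ex (stop (blk tt) z) , resting-move {s = s'} {tick s'} refl refl refl (Resting.CNT≡ re) ≤-refl re

 start-block' : Block
 start-block' = mov RUN (lit 1) ∷ []

 empty-stored : ∀ s j → Stored s j []
 empty-stored s zero = tt
 empty-stored s (suc j) = tt

 module Planting (r : Fin n) (s0 : State R2) where

  record StartInv (J : ℕ) (s : State R2) : Set where
   field
    frame : Frame 8 s0 s
    pl≡ : pl s ≡ pl s0
    out≡ : out s ≡ out s0
    starts : ∀ j → j < J → lev s (xA + j) ≡ ν r
    words : ∀ a → (∀ j → j ≤ K → a ≢ xA + j) → lev s a ≡ lev s0 a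
    tick≡ : suc (ticks s) ≡ J + ticks s0
   kept = below frame

  start-quiet : ∀ {J s s'} → Quiet 8 s s' → ticks s' ≡ ticks s → StartInv J s → StartInv J s'
  start-quiet q t i = record { frame = λ x h → Quiet.frame q x h · frame x h; pl≡ = Quiet.pl≡ q · pl≡; out≡ = Quiet.out≡ q · out≡
   ; starts = λ j h → Quiet.lev≡ q ∙ (xA + j) · starts j h; words = λ a h → Quiet.lev≡ q ∙ a · words a h
   ; tick≡ = cong suc t · tick≡ }
    where open StartInv i

  here-spec : reg s0 RT ≡ ν r → ∀ J s → J < K → reg s LEV ≡ suc J → StartInv (suc J) s →
   Σ[ s' ∈ State R2 ] Exec (block here-block) s s' × reg s' LEV ≡ suc J × StartInv (suc (suc J)) (tick (runs next-block s'))
  here-spec RT≡ J s J<K L≡ i = s1 , blk (st-ok (cong (xA +_) L≡) (x<w J<K) (x<PB J<K) , tt) , L≡ , record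
   { frame = λ x h → runs-frame {8} (here-block ++ alu add LEV (var LEV) (lit 1) ∷ []) s refl x h · frame x h
   ; pl≡ = pl≡; out≡ = out≡; starts = λ j h → at j (≤-split (≤-pred h))
   ; words = λ a h → updℕ-≢ (lev s) (xA + reg s LEV) _ a (λ e → h (suc J) J<K (sym e · cong (xA +_) L≡)) · words a h
   ; tick≡ = cong suc tick≡ }
   where
   open StartInv i
   s1 = runs here-block s
   at : ∀ j → j < suc J ⊎ j ≡ suc J → updℕ (lev s) (xA + reg s LEV) (reg s RT) (xA + j) ≡ ν r
   at j (inl j<) = updℕ-≢ (lev s) (xA + reg s LEV) _ (xA + j) (λ e → x-inj (<⇒≢ j<) (sym e · cong (xA +_) L≡)) · starts j j<
   at .(suc J) (inr refl) = cong (λ l → updℕ (lev s) (xA + l) (reg s RT) (xA + suc J)) L≡ · updℕ-≡ (lev s) (xA + suc J) _ · below {8} {reg s0} {reg s} frame RT · RT≡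

 module _ {rs κ ρ s} {r : Fin n} (re : Resting (r ∷ rs) κ ((K + 1) + ρ) 0 s) (RT≡ : reg s RT ≡ ν r) where
  open Resting re

  new-tree-spec : lookup c r ≡ white → Runs new-tree s (Resting rs κ ρ 1)
  new-tree-spec wh = let (s2 , ex2 , i) = levels-spec (λ {J} {s} i → start-quiet {J} {s} (runs-quiet {8} test-block s refl) refl i) (here-spec RT≡) s1 init in after-levels s2 ex2 i
   where
   Result = Runs new-tree s (Resting rs κ ρ 1)
   c' : Vec Colour n
   c' = c [ r ]≔ gray
   s1 = runs plant-block s
   open Planting r s1
   open Levelwise (block here-block) StartInv
   f1 : ℕ → ℕ → Bool
   f1 = wrP (pl s) nwP (reg s RT) 1 1
   high : ∀ r → 3 ≤ r → ∀ o → pl s1 r o ≡ pl s r o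
   high r 3≤r o = wrP-plane f1 grP (reg s RT) 1 1 r o (<⇒≢ (s≤s z<s » 3≤r)) · wrP-plane (pl s) nwP (reg s RT) 1 1 r o (<⇒≢ (z<s » 3≤r))
   hues1 : Hues c' s1
   hues1 = hues (λ x → wrP-plane f1 grP (reg s RT) 1 1 nwP (ν x) (λ ()) · hue-upd {c} (pl s) nwP nonWhite r gray true RT≡ (Hues.nw hues-ok) refl x)
    (hue-upd {c} f1 grP isGray r gray true RT≡ (λ x → wrP-plane (pl s) nwP (reg s RT) 1 1 grP (ν x) (λ ()) · Hues.gr hues-ok x) refl)
   xA≡0 = +0 xA
   ok-1 : oks plant-block s
   ok-1 = tt , mark-ok z≤n (s≤s z<s) RT≡ , mark-ok z<s (s≤s z<s) RT≡ , tt , lit! , lit! , (≡< (sym xA≡0) (x<w {0} z≤n) , tt , ≡< (sym xA≡0) (x<PB {0} z≤n) , fits) , tt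
   init : StartInv 1 (runs first-level s1)
   init = record { frame = runs-frame {8} first-level s1 refl; pl≡ = refl; out≡ = refl
    ; starts = λ { zero _ → cong (updℕ (lev s) xA (reg s RT)) xA≡0 · updℕ-≡ (lev s) xA _ · RT≡; (suc j) (s≤s ()) }; words = λ _ _ → refl; tick≡ = refl }
   trace1 : Trace kind G ⟨ rs , r ∷ [] , c' , es ⟩ (out s1)
   trace1 = trace-step kind G trace (newRoot wh) (cong (λ z → out s ++ turnsGray z ∷ []) RT≡)
   after-levels : ∀ s2 → Exec (levels (block here-block)) s1 s2 → StartInv (suc K) s2 → Result
   after-levels s2 ex2 i = let (s3 , ex3 , b) = back-edges-spec {rs} {[]} {c'} {es} {prog} r 0 s2 (fr U · RT≡) (fr PAR) hues2 (lookup-≡ r c gray) (fair kind G {c} r closed wh)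
                                (before-root kind G r explored wh) (subst (Trace kind G _) (sym (StartInv.out≡ i)) trace1)
    in after-back s3 ex3 b
    where
    fr = StartInv.kept i
    hues2 = hues-pl (StartInv.pl≡ i) hues1
    word : ∀ a → (∀ j → j ≤ K → a ≢ xA + j) → lev s2 a ≡ lev s a
    word a h = StartInv.words i a h · updℕ-≢ (lev s) xA (reg s RT) a (λ e → h 0 z≤n (sym e · sym xA≡0))
    after-back : ∀ s3 → Exec (back-edges kind) s2 s3 → Backed rs [] c' prog r s2 s3 → Result
    -- The extra unit in `suc ρ` is carried through the search of this tree to pay for the tick of
    -- the root loop.
    after-back s3 ex3 b = let (s5 , ex5 , re') = search-loop (remaining q') {ρ = suc ρ} ≤-refl running4 in
     s5 , (blk ok-1 ▸ ex2 ▸ ex3 ▸ blk (lit! , tt) ▸ ex5) , resting-move {s = s5} {s5} refl refl refl (Resting.CNT≡ re') (=≥ (+-suc (ticks s5) ρ)) re'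
     where
     s4 = runs start-block' s3
     fr3 = Backed.kept b
     q' : View
     q' = view c' (Backed.es' b) r 0 [] prog
     lev4 : ∀ a → lev s4 a ≡ lev s2 a
     lev4 a = Backed.lev≡ b ∙ a
     inv = path-root r no-gray
     core4 : Core rs r κ q' s4
     core4 = record { inv = inv ; hues-ok = hues-pl (Backed.pl≡ b) hues2 ; RT≡ = fr3 RT · fr RT · RT≡; U≡ = fr3 U · fr U · RT≡; I≡ = fr3 I · fr I
      ; RUN≡ = refl; CNT≡ = fr3 CNT · fr CNT · CNT≡; i≤ = z≤n; seen = λ _ (); closed = closed-gray (net kind G) {c} r closed
      ; explored = Backed.explored b; prog-u = prog-white r wh; prog-ps = []; prog-white = λ v wv → prog-white v (white-upd⁻ c r v gray≢white wv); trace = Backed.trace b }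
     gh : Ghost
     gh = ghost (λ _ → []) (λ _ → r) (λ _ → []) N
     running4 : Running rs r κ (suc ρ) 0 q' s4
     running4 = record { core = core4; gh = gh ; settled = record { z0 = refl; x0 = refl; N0 = Resting.N0 re ; zones = record
        { lvl = λ j j≤K → level refl (lev4 (xA + j) · StartInv.starts i j j≤K)
         (λ v → (Backed.pl≡ b · StartInv.pl≡ i) ∙ (inP + j) ∙ ν v · high (inP + j) (m≤m+n 3 j) (ν v) · blank j (≤-pred j≤K) v)
         (empty-stored s4 j)
         (λ h → lev4 (spA + j) · word (spA + j) (λ i _ → sp≢x (≤-pred j≤K)) · sp≡ j (≤-pred j≤K) h , z≤n)
        ; nest = λ _ _ → refl }
       ; full = λ h → ⊥! (h refl)
       ; paid = λ j j<K → =≤ (cong (credit * N (suc j) +_) (0∸n≡0 ceiling) · +0 _) » Resting.paid re j j<K » +ˡ≤ _ (m≤m+n _ (weight (suc j) r) » tolls-gray c r wh (suc j))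
       ; lvs = record { lengths = λ {j} j≤K → lev4 (bA + j) · word (bA + j) (λ i i≤K e → x≢b i≤K (sym e)) · lengths lvs j≤K } }
      ; budget = +ˡ≤ _ (Backed.tick≤ b) » =≤ (cong (λ z → outdeg r + z + (remaining q' + suc ρ)) (suc-injective (StartInv.tick≡ i)) ·
       arith K (outdeg r) (ticks s) (undiscovered c') unit ρ · cong (λ z → ticks s + (z + ((K + 1) + ρ))) (sym (undiscovered-gray c r wh))) » budget }
      where
      arith : ∀ K D t W b ρ → D + (K + t) + ((W + b * (D + 1 + 0)) + suc ρ) ≡ t + ((W + (b * (D + 1) + D)) + ((K + 1) + ρ))
      arith = ring

 -- The `K + 1` ticks per root pay for writing the start vertices of the levels and for the
 -- iteration of the root loop.
 root-step-spec : ∀ {r rs κ ρ s} → suc κ ≤ n → toℕ r ≡ n ∸ suc κ → Resting (r ∷ rs) (suc κ) ((K + 1) + ρ) 0 s → Runs root-step s (Resting rs κ ρ 1)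
 root-step-spec {r} {rs} {κ} {ρ} {s} κ<n r≡ re = colour (nonWhite (lookup c r)) refl
  where
  open Resting re
  s1 = runs root-block s
  RT1 : reg s1 RT ≡ ν r
  RT1 = cong (λ z → n ∸ z + 1) CNT≡ · +-comm _ 1 · cong suc (sym r≡)
  CC1 : reg s1 CC ≡ bit (nonWhite (lookup c r))
  CC1 = cong (λ o → num (pl s nwP) o 1) RT1 · num-1 (pl s nwP) (ν r) · cong bit (Hues.nw hues-ok r)
  ok-1 : oks root-block s
  ok-1 = tt , (tt , tt , ≡≤ CNT≡ κ<n) , (tt , lit! , ≡< RT1 (ν<w r)) , test-ok z≤n RT1 , tt
  Result = Runs root-step s (Resting rs κ ρ 1)
  lower : ∀ {s2} → Exec (ifnz CC skip new-tree) s1 s2 → Resting rs (suc κ) ρ 1 s2 → Result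
  lower {s2} ex re2 = runs last-block s2 , (blk ok-1 ▸ ex ▸ blk ((tt , lit! , subst (1 ≤_) (sym (Resting.CNT≡ re2)) z<s) , tt)) ,
   resting-move {s = s2} {runs last-block s2} refl refl refl (cong (_∸ 1) (Resting.CNT≡ re2)) ≤-refl re2
  re1 : Resting (r ∷ rs) (suc κ) ((K + 1) + ρ) 0 s1
  re1 = resting-move {s = s} {s1} refl refl refl CNT≡ ≤-refl re
  colour : ∀ b → nonWhite (lookup c r) ≡ b → Result
  colour true h = lower (ifT (λ z → bit≢0 h (sym CC1 · z)) (blk tt)) (record
   { c = c; es = es; prog = prog; N = N; N0 = N0; hues-ok = hues (Hues.nw hues-ok) (Hues.gr hues-ok); CNT≡ = CNT≡; no-gray = no-gray; closed = closed; explored = explored; prog-white = prog-white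
   ; trace = trace-step kind G trace (skipRoot (nonWhite-true⇒≢ h)) (sym (++-identityʳ (out s))); lvs = levels-keep refl lvs; blank = blank; sp≡ = sp≡; paid = paid
   ; budget = m≤m+n _ K » =≤ (arith K (ticks s) (undiscovered c) ρ) » budget })
    where
    arith : ∀ K t W ρ → 1 + t + (W + ρ) + K ≡ t + (W + ((K + 1) + ρ))
    arith = ring
  colour false h = let (s2 , ex , re2) = new-tree-spec re1 RT1 (nonWhite-false⇒≡ h) in lower (ifF (CC1 · cong bit h) ex) re2

 root-loop : ∀ κ {s} → κ ≤ n → Resting (drop (n ∸ κ) (allFin n)) κ ((K + 1) * κ) 0 s → Runs (loop skip CNT root-step) s (Resting [] 0 0 0)
 root-loop zero {s} κ≤n re = s , stop (blk tt) (Resting.CNT≡ re) , subst₂ (λ rs ρ → Resting rs 0 ρ 0 s) (drop-allFin n) (*-zeroʳ (K + 1)) re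
 root-loop (suc κ) {s} κ<n re =
  let (s1 , ex1 , re1) = root-step-spec κ<n (toℕ-fromℕ< i<n) (subst₂ (λ rs ρ → Resting rs (suc κ) ρ 0 s) (drop-tabulate (λ i → i) (n ∸ suc κ) i<n) (*-suc (K + 1) κ) re)
      (s' , ex' , re') = root-loop κ (<⇒≤ κ<n) (resting-move {s = s1} {tick s1} refl refl refl (Resting.CNT≡ re1) ≤-refl (subst (λ i → Resting (drop i (allFin n)) κ ((K + 1) * κ) 1 s1) (sym (∸-suc κ<n)) re1))
  in s' , again (blk tt) (≢0 (Resting.CNT≡ re)) ex1 ex' , re'
  where
  i<n : n ∸ suc κ < n
  i<n = ∸-monoʳ-< z<s κ<n

 -- Initialization and the complete search

 length-start : Block
 length-start = mov P1 (lit 1) ∷ []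

 record Lengthed (x : ℕ) (s s' : State R2) : Set where
  field
   still : Quiet 9 s s'
   P1≡ : reg s' P1 ≡ bl x
   tick≤ : ticks s' ≤ ⌊log₂ x ⌋ + ticks s

 shift-zero : ∀ x b → x < 2 ^ b → x /2^ b ≡ 0
 shift-zero x b h = m<n⇒m/n≡0 {{m^n≢0 2 b}} h

 bit-length-spec : ∀ x s → reg s P2 ≡ x → bl x ≤ n → Runs bit-length s (Lengthed x s)
 bit-length-spec x s P2≡ x≤ = let (s' , ex , r) = go ⌊log₂ x ⌋ 1 s1 (+-comm _ 1) z<s refl P2≡ (runs-quiet {9} length-start s refl) refl in s' , (blk (lit! , tt) ▸ ex) , r
  where
  s1 = runs length-start s
  go : ∀ m b t → m + b ≡ bl x → 1 ≤ b → reg t P1 ≡ b → reg t P2 ≡ x → Quiet 9 s t → suc (ticks t) ≡ b + ticks s → Runs (loop (block length-test) P3 (block length-next)) t (Lengthed x s)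
  go zero b t refl 1≤b p1 p2 q tk = runs length-test t , stop (blk ((tt , tt , tt) , tt)) ((cong₂ _/2^_ p2 p1) · shift-zero x (bl x) (x<2^bl x)) ,
   record { still = quiet-trans q (runs-quiet {9} length-test t refl); P1≡ = p1; tick≤ = =≤ (suc-injective tk) }
  go (suc m) b t m+b 1≤b p1 p2 q tk =
   let (s' , ex , r) = go m (suc b) (tick (runs length-next (runs length-test t))) (+-suc m b · m+b) z<s (cong (_+ 1) p1 · +-comm b 1) p2
        (quiet-trans q (quiet-tick (runs-quiet {9} (length-test ++ length-next) t refl))) (cong suc tk)
   in s' , again (blk ((tt , tt , tt) , tt)) (λ z → <⇒≱ b<bl (bl-≤ b x 1≤b (m/n≡0⇒m<n {{m^n≢0 2 b}} (sym (cong₂ _/2^_ p2 p1) · z))))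
    (blk ((tt , lit! , n<w (=≤ (cong (_+ 1) p1 · +-comm b 1) » b<bl » x≤)) , tt)) ex , r
   where
   b<bl : b < bl x
   b<bl = s≤s (m≤n+m b m) » =≤ m+b

 L≤n : L ≤ n
 L≤n = m≤n+m L K » m≤m+n (K + L) 4 » K+L+4≤n

 record Measured (j : ℕ) (s : State R2) : Set where
  field
   LEV≡ : reg s LEV ≡ j
   P1≡ : reg s P1 ≡ bb j
   lengths : ∀ i → j ≤ i → i ≤ K → lev s (bA + i) ≡ bb i
   out≡ : out s ≡ []
   tick≤ : ticks s + j * suc L ≤ L + K * suc L

 log≤L : ∀ x → bl x ≤ L → ⌊log₂ x ⌋ ≤ L
 log≤L x h = n≤1+n _ » h

 set-length : ∀ {s j} i → lev s (bA + reg s LEV) ≡ bb (reg s LEV) → reg s LEV ≡ j → i ≡ j → lev s (bA + i) ≡ bb i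
 set-length i h refl refl = h

 init-lengths-spec : ∀ s → out s ≡ [] → ticks s ≡ 0 → Runs init-lengths s (Measured 0)
 init-lengths-spec s o t = let (s2 , ex , r) = bit-length-spec n s1 refl L≤n in after s2 ex r
  where
  Result = Runs init-lengths s (Measured 0)
  s1 = runs measure-start s
  store-top : Block
  store-top = ST (off bA LEV) (var P1) ∷ []
  bbK≡ : bb K ≡ bl n
  bbK≡ = cong (tower n) (n∸n≡0 K)
  go : ∀ j t → j ≤ K → Measured j t → Runs (loop skip LEV (block (mov P2 (var P1) ∷ []) ⨾ bit-length ⨾ block measure-next)) t (Measured 0)
  go zero t j≤K m = t , stop (blk tt) (Measured.LEV≡ m) , m
  go (suc j) t j<K m = let (t-2 , ex , r) = bit-length-spec (bb (suc j)) t-1 (Measured.P1≡ m) (bl≤L » L≤n) in next t-2 ex r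
   where
   t-1 = runs (mov P2 (var P1) ∷ []) t
   bl≡ : bl (bb (suc j)) ≡ bb j
   bl≡ = sym (cong (tower n) (∸-suc j<K))
   bl≤L = =≤ bl≡ » bb≤L j
   next : ∀ t-2 → Exec bit-length t-1 t-2 → Lengthed (bb (suc j)) t-1 t-2 → Runs (loop skip LEV (block (mov P2 (var P1) ∷ []) ⨾ bit-length ⨾ block measure-next)) t (Measured 0)
   next t-2 ex r = let (s' , ex' , m') = go j (tick t-3) (<⇒≤ j<K) m3 in
    s' , again (blk tt) (≢0 (Measured.LEV≡ m)) (blk (tt , tt) ▸ ex ▸ blk ok-2) ex' , m'
    where
    t-3 = runs measure-next t-2
    L2 = Quiet.kept (Lengthed.still r) LEV · Measured.LEV≡ m
    L3 : reg t-2 LEV ∸ 1 ≡ j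
    L3 = cong (_∸ 1) L2
    ok-2 : oks measure-next t-2
    ok-2 = (tt , lit! , subst (1 ≤_) (sym L2) z<s) , st-ok (cong (bA +_) L3) (b<w (<⇒≤ j<K)) (b<PB (<⇒≤ j<K)) , tt
    m3 : Measured j (tick t-3)
    m3 = record { LEV≡ = L3; P1≡ = Lengthed.P1≡ r · bl≡; lengths = λ i j≤i i≤K → at i i≤K (≤-split j≤i) ; out≡ = Quiet.out≡ (Lengthed.still r) · Measured.out≡ m
     ; tick≤ = =≤ (e (ticks t-2) L j) » +ˡ≤ _ (Lengthed.tick≤ r » +ˡ≤ _ (log≤L (bb (suc j)) bl≤L)) » =≤ (e' L (ticks t) j) » Measured.tick≤ m }
      where
      e : ∀ t L j → suc t + j * suc L ≡ t + (1 + j * suc L)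
      e = ring
      e' : ∀ L t j → L + t + (1 + j * suc L) ≡ t + suc j * suc L
      e' = ring
      at : ∀ i → i ≤ K → j < i ⊎ j ≡ i → updℕ (lev t-2) (bA + (reg t-2 LEV ∸ 1)) (reg t-2 P1) (bA + i) ≡ bb i
      at i i≤K (inl j<i) = updℕ-≢ (lev t-2) (bA + (reg t-2 LEV ∸ 1)) _ (bA + i) (λ e → <⇒≢ j<i (sym L3 · +-cancelˡ-≡ bA _ _ e)) ·
       Quiet.lev≡ (Lengthed.still r) ∙ (bA + i) · Measured.lengths m i j<i i≤K
      at .j i≤K (inr refl) = cong (λ z → updℕ (lev t-2) (bA + z) (reg t-2 P1) (bA + j)) L3 · updℕ-≡ (lev t-2) (bA + j) _ · Lengthed.P1≡ r · bl≡
  after : ∀ s2 → Exec bit-length s1 s2 → Lengthed n s1 s2 → Result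
  after s2 ex r = let (s' , ex' , m) = go K (runs store-top s2) ≤-refl m3 in
   s' , (blk (tt , K<w , tt) ▸ ex ▸ blk (st-ok (cong (bA +_) L2) (b<w ≤-refl) (b<PB ≤-refl) , tt) ▸ ex') , m
   where
   L2 = Quiet.kept (Lengthed.still r) LEV
   m3 : Measured K (runs store-top s2)
   m3 = record { LEV≡ = L2; P1≡ = Lengthed.P1≡ r · sym bbK≡ ; lengths = λ i K≤i i≤K → subst (λ i → updℕ (lev s2) (bA + reg s2 LEV) (reg s2 P1) (bA + i) ≡ bb i) (≤-antisym K≤i i≤K)
     (cong (λ z → updℕ (lev s2) (bA + z) (reg s2 P1) (bA + K)) L2 · updℕ-≡ (lev s2) (bA + K) _ · Lengthed.P1≡ r · sym bbK≡)
    ; out≡ = Quiet.out≡ (Lengthed.still r) · o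
    ; tick≤ = +ˡ≤ _ (Lengthed.tick≤ r » =≤ (cong (⌊log₂ n ⌋ +_) t · +0 _) » log≤L n ≤-refl) }

 module _ (t-0 : ℕ) where

  record Blank (J : ℕ) (s : State R2) : Set where
   field
    lvs : Levels s
    nw0 : ∀ (v : Fin n) → pl s nwP (ν v) ≡ false
    gr0 : ∀ (v : Fin n) → pl s grP (ν v) ≡ false
    blank : ∀ j → j < J → Marks (pl s (inP + j)) []
    sp0 : ∀ j → j < J → j ≢ 0 → lev s (spA + j) ≡ 0
    out≡ : out s ≡ []
    tick≡ : ticks s + (n + 1) ≡ t-0 + J * (n + 1)

  blank-quiet : ∀ {k J s s'} → Quiet k s s' → ticks s' ≡ ticks s → Blank J s → Blank J s'
  blank-quiet q t b = record { lvs = levels-quiet q lvs; nw0 = λ v → Quiet.pl≡ q ∙ nwP ∙ ν v · nw0 v; gr0 = λ v → Quiet.pl≡ q ∙ grP ∙ ν v · gr0 v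
   ; blank = λ j h v → Quiet.pl≡ q ∙ (inP + j) ∙ ν v · blank j h v; sp0 = λ j h h' → Quiet.lev≡ q ∙ (spA + j) · sp0 j h h'
   ; out≡ = Quiet.out≡ q · out≡; tick≡ = cong (_+ (n + 1)) t · tick≡ }
    where open Blank b

  clear-level-spec : ∀ J s → J < K → reg s LEV ≡ suc J → Blank (suc J) s → Σ[ s' ∈ State R2 ] Exec clear-level s s' × reg s' LEV ≡ suc J × Blank (suc (suc J)) (tick (runs next-block s'))
  clear-level-spec J s J<K L≡ b =
   let (s1 , ex , r) = clear-spec (off inP LEV) (inP + suc J) s (in<NR J<K)
        (λ t f → subst (λ z → inP + z < 2 ^ w) (sym (below {32} {reg s} {reg t} f LEV · L≡)) (in<w J<K) , cong (inP +_) (below {32} {reg s} {reg t} f LEV · L≡))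
   in after s1 ex r
   where
   open Blank b
   after : ∀ s1 → Exec (clear (off inP LEV)) s s1 → Cleared (inP + suc J) s s1 →
    Σ[ s' ∈ State R2 ] Exec clear-level s s' × reg s' LEV ≡ suc J × Blank (suc (suc J)) (tick (runs next-block s'))
   after s1 ex r = runs zero-block s1 , (ex ▸ blk ((≡< L1 (lin 0 0 z≤n z≤n J<K) , lit! , ≡< L1 (sp<PB J<K) , fits) , tt)) , L1 , record
    { lvs = record { lengths = λ {i} i≤K → updℕ-≢ (lev s1) (reg s1 LEV) 0 (bA + i) (λ e → sp≢b J<K (sym L1 · e)) · Cleared.lev≡ r ∙ (bA + i) · lengths lvs i≤K }
    ; nw0 = λ v → Cleared.others r nwP (ν v) (λ ()) · nw0 v; gr0 = λ v → Cleared.others r grP (ν v) (λ ()) · gr0 v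
    ; blank = λ j h → marks-at j (≤-split (≤-pred h))
    ; sp0 = λ j h h' → sp-at j h' (≤-split (≤-pred h))
    ; out≡ = Cleared.out≡ r · out≡
    ; tick≡ = cong (λ z → suc z + (n + 1)) (Cleared.ticks≡ r) · e n (ticks s) · cong ((n + 1) +_) tick≡ · x+yz≡y+xz (n + 1) t-0 (suc J * (n + 1)) }
    where
    zero-block = ST (off spA LEV) (lit 0) ∷ []
    L1 = Cleared.kept r LEV · L≡
    e : ∀ n t → suc (n + t) + (n + 1) ≡ (n + 1) + (t + (n + 1))
    e = ring
    marks-at : ∀ j → j < suc J ⊎ j ≡ suc J → Marks (pl s1 (inP + j)) []
    marks-at j (inl j<) v = Cleared.others r (inP + j) (ν v) (in-inj (<⇒≢ j<)) · blank j j< v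
    marks-at .(suc J) (inr refl) v = Cleared.cleared r v
    sp-at : ∀ j → j ≢ 0 → j < suc J ⊎ j ≡ suc J → updℕ (lev s1) (reg s1 LEV) 0 j ≡ 0
    sp-at j h (inl j<) = updℕ-≢ (lev s1) (reg s1 LEV) 0 j (λ e → <⇒≢ j< (sym e · L1)) · Cleared.lev≡ r ∙ j · sp0 j j< h
    sp-at .(suc J) h (inr refl) = cong (λ z → updℕ (lev s1) z 0 (suc J)) L1 · updℕ-≡ (lev s1) (suc J) 0

 white-all : ∀ (v : Fin n) → lookup (Vec.replicate n white) v ≡ white
 white-all v = lookup-replicate v white

 record Searched (s' : State R2) : Set where
  field
   τ : List (Event (Fin n))
   c : Vec Colour n
   N : ℕ → ℕ
   dfs : IsDFS kind G τ
   out≡ : out s' ≡ map (mapEvent ν) τ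
   N0 : N 0 ≡ 0
   paid : ∀ j → j < K → credit * N (suc j) ≤ tolls c (suc j) + credit * N j
   tick≤ : ticks s' ≤ B0 + total K N

 explored-none : ∀ kind {n} (G : Graph kind n) → Explored kind G (Vec.replicate n white) [] (λ _ → 0)
 explored-none dir G p x = (λ ()) , λ k ()
 explored-none undir G a b ab = (λ ()) , λ h → ⊥! (h (lookup-replicate a white))

 main-spec : ∀ s → out s ≡ [] → ticks s ≡ 0 → Runs main s Searched
 main-spec s o t = let (s1 , ex , m) = init-lengths-spec s o t in after-lengths s1 ex m
  where
  Result = Runs main s Searched
  after-lengths : ∀ s1 → Exec init-lengths s s1 → Measured 0 s1 → Result
  after-lengths s1 ex1 m = let (s2 , ex , r) = clear-spec (lit nwP) nwP s1 (plane<NR z≤n) (λ _ _ → lit! , refl) in after2 s2 ex r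
   where
   after2 : ∀ s2 → Exec (clear (lit nwP)) s1 s2 → Cleared nwP s1 s2 → Result
   after2 s2 ex2 r2 = let (s3 , ex , r) = clear-spec (lit grP) grP s2 (plane<NR z<s) (λ _ _ → lit! , refl) in after3 s3 ex r
    where
    after3 : ∀ s3 → Exec (clear (lit grP)) s2 s3 → Cleared grP s2 s3 → Result
    after3 s3 ex3 r3 = let (s4 , ex , r) = clear-spec (lit inP) inP s3 (plane<NR ≤-refl) (λ _ _ → lit! , refl) in after4 s4 ex r
     where
     after4 : ∀ s4 → Exec (clear (lit inP)) s3 s4 → Cleared inP s3 s4 → Result
     after4 s4 ex4 r4 = let (s5 , ex , b) = levels-spec (λ {J} {s} b → blank-quiet t-0 (runs-quiet {8} test-block s refl) refl b) (clear-level-spec t-0) s4 init in after5 s5 ex b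
      where
      t-0 = ticks s4
      open Levelwise clear-level (Blank t-0)
      init : Blank t-0 1 (runs first-level s4)
      init = record { lvs = record { lengths = λ {i} i≤K → (Cleared.lev≡ r4 · Cleared.lev≡ r3 · Cleared.lev≡ r2) ∙ (bA + i) · Measured.lengths m i z≤n i≤K }
       ; nw0 = λ v → Cleared.others r4 nwP (ν v) (λ ()) · Cleared.others r3 nwP (ν v) (λ ()) · Cleared.cleared r2 v
       ; gr0 = λ v → Cleared.others r4 grP (ν v) (λ ()) · Cleared.cleared r3 v
       ; blank = λ { zero _ v → Cleared.cleared r4 v; (suc j) (s≤s ()) }; sp0 = λ { zero _ h → ⊥! (h refl); (suc j) (s≤s ()) _ }
       ; out≡ = Cleared.out≡ r4 · Cleared.out≡ r3 · Cleared.out≡ r2 · Measured.out≡ m; tick≡ = cong (t-0 +_) (sym (*-identityˡ (n + 1))) }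
      after5 : ∀ s5 → Exec (levels clear-level) s4 s5 → Blank t-0 (suc K) s5 → Result
      after5 s5 ex5 b = let (s7 , ex , re) = root-loop n ≤-refl resting in after7 s7 ex re
       where
       s6 = runs (getN CNT ∷ []) s5
       ticks5 : ticks s5 ≤ init-ticks
       ticks5 = +-cancelʳ-≤ (n + 1) _ _ (=≤ (Blank.tick≡ b · cong (_+ suc K * (n + 1)) (Cleared.ticks≡ r4 · cong (n +_) (Cleared.ticks≡ r3 · cong (n +_) (Cleared.ticks≡ r2)))) »
        =≤ (e n (ticks s1) K) » +ˡ≤ _ (m≤m+n (ticks s1) 0 » Measured.tick≤ m) » =≤ (e' (L + K * suc L) n K))
        where
        e : ∀ n t K → n + (n + (n + t)) + suc K * (n + 1) ≡ t + (3 * n + (K * (n + 1) + (n + 1)))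
        e = ring
        e' : ∀ a n K → a + (3 * n + (K * (n + 1) + (n + 1))) ≡ a + 3 * n + K * (n + 1) + (n + 1)
        e' = ring
       resting : Resting (drop (n ∸ n) (allFin n)) n ((K + 1) * n) 0 s6
       resting = subst (λ i → Resting (drop i (allFin n)) n ((K + 1) * n) 0 s6) (sym (n∸n≡0 n)) record { c = Vec.replicate n white; es = []; prog = λ _ → 0; N = λ _ → 0; N0 = refl
        ; hues-ok = hues (λ v → Blank.nw0 b v · sym (cong nonWhite (white-all v))) (λ v → Blank.gr0 b v · sym (cong isGray (white-all v)))
        ; CNT≡ = refl; no-gray = λ v h → gray≢white (sym h · white-all v); closed = λ v h → ⊥! (black≢white (sym h · white-all v))
        ; explored = explored-none kind G; prog-white = λ _ _ → refl; trace = [] , Blank.out≡ b , (λ comp → comp)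
        ; lvs = levels-keep refl (Blank.lvs b); blank = λ j j≤K → Blank.blank b j (s≤s j≤K); sp≡ = λ j j≤K → Blank.sp0 b j (s≤s j≤K)
        ; paid = λ j j<K → =≤ (*-zeroʳ credit) » z≤n
        ; budget = +≤+ ticks5 (+ˡ≤ _ (=≤ (sumF-cong (λ v → cong (λ h → worth h v) (white-all v))))) » m≤m+n B0 _ }
       after7 : ∀ s7 → Exec (loop skip CNT root-step) s6 s7 → Resting [] 0 0 0 s7 → Result
       after7 s7 ex7 re = s7 , (ex1 ▸ ex2 ▸ ex3 ▸ ex4 ▸ ex5 ▸ blk (tt , tt) ▸ ex7) , record
        { τ = τ ++ []; c = Resting.c re; N = Resting.N re; dfs = allFin n , ↭-refl , snd (snd (Resting.trace re)) CompletesWith.done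
        ; out≡ = fst (snd (Resting.trace re)) · cong (map (mapEvent ν)) (sym (++-identityʳ τ))
        ; N0 = Resting.N0 re; paid = Resting.paid re; tick≤ = m≤m+n _ _ » Resting.budget re }
        where
        τ = fst (Resting.trace re)

 -- Running time

 D : ℕ
 D = sumF outdeg

 n≤8credit : n ≤ 8 * credit
 n≤8credit = +-cancelʳ-≤ (8 * L) n _ (begin
  n + 8 * L ≡⟨ cong (_+ 8 * L) (quot+rem n 4 z<s) ⟩
  quarter * 4 + mod n 4 + 8 * L ≤⟨ +ˡ≤ (8 * L) (+ʳ≤ (quarter * 4) (≤-pred (remainder-< n 4 z<s))) ⟩
  quarter * 4 + 3 + 8 * L ≤⟨ m≤m+n _ (4 * L + 9) ⟩
  quarter * 4 + 3 + 8 * L + (4 * L + 9) ≡⟨ e1 quarter L ⟩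
  4 * quarter + 4 * (3 * L + 3) ≤⟨ +ʳ≤ (4 * quarter) (*ʳ≤ 4 quarter>L) ⟩
  4 * quarter + 4 * quarter ≡⟨ e2 quarter ⟩
  8 * quarter ≤⟨ *ʳ≤ 8 (m≤n+m∸n quarter L) ⟩
  8 * (L + credit) ≡⟨ e3 L credit ⟩
  8 * credit + 8 * L ∎)
  where
  open ≤-Reasoning
  e1 : ∀ q L → q * 4 + 3 + 8 * L + (4 * L + 9) ≡ 4 * q + 4 * (3 * L + 3)
  e1 = ring
  e2 : ∀ q → 4 * q + 4 * q ≡ 8 * q
  e2 = ring
  e3 : ∀ L c → 8 * (L + c) ≡ 8 * c + 8 * L
  e3 = ring

 toll≤ : ∀ j h v → toll j h v ≤ 2 * weight j v
 toll≤ j white v = z≤n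
 toll≤ j gray v = m≤m+n _ _
 toll≤ j black v = ≤-refl

 tolls≤ : ∀ c j → tolls c j ≤ 2 * sumF (weight j)
 tolls≤ c j = sumF-mono (λ v → toll≤ j (lookup c v) v) » =≤ (sumF-* 2 (weight j))

 weights≤D : ∀ j → sumF (weight j) ≤ D
 weights≤D j with j ≡ᵇ K
 ... | true = sumF-mono (λ v → m⊓n≤n (bb j) (indeg v)) » sum-indeg≤ (net kind G)
 ... | false = sumF-mono (λ v → m⊓n≤n (bb j) (outdeg v))

 weights≤bb : ∀ j → sumF (weight j) ≤ n * bb j
 weights≤bb j = sumF-mono {n} {weight j} {λ _ → bb j} (λ v → m⊓n≤m (bb j) _) » =≤ (sumF-const n (bb j))

 bb-suc : ∀ j → j < K → bb j ≡ bl (bb (suc j))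
 bb-suc j j<K = cong (tower n) (∸-suc j<K)

 bb-mono : ∀ j → j < K → bb j ≤ bb (suc j)
 bb-mono j j<K = =≤ (cong (tower n) (∸-suc j<K)) » tower-suc≤ n (K ∸ suc j)

 module _ {s : State R2} (r : Searched s) where
  open Searched r

  2D+2jD : ∀ j D → 2 * D + 2 * (j * D) ≡ 2 * (suc j * D)
  2D+2jD = ring
  -- Unrolls `Paid` down to level 0, which is never refilled. The 2 stands for one push and one pop
  -- of every vertex, the factor `j` for the cascades. This bound by degrees serves the linear part
  -- of the walks, `refills-bb` the scans.
  refills-D : ∀ j → j ≤ K → credit * N j ≤ 2 * (j * D)
  refills-D zero _ = =≤ (cong (credit *_) N0 · *-zeroʳ credit) » z≤n
  refills-D (suc j) j<K = paid j j<K » +≤+ (tolls≤ c (suc j) » *ʳ≤ 2 (weights≤D (suc j))) (refills-D j (<⇒≤ j<K)) » =≤ (2D+2jD j D)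

  refills-bb : ∀ j → j ≤ K → credit * N j ≤ 2 * (j * (n * bb j))
  refills-bb zero _ = =≤ (cong (credit *_) N0 · *-zeroʳ credit) » z≤n
  refills-bb (suc j) j<K = paid j j<K » +≤+ (tolls≤ c (suc j) » *ʳ≤ 2 (weights≤bb (suc j))) (refills-bb j (<⇒≤ j<K) » *ʳ≤ 2 (*ʳ≤ j (*ʳ≤ n (bb-mono j j<K)))) » =≤ (2D+2jD j (n * bb (suc j)))

  refills≤ : ∀ j → j ≤ K → N j ≤ 16 * (j * bb j)
  refills≤ j j≤K = *-cancelˡ-≤ n {{>-nonZero n≥1}} (begin
   n * N j ≤⟨ *ˡ≤ (N j) n≤8credit ⟩
   8 * credit * N j ≡⟨ *-assoc 8 credit (N j) ⟩
   8 * (credit * N j) ≤⟨ *ʳ≤ 8 (refills-bb j j≤K) ⟩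
   8 * (2 * (j * (n * bb j))) ≡⟨ e n j (bb j) ⟩
   n * (16 * (j * bb j)) ∎)
   where
   open ≤-Reasoning
   e : ∀ n j b → 8 * (2 * (j * (n * b))) ≡ n * (16 * (j * b))
   e = ring

  -- A refill from level j saves a factor of at least the field length on level suc j.
  scan-cost : ∀ j → j < K → N (suc j) * sumF (λ v → outdeg v /2^ bb j) ≤ 16 * (suc j * D)
  scan-cost j j<K = begin
   N (suc j) * sumF (λ v → outdeg v /2^ bb j) ≡⟨ sym (sumF-* (N (suc j)) (λ v → outdeg v /2^ bb j)) ⟩
   sumF (λ v → N (suc j) * (outdeg v /2^ bb j)) ≤⟨ sumF-mono each ⟩
   sumF (λ v → 16 * suc j * outdeg v) ≡⟨ sumF-* (16 * suc j) outdeg ⟩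
   16 * suc j * D ≡⟨ *-assoc 16 (suc j) D ⟩
   16 * (suc j * D) ∎
   where
   open ≤-Reasoning
   b = bb (suc j)
   each : ∀ v → N (suc j) * (outdeg v /2^ bb j) ≤ 16 * suc j * outdeg v
   each v = begin
    N (suc j) * (outdeg v /2^ bb j) ≤⟨ *ˡ≤ (outdeg v /2^ bb j) (refills≤ (suc j) j<K) ⟩
    16 * (suc j * b) * (outdeg v /2^ bb j) ≡⟨ e j b (outdeg v /2^ bb j) ⟩
    16 * suc j * ((outdeg v /2^ bb j) * b) ≤⟨ *ʳ≤ (16 * suc j) (*ʳ≤ (outdeg v /2^ bb j) (<⇒≤ (subst (λ z → b < 2 ^ z) (sym (bb-suc j j<K)) (x<2^bl b)))) ⟩
    16 * suc j * ((outdeg v /2^ bb j) * 2 ^ bb j) ≤⟨ *ʳ≤ (16 * suc j) (m/n*n≤m (outdeg v) (2 ^ bb j) {{m^n≢0 2 (bb j)}}) ⟩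
    16 * suc j * outdeg v ∎
    where
    e : ∀ j b x → 16 * (suc j * b) * x ≡ 16 * suc j * (x * b)
    e = ring

  -- A refill requires Ω(n) bits of toll, and the tolls on each level sum to O(D) because field
  -- lengths are capped by degrees.
  walk-cost : ∀ j → j < K → N (suc j) * n ≤ 16 * (suc j * D)
  walk-cost j j<K = begin
   N (suc j) * n ≤⟨ *ʳ≤ (N (suc j)) n≤8credit ⟩
   N (suc j) * (8 * credit) ≡⟨ e1 (N (suc j)) credit ⟩
   8 * (credit * N (suc j)) ≤⟨ *ʳ≤ 8 (refills-D (suc j) j<K) ⟩
   8 * (2 * (suc j * D)) ≡⟨ e2 (suc j * D) ⟩
   16 * (suc j * D) ∎
   where
   open ≤-Reasoning
   e1 : ∀ N c → N * (8 * c) ≡ 8 * (c * N)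
   e1 = ring
   e2 : ∀ x → 8 * (2 * x) ≡ 16 * x
   e2 = ring

  cost≡ : ∀ j → cost j ≡ 7 * n + 2 * sumF (λ v → outdeg v /2^ bb j)
  cost≡ j = cong (λ z → 3 * n + 2 * z) (sumF-cong (λ v → e (outdeg v /2^ bb j)) · sumF-+ (λ v → outdeg v /2^ bb j) (λ _ → 2) · cong (sumF (λ v → outdeg v /2^ bb j) +_) (sumF-const n 2)) ·
   e' n (sumF (λ v → outdeg v /2^ bb j))
   where
   e : ∀ x → suc (x + 1) ≡ x + 2
   e = ring
   e' : ∀ n x → 3 * n + 2 * (x + n * 2) ≡ 7 * n + 2 * x
   e' = ring

  -- A refill costs `7 * n` plus twice a scan, and both kinds are bounded with the factor 16; so 144
  -- is 9 times 16.
  level-cost : ∀ j → j < K → N (suc j) * cost j ≤ 144 * (suc j * D)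
  level-cost j j<K = begin
   N (suc j) * cost j ≡⟨ cong (N (suc j) *_) (cost≡ j) ⟩
   N (suc j) * (7 * n + 2 * A) ≡⟨ e1 (N (suc j)) n A ⟩
   7 * (N (suc j) * n) + 2 * (N (suc j) * A) ≤⟨ +≤+ (*ʳ≤ 7 (walk-cost j j<K)) (*ʳ≤ 2 (scan-cost j j<K)) ⟩
   7 * (16 * (suc j * D)) + 2 * (16 * (suc j * D)) ≡⟨ e2 (suc j * D) ⟩
   144 * (suc j * D) ∎
   where
   open ≤-Reasoning
   A = sumF (λ v → outdeg v /2^ bb j)
   e1 : ∀ N n A → N * (7 * n + 2 * A) ≡ 7 * (N * n) + 2 * (N * A)
   e1 = ring
   e2 : ∀ x → 7 * (16 * x) + 2 * (16 * x) ≡ 144 * x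
   e2 = ring

  total≤ : ∀ k → k ≤ K → total k N ≤ k * (144 * (K * D))
  total≤ zero _ = z≤n
  total≤ (suc k) k<K = +≤+ (level-cost k k<K » *ʳ≤ 144 (*ˡ≤ D k<K)) (total≤ k (<⇒≤ k<K))

  B0≤ : B0 ≤ (7 * K + 6) * n + (2 * K + 2) * D
  B0≤ = begin
   L + K * suc L + 3 * n + K * (n + 1) + (sumF (λ v → (2 * K + 1) * (outdeg v + 1) + outdeg v) + (K + 1) * n)
    ≤⟨ +≤+ (+≤+ (+ˡ≤ (3 * n) (+≤+ L≤n (*ʳ≤ K (s≤s L≤n)))) ≤-refl) (+ˡ≤ _ (=≤ unfold)) ⟩
   n + K * suc n + 3 * n + K * (n + 1) + ((2 * K + 2) * D + n * (2 * K + 1) + (K + 1) * n)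
    ≡⟨ e1 K n D ⟩
   (5 * K + 6) * n + 2 * (K * 1) + (2 * K + 2) * D
    ≤⟨ +ˡ≤ _ (+ʳ≤ ((5 * K + 6) * n) (*ʳ≤ 2 (*ʳ≤ K n≥1))) ⟩
   (5 * K + 6) * n + 2 * (K * n) + (2 * K + 2) * D
    ≡⟨ e2 K n ((2 * K + 2) * D) ⟩
   (7 * K + 6) * n + (2 * K + 2) * D ∎
   where
   open ≤-Reasoning
   e1 : ∀ K n D → n + K * suc n + 3 * n + K * (n + 1) + ((2 * K + 2) * D + n * (2 * K + 1) + (K + 1) * n) ≡ (5 * K + 6) * n + 2 * (K * 1) + (2 * K + 2) * D
   e1 = ring
   e2 : ∀ K n x → (5 * K + 6) * n + 2 * (K * n) + x ≡ (7 * K + 6) * n + x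
   e2 = ring
   e3 : ∀ K d → (2 * K + 1) * (d + 1) + d ≡ (2 * K + 2) * d + (2 * K + 1)
   e3 = ring
   unfold : sumF (λ v → (2 * K + 1) * (outdeg v + 1) + outdeg v) ≡ (2 * K + 2) * D + n * (2 * K + 1)
   unfold = sumF-cong (λ v → e3 K (outdeg v)) · sumF-+ (λ v → (2 * K + 2) * outdeg v) (λ _ → 2 * K + 1) · (cong₂ _+_ (sumF-* (2 * K + 2) outdeg) (sumF-const n (2 * K + 1)))

  ticks≤ : ticks s ≤ pace K * (n + #edges kind G)
  ticks≤ = begin
   ticks s ≤⟨ tick≤ ⟩
   B0 + total K N ≤⟨ +≤+ B0≤ (total≤ K ≤-refl) ⟩
   (7 * K + 6) * n + (2 * K + 2) * D + K * (144 * (K * D)) ≡⟨ e1 K n D ⟩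
   (7 * K + 6) * n + Y * D ≤⟨ +ʳ≤ ((7 * K + 6) * n) (*ʳ≤ Y (sum-outdeg≤ kind G » +ˡ≤ _ n≥1)) ⟩
   (7 * K + 6) * n + Y * (n + 2 * m) ≤⟨ m≤m+n _ (Y * n + (7 * K + 6) * m) ⟩
   (7 * K + 6) * n + Y * (n + 2 * m) + (Y * n + (7 * K + 6) * m) ≡⟨ e2 (7 * K + 6) Y n m ⟩
   ((7 * K + 6) + 2 * Y) * (n + m) ∎
   where
   open ≤-Reasoning
   m = #edges kind G
   Y = 2 * K + 2 + 144 * (K * K)
   e1 : ∀ K n D → (7 * K + 6) * n + (2 * K + 2) * D + K * (144 * (K * D)) ≡ (7 * K + 6) * n + (2 * K + 2 + 144 * (K * K)) * D
   e1 = ring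
   e2 : ∀ X Y n m → X * n + Y * (n + 2 * m) + (Y * n + X * m) ≡ (X + 2 * Y) * (n + m)
   e2 = ring

-- Space and the threshold between small and large graphs

quotient*≤ : ∀ x y → div x y * y ≤ x
quotient*≤ x zero = z≤n
quotient*≤ x (suc y) = m/n*n≤m x (suc y)

bl-+ : ∀ x c → bl (x + c) ≤ bl x + c
bl-+ x c = bl-≤ (bl x + c) (x + c) z<s (go c)
 where
 go : ∀ c → x + c < 2 ^ (bl x + c)
 go zero = subst₂ _<_ (sym (+0 x)) (cong (2 ^_) (sym (+0 (bl x)))) (x<2^bl x)
 go (suc c) = subst₂ _<_ (sym (+-suc x c)) (cong (2 ^_) (sym (+-suc (bl x) c))) (s≤s (go c) » +ˡ≤ (2 ^ (bl x + c)) (m^n>0 2 (bl x + c)) » =≤ (cong (2 ^ (bl x + c) +_) (sym (+0 _))))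

log₂≤ : ∀ x → ⌊log₂ x ⌋ ≤ x
log₂≤ zero = z≤n
log₂≤ (suc x) = n≤1+n _ » bl≤x (suc x) z<s

-- `bl` exceeds the rounded logarithm by one in each round, and `bl-+` shows that a logarithm does
-- not enlarge an excess accumulated before.
tower≤log : ∀ n i → tower n i ≤ ⌊log^ suc i ⌋ n + suc i
tower≤log n zero = =≤ (+-comm 1 _)
tower≤log n (suc i) = s≤s (⌊log₂⌋-mono-≤ (tower≤log n i)) » bl-+ (⌊log^ suc i ⌋ n) (suc i) » =≥ (+-suc (⌊log₂ (⌊log^ suc i ⌋ n) ⌋) (suc i))

-- `tower n k` is governed by the logarithm iterated `suc k` times. One round is given away, which
-- permits `K = k` and thereby at least two levels for every `k`.
tower≤ : ∀ n k → tower n k ≤ suc k * suc (⌊log^ k ⌋ n)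
tower≤ n k = tower≤log n k » +ˡ≤ (suc k) (log₂≤ (⌊log^ k ⌋ n)) » +ˡ≤ (suc k) (m≤n*m (⌊log^ k ⌋ n) (suc k)) » =≤ (e (suc k) (⌊log^ k ⌋ n))
 where
 e : ∀ k x → k * x + k ≡ k * suc x
 e = ring

words : ℕ → ℕ → ℕ → ℕ → ℕ → ℕ
words n w PB NR b0 = PB + NR * (div n w + 2) + div n (div w b0) + 2

quotient>0 : ∀ w b → 0 < b → b ≤ w → 0 < div w b
quotient>0 w (suc b) _ b≤w = m≥n⇒m/n>0 b≤w

-- Each plane has `n` bits up to a constant number of words. Since slots do not cross word
-- boundaries, up to half of a word may be lost, hence the factor 2 at `n * b0`.
space≤ : ∀ n w PB NR b0 → 0 < b0 → b0 ≤ w → words n w PB NR b0 * w ≤ (PB + 2 * NR + 2) * w + NR * n + 2 * (n * b0)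
space≤ n w PB NR b0 b0>0 b0≤w = begin
 (PB + NR * (q + 2) + p + 2) * w ≡⟨ e1 PB NR q p w ⟩
 (PB + 2 * NR + 2) * w + NR * (q * w) + p * w ≤⟨ +≤+ (+ʳ≤ ((PB + 2 * NR + 2) * w) (*ʳ≤ NR (quotient*≤ n w))) slots ⟩
 (PB + 2 * NR + 2) * w + NR * n + 2 * (n * b0) ∎
 where
 open ≤-Reasoning
 q = div n w
 g = div w b0
 p = div n g
 e1 : ∀ PB NR q p w → (PB + NR * (q + 2) + p + 2) * w ≡ (PB + 2 * NR + 2) * w + NR * (q * w) + p * w
 e1 = ring
 e2 : ∀ g b → g * b + 1 * b ≤ g * b + g * b → g * b + b ≤ 2 * (g * b)
 e2 g b h = subst₂ _≤_ (cong (g * b +_) (*-identityˡ b)) (cong (g * b +_) (sym (+0 (g * b)))) h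
 e3 : ∀ p g b → p * (2 * (g * b)) ≡ 2 * (p * g * b)
 e3 = ring
 w≤ : w ≤ 2 * (g * b0)
 w≤ = =≤ (quot+rem w b0 b0>0) » +ʳ≤ (g * b0) (<⇒≤ (remainder-< w b0 b0>0)) » e2 g b0 (+ʳ≤ (g * b0) (*ˡ≤ b0 (quotient>0 w b0 b0>0 b0≤w)))
 slots : p * w ≤ 2 * (n * b0)
 slots = *ʳ≤ p w≤ » =≤ (e3 p g b0) » *ʳ≤ 2 (*ˡ≤ b0 (quotient*≤ n g))

4*bl≤ : ∀ x → 32 ≤ x → 4 * bl x ≤ x
4*bl≤ x 32≤x = *ʳ≤ 4 (bl-≤ q x (z<s » 8≤q) x<) » =≤ (*-comm 4 q) » m/n*n≤m x 4
 where
 q = x / 4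
 8≤q : 8 ≤ q
 8≤q = /-monoˡ-≤ 4 32≤x
 grow : ∀ m → 4 * (8 + m) + 4 ≤ 2 ^ (8 + m)
 grow zero = ≤!
 grow (suc m) = begin
  4 * (8 + suc m) + 4 ≡⟨ e m ⟩
  4 * (8 + m) + 4 + 4 ≤⟨ +≤+ (grow m) (m≤n+m 4 (4 * (8 + m)) » grow m) ⟩
  2 ^ (8 + m) + 2 ^ (8 + m) ≡⟨ cong (2 ^ (8 + m) +_) (sym (+0 _)) ⟩
  2 ^ (8 + suc m) ∎
  where
  open ≤-Reasoning
  e : ∀ m → 4 * (8 + suc m) + 4 ≡ 4 * (8 + m) + 4 + 4
  e = ring
 x< : x < 2 ^ q
 x< = begin-strict
  x ≡⟨ m≡m%n+[m/n]*n x 4 ⟩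
  x % 4 + q * 4 <⟨ +-monoˡ-< (q * 4) (m%n<n x 4) ⟩
  4 + q * 4 ≡⟨ +-comm 4 (q * 4) · cong (_+ 4) (*-comm q 4) ⟩
  4 * q + 4 ≤⟨ subst (λ z → 4 * z + 4 ≤ 2 ^ z) (m+[n∸m]≡n 8≤q) (grow (q ∸ 8)) ⟩
  2 ^ q ∎
  where open ≤-Reasoning

128*≤2^ : ∀ x → 11 ≤ x → 128 * x ≤ 2 ^ x
128*≤2^ x 11≤x = subst (λ z → 128 * z ≤ 2 ^ z) (m+[n∸m]≡n 11≤x) (go (x ∸ 11))
 where
 go : ∀ m → 128 * (11 + m) ≤ 2 ^ (11 + m)
 go zero = ≤!
 go (suc m) = begin
  128 * (11 + suc m) ≡⟨ e m ⟩
  128 * (11 + m) + 128 ≤⟨ +≤+ (go m) (^-monoʳ-≤ 2 {7} {11 + m} (≤! » m≤m+n 11 m) » ≤-refl) ⟩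
  2 ^ (11 + m) + 2 ^ (11 + m) ≡⟨ cong (2 ^ (11 + m) +_) (sym (+0 _)) ⟩
  2 ^ (11 + suc m) ∎
  where
  open ≤-Reasoning
  e : ∀ m → 128 * (11 + suc m) ≡ 128 * (11 + m) + 128
  e = ring

2^log₂≤ : ∀ n → 1 ≤ n → 2 ^ ⌊log₂ n ⌋ ≤ n
2^log₂≤ n n≥1 with ⌊log₂ n ⌋ in eqn
... | zero = n≥1
... | suc l = ≮⇒≥ (λ h → 1+n≰n (=≤ (cong suc (sym eqn)) » bl-≤ (suc l) n z<s h))

exponent>0 : ∀ {w n} → 1 ≤ n → n < 2 ^ w → 0 < w
exponent>0 {zero} 1≤n n<1 = ⊥! (<⇒≱ n<1 1≤n)
exponent>0 {suc w} _ _ = z<s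

tower≤w : ∀ n w K → 1 ≤ n → n < 2 ^ w → tower n K ≤ w
tower≤w n w K n≥1 n<2^w = tower≤bl n K » bl-≤ w n (exponent>0 n≥1 n<2^w) n<2^w

-- A logarithm of at least `8 * K + 32` covers `4 * NR = 8 * K + 20 ≤ w`, the bound 32 needed to fit
-- four slots into a word, and `64 * (K + bl n + 4) ≤ n`.
threshold : ℕ → ℕ
threshold K = 2 ^ (8 * K + 32)

large-enough : ∀ K n w → 1 ≤ K → threshold K ≤ n → n < 2 ^ w → Large K n w
large-enough K n w K≥1 N≤n n<2^w = record { n<2^w = n<2^w; K≥1 = K≥1; big = big ; fits = *-cancelˡ-≤ 4 (fourS » *ˡ≤ n (≤! {3} {4})) » <⇒≤ n<2^w }
  where
  n≥1 : 1 ≤ n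
  n≥1 = m^n>0 2 (8 * K + 32) » N≤n
  ℓ = ⌊log₂ n ⌋
  T≤ℓ : 8 * K + 32 ≤ ℓ
  T≤ℓ = ≡≤ (sym (⌊log₂[2^n]⌋≡n (8 * K + 32))) (⌊log₂⌋-mono-≤ N≤n)
  big : 64 * (K + bl n + 4) ≤ n
  big = begin
   64 * (K + suc ℓ + 4) ≡⟨ e K ℓ ⟩
   64 * (K + 5) + 64 * ℓ ≤⟨ +ˡ≤ (64 * ℓ) (*ʳ≤ 64 (+≤+ (m≤n*m K 8) ≤! » T≤ℓ)) ⟩
   64 * ℓ + 64 * ℓ ≡⟨ e' ℓ ⟩
   128 * ℓ ≤⟨ 128*≤2^ ℓ (≤! » m≤n+m 32 (8 * K) » T≤ℓ) ⟩
   2 ^ ℓ ≤⟨ 2^log₂≤ n n≥1 ⟩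
   n ∎
   where
   open ≤-Reasoning
   e : ∀ K l → 64 * (K + suc l + 4) ≡ 64 * (K + 5) + 64 * l
   e = ring
   e' : ∀ l → 64 * l + 64 * l ≡ 128 * l
   e' = ring
  b0 PB NR : ℕ
  b0 = tower n K
  PB = 3 * suc K
  NR = 3 + 2 * suc K
  L≤w : bl n ≤ w
  L≤w = bl-≤ w n (exponent>0 n≥1 n<2^w) n<2^w
  b0≤ : b0 ≤ bl (bl n)
  b0≤ = tower≤1 K K≥1
   where
   tower≤1 : ∀ K → 1 ≤ K → tower n K ≤ bl (bl n)
   tower≤1 (suc zero) _ = ≤-refl
   tower≤1 (suc (suc K)) _ = tower-suc≤ n (suc K) » tower≤1 (suc K) z<s
  g≥4 : 4 ≤ div w b0
  g≥4 = quotient≥ w b0 (tower>0 n K) (*ʳ≤ 4 b0≤ » 4*bl≤ (bl n) (m≤n+m 32 (8 * K) » T≤ℓ » n≤1+n ℓ) » L≤w)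
   where
   quotient≥ : ∀ w b → 0 < b → 4 * b ≤ w → 4 ≤ div w b
   quotient≥ w (suc b) _ h = =≥ (m*n/n≡m 4 (suc b)) » /-monoˡ-≤ (suc b) h
  4NR≤w : 4 * NR ≤ w
  4NR≤w = =≤ (e K) » +ʳ≤ (8 * K) ≤! » T≤ℓ » n≤1+n ℓ » L≤w
   where
   e : ∀ K → 4 * (3 + 2 * suc K) ≡ 8 * K + 20
   e = ring
  constants : 4 * (PB + 2 * NR + 2) ≤ n
  constants = =≤ (e K) » m≤m+n _ (36 * K + 64 * bl n + 196) » =≤ (e' K (bl n)) » big
   where
   e : ∀ K → 4 * (3 * suc K + 2 * (3 + 2 * suc K) + 2) ≡ 28 * K + 60
   e = ring
   e' : ∀ K L → 28 * K + 60 + (36 * K + 64 * L + 196) ≡ 64 * (K + L + 4)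
   e' = ring
  -- The constant part, the planes and the slots occupy at most a quarter of `n` words each, so
  -- every address fits into a word.
  fourS : 4 * words n w PB NR b0 ≤ 3 * n
  fourS = begin
   4 * (PB + NR * (div n w + 2) + div n (div w b0) + 2)
    ≡⟨ e PB NR (div n w) (div n (div w b0)) ⟩
   4 * (PB + 2 * NR + 2) + div n w * (4 * NR) + div n (div w b0) * 4
    ≤⟨ +≤+ (+≤+ constants (*ʳ≤ (div n w) 4NR≤w » quotient*≤ n w)) (*ʳ≤ (div n (div w b0)) g≥4 » quotient*≤ n (div w b0)) ⟩
   n + n + n
    ≡⟨ e' n ⟩
   3 * n ∎
   where
   open ≤-Reasoning
   e : ∀ PB NR q p → 4 * (PB + NR * (q + 2) + p + 2) ≡ 4 * (PB + 2 * NR + 2) + q * (4 * NR) + p * 4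
   e = ring
   e' : ∀ n → n + n + n ≡ 3 * n
   e' = ring

-- The complete program and its resources

contents : ∀ {m S} → Vec (Fin m) S → ℕ → ℕ
contents [] a = 0
contents (x ∷ mem) zero = toℕ x
contents (x ∷ mem) (suc a) = contents mem a

contents-lookup : ∀ {m S} (mem : Vec (Fin m) S) i → toℕ (lookup mem i) ≡ contents mem (toℕ i)
contents-lookup (x ∷ mem) zero = refl
contents-lookup (x ∷ mem) (suc i) = contents-lookup mem i

module Whole (kind : Kind) (K : ℕ) (K≥1 : 1 ≤ K) where
 open Code2 kind K using (main; PB2; NR2)
 open Tree kind using (dispatch; dispatch-small; dispatch-big; Emits)
 open Compile {Query kind} PB2 NR2 R2

 command : Cmd (Query kind) R2
 command = dispatch (threshold K) 0 main

 instructions : List (Instruction (Query kind) (12 + R2))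
 instructions = compile command 0 ++ halt ∷ []

 program : Program (Query kind)
 program = record { extraRegisters = 10 + R2; code = instructions }

 timeC spaceC : ℕ
 timeC = csize command * suc (pace K) + 1
 -- There are 52 registers, namely 12 of the machine code and the 40 of the program; the other two
 -- words come from `space≤`.
 spaceC = (54 + PB2 + 2 * NR2) + NR2 + 2 * suc K

 space : ℕ → ℕ → ℕ
 space n w = words n w PB2 NR2 (tower n K)

 bits≤ : ∀ n w → 1 ≤ n → n < 2 ^ w → bitsUsed program w (space n w) ≤ spaceC * (n * suc (⌊log^ K ⌋ n) + w)
 bits≤ n w n≥1 n<2^w = begin
  (52 + words n w PB2 NR2 b0) * w ≡⟨ *-distribʳ-+ w 52 (words n w PB2 NR2 b0) ⟩
  52 * w + words n w PB2 NR2 b0 * w ≤⟨ +ʳ≤ (52 * w) (space≤ n w PB2 NR2 b0 (tower>0 n K) (tower≤w n w K n≥1 n<2^w)) ⟩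
  52 * w + ((PB2 + 2 * NR2 + 2) * w + NR2 * n + 2 * (n * b0))
   ≤⟨ +ʳ≤ (52 * w) (+≤+ (+ʳ≤ ((PB2 + 2 * NR2 + 2) * w) (*ʳ≤ NR2 (m≤m*n n (suc l)))) (*ʳ≤ 2 (*ʳ≤ n (tower≤ n K)))) ⟩
  52 * w + ((PB2 + 2 * NR2 + 2) * w + NR2 * (n * suc l) + 2 * (n * (suc K * suc l)))
   ≡⟨ e1 PB2 NR2 w n (suc l) (suc K) ⟩
  (54 + PB2 + 2 * NR2) * w + (NR2 + 2 * suc K) * (n * suc l)
   ≤⟨ m≤m+n _ ((NR2 + 2 * suc K) * w + (54 + PB2 + 2 * NR2) * (n * suc l)) ⟩
  (54 + PB2 + 2 * NR2) * w + (NR2 + 2 * suc K) * (n * suc l) + ((NR2 + 2 * suc K) * w + (54 + PB2 + 2 * NR2) * (n * suc l))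
   ≡⟨ e2 (54 + PB2 + 2 * NR2) NR2 (2 * suc K) w (n * suc l) ⟩
  spaceC * (n * suc l + w) ∎
  where
  open ≤-Reasoning
  b0 = tower n K
  l = ⌊log^ K ⌋ n
  e1 : ∀ P N w n l k → 52 * w + ((P + 2 * N + 2) * w + N * (n * l) + 2 * (n * (k * l))) ≡ (54 + P + 2 * N) * w + (N + 2 * k) * (n * l)
  e1 = ring
  e2 : ∀ A N k w x → A * w + (N + k) * x + ((N + k) * w + A * x) ≡ (A + N + k) * (x + w)
  e2 = ring

 module _ {n w : ℕ} (n≥1 : 1 ≤ n) (n<2^w : n < 2 ^ w) (G : Graph kind n) where

  b0 : ℕ
  b0 = tower n K

  w>0 : 0 < w
  w>0 = exponent>0 n≥1 n<2^w

  open Semantics (answer kind G) n w PB2 NR2 b0 R2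
  open Layout (answer kind G) n w PB2 NR2 b0 R2 using (Abase; A0base; memrel; rel2)
  open Correct (answer kind G) n w PB2 NR2 b0 R2 instructions w>0 n<2^w (tower>0 n K) (tower≤w n w K n≥1 n<2^w) z<s
  open Machine (answer kind G) program w S
  open Sound (answer kind G) program w S w>0

  -- The arbitrary initial memory is simply read through the layout, so the relation holds from the
  -- start; the program clears the planes and sets the level words that it relies on.
  state0 : Vec (Word w) S → State R2
  state0 mem = st (λ _ → 0) m (λ r o → ab w m (Abase r + o)) (λ v → num (λ l → ab w m (A0base v + l)) 0 b0) [] 0
   where m = contents mem

  related : ∀ mem → RelC (state0 mem) (initial n mem)
  related mem = mst (λ x → toℕ (lookup (Config.registers (initial n mem)) x)) (contents mem) [] , rel1 (λ _ → refl) (contents-lookup mem) ,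
   rel2 (toℕ-truncate-< w n n<2^w) (toℕ-truncate-< w w (n<2^n w)) (λ x → cong toℕ (lookup-replicate (10 ↑ʳ x) (truncate w 0)) · toℕ-truncate-< w 0 (m^n>0 2 w))
    (memrel (λ _ _ → refl) (λ _ _ _ _ → refl) (λ v l _ l<b → sym (tb-num (λ l → ab w (contents mem) (A0base v + l)) 0 b0 l l<b)) (λ v _ → num-< (λ l → ab w (contents mem) (A0base v + l)) 0 b0))
    refl

  record Traversed (s s' : State R2) : Set where
   field
    τ : List (Event (Fin n))
    dfs : IsDFS kind G τ
    out≡ : out s' ≡ map (mapEvent ν) τ
    tick≤ : ticks s' ≤ pace K * (n + #edges kind G)

  traverse : ∀ s → out s ≡ [] → ticks s ≡ 0 → Σ[ s' ∈ State R2 ] Exec command s s' × Traversed s s'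
  traverse s o t with threshold K ≤? n
  ... | no N≰n = let (s' , τ , ex , em , comp) = dispatch-small G w PB2 NR2 b0 n<2^w (threshold K) 0 main s z≤n (≰⇒> N≰n) in
   s' , ex , record { τ = τ; dfs = allFin n , ↭-refl , comp; out≡ = Emits.emitted em · cong (_++ map (mapEvent ν) τ) o ; tick≤ = =≤ (Emits.no-tick em · t) » z≤n }
  ... | yes N≤n = dispatch-big G w PB2 NR2 b0 n<2^w (threshold K) 0 main s N≤n (Traversed s) λ s1 _ _ _ o1 t-1 → search s1 (o1 · o) (t-1 · t)
   where
   large : Large K n w
   large = large-enough K n w K≥1 N≤n n<2^w
   open LargeCase G large using (main-spec; module Searched; ticks≤)
   search : ∀ s1 → out s1 ≡ [] → ticks s1 ≡ 0 → Σ[ s' ∈ State R2 ] Exec main s1 s' × Traversed s s'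
   search s1 o1 t-1 = let (s' , ex , r) = main-spec s1 o1 t-1 in s' , ex , record { τ = Searched.τ r; dfs = Searched.dfs r; out≡ = Searched.out≡ r; tick≤ = ticks≤ r }

  carries-out : CarriesOutDFS kind program G w S (timeC * (n + #edges kind G))
  carries-out mem = let (s' , ex , tr) = traverse (state0 mem) refl refl in finish s' tr (sound ex (related mem) (at-++ˡ 0 (compile command 0) at-start))
   where
   at-start : At 0 (compile command 0 ++ halt ∷ [])
   at-start = [] , sym (++-identityʳ instructions)
   finish : ∀ s' → Traversed (state0 mem) s' → Outcome (csize command) (state0 mem) s' (initial n mem) →
    Σ[ τ ∈ List (Event (Fin n)) ] Σ[ t ∈ ℕ ] IsDFS kind G τ × Run (initial n mem) t (map (mapEvent ν) τ) × t ≤ timeC * (n + #edges kind G)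
   finish s' tr oc = Traversed.τ tr , Outcome.k oc + 1 , Traversed.dfs tr ,
    subst (Run (initial n mem) (Outcome.k oc + 1)) (++-identityʳ (Outcome.τ oc) · sym (Outcome.out' oc) · Traversed.out≡ tr)
     (Outcome.reach oc (halted (at-fetch (Config.pc (Outcome.cfg' oc)) at-halt))) ,
    time≤
    where
    at-halt : At (Config.pc (Outcome.cfg' oc)) (halt ∷ [])
    at-halt = subst (λ p → At p (halt ∷ [])) (length-compile command 0 · sym (Outcome.pc' oc)) (at-++ʳ 0 (compile command 0) at-start)
    M = n + #edges kind G
    Δ≤ : Outcome.Δ oc ≤ pace K * M
    Δ≤ = =≤ (sym (+0 _) · sym (Outcome.tick' oc)) » Traversed.tick≤ tr
    M≥1 : 1 ≤ M
    M≥1 = n≥1 » m≤m+n n _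
    time≤ : Outcome.k oc + 1 ≤ timeC * M
    time≤ = begin
     Outcome.k oc + 1 ≤⟨ +ˡ≤ 1 (Outcome.bound oc) ⟩
     csize command * suc (Outcome.Δ oc) + 1 ≤⟨ +≤+ (*ʳ≤ (csize command) (+≤+ M≥1 Δ≤)) M≥1 ⟩
     csize command * (M + pace K * M) + M ≡⟨ e (csize command) M (pace K) ⟩
     timeC * M ∎
     where
     open ≤-Reasoning
     e : ∀ c M p → c * (M + p * M) + M ≡ (c * suc p + 1) * M
     e = ring

theorem5p5 : (k : ℕ) → 1 ≤ k → (kind : Kind) →
  Σ[ P ∈ Program (Query kind) ] Σ[ C ∈ ℕ ]
    ((n w : ℕ) → 1 ≤ n → n < 2 ^ w → (G : Graph kind n) →
      Σ[ S ∈ ℕ ]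
        (bitsUsed P w S ≤ C * (n * suc (⌊log^ k ⌋ n) + w)
         × CarriesOutDFS kind P G w S (C * (n + #edges kind G))))
theorem5p5 k k≥1 kind = program , spaceC + timeC , λ n w n≥1 n<2^w G → space n w , bits≤ n w n≥1 n<2^w » *ˡ≤ (n * suc (⌊log^ k ⌋ n) + w) (m≤m+n spaceC timeC) ,
 λ mem → let (τ , t , dfs , run , t≤) = carries-out n≥1 n<2^w G mem in
  τ , t , dfs , run , t≤ » *ˡ≤ (n + #edges kind G) (m≤n+m timeC spaceC)
 where open Whole kind k k≥1
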